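{- Let $q$ be a fixed odd prime power and $d\ge1$ a fixed integer. Assume the following hypothesis (uniform polynomial Chowla conjecture): for every fixed $c>0$, for $F\in\mathbb{F}_q[y][T]$ separable in $T$ one has $\sum_{h\in\mathbb{F}_q[y]\text{ monic},\,\deg h=n}\lambda(F(y,h(y)))=o(q^n)$ as $n\to\infty$, uniformly in all such $F$ with $\deg_yF\le cn$, $\deg_TF\le c$. Let $f=y^n+a_{n-1}(x)y^{n-1}+\cdots+a_0(x)$ with $a_0,\ldots,a_{n-1}\in\mathbb{F}_q[x]$ chosen independently and uniformly from the polynomials of degree at most $d$. Then $$\lim_{n\to\infty}\mathbb{P}\bigl(\mathrm{con}_x(f)=1\text{ and }\mathrm{disc}_y(f)=at^2\text{ for some }t\in\mathbb{F}_q[x],\ a\in\mathbb{F}_q\bigr)=0.$$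
   Context: $\lambda$ is the Liouville function on nonzero polynomials of $\mathbb{F}_q[y]$: $\lambda(g)=(-1)^k$ with $k$ the number of monic irreducible factors of $g$ counted with multiplicity. $\mathrm{con}_x(f)$ is the monic gcd of the coefficients of $f$ viewed as a polynomial in $x$ over $\mathbb{F}_q[y]$. $\mathrm{disc}_y(f)\in\mathbb{F}_q[x]$ is the discriminant of $f$ as a monic polynomial in $y$, i.e. $\prod_{i<j}(\alpha_i-\alpha_j)^2$ over its roots $\alpha_i$. -}

module Defs where

open import Level using (0ℓ)
open import Data.Bool using (Bool; true; false; if_then_else_)
open import Data.Nat as ℕ using (ℕ; zero; suc; _∸_; _≤ᵇ_; _≡ᵇ_)
open import Data.Nat.DivMod using (_/_; _%_)
open import Data.Integer as ℤ using (ℤ; +_; ∣_∣)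
open import Data.Rational as ℚ using (ℚ)
open import Data.Fin using (Fin; toℕ; punchIn)
import Data.Fin as Fin
open import Data.List using (List; []; _∷_; map; foldr; length; _++_; [_]; allFin; concatMap)
open import Data.List.Relation.Unary.All using (All)
open import Data.List.Relation.Unary.Unique.Propositional using (Unique)
open import Data.List.Membership.Propositional using (_∈_)
open import Data.Vec as Vec using (Vec; toList)
open import Data.Product using (Σ; ∃; _×_; _,_)
open import Data.Sum using (_⊎_)
open import Relation.Nullary using (¬_)
open import Relation.Binary.PropositionalEquality using (_≡_)
open import Algebra.Bundles.Raw using (RawRing)
open import Algebra.Structures using (IsCommutativeRing)

record FiniteField : Set₁ where
  infixl 7 _*_
  infixl 6 _+_
  field
    F       : Set
    _+_     : F → F → F
    _*_     : F → F → F
    -_      : F → F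
    0#      : F
    1#      : F
    isCommutativeRing : IsCommutativeRing _≡_ _+_ _*_ -_ 0# 1#
    0≢1     : ¬ (0# ≡ 1#)
    inverse : (a : F) → ¬ (a ≡ 0#) → Σ F (λ b → a * b ≡ 1#)
    elems   : List F
    elems-complete : (a : F) → a ∈ elems
    elems-unique   : Unique elems

  card : ℕ
  card = length elems

  raw : RawRing 0ℓ 0ℓ
  raw = record { Carrier = F ; _≈_ = _≡_ ; _+_ = _+_ ; _*_ = _*_ ; -_ = -_
               ; 0# = 0# ; 1# = 1# }

-- Polynomials in one variable over a raw ring, as coefficient lists
-- (constant coefficient first); equality is coefficientwise (so trailing
-- zeros are irrelevant).

module PolyOps (R : RawRing 0ℓ 0ℓ) where
  open RawRing R

  Poly : Set
  Poly = List Carrier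

  coeff : ℕ → Poly → Carrier
  coeff _       []      = 0#
  coeff zero    (a ∷ _) = a
  coeff (suc i) (_ ∷ p) = coeff i p

  _≈P_ : Poly → Poly → Set
  p ≈P q = (i : ℕ) → coeff i p ≈ coeff i q

  constP : Carrier → Poly
  constP a = a ∷ []

  0P 1P : Poly
  0P = []
  1P = constP 1#

  _+P_ : Poly → Poly → Poly
  []      +P q       = q
  (a ∷ p) +P []      = a ∷ p
  (a ∷ p) +P (b ∷ q) = (a + b) ∷ (p +P q)

  -P_ : Poly → Poly
  -P p = map -_ p

  _*P_ : Poly → Poly → Poly
  []      *P q = []
  (a ∷ p) *P q = map (a *_) q +P (0# ∷ (p *P q))

  prodP : List Poly → Poly
  prodP = foldr _*P_ 1P

  natMul : ℕ → Carrier → Carrier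
  natMul zero    a = 0#
  natMul (suc n) a = a + natMul n a

  derivAux : ℕ → Poly → Poly
  derivAux k []      = []
  derivAux k (a ∷ p) = natMul k a ∷ derivAux (suc k) p

  deriv : Poly → Poly
  deriv []      = []
  deriv (_ ∷ p) = derivAux 1 p

  evalP : Poly → Carrier → Carrier
  evalP p x = foldr (λ a acc → a + x * acc) 0# p

  IsZeroP : Poly → Set
  IsZeroP p = (i : ℕ) → coeff i p ≈ 0#

  IsConstP : Poly → Set
  IsConstP p = (i : ℕ) → coeff (suc i) p ≈ 0#

  HasDeg : Poly → ℕ → Set
  HasDeg p k = ¬ (coeff k p ≈ 0#) × ((i : ℕ) → k ℕ.< i → coeff i p ≈ 0#)

  Monic : Poly → Set
  Monic p = ∃ λ k → coeff k p ≈ 1# × ((i : ℕ) → k ℕ.< i → coeff i p ≈ 0#)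

  Divides : Poly → Poly → Set
  Divides g p = ∃ λ k → (g *P k) ≈P p

  Irreducible : Poly → Set
  Irreducible p = ¬ IsConstP p ×
    ((a b : Poly) → p ≈P (a *P b) → IsConstP a ⊎ IsConstP b)

  negPow : ℕ → Carrier → Carrier
  negPow zero    a = a
  negPow (suc k) a = - negPow k a

  det : (m : ℕ) → (Fin m → Fin m → Carrier) → Carrier
  det zero    M = 1#
  det (suc m) M =
    foldr _+_ 0#
      (map (λ j → negPow (toℕ j) (M Fin.zero j * det m (λ r c → M (Fin.suc r) (punchIn j c))))
           (allFin (suc m)))

  -- Sylvester matrix of p (formal degree m) and g (formal degree k);
  -- its determinant is the resultant Res_{m,k}(p, g).
  sylvester : (m k : ℕ) → Poly → Poly → Fin (k ℕ.+ m) → Fin (k ℕ.+ m) → Carrier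
  sylvester m k p g r c =
    if r' ℕ.<ᵇ k
    then (if (r' ≤ᵇ c') ∧' ((c' ∸ r') ≤ᵇ m) then coeff (m ∸ (c' ∸ r')) p else 0#)
    else (if ((r' ∸ k) ≤ᵇ c') ∧' ((c' ∸ (r' ∸ k)) ≤ᵇ k) then coeff (k ∸ (c' ∸ (r' ∸ k))) g else 0#)
    where
      r' = toℕ r
      c' = toℕ c
      _∧'_ : Bool → Bool → Bool
      true ∧' b = b
      false ∧' _ = false

  resultant : (m k : ℕ) → Poly → Poly → Carrier
  resultant m k p g = det (k ℕ.+ m) (sylvester m k p g)

  discMonic : ℕ → Poly → Carrier
  discMonic n p = negPow ((n ℕ.* (n ∸ 1)) / 2) (resultant n (n ∸ 1) p (deriv p))

PolyRaw : RawRing 0ℓ 0ℓ → RawRing 0ℓ 0ℓ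
PolyRaw R = record { Carrier = Poly ; _≈_ = _≈P_ ; _+_ = _+P_ ; _*_ = _*P_
                   ; -_ = -P_ ; 0# = 0P ; 1# = 1P }
  where open PolyOps R

signℤ : ℕ → ℤ
signℤ zero    = + 1
signℤ (suc k) = ℤ.- signℤ k

ℕtoℚ : ℕ → ℚ
ℕtoℚ n = (+ n) ℚ./ 1

allVecs : {A : Set} → List A → (n : ℕ) → List (Vec A n)
allVecs xs zero    = Vec.[] ∷ []
allVecs xs (suc n) = concatMap (λ x → map (x Vec.∷_) (allVecs xs n)) xs

sumℤ : List ℤ → ℤ
sumℤ = foldr ℤ._+_ (+ 0)

module OverField (K : FiniteField) where
  open FiniteField K public using (F; 0#; 1#; card; elems)

  -- 𝔽_q[y] (also used for 𝔽_q[x])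
  open PolyOps (FiniteField.raw K) public
  module P2 = PolyOps (PolyRaw (FiniteField.raw K))

  IsLiouville : (Poly → ℤ) → Set
  IsLiouville lam =
    ((p p' : Poly) → p ≈P p' → lam p ≡ lam p') ×
    ((c : F) (ps : List Poly) → ¬ (c ≡ 0#) →
       All (λ p → Monic p × Irreducible p) ps →
       lam (constP c *P prodP ps) ≡ signℤ (length ps))

  monicOfDeg : ℕ → List Poly
  monicOfDeg n = map (λ v → toList v ++ [ 1# ]) (allVecs elems n)

  -- F ∈ 𝔽_q[y][T] is separable in T: F and ∂F/∂T are coprime in
  -- 𝔽_q(y)[T], i.e. (clearing denominators) A F + B ∂F/∂T = r
  -- for some A, B ∈ 𝔽_q[y][T] and nonzero r ∈ 𝔽_q[y].
  SeparableT : P2.Poly → Set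
  SeparableT Fp = ∃ λ (A : P2.Poly) → ∃ λ (B : P2.Poly) → ∃ λ (r : Poly) →
    ¬ IsZeroP r × P2._≈P_ ((A P2.*P Fp) P2.+P (B P2.*P P2.deriv Fp)) (P2.constP r)

  PosDegT : P2.Poly → Set
  PosDegT Fp = ∃ λ i → ¬ IsZeroP (P2.coeff (suc i) Fp)

  DegT≤ : P2.Poly → ℚ → Set
  DegT≤ Fp c = (i : ℕ) → ¬ IsZeroP (P2.coeff i Fp) → ℕtoℚ i ℚ.≤ c

  DegY≤ : P2.Poly → ℚ → Set
  DegY≤ Fp b = (i j : ℕ) → ¬ (coeff j (P2.coeff i Fp) ≡ 0#) → ℕtoℚ j ℚ.≤ b

  chowlaSum : (Poly → ℤ) → P2.Poly → ℕ → ℤ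
  chowlaSum lam Fp n = sumℤ (map (λ h → lam (P2.evalP Fp h)) (monicOfDeg n))

  UniformChowla : (Poly → ℤ) → Set
  UniformChowla lam =
    (c : ℚ) → ℚ.0ℚ ℚ.< c → (ε : ℚ) → ℚ.0ℚ ℚ.< ε →
    ∃ λ N → (n : ℕ) → N ℕ.≤ n → (Fp : P2.Poly) →
      SeparableT Fp → PosDegT Fp → DegY≤ Fp (c ℚ.* ℕtoℚ n) → DegT≤ Fp c →
      ℕtoℚ ∣ chowlaSum lam Fp n ∣ ℚ.≤ ε ℚ.* ℕtoℚ (card ℕ.^ n)

  -- an outcome: (a₀,…,a_{n-1}), each aᵢ given by its d+1 coefficients
  Outcome : ℕ → ℕ → Set
  Outcome d n = Vec (Vec F (suc d)) n

  fPoly : {d n : ℕ} → Outcome d n → P2.Poly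
  fPoly as = map toList (toList as) ++ [ 1P ]

  -- con_x(f) = 1: every common divisor in 𝔽_q[y] of the coefficients
  -- of f as a polynomial in x (the coefficient of xʲ is Σᵢ [xʲ]aᵢ · yⁱ)
  -- is a constant.
  ContentOne : P2.Poly → Set
  ContentOne f = (g : Poly) → ((j : ℕ) → Divides g (map (coeff j) f)) → IsConstP g

  DiscSquareClass : ℕ → P2.Poly → Set
  DiscSquareClass n f = ∃ λ (a : F) → ∃ λ (t : Poly) →
    P2.discMonic n f ≈P (constP a *P (t *P t))

  Event : (d n : ℕ) → Outcome d n → Set
  Event d n as = ContentOne (fPoly as) × DiscSquareClass n (fPoly as)

{-# OPTIONS --safe #-}
module Submission where

-- Write f = Σ_j f_j(y) x^j with f_0 monic of degree n.  For α in a finite extension of F_q whose period k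
-- under the Frobenius φ is odd, let N_α(f) ∈ F_q[y] be the norm of f(α,y).  If f(α,y) has no double root,
-- Stickelberger's argument (the sign of φ^k as a permutation of the roots, read off the Vandermonde product)
-- shows that disc_y(f) = a t² forces λ(N_α(f)) = (-1)^n χ(±a), a value that does not depend on α.  As a function
-- of f_0 = h, N_α(f) is a polynomial of degree k in h, so for α, α' of different periods the Chowla
-- hypothesis applied to N_α N_α' makes λ(N_α(f)) and λ(N_α'(f)) uncorrelated, and by the second moment the
-- values at M such α agree with probability at most 2/M.  It remains to discard double roots.  If β is a double
-- root of f(α,y) of period s, content one forces s d ≥ k; for 2s ≤ n the condition determines f_0 modulo the square
-- of the minimal polynomial of β, and for 2s > n one varies f_0 by w(y^q), which does not change the
-- derivative of f(α,y).  The α are taken of periods 3^j.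

-- The order of choices makes all bounds uniform: `ε` fixes `B`, then the number `M` of points α,
-- then the allowed density of order 1/`D` for discarded outcomes, then the periods (large against
-- `d` and `D`), then the Chowla constant `c`, and last `N`. As the periods do not depend on n, the
-- T-degree of N_α N_α' and its y-degree divided by n stay bounded, as the hypothesis demands. Its
-- separability in T is not automatic: conjugates γ ≠ γ' with f(γ,y) = f(γ',y) produce a repeated
-- root. Such collisions are made rare by varying the coefficient f_1 of x, which is where d ≥ 1
-- enters. Odd k makes φ^k act on square roots of elements of F_q as φ does, and makes every
-- φ^k-orbit of roots contribute an odd number of prime factors to the norm. With powers of a single
-- prime, an exact period is certified by excluding one subfield. In place of an algebraic closure,
-- each n gets a finite field in which all the f(α,y) for that n split. Probabilities appear as
-- inequalities between list lengths, cleared of denominators.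

open import Defs

-- Commutative rings, ring homomorphisms and polynomial rings.

module PolynomialRings where
  open import Level using (0ℓ)
  open import Algebra.Bundles using (CommutativeRing)
  open import Algebra.Structures using (IsCommutativeRing)
  open import Data.Nat as ℕ using (ℕ; zero; suc; z≤n; s≤s)
  import Data.Nat.Properties as ℕₚ
  open import Data.List using (List; []; _∷_; map; length; _++_)
  open import Data.Product using (_×_; _,_; proj₁; proj₂)
  open import Data.Maybe using (just; nothing)
  open import Data.Empty using (⊥-elim)
  open import Relation.Nullary using (yes; no)
  open import Relation.Binary using (WeaklyDecidable)
  open import Relation.Binary.PropositionalEquality as ≡ using (_≡_; _≢_)
  open import Algebra.Bundles.Raw using (RawRing)
  import Algebra.Solver.Ring as RingSolverBase
  import Algebra.Solver.Ring.AlmostCommutativeRing as ACR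
  import Algebra.Properties.Ring as RingProperties
  import Algebra.Properties.AbelianGroup as AbelianGroupProperties
  import Algebra.Properties.Semiring.Mult as SemiringMult
  import Relation.Binary.Reasoning.Setoid as SetoidReasoning

  CR : Set₁
  CR = CommutativeRing 0ℓ 0ℓ

  -- Integer coefficients for the ring solver, as formal differences of naturals.
  module Solver (R : CR) where
    open CommutativeRing R
    open RingProperties ring
    open AbelianGroupProperties +-abelianGroup using (⁻¹-∙-comm; ⁻¹-involutive)
    open SemiringMult semiring using (×-homo-+; ×1-homo-*) renaming (_×_ to _·_)
    open SetoidReasoning setoid

    differences : RawRing 0ℓ 0ℓ
    differences = record
      { Carrier = ℕ × ℕ
      ; _≈_ = _≡_
      ; _+_ = λ { (a , b) (c , d) → (a ℕ.+ c) , (b ℕ.+ d) }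
      ; _*_ = λ { (a , b) (c , d) → (a ℕ.* c ℕ.+ b ℕ.* d) , (a ℕ.* d ℕ.+ b ℕ.* c) }
      ; -_ = λ { (a , b) → b , a }
      ; 0# = 0 , 0
      ; 1# = 1 , 0
      }

    private
      ⟦_⟧ : ℕ × ℕ → Carrier
      ⟦ a , b ⟧ = (a · 1#) - (b · 1#)

      interchange : ∀ w x y z → (w + x) + (y + z) ≈ (w + y) + (x + z)
      interchange w x y z = begin
        (w + x) + (y + z) ≈⟨ +-assoc w x (y + z) ⟩
        w + (x + (y + z)) ≈⟨ +-congˡ (trans (sym (+-assoc x y z)) (+-congʳ (+-comm x y))) ⟩
        w + ((y + x) + z) ≈⟨ +-congˡ (+-assoc y x z) ⟩
        w + (y + (x + z)) ≈⟨ sym (+-assoc w y (x + z)) ⟩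
        (w + y) + (x + z) ∎

      +-hom : ∀ x y → ⟦ RawRing._+_ differences x y ⟧ ≈ ⟦ x ⟧ + ⟦ y ⟧
      +-hom (a , b) (c , d) = begin
        ((a ℕ.+ c) · 1#) - ((b ℕ.+ d) · 1#)
          ≈⟨ +-cong (×-homo-+ 1# a c) (-‿cong (×-homo-+ 1# b d)) ⟩
        (a · 1# + c · 1#) - (b · 1# + d · 1#)
          ≈⟨ +-congˡ (sym (⁻¹-∙-comm _ _)) ⟩
        (a · 1# + c · 1#) + (- (b · 1#) + - (d · 1#))
          ≈⟨ interchange _ _ _ _ ⟩
        ⟦ a , b ⟧ + ⟦ c , d ⟧ ∎

      neg-neg : ∀ x y → (- x) * (- y) ≈ x * y
      neg-neg x y = begin
        (- x) * (- y) ≈⟨ sym (-‿distribˡ-* x (- y)) ⟩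
        - (x * (- y)) ≈⟨ -‿cong (sym (-‿distribʳ-* x y)) ⟩
        - - (x * y)   ≈⟨ ⁻¹-involutive _ ⟩
        x * y         ∎

      *-hom : ∀ x y → ⟦ RawRing._*_ differences x y ⟧ ≈ ⟦ x ⟧ * ⟦ y ⟧
      *-hom (a , b) (c , d) = begin
        ((a ℕ.* c ℕ.+ b ℕ.* d) · 1#) - ((a ℕ.* d ℕ.+ b ℕ.* c) · 1#)
          ≈⟨ +-cong (two a c b d) (-‿cong (two a d b c)) ⟩
        (A * C + B * D) - (A * D + B * C)
          ≈⟨ +-congˡ (sym (⁻¹-∙-comm _ _)) ⟩
        (A * C + B * D) + (- (A * D) + - (B * C))
          ≈⟨ interchange _ _ _ _ ⟩
        (A * C + - (A * D)) + (B * D + - (B * C))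
          ≈⟨ +-cong (+-congˡ (-‿distribʳ-* A D)) (trans (+-comm _ _) (+-cong (-‿distribˡ-* B C) (sym (neg-neg B D)))) ⟩
        (A * C + A * (- D)) + ((- B) * C + (- B) * (- D))
          ≈⟨ +-cong (sym (distribˡ A C (- D))) (sym (distribˡ (- B) C (- D))) ⟩
        A * (C - D) + (- B) * (C - D)
          ≈⟨ sym (distribʳ (C - D) A (- B)) ⟩
        ⟦ a , b ⟧ * ⟦ c , d ⟧ ∎
        where
          A = a · 1#
          B = b · 1#
          C = c · 1#
          D = d · 1#
          two : ∀ i j k l → (i ℕ.* j ℕ.+ k ℕ.* l) · 1# ≈ (i · 1#) * (j · 1#) + (k · 1#) * (l · 1#)
          two i j k l = trans (×-homo-+ 1# (i ℕ.* j) (k ℕ.* l)) (+-cong (×1-homo-* i j) (×1-homo-* k l))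

      neg-hom : ∀ x → ⟦ RawRing.-_ differences x ⟧ ≈ - ⟦ x ⟧
      neg-hom (a , b) = sym (trans (sym (⁻¹-∙-comm _ _)) (trans (+-congˡ (⁻¹-involutive _)) (+-comm _ _)))

      morphism : differences ACR.-Raw-AlmostCommutative⟶ ACR.fromCommutativeRing R
      morphism = record
        { ⟦_⟧ = ⟦_⟧ ; +-homo = +-hom ; *-homo = *-hom ; -‿homo = neg-hom
        ; 0-homo = -‿inverseʳ 0#
        ; 1-homo = trans (+-cong (+-identityʳ 1#) -0#≈0#) (+-identityʳ 1#) }

      -- Formal differences have no normal form, so two coefficients are compared by their cross
      -- sums.
      equal : WeaklyDecidable (ACR.Induced-equivalence morphism)
      equal (a , b) (c , d) with (a ℕ.+ d) ℕ.≟ (c ℕ.+ b)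
      ... | no _ = nothing
      ... | yes e = just (begin
        A - B               ≈⟨ sym (+-identityʳ _) ⟩
        (A - B) + 0#        ≈⟨ +-congˡ (sym (-‿inverseʳ D)) ⟩
        (A - B) + (D - D)   ≈⟨ interchange _ _ _ _ ⟩
        (A + D) + (- B - D) ≈⟨ +-congʳ (trans (sym (×-homo-+ 1# a d)) (trans (reflexive (≡.cong (_· 1#) e)) (×-homo-+ 1# c b))) ⟩
        (C + B) + (- B - D) ≈⟨ trans (interchange _ _ _ _) (+-congˡ refl) ⟩
        (C - B) + (B - D)   ≈⟨ trans (+-congˡ (+-comm _ _)) (interchange _ _ _ _) ⟩
        (C - D) + (- B + B) ≈⟨ +-congˡ (-‿inverseˡ B) ⟩
        (C - D) + 0#        ≈⟨ +-identityʳ _ ⟩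
        C - D               ∎)
        where
          A = a · 1#
          B = b · 1#
          C = c · 1#
          D = d · 1#

    open RingSolverBase differences (ACR.fromCommutativeRing R) morphism equal public
      using (solve; _:=_; _:+_; _:*_; _:-_; :-_; con)

  record Hom (A B : CR) : Set where
    private
      module A = CommutativeRing A
      module B = CommutativeRing B
    field
      ⟦_⟧ : A.Carrier → B.Carrier
      ⟦⟧-cong : ∀ {x y} → x A.≈ y → ⟦ x ⟧ B.≈ ⟦ y ⟧
      +-homo : ∀ x y → ⟦ x A.+ y ⟧ B.≈ ⟦ x ⟧ B.+ ⟦ y ⟧
      *-homo : ∀ x y → ⟦ x A.* y ⟧ B.≈ ⟦ x ⟧ B.* ⟦ y ⟧
      1-homo : ⟦ A.1# ⟧ B.≈ B.1#

    open AbelianGroupProperties B.+-abelianGroup using (identityʳ-unique; inverseʳ-unique)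

    0-homo : ⟦ A.0# ⟧ B.≈ B.0#
    0-homo = identityʳ-unique ⟦ A.0# ⟧ ⟦ A.0# ⟧ (B.trans (B.sym (+-homo A.0# A.0#)) (⟦⟧-cong (A.+-identityˡ A.0#)))

    -‿homo : ∀ x → ⟦ A.- x ⟧ B.≈ B.- ⟦ x ⟧
    -‿homo x = inverseʳ-unique ⟦ x ⟧ ⟦ A.- x ⟧
      (B.trans (B.sym (+-homo x (A.- x))) (B.trans (⟦⟧-cong (A.-‿inverseʳ x)) 0-homo))

  idH : {A : CR} → Hom A A
  idH {A} = record { ⟦_⟧ = λ x → x ; ⟦⟧-cong = λ e → e ; +-homo = λ _ _ → refl ; *-homo = λ _ _ → refl ; 1-homo = refl }
    where open CommutativeRing A

  infixr 9 _∘H_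
  _∘H_ : {A B C : CR} → Hom B C → Hom A B → Hom A C
  _∘H_ {A} {B} {C} g f = record
    { ⟦_⟧ = λ x → G.⟦ F.⟦ x ⟧ ⟧
    ; ⟦⟧-cong = λ e → G.⟦⟧-cong (F.⟦⟧-cong e)
    ; +-homo = λ x y → trans (G.⟦⟧-cong (F.+-homo x y)) (G.+-homo _ _)
    ; *-homo = λ x y → trans (G.⟦⟧-cong (F.*-homo x y)) (G.*-homo _ _)
    ; 1-homo = trans (G.⟦⟧-cong F.1-homo) G.1-homo }
    where
      module F = Hom f
      module G = Hom g
      open CommutativeRing C

  module PolyTheory (R : CR) where
    open CommutativeRing R hiding (zero)
    open RingProperties ring using (-0#≈0#)
    open PolyOps rawRing public renaming (_≈P_ to infix 4 _≈P_; _+P_ to _+ᴿ_; _*P_ to _*ᴿ_; -P_ to -ᴿ_)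
    open SetoidReasoning setoid
    open Solver R

    infix 4 _≋_
    -- Wrapping coefficientwise equality in a record lets the two sides be inferred.
    record _≋_ (p q : Poly) : Set where
      constructor mk
      field at : p ≈P q
    open _≋_ public

    infixl 6 _+P_
    infixl 7 _*P_
    infix 8 -P_

    -- Opaque copies of the polynomial operations, so that unification treats them as rigid.
    opaque
      _+P_ _*P_ : Poly → Poly → Poly
      _+P_ = _+ᴿ_
      _*P_ = _*ᴿ_

      -P_ : Poly → Poly
      -P_ = -ᴿ_

    opaque
      unfolding _+P_ _*P_ -P_

      coeff-+ : ∀ i p q → coeff i (p +P q) ≈ coeff i p + coeff i q
      coeff-+ i [] q = sym (+-identityˡ _)
      coeff-+ i (a ∷ p) [] = sym (+-identityʳ _)
      coeff-+ zero (a ∷ p) (b ∷ q) = refl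
      coeff-+ (suc i) (a ∷ p) (b ∷ q) = coeff-+ i p q

      coeff-scale : ∀ i a q → coeff i (map (a *_) q) ≈ a * coeff i q
      coeff-scale i a [] = sym (zeroʳ a)
      coeff-scale zero a (b ∷ q) = refl
      coeff-scale (suc i) a (b ∷ q) = coeff-scale i a q

      coeff-neg : ∀ i p → coeff i (-P p) ≈ - coeff i p
      coeff-neg i [] = sym -0#≈0#
      coeff-neg zero (a ∷ p) = refl
      coeff-neg (suc i) (a ∷ p) = coeff-neg i p

      coeff-∷* : ∀ i a p q → coeff i ((a ∷ p) *P q) ≈ a * coeff i q + coeff i (0# ∷ (p *P q))
      coeff-∷* i a p q = trans (coeff-+ i (map (a *_) q) _) (+-congʳ (coeff-scale i a q))

      shift-cong : ∀ i {p q} → p ≈P q → coeff i (0# ∷ p) ≈ coeff i (0# ∷ q)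
      shift-cong zero e = refl
      shift-cong (suc i) e = e i

      shift-+ : ∀ i p q → coeff i (0# ∷ (p +P q)) ≈ coeff i (0# ∷ p) + coeff i (0# ∷ q)
      shift-+ zero p q = sym (+-identityˡ 0#)
      shift-+ (suc i) p q = coeff-+ i p q

      shift-zero : ∀ i p → IsZeroP p → coeff i (0# ∷ p) ≈ 0#
      shift-zero zero p z = refl
      shift-zero (suc i) p z = z i

      ≋-refl : ∀ {p} → p ≋ p
      ≋-refl = mk λ i → refl
      ≋-sym : ∀ {p q} → p ≋ q → q ≋ p
      ≋-sym (mk e) = mk λ i → sym (e i)
      ≋-trans : ∀ {p q r} → p ≋ q → q ≋ r → p ≋ r
      ≋-trans (mk e) (mk f) = mk λ i → trans (e i) (f i)

      private
        +c : ∀ {p p' q q'} → p ≋ p' → q ≋ q' → p +P q ≋ p' +P q'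
        +c {p} {p'} {q} {q'} (mk e) (mk f) =
          mk λ i → trans (coeff-+ i p q) (trans (+-cong (e i) (f i)) (sym (coeff-+ i p' q')))

        +as : ∀ p q r → (p +P q) +P r ≋ p +P (q +P r)
        +as p q r = mk λ i → begin
          coeff i ((p +P q) +P r)             ≈⟨ trans (coeff-+ i (p +P q) r) (+-congʳ (coeff-+ i p q)) ⟩
          (coeff i p + coeff i q) + coeff i r ≈⟨ +-assoc _ _ _ ⟩
          coeff i p + (coeff i q + coeff i r) ≈⟨ sym (trans (coeff-+ i p (q +P r)) (+-congˡ (coeff-+ i q r))) ⟩
          coeff i (p +P (q +P r))             ∎

        +cm : ∀ p q → p +P q ≋ q +P p
        +cm p q = mk λ i → trans (coeff-+ i p q) (trans (+-comm _ _) (sym (coeff-+ i q p)))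

        +idʳ : ∀ p → p +P [] ≋ p
        +idʳ p = mk λ i → trans (coeff-+ i p []) (+-identityʳ _)

        +inv : ∀ p → p +P (-P p) ≋ []
        +inv p = mk λ i → trans (coeff-+ i p (-P p)) (trans (+-congˡ (coeff-neg i p)) (-‿inverseʳ _))

        -c : ∀ {p q} → p ≋ q → -P p ≋ -P q
        -c {p} {q} (mk e) = mk λ i → trans (coeff-neg i p) (trans (-‿cong (e i)) (sym (coeff-neg i q)))

        zero* : ∀ p q → IsZeroP p → IsZeroP (p *P q)
        zero* [] q z i = refl
        zero* (a ∷ p) q z i = begin
          coeff i ((a ∷ p) *P q)                   ≈⟨ coeff-∷* i a p q ⟩
          a * coeff i q + coeff i (0# ∷ (p *P q)) ≈⟨ +-cong (*-congʳ (z 0)) (shift-zero i _ (zero* p q (λ j → z (suc j)))) ⟩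
          0# * coeff i q + 0#                      ≈⟨ trans (+-identityʳ _) (zeroˡ _) ⟩
          0#                                       ∎

        *cˡ : ∀ p p' q → p ≈P p' → p *P q ≈P p' *P q
        *cˡ [] p' q e i = sym (zero* p' q (λ j → sym (e j)) i)
        *cˡ (a ∷ p) [] q e i = zero* (a ∷ p) q e i
        *cˡ (a ∷ p) (b ∷ p') q e i = begin
          coeff i ((a ∷ p) *P q)                    ≈⟨ coeff-∷* i a p q ⟩
          a * coeff i q + coeff i (0# ∷ (p *P q))  ≈⟨ +-cong (*-congʳ (e 0)) (shift-cong i (*cˡ p p' q (λ j → e (suc j)))) ⟩
          b * coeff i q + coeff i (0# ∷ (p' *P q)) ≈⟨ sym (coeff-∷* i b p' q) ⟩
          coeff i ((b ∷ p') *P q)                   ∎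

        *cʳ : ∀ p q q' → q ≈P q' → p *P q ≈P p *P q'
        *cʳ [] q q' e i = refl
        *cʳ (a ∷ p) q q' e i = trans (coeff-∷* i a p q)
          (trans (+-cong (*-congˡ (e i)) (shift-cong i (*cʳ p q q' e))) (sym (coeff-∷* i a p q')))

        *c : ∀ {p p' q q'} → p ≋ p' → q ≋ q' → p *P q ≋ p' *P q'
        *c {p} {p'} {q} {q'} (mk e) (mk f) = mk λ i → trans (*cˡ p p' q e i) (*cʳ p' q q' f i)

        *zʳ : ∀ p → IsZeroP (p *P [])
        *zʳ [] i = refl
        *zʳ (a ∷ p) i = shift-zero i _ (*zʳ p)

        disʳ : ∀ r p q → (p +P q) *P r ≋ (p *P r) +P (q *P r)
        disʳ r [] q = ≋-refl
        disʳ r (a ∷ p) [] = ≋-sym (+idʳ ((a ∷ p) *P r))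
        disʳ r (a ∷ p) (b ∷ q) = mk λ i → begin
          coeff i (((a + b) ∷ (p +P q)) *P r)
            ≈⟨ coeff-∷* i (a + b) (p +P q) r ⟩
          (a + b) * coeff i r + coeff i (0# ∷ ((p +P q) *P r))
            ≈⟨ +-congˡ (trans (shift-cong i (at (disʳ r p q))) (shift-+ i (p *P r) (q *P r))) ⟩
          (a + b) * coeff i r + (coeff i (0# ∷ (p *P r)) + coeff i (0# ∷ (q *P r)))
            ≈⟨ solve 5 (λ a b r x y → (a :+ b) :* r :+ (x :+ y) := (a :* r :+ x) :+ (b :* r :+ y)) refl a b _ _ _ ⟩
          (a * coeff i r + coeff i (0# ∷ (p *P r))) + (b * coeff i r + coeff i (0# ∷ (q *P r)))
            ≈⟨ sym (trans (coeff-+ i ((a ∷ p) *P r) ((b ∷ q) *P r)) (+-cong (coeff-∷* i a p r) (coeff-∷* i b q r))) ⟩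
          coeff i (((a ∷ p) *P r) +P ((b ∷ q) *P r)) ∎

        -- The mirror image of `coeff-∷*`. Multiplication recurses on its left factor, so
        -- commutativity needs the expansion along the right factor as well.
        *∷ʳ : ∀ i p b q → coeff i (p *P (b ∷ q)) ≈ b * coeff i p + coeff i (0# ∷ (p *P q))
        *∷ʳ zero [] b q = sym (trans (+-identityʳ _) (zeroʳ b))
        *∷ʳ (suc i) [] b q = sym (trans (+-identityʳ _) (zeroʳ b))
        *∷ʳ zero (a ∷ p) b q = trans (coeff-∷* 0 a p (b ∷ q)) (+-congʳ (*-comm a b))
        *∷ʳ (suc i) (a ∷ p) b q = begin
          coeff (suc i) ((a ∷ p) *P (b ∷ q))
            ≈⟨ coeff-∷* (suc i) a p (b ∷ q) ⟩
          a * coeff i q + coeff i (p *P (b ∷ q))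
            ≈⟨ +-congˡ (*∷ʳ i p b q) ⟩
          a * coeff i q + (b * coeff i p + coeff i (0# ∷ (p *P q)))
            ≈⟨ solve 3 (λ x y z → x :+ (y :+ z) := y :+ (x :+ z)) refl _ _ _ ⟩
          b * coeff i p + (a * coeff i q + coeff i (0# ∷ (p *P q)))
            ≈⟨ +-congˡ (sym (coeff-∷* i a p q)) ⟩
          b * coeff i p + coeff i ((a ∷ p) *P q) ∎

        *cm : ∀ p q → p *P q ≋ q *P p
        *cm [] q = mk λ i → sym (*zʳ q i)
        *cm (a ∷ p) q = mk λ i → trans (coeff-∷* i a p q)
          (trans (+-congˡ (shift-cong i (at (*cm p q)))) (sym (*∷ʳ i q a p)))

        scale* : ∀ a q r → map (a *_) q *P r ≋ map (a *_) (q *P r)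
        scale* a [] r = ≋-refl
        scale* a (b ∷ q) r = mk λ i → begin
          coeff i (((a * b) ∷ map (a *_) q) *P r)
            ≈⟨ coeff-∷* i (a * b) (map (a *_) q) r ⟩
          (a * b) * coeff i r + coeff i (0# ∷ (map (a *_) q *P r))
            ≈⟨ +-cong (*-assoc a b _) (trans (shift-cong i (at (scale* a q r))) (lem i)) ⟩
          a * (b * coeff i r) + a * coeff i (0# ∷ (q *P r))
            ≈⟨ trans (sym (distribˡ a _ _)) (*-congˡ (sym (coeff-∷* i b q r))) ⟩
          a * coeff i ((b ∷ q) *P r)
            ≈⟨ sym (coeff-scale i a ((b ∷ q) *P r)) ⟩
          coeff i (map (a *_) ((b ∷ q) *P r)) ∎
          where
            lem : ∀ i → coeff i (0# ∷ map (a *_) (q *P r)) ≈ a * coeff i (0# ∷ (q *P r))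
            lem zero = sym (zeroʳ a)
            lem (suc i) = coeff-scale i a (q *P r)

        *as : ∀ p q r → (p *P q) *P r ≋ p *P (q *P r)
        *as [] q r = ≋-refl
        *as (a ∷ p) q r = ≋-trans (disʳ r (map (a *_) q) (0# ∷ (p *P q))) (+c (scale* a q r) (mk λ i → begin
          coeff i ((0# ∷ (p *P q)) *P r)                          ≈⟨ coeff-∷* i 0# (p *P q) r ⟩
          0# * coeff i r + coeff i (0# ∷ ((p *P q) *P r))         ≈⟨ trans (+-congʳ (zeroˡ _)) (+-identityˡ _) ⟩
          coeff i (0# ∷ ((p *P q) *P r))                          ≈⟨ shift-cong i (at (*as p q r)) ⟩
          coeff i (0# ∷ (p *P (q *P r)))                          ∎))

        *idˡ : ∀ p → 1P *P p ≋ p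
        *idˡ p = mk λ i → begin
          coeff i (1P *P p)                     ≈⟨ coeff-∷* i 1# [] p ⟩
          1# * coeff i p + coeff i (0# ∷ [])   ≈⟨ +-cong (*-identityˡ _) (shift-zero i [] (λ _ → refl)) ⟩
          coeff i p + 0#                        ≈⟨ +-identityʳ _ ⟩
          coeff i p                             ∎

    opaque
      unfolding _+P_ _*P_ -P_

      poly-isCommutativeRing : IsCommutativeRing _≋_ _+P_ _*P_ -P_ 0P 1P
      poly-isCommutativeRing = record
        { isRing = record
          { +-isAbelianGroup = record
            { isGroup = record
              { isMonoid = record
                { isSemigroup = record
                  { isMagma = record
                    { isEquivalence = record { refl = ≋-refl ; sym = ≋-sym ; trans = ≋-trans }
                    ; ∙-cong = +c }
                  ; assoc = +as }
                ; identity = (λ p → ≋-refl) , +idʳ }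
              ; inverse = (λ p → ≋-trans (+cm (-P p) p) (+inv p)) , +inv
              ; ⁻¹-cong = -c }
            ; comm = +cm }
          ; *-cong = *c
          ; *-assoc = *as
          ; *-identity = *idˡ , (λ p → ≋-trans (*cm p 1P) (*idˡ p))
          ; distrib = (λ r p q → ≋-trans (*cm r (p +P q)) (≋-trans (disʳ r p q) (+c (*cm p r) (*cm q r)))) , disʳ }
        ; *-comm = *cm }

    polyRing : CR
    polyRing = record
      { Carrier = Poly ; _≈_ = _≋_ ; _+_ = _+P_ ; _*_ = _*P_ ; -_ = -P_ ; 0# = 0P ; 1# = 1P
      ; isCommutativeRing = poly-isCommutativeRing }

    module PR = CommutativeRing polyRing

    opaque
      unfolding _+P_ _*P_ -P_

      -- These three equalities are the bridge between the operations of the statement and their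
      -- opaque copies.
      raw-+ : ∀ p q → p +ᴿ q ≡ p +P q
      raw-+ p q = ≡.refl

      raw-* : ∀ p q → p *ᴿ q ≡ p *P q
      raw-* p q = ≡.refl

      raw-neg : ∀ p → -ᴿ p ≡ -P p
      raw-neg p = ≡.refl

      ∷* : ∀ a p q → (a ∷ p) *P q ≋ map (a *_) q +P (0# ∷ (p *P q))
      ∷* a p q = ≋-refl

      []* : ∀ q → [] *P q ≋ []
      []* q = ≋-refl

      coeff-const* : ∀ i a p → coeff i (constP a *P p) ≈ a * coeff i p
      coeff-const* i a p = trans (coeff-∷* i a [] p) (trans (+-congˡ (shift-zero i [] (λ _ → refl))) (+-identityʳ _))

    ∷-cong : ∀ {a b p q} → a ≈ b → p ≋ q → a ∷ p ≋ b ∷ q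
    ∷-cong e (mk f) = mk λ { zero → e ; (suc i) → f i }

    opaque
      unfolding _+P_ _*P_ -P_

      ∷-split : ∀ a p → a ∷ p ≋ constP a +P (0# ∷ p)
      ∷-split a p = mk λ { zero → sym (+-identityʳ a) ; (suc i) → refl }

    constP-cong : ∀ {a b} → a ≈ b → constP a ≋ constP b
    constP-cong e = ∷-cong e ≋-refl

    eval-zero : ∀ p x → IsZeroP p → evalP p x ≈ 0#
    eval-zero [] x z = refl
    eval-zero (a ∷ p) x z = trans (+-cong (z 0) (trans (*-congˡ (eval-zero p x (λ i → z (suc i)))) (zeroʳ x))) (+-identityʳ 0#)

    eval-cong : ∀ {p q x y} → p ≋ q → x ≈ y → evalP p x ≈ evalP q y
    eval-cong {p} {q} (mk e) f = go p q e f
      where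
        go : ∀ p q {x y} → p ≈P q → x ≈ y → evalP p x ≈ evalP q y
        go [] q {x} {y} e f = sym (eval-zero q y (λ i → sym (e i)))
        go (a ∷ p) [] {x} e f = eval-zero (a ∷ p) x e
        go (a ∷ p) (b ∷ q) e f = +-cong (e 0) (*-cong f (go p q (λ i → e (suc i)) f))

    opaque
      unfolding _+P_ _*P_ -P_

      eval-+ : ∀ p q x → evalP (p +P q) x ≈ evalP p x + evalP q x
      eval-+ [] q x = sym (+-identityˡ _)
      eval-+ (a ∷ p) [] x = sym (+-identityʳ _)
      eval-+ (a ∷ p) (b ∷ q) x = trans (+-congˡ (*-congˡ (eval-+ p q x)))
        (solve 5 (λ a b x u v → (a :+ b) :+ x :* (u :+ v) := (a :+ x :* u) :+ (b :+ x :* v)) refl a b x _ _)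

      eval-scale : ∀ a p x → evalP (map (a *_) p) x ≈ a * evalP p x
      eval-scale a [] x = sym (zeroʳ a)
      eval-scale a (b ∷ p) x = trans (+-congˡ (*-congˡ (eval-scale a p x)))
        (solve 4 (λ a b x u → a :* b :+ x :* (a :* u) := a :* (b :+ x :* u)) refl a b x _)

      eval-* : ∀ p q x → evalP (p *P q) x ≈ evalP p x * evalP q x
      eval-* [] q x = sym (zeroˡ _)
      eval-* (a ∷ p) q x = begin
        evalP (map (a *_) q +P (0# ∷ (p *P q))) x             ≈⟨ eval-+ (map (a *_) q) _ x ⟩
        evalP (map (a *_) q) x + (0# + x * evalP (p *P q) x)   ≈⟨ +-cong (eval-scale a q x) (trans (+-identityˡ _) (*-congˡ (eval-* p q x))) ⟩
        a * evalP q x + x * (evalP p x * evalP q x)             ≈⟨ solve 4 (λ a q x p → a :* q :+ x :* (p :* q) := (a :+ x :* p) :* q) refl a _ x _ ⟩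
        (a + x * evalP p x) * evalP q x                         ∎

    eval-const : ∀ a x → evalP (constP a) x ≈ a
    eval-const a x = trans (+-congˡ (zeroʳ x)) (+-identityʳ a)

    evalHom : Carrier → Hom polyRing R
    evalHom x = record
      { ⟦_⟧ = λ p → evalP p x ; ⟦⟧-cong = λ e → eval-cong e refl
      ; +-homo = λ p q → eval-+ p q x ; *-homo = λ p q → eval-* p q x ; 1-homo = eval-const 1# x }

    opaque
      unfolding _+P_ _*P_ -P_

      const-+ : ∀ a b → constP (a + b) ≋ constP a +P constP b
      const-+ a b = ≋-refl

    const-* : ∀ a b → constP (a * b) ≋ constP a *P constP b
    const-* a b = mk λ i → sym (trans (coeff-const* i a (constP b)) (lem i))
      where
        lem : ∀ i → a * coeff i (constP b) ≈ coeff i (constP (a * b))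
        lem zero = refl
        lem (suc i) = zeroʳ a

    constHom : Hom R polyRing
    constHom = record
      { ⟦_⟧ = constP ; ⟦⟧-cong = constP-cong ; +-homo = const-+ ; *-homo = const-* ; 1-homo = ≋-refl }

    -- A strict bound makes sense for the zero polynomial too, so degrees never need a value at 0.
    record DegLt (m : ℕ) (p : Poly) : Set where
      constructor dlt
      field vanish : ∀ i → m ℕ.≤ i → coeff i p ≈ 0#
    open DegLt public

    record MonicDeg (m : ℕ) (p : Poly) : Set where
      constructor _&_
      field
        lead : coeff m p ≈ 1#
        degLt : DegLt (suc m) p
    open MonicDeg public

    degLt-cong : ∀ {m p q} → p ≋ q → DegLt m p → DegLt m q
    degLt-cong (mk e) (dlt d) = dlt λ i m≤i → trans (sym (e i)) (d i m≤i)

    degLt-mono : ∀ {m m' p} → m ℕ.≤ m' → DegLt m p → DegLt m' p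
    degLt-mono le (dlt d) = dlt λ i m≤i → d i (ℕₚ.≤-trans le m≤i)

    monicDeg-cong : ∀ {m p q} → p ≋ q → MonicDeg m p → MonicDeg m q
    monicDeg-cong {m} e (l & d) = trans (sym (at e m)) l & degLt-cong e d

    degLt-+ : ∀ {m p q} → DegLt m p → DegLt m q → DegLt m (p +P q)
    degLt-+ {p = p} {q} (dlt d) (dlt e) = dlt λ i m≤i → trans (coeff-+ i p q) (trans (+-cong (d i m≤i) (e i m≤i)) (+-identityʳ 0#))

    degLt-neg : ∀ {m p} → DegLt m p → DegLt m (-P p)
    degLt-neg {p = p} (dlt d) = dlt λ i m≤i → trans (coeff-neg i p) (trans (-‿cong (d i m≤i)) -0#≈0#)

    degLt-length : ∀ p → DegLt (length p) p
    degLt-length p = dlt (go p)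
      where
        go : ∀ p i → length p ℕ.≤ i → coeff i p ≈ 0#
        go [] i _ = refl
        go (a ∷ p) (suc i) (s≤s le) = go p i le

    opaque
      unfolding _+P_ _*P_ -P_

      private
        deg* : ∀ {a b} p q → (∀ i → a ℕ.< i → coeff i p ≈ 0#) → (∀ i → b ℕ.< i → coeff i q ≈ 0#) →
          coeff (a ℕ.+ b) (p *P q) ≈ coeff a p * coeff b q × (∀ i → a ℕ.+ b ℕ.< i → coeff i (p *P q) ≈ 0#)
        deg* [] q dp dq = sym (zeroˡ _) , λ i _ → refl
        deg* {zero} {b} (c ∷ p) q dp dq = top b , λ i b<i → trans (top i) (trans (*-congˡ (dq i b<i)) (zeroʳ c))
          where
            top : ∀ i → coeff i ((c ∷ p) *P q) ≈ c * coeff i q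
            top i = trans (coeff-∷* i c p q) (trans (+-congˡ (shift-zero i _ (zero* p q (λ j → dp (suc j) (s≤s z≤n))))) (+-identityʳ _))
        deg* {suc a} {b} (c ∷ p) q dp dq with deg* {a} {b} p q (λ i lt → dp (suc i) (s≤s lt)) dq
        ... | l , d =
          trans (coeff-∷* (suc (a ℕ.+ b)) c p q)
            (trans (+-cong (trans (*-congˡ (dq (suc (a ℕ.+ b)) (s≤s (ℕₚ.m≤n+m b a)))) (zeroʳ c)) l) (+-identityˡ _)) ,
          λ { (suc i) (s≤s lt) → trans (coeff-∷* (suc i) c p q)
                (trans (+-cong (trans (*-congˡ (dq (suc i) (ℕₚ.≤-trans (s≤s (ℕₚ.m≤n+m b a)) (ℕₚ.≤-trans lt (ℕₚ.n≤1+n i))))) (zeroʳ c)) (d i lt)) (+-identityˡ _)) }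

    coeff-top-* : ∀ {a b} p q → DegLt (suc a) p → DegLt (suc b) q → coeff (a ℕ.+ b) (p *P q) ≈ coeff a p * coeff b q
    coeff-top-* p q (dlt dp) (dlt dq) = proj₁ (deg* p q dp dq)

    degLt-* : ∀ {a b} p q → DegLt (suc a) p → DegLt (suc b) q → DegLt (suc (a ℕ.+ b)) (p *P q)
    degLt-* p q (dlt dp) (dlt dq) = dlt (proj₂ (deg* p q dp dq))

    monicDeg-* : ∀ {a b p q} → MonicDeg a p → MonicDeg b q → MonicDeg (a ℕ.+ b) (p *P q)
    monicDeg-* {p = p} {q} (lp & dp) (lq & dq) =
      trans (coeff-top-* p q dp dq) (trans (*-cong lp lq) (*-identityˡ 1#)) & degLt-* p q dp dq

    monicDeg-1 : MonicDeg 0 1P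
    monicDeg-1 = refl & dlt λ { (suc i) _ → refl }

    opaque
      unfolding _+P_ _*P_ -P_

      lin : Carrier → Poly
      lin b = (- b) ∷ 1# ∷ []

      monicDeg-lin : ∀ b → MonicDeg 1 (lin b)
      monicDeg-lin b = refl & dlt λ { (suc zero) (s≤s ()) ; (suc (suc i)) _ → refl }

      lin-cong : ∀ {a b} → a ≈ b → lin a ≋ lin b
      lin-cong e = ∷-cong (-‿cong e) ≋-refl

      eval-lin : ∀ b x → evalP (lin b) x ≈ x - b
      eval-lin b x = trans (+-congˡ (*-congˡ (eval-const 1# x))) (trans (+-congˡ (*-identityʳ x)) (+-comm (- b) x))

      lin* : ∀ x p → lin x *P p ≋ (0# ∷ p) +P map ((- x) *_) p
      lin* x p = mk λ i → begin
        coeff i (lin x *P p)                                              ≈⟨ coeff-∷* i (- x) (1# ∷ []) p ⟩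
        (- x) * coeff i p + coeff i (0# ∷ (1P *P p))                      ≈⟨ +-comm _ _ ⟩
        coeff i (0# ∷ (1P *P p)) + (- x) * coeff i p                      ≈⟨ +-cong (shift-cong i (at (*idˡ p))) (sym (coeff-scale i (- x) p)) ⟩
        coeff i (0# ∷ p) + coeff i (map ((- x) *_) p)                     ≈⟨ sym (coeff-+ i (0# ∷ p) (map ((- x) *_) p)) ⟩
        coeff i ((0# ∷ p) +P map ((- x) *_) p)                            ∎

      deriv-lin : ∀ b → deriv (lin b) ≋ 1P
      deriv-lin b = ∷-cong (+-identityʳ 1#) ≋-refl

    lin-root : ∀ b p → evalP (lin b *P p) b ≈ 0#
    lin-root b p = trans (eval-* (lin b) p b) (trans (*-congʳ (trans (eval-lin b b) (-‿inverseʳ b))) (zeroˡ _))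

    prodLin : List Carrier → Poly
    prodLin [] = 1P
    prodLin (b ∷ bs) = lin b *P prodLin bs

    monicDeg-prodLin : ∀ bs → MonicDeg (length bs) (prodLin bs)
    monicDeg-prodLin [] = monicDeg-1
    monicDeg-prodLin (b ∷ bs) = monicDeg-* (monicDeg-lin b) (monicDeg-prodLin bs)

    prodLin-++ : ∀ as bs → prodLin (as ++ bs) ≋ prodLin as *P prodLin bs
    prodLin-++ [] bs = PR.sym (PR.*-identityˡ _)
    prodLin-++ (a ∷ as) bs = PR.trans (PR.*-congˡ (prodLin-++ as bs)) (PR.sym (PR.*-assoc _ _ _))

    diffs : Carrier → List Carrier → Carrier
    diffs x [] = 1#
    diffs x (b ∷ bs) = (x - b) * diffs x bs

    eval-prodLin : ∀ bs x → evalP (prodLin bs) x ≈ diffs x bs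
    eval-prodLin [] x = eval-const 1# x
    eval-prodLin (b ∷ bs) x = trans (eval-* (lin b) (prodLin bs) x) (*-cong (eval-lin b x) (eval-prodLin bs x))

    -- Horner's scheme for division by X - x: the coefficients of the quotient are the values at x
    -- of the successive tails of the polynomial.
    quot : Poly → Carrier → Poly
    quot [] x = []
    quot (a ∷ p) x = evalP p x ∷ quot p x

    quot-spec : ∀ p x → p ≋ lin x *P quot p x +P constP (evalP p x)
    quot-spec [] x = mk λ { i → sym (trans (coeff-+ i (lin x *P []) (constP 0#)) (trans (+-cong (*zʳ (lin x) i) (z i)) (+-identityʳ 0#))) }
      where
        z : ∀ i → coeff i (constP 0#) ≈ 0#
        z zero = refl
        z (suc i) = refl
    quot-spec (a ∷ p) x = mk λ i → sym (trans (coeff-+ i (lin x *P (e ∷ k)) (constP (a + x * e)))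
        (trans (+-congʳ (trans (at (lin* x (e ∷ k)) i) (coeff-+ i (0# ∷ e ∷ k) (map ((- x) *_) (e ∷ k))))) (go i)))
      where
        e = evalP p x
        k = quot p x
        ih : ∀ i → coeff i p ≈ (coeff i (0# ∷ k) + coeff i (map ((- x) *_) k)) + coeff i (constP e)
        ih i = trans (at (quot-spec p x) i) (trans (coeff-+ i (lin x *P k) (constP e)) (+-congʳ (trans (at (lin* x k) i) (coeff-+ i (0# ∷ k) (map ((- x) *_) k)))))
        go : ∀ i → (coeff i (0# ∷ e ∷ k) + coeff i (map ((- x) *_) (e ∷ k))) + coeff i (constP (a + x * e)) ≈ coeff i (a ∷ p)
        go zero = trans (+-congʳ (+-identityˡ _)) (solve 3 (λ x e a → (:- x) :* e :+ (a :+ x :* e) := a) refl x e a)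
        go (suc zero) = trans (+-identityʳ _) (trans (trans (+-comm _ _) (sym (trans (+-congʳ (+-identityˡ _)) refl))) (sym (ih 0)))
        go (suc (suc i)) = sym (ih (suc i))

    factor : ∀ p x → evalP p x ≈ 0# → p ≋ lin x *P quot p x
    factor p x r = PR.trans (quot-spec p x) (mk λ i → trans (coeff-+ i (lin x *P quot p x) (constP (evalP p x))) (trans (+-congˡ (z i)) (+-identityʳ _)))
      where
        z : ∀ i → coeff i (constP (evalP p x)) ≈ 0#
        z zero = r
        z (suc i) = refl

    natMul-cong : ∀ n {a b} → a ≈ b → natMul n a ≈ natMul n b
    natMul-cong zero e = refl
    natMul-cong (suc n) e = +-cong e (natMul-cong n e)

    natMul-+ : ∀ n a b → natMul n (a + b) ≈ natMul n a + natMul n b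
    natMul-+ zero a b = sym (+-identityʳ 0#)
    natMul-+ (suc n) a b = trans (+-congˡ (natMul-+ n a b)) (solve 4 (λ a b x y → (a :+ b) :+ (x :+ y) := (a :+ x) :+ (b :+ y)) refl a b _ _)

    natMul-* : ∀ n a b → natMul n (a * b) ≈ a * natMul n b
    natMul-* zero a b = sym (zeroʳ a)
    natMul-* (suc n) a b = trans (+-congˡ (natMul-* n a b)) (sym (distribˡ a b _))

    natMul-0 : ∀ n → natMul n 0# ≈ 0#
    natMul-0 zero = refl
    natMul-0 (suc n) = trans (+-identityˡ _) (natMul-0 n)

    natMul-1 : ∀ n a → natMul n a ≈ a * natMul n 1#
    natMul-1 n a = trans (natMul-cong n (sym (*-identityʳ a))) (natMul-* n a 1#)

    natMul-add : ∀ m n a → natMul (m ℕ.+ n) a ≈ natMul m a + natMul n a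
    natMul-add zero n a = sym (+-identityˡ _)
    natMul-add (suc m) n a = trans (+-congˡ (natMul-add m n a)) (sym (+-assoc _ _ _))

    natMul-mul : ∀ m n a → natMul (m ℕ.* n) a ≈ natMul m (natMul n a)
    natMul-mul zero n a = refl
    natMul-mul (suc m) n a = trans (natMul-add n (m ℕ.* n) a) (+-congˡ (natMul-mul m n a))

    coeff-derivAux : ∀ k i p → coeff i (derivAux k p) ≈ natMul (k ℕ.+ i) (coeff i p)
    coeff-derivAux k i [] = sym (natMul-0 (k ℕ.+ i))
    coeff-derivAux k zero (a ∷ p) = reflexive (≡.cong (λ m → natMul m a) (≡.sym (ℕₚ.+-identityʳ k)))
    coeff-derivAux k (suc i) (a ∷ p) = trans (coeff-derivAux (suc k) i p)
      (reflexive (≡.cong (λ m → natMul m (coeff i p)) (≡.sym (ℕₚ.+-suc k i))))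

    coeff-deriv : ∀ i p → coeff i (deriv p) ≈ natMul (suc i) (coeff (suc i) p)
    coeff-deriv i [] = sym (natMul-0 (suc i))
    coeff-deriv i (a ∷ p) = coeff-derivAux 1 i p

    deriv-cong : ∀ {p q} → p ≋ q → deriv p ≋ deriv q
    deriv-cong {p} {q} (mk e) = mk λ i → trans (coeff-deriv i p) (trans (natMul-cong (suc i) (e (suc i))) (sym (coeff-deriv i q)))

    shift-+P : ∀ p q → (0# ∷ p) +P (0# ∷ q) ≋ 0# ∷ (p +P q)
    shift-+P p q = mk λ { zero → trans (coeff-+ 0 (0# ∷ p) (0# ∷ q)) (+-identityʳ 0#) ; (suc i) → trans (coeff-+ (suc i) (0# ∷ p) (0# ∷ q)) (sym (coeff-+ i p q)) }

    deriv-+ : ∀ p q → deriv (p +P q) ≋ deriv p +P deriv q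
    deriv-+ p q = mk λ i → begin
      coeff i (deriv (p +P q)) ≈⟨ trans (coeff-deriv i (p +P q)) (trans (natMul-cong (suc i) (coeff-+ (suc i) p q)) (natMul-+ (suc i) _ _)) ⟩
      natMul (suc i) (coeff (suc i) p) + natMul (suc i) (coeff (suc i) q) ≈⟨ sym (trans (coeff-+ i (deriv p) (deriv q)) (+-cong (coeff-deriv i p) (coeff-deriv i q))) ⟩
      coeff i (deriv p +P deriv q) ∎

    deriv-scale : ∀ a p → deriv (map (a *_) p) ≋ map (a *_) (deriv p)
    deriv-scale a p = mk λ i → trans (coeff-deriv i (map (a *_) p)) (trans (natMul-cong (suc i) (coeff-scale (suc i) a p))
      (trans (natMul-* (suc i) a _) (sym (trans (coeff-scale i a (deriv p)) (*-congˡ (coeff-deriv i p))))))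

    deriv-∷ : ∀ a p → deriv (a ∷ p) ≋ p +P (0# ∷ deriv p)
    deriv-∷ a p = mk λ i → trans (coeff-deriv i (a ∷ p)) (sym (trans (coeff-+ i p (0# ∷ deriv p)) (+-congˡ (lem i))))
      where
        lem : ∀ i → coeff i (0# ∷ deriv p) ≈ natMul i (coeff i p)
        lem zero = refl
        lem (suc i) = coeff-deriv i p

    shift* : ∀ p q → (0# ∷ p) *P q ≋ 0# ∷ (p *P q)
    shift* p q = mk λ i → trans (coeff-∷* i 0# p q) (trans (+-congʳ (zeroˡ _)) (+-identityˡ _))

    deriv-* : ∀ p q → deriv (p *P q) ≋ deriv p *P q +P p *P deriv q
    deriv-* [] q = PR.trans (deriv-cong ([]* q)) (PR.sym (PR.trans (PR.+-cong ([]* q) ([]* (deriv q))) (PR.+-identityʳ _)))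
    deriv-* (a ∷ p) q =
      PR.trans (deriv-cong (∷* a p q)) (PR.trans (deriv-+ (map (a *_) q) (0# ∷ (p *P q)))
      (PR.trans (PR.+-cong (deriv-scale a q) (PR.trans (deriv-∷ 0# (p *P q))
          (PR.+-congˡ (PR.trans (∷-cong refl (deriv-* p q)) (PR.sym (PR.trans (PR.+-cong (shift* (deriv p) q) (shift* p (deriv q))) (shift-+P (deriv p *P q) (p *P deriv q))))))))
      (PR.trans (PSolver.solve 5 (λ s u v w t → s PSolver.:+ (u PSolver.:* v PSolver.:+ (w PSolver.:* v PSolver.:+ t))
             PSolver.:= (u PSolver.:+ w) PSolver.:* v PSolver.:+ (s PSolver.:+ t)) ≋-refl (map (a *_) (deriv q)) p q (0# ∷ deriv p) ((0# ∷ p) *P deriv q))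
      (PR.+-cong (PR.*-congʳ (PR.sym (deriv-∷ a p))) (PR.trans (PR.+-congˡ (shift* p (deriv q))) (PR.sym (∷* a p (deriv q))))))))
      where module PSolver = Solver polyRing

    degLt-deriv : ∀ {m p} → DegLt (suc m) p → DegLt m (deriv p)
    degLt-deriv {m} {p} (dlt d) = dlt λ i m≤i → trans (coeff-deriv i p) (trans (natMul-cong (suc i) (d (suc i) (s≤s m≤i))) (natMul-0 (suc i)))

    Xpow : ℕ → Poly
    Xpow zero = 1P
    Xpow (suc n) = 0# ∷ Xpow n

    pow : Carrier → ℕ → Carrier
    pow x zero = 1#
    pow x (suc n) = x * pow x n

    eval-Xpow : ∀ n x → evalP (Xpow n) x ≈ pow x n
    eval-Xpow zero x = eval-const 1# x
    eval-Xpow (suc n) x = trans (+-identityˡ _) (*-congˡ (eval-Xpow n x))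

    monicDeg-Xpow : ∀ n → MonicDeg n (Xpow n)
    monicDeg-Xpow zero = monicDeg-1
    monicDeg-Xpow (suc n) with monicDeg-Xpow n
    ... | l & dlt d = l & dlt λ { (suc i) (s≤s lt) → d i lt }

    -- Only the coefficient of degree Q - 1 could survive, and it is Q · 1. Applied with Q a power
    -- of q, this is how the characteristic enters.
    deriv-Xpow : ∀ Q → natMul Q 1# ≈ 0# → deriv (Xpow Q) ≋ 0P
    deriv-Xpow Q z = mk λ i → trans (coeff-deriv i (Xpow Q)) (go i)
      where
        at-other : ∀ Q i → i ≢ Q → coeff i (Xpow Q) ≈ 0#
        at-other zero zero ne = ⊥-elim (ne ≡.refl)
        at-other zero (suc i) ne = refl
        at-other (suc Q) zero ne = refl
        at-other (suc Q) (suc i) ne = at-other Q i (λ e → ne (≡.cong suc e))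
        go : ∀ i → natMul (suc i) (coeff (suc i) (Xpow Q)) ≈ 0#
        go i with suc i ℕ.≟ Q
        ... | yes ≡.refl = trans (natMul-cong (suc i) (lead (monicDeg-Xpow (suc i)))) z
        ... | no ne = trans (natMul-cong (suc i) (at-other Q (suc i) ne)) (natMul-0 (suc i))

  infixl 10 _[X]
  _[X] : CR → CR
  R [X] = PolyTheory.polyRing R

  module MapPoly {A B : CR} (h : Hom A B) where
    private
      module A = CommutativeRing A
      module B = CommutativeRing B
      module PA = PolyTheory A
      module PB = PolyTheory B
    open Hom h
    open PB using (_≋_; mk; at)

    coeff-map : ∀ i p → PB.coeff i (map ⟦_⟧ p) B.≈ ⟦ PA.coeff i p ⟧
    coeff-map i [] = B.sym 0-homo
    coeff-map zero (a ∷ p) = B.refl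
    coeff-map (suc i) (a ∷ p) = coeff-map i p

    mapP : PA.Poly → PB.Poly
    mapP = map ⟦_⟧

    opaque
      unfolding PolyTheory._+P_ PolyTheory._*P_

      mapP-scale : ∀ a p → mapP (map (a A.*_) p) ≋ map (⟦ a ⟧ B.*_) (mapP p)
      mapP-scale a [] = PB.≋-refl
      mapP-scale a (b ∷ p) = PB.∷-cong (*-homo a b) (mapP-scale a p)

      mapP-+ : ∀ p q → mapP (p PA.+P q) ≋ mapP p PB.+P mapP q
      mapP-+ [] q = PB.≋-refl
      mapP-+ (a ∷ p) [] = PB.≋-refl
      mapP-+ (a ∷ p) (b ∷ q) = PB.∷-cong (+-homo a b) (mapP-+ p q)

      mapP-* : ∀ p q → mapP (p PA.*P q) ≋ mapP p PB.*P mapP q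
      mapP-* [] q = PB.≋-refl
      mapP-* (a ∷ p) q = PB.PR.trans (mapP-+ (map (a A.*_) q) (A.0# ∷ (p PA.*P q)))
        (PB.PR.+-cong (mapP-scale a q) (PB.∷-cong 0-homo (mapP-* p q)))

    polyHom : Hom (A [X]) (B [X])
    polyHom = record
      { ⟦_⟧ = mapP
      ; ⟦⟧-cong = λ {p} {q} e → mk λ i → B.trans (coeff-map i p) (B.trans (⟦⟧-cong (PA.at e i)) (B.sym (coeff-map i q)))
      ; +-homo = mapP-+ ; *-homo = mapP-* ; 1-homo = PB.∷-cong 1-homo PB.≋-refl }

    eval-map : ∀ p x → ⟦ PA.evalP p x ⟧ B.≈ PB.evalP (mapP p) ⟦ x ⟧
    eval-map [] x = 0-homo
    eval-map (a ∷ p) x = B.trans (+-homo a _) (B.+-congˡ (B.trans (*-homo x _) (B.*-congˡ (eval-map p x))))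

    opaque
      unfolding PolyTheory.lin
      mapP-lin : ∀ b → mapP (PA.lin b) ≋ PB.lin ⟦ b ⟧
      mapP-lin b = PB.∷-cong (-‿homo b) (PB.∷-cong 1-homo PB.≋-refl)

    mapP-prodLin : ∀ bs → mapP (PA.prodLin bs) ≋ PB.prodLin (map ⟦_⟧ bs)
    mapP-prodLin [] = PB.∷-cong 1-homo PB.≋-refl
    mapP-prodLin (b ∷ bs) = PB.PR.trans (mapP-* (PA.lin b) (PA.prodLin bs)) (PB.PR.*-cong (mapP-lin b) (mapP-prodLin bs))

    natMul-homo : ∀ n a → ⟦ PA.natMul n a ⟧ B.≈ PB.natMul n ⟦ a ⟧
    natMul-homo zero a = 0-homo
    natMul-homo (suc n) a = B.trans (+-homo a _) (B.+-congˡ (natMul-homo n a))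

    mapP-deriv : ∀ p → mapP (PA.deriv p) ≋ PB.deriv (mapP p)
    mapP-deriv p = mk λ i → B.trans (coeff-map i (PA.deriv p)) (B.trans (⟦⟧-cong (PA.coeff-deriv i p))
      (B.trans (natMul-homo (suc i) (PA.coeff (suc i) p)) (B.trans (PB.natMul-cong (suc i) (B.sym (coeff-map (suc i) p))) (B.sym (PB.coeff-deriv i (mapP p))))))

    mapP-monicDeg : ∀ {m p} → PA.MonicDeg m p → PB.MonicDeg m (mapP p)
    mapP-monicDeg {m} {p} (l PA.& PA.dlt d) = B.trans (coeff-map m p) (B.trans (⟦⟧-cong l) 1-homo) PB.&
      PB.dlt λ i lt → B.trans (coeff-map i p) (B.trans (⟦⟧-cong (d i lt)) 0-homo)

    mapP-degLt : ∀ {m p} → PA.DegLt m p → PB.DegLt m (mapP p)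
    mapP-degLt {m} {p} (PA.dlt d) = PB.dlt λ i le → B.trans (coeff-map i p) (B.trans (⟦⟧-cong (d i le)) 0-homo)

    pow-homo : ∀ n x → ⟦ PA.pow x n ⟧ B.≈ PB.pow ⟦ x ⟧ n
    pow-homo zero x = 1-homo
    pow-homo (suc n) x = B.trans (*-homo x _) (B.*-congˡ (pow-homo n x))

open PolynomialRings

-- Domains, Euclidean division, finite fields and splitting fields.

module FieldExtensions where
  open import Algebra.Bundles using (CommutativeRing)
  open import Data.Nat as ℕ using (ℕ; zero; suc; z≤n; s≤s)
  import Data.Nat.Properties as ℕₚ
  open import Data.List using (List; []; _∷_; map; foldr; length; _++_)
  import Data.List.Properties as Listₚ
  open import Data.Vec using (toList)
  open import Data.List.Relation.Unary.All as All using (All; []; _∷_)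
  open import Data.List.Relation.Unary.Any as Any using (Any; here)
  import Data.List.Relation.Unary.Any.Properties as Anyₚ
  import Data.List.Relation.Unary.All.Properties as Allₚ
  open import Data.List.Relation.Unary.AllPairs using (AllPairs; []; _∷_)
  open import Data.Product using (Σ; ∃; _×_; _,_)
  open import Data.Sum using (_⊎_; inj₁; inj₂; [_,_]′)
  open import Data.Empty using (⊥; ⊥-elim)
  open import Relation.Nullary using (¬_; Dec; yes; no; ¬?)
  open import Relation.Binary using (tri<; tri≈; tri>)
  open import Relation.Nullary.Decidable using (_×-dec_; map′)
  open import Relation.Binary.PropositionalEquality as ≡ using (_≡_)
  import Relation.Binary.Reasoning.Setoid as SetoidReasoning

  record IsDomain (R : CR) : Set where
    open CommutativeRing R
    field
      _≟_ : ∀ x y → Dec (x ≈ y)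
      1≉0 : ¬ (1# ≈ 0#)
      noZeroDivisors : ∀ x y → x * y ≈ 0# → x ≈ 0# ⊎ y ≈ 0#

  module DomainBasics (R : CR) (dom : IsDomain R) where
    open CommutativeRing R
    open IsDomain dom
    open Solver R

    nonzero-* : ∀ {x y} → ¬ x ≈ 0# → ¬ y ≈ 0# → ¬ x * y ≈ 0#
    nonzero-* {x} {y} nx ny e = [ nx , ny ]′ (noZeroDivisors x y e)

    sub-zero : ∀ {x y} → x - y ≈ 0# → x ≈ y
    sub-zero {x} {y} e = trans (solve 2 (λ x y → x := (x :- y) :+ y) refl x y) (trans (+-congʳ e) (+-identityˡ y))

    zero-sub : ∀ {x y} → x ≈ y → x - y ≈ 0#
    zero-sub {x} {y} e = trans (+-congʳ e) (-‿inverseʳ y)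

    cancelˡ : ∀ {x a b} → ¬ x ≈ 0# → x * a ≈ x * b → a ≈ b
    cancelˡ {x} {a} {b} nx e = [ (λ z → ⊥-elim (nx z)) , sub-zero ]′
      (noZeroDivisors x (a - b) (trans (solve 3 (λ x a b → x :* (a :- b) := x :* a :- x :* b) refl x a b) (zero-sub e)))

  module DomainTheory (R : CR) (dom : IsDomain R) where
    open CommutativeRing R hiding (zero)
    open IsDomain dom
    open DomainBasics R dom public
    open PolyTheory R
    open SetoidReasoning setoid

    -- Replaces a degree function: decidable equality with 0 finds the true leading coefficient of a
    -- list that may end in zeros.
    degView : ∀ p → IsZeroP p ⊎ (∃ λ m → ¬ coeff m p ≈ 0# × DegLt (suc m) p)
    degView [] = inj₁ λ i → refl
    degView (a ∷ p) with degView p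
    ... | inj₂ (m , n , dlt d) = inj₂ (suc m , n , dlt λ { (suc i) (s≤s le) → d i le })
    ... | inj₁ z with a ≟ 0#
    ...   | yes a0 = inj₁ λ { zero → a0 ; (suc i) → z i }
    ...   | no na = inj₂ (0 , na , dlt λ { (suc i) _ → z i })

    isZero? : ∀ p → Dec (IsZeroP p)
    isZero? p with degView p
    ... | inj₁ z = yes z
    ... | inj₂ (m , n , _) = no λ z → n (z m)

    isConst? : ∀ p → Dec (IsConstP p)
    isConst? [] = yes λ i → refl
    isConst? (a ∷ p) = isZero? p

    poly-isDomain : IsDomain polyRing
    poly-isDomain = record
      { _≟_ = λ p q → map′ (λ z → mk λ i → sub-zero (trans (sym (diff i p q)) (z i)))
                            (λ e i → trans (diff i p q) (zero-sub (at e i))) (isZero? (p +P -P q))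
      ; 1≉0 = λ e → 1≉0 (at e 0)
      ; noZeroDivisors = nzd }
      where
        diff : ∀ i p q → coeff i (p +P -P q) ≈ coeff i p - coeff i q
        diff i p q = trans (coeff-+ i p (-P q)) (+-congˡ (coeff-neg i q))
        nzd : ∀ p q → p *P q ≋ 0P → p ≋ 0P ⊎ q ≋ 0P
        nzd p q e with degView p | degView q
        ... | inj₁ z | _ = inj₁ (mk z)
        ... | inj₂ _ | inj₁ z = inj₂ (mk z)
        ... | inj₂ (m , nm , dm) | inj₂ (n , nn , dn) =
          ⊥-elim (nonzero-* nm nn (trans (sym (coeff-top-* p q dm dn)) (at e (m ℕ.+ n))))

    Distinct : List Carrier → Set
    Distinct = AllPairs (λ x y → ¬ x ≈ y)

    Roots : Poly → List Carrier → Set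
    Roots p = All (λ x → evalP p x ≈ 0#)

    eval-lin-nonzero : ∀ {x y} → ¬ x ≈ y → ¬ evalP (lin x) y ≈ 0#
    eval-lin-nonzero {x} {y} ne e = ne (sym (sub-zero (trans (sym (eval-lin x y)) e)))

    -- After division by X - x the other points remain roots of the quotient, because a domain lets
    -- the nonzero factor y - x be dropped.
    distinct-roots : ∀ p xs → Distinct xs → Roots p xs → ∃ λ k → p ≋ prodLin xs *P k
    distinct-roots p [] _ _ = p , PR.sym (PR.*-identityˡ p)
    distinct-roots p (x ∷ xs) (nx ∷ ds) (r ∷ rs) =
      let k , e = distinct-roots (quot p x) xs ds (All.tabulate λ {y} y∈ → root (All.lookup nx y∈) (All.lookup rs y∈))
      in k , PR.trans (factor p x r) (PR.trans (PR.*-congˡ e) (PR.sym (PR.*-assoc _ _ _)))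
      where
        root : ∀ {y} → ¬ x ≈ y → evalP p y ≈ 0# → evalP (quot p x) y ≈ 0#
        root {y} ne ry with noZeroDivisors (evalP (lin x) y) (evalP (quot p x) y)
            (trans (sym (eval-* (lin x) (quot p x) y)) (trans (eval-cong (PR.sym (factor p x r)) refl) ry))
        ... | inj₁ z = ⊥-elim (eval-lin-nonzero ne z)
        ... | inj₂ z = z

    -- The top coefficient of the product is that of `k`, in a degree at least m where the product
    -- vanishes.
    monic-multiple-zero : ∀ {m} p k → MonicDeg m p → DegLt m (p *P k) → IsZeroP k
    monic-multiple-zero {m} p k (l & d) (dlt v) with degView k
    ... | inj₁ z = z
    ... | inj₂ (j , nj , dj) = ⊥-elim (nj (begin
      coeff j k              ≈⟨ sym (*-identityˡ _) ⟩
      1# * coeff j k         ≈⟨ *-congʳ (sym l) ⟩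
      coeff m p * coeff j k  ≈⟨ sym (coeff-top-* p k d dj) ⟩
      coeff (m ℕ.+ j) (p *P k) ≈⟨ v (m ℕ.+ j) (ℕₚ.m≤m+n m j) ⟩
      0#                     ∎))

    too-many-roots : ∀ p xs → DegLt (length xs) p → Distinct xs → Roots p xs → p ≋ 0P
    too-many-roots p xs d ds rs with distinct-roots p xs ds rs
    ... | k , e = PR.trans e (PR.trans (PR.*-congˡ (mk (monic-multiple-zero (prodLin xs) k (monicDeg-prodLin xs) (degLt-cong e d)))) (PR.zeroʳ _))

    monic-nonzero : ∀ {m p} → MonicDeg m p → ¬ p ≋ 0P
    monic-nonzero {m} (l & _) e = 1≉0 (trans (sym l) (at e m))

    poly-cancelˡ : ∀ {m p a b} → MonicDeg m p → p *P a ≋ p *P b → a ≋ b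
    poly-cancelˡ mp e = DomainBasics.cancelˡ polyRing poly-isDomain (monic-nonzero mp) e

    monicDeg-unique : ∀ {a b p} → MonicDeg a p → MonicDeg b p → a ≡ b
    monicDeg-unique {a} {b} (la & dlt da) (lb & dlt db) with ℕₚ.<-cmp a b
    ... | tri< lt _ _ = ⊥-elim (1≉0 (trans (sym lb) (da b lt)))
    ... | tri≈ _ e _ = e
    ... | tri> _ _ gt = ⊥-elim (1≉0 (trans (sym la) (db a gt)))

    monic-cofactor : ∀ {a m} p q → MonicDeg a p → MonicDeg (a ℕ.+ m) (p *P q) → MonicDeg m q
    monic-cofactor {a} {m} p q mp@(l & d) mpq@(lpq & dlt v) with degView q
    ... | inj₁ z = ⊥-elim (monic-nonzero mpq (PR.trans (PR.*-congˡ (mk z)) (PR.zeroʳ p)))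
    ... | inj₂ (j , nj , dj) = ≡.subst (λ m → MonicDeg m q) j≡m (leadq & dj)
      where
        top : coeff (a ℕ.+ j) (p *P q) ≈ coeff j q
        top = trans (coeff-top-* p q d dj) (trans (*-congʳ l) (*-identityˡ _))
        a+j≡a+m : a ℕ.+ j ≡ a ℕ.+ m
        a+j≡a+m with ℕₚ.<-cmp (a ℕ.+ j) (a ℕ.+ m)
        ... | tri< lt _ _ = ⊥-elim (1≉0 (trans (sym lpq) (vanish (degLt-* p q d dj) (a ℕ.+ m) lt)))
        ... | tri≈ _ e _ = e
        ... | tri> _ _ gt = ⊥-elim (nj (trans (sym top) (v (a ℕ.+ j) gt)))
        j≡m : j ≡ m
        j≡m = ℕₚ.+-cancelˡ-≡ a j m a+j≡a+m
        leadq : coeff j q ≈ 1#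
        leadq = trans (sym top) (trans (reflexive (≡.cong (λ k → coeff k (p *P q)) a+j≡a+m)) lpq)

  module Division (R : CR) where
    open CommutativeRing R hiding (zero)
    open PolyTheory R
    private module PS = Solver polyRing
    open Solver R

    -- Recursion on the coefficients of the dividend: the earlier quotient and remainder are
    -- shifted, and one multiple of `P` removes the coefficient of degree m which the shift can
    -- create. A unit as leading coefficient suffices, which the Euclidean algorithm uses.
    divMod : ∀ {m} P u → DegLt (suc m) P → coeff m P * u ≈ 1# →
      ∀ p → ∃ λ k → ∃ λ r → p ≋ P *P k +P r × DegLt m r
    divMod P u dP lu [] = [] , [] , PR.sym (PR.trans (PR.+-identityʳ _) (PR.zeroʳ P)) , dlt λ i _ → refl
    divMod {m} P u (dlt dP) lu (a ∷ p) with divMod P u (dlt dP) lu p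
    ... | k , r , e , dlt dr = c ∷ k , (a ∷ r) +P -P (constP c *P P) , spec , dlt bound
      where
        c = coeff m (a ∷ r) * u
        shifted : 0# ∷ p ≋ P *P (0# ∷ k) +P (0# ∷ r)
        shifted = PR.trans (∷-cong refl e) (PR.trans (PR.sym (shift-+P (P *P k) r))
          (PR.+-congʳ (PR.trans (∷-cong refl (PR.*-comm P k)) (PR.trans (PR.sym (shift* k P)) (PR.*-comm _ P)))))
        spec : a ∷ p ≋ P *P (c ∷ k) +P ((a ∷ r) +P -P (constP c *P P))
        spec = PR.trans (∷-split a p) (PR.trans (PR.+-congˡ shifted)
          (PR.trans (PS.solve 5 (λ A P K T C → A PS.:+ (P PS.:* K PS.:+ T) PS.:= P PS.:* (C PS.:+ K) PS.:+ ((A PS.:+ T) PS.:- C PS.:* P))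
              PR.refl (constP a) P (0# ∷ k) (0# ∷ r) (constP c))
            (PR.+-cong (PR.*-congˡ (PR.sym (∷-split c k))) (PR.+-congʳ (PR.sym (∷-split a r))))))
        cf : ∀ i → coeff i ((a ∷ r) +P -P (constP c *P P)) ≈ coeff i (a ∷ r) - c * coeff i P
        cf i = trans (coeff-+ i (a ∷ r) _) (+-congˡ (trans (coeff-neg i _) (-‿cong (coeff-const* i c P))))
        atm : ∀ x l → l * u ≈ 1# → x - (x * u) * l ≈ 0#
        atm x l lu = trans (+-congˡ (-‿cong (trans (solve 3 (λ x u l → (x :* u) :* l := x :* (l :* u)) refl x u l) (trans (*-congˡ lu) (*-identityʳ x))))) (-‿inverseʳ x)
        off : ∀ x y → x ≈ 0# → y ≈ 0# → x - c * y ≈ 0#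
        off x y ex ey = trans (+-cong ex (-‿cong (trans (*-congˡ ey) (zeroʳ c)))) (-‿inverseʳ 0#)
        bound : ∀ i → m ℕ.≤ i → coeff i ((a ∷ r) +P -P (constP c *P P)) ≈ 0#
        bound i le with m ℕ.≟ i
        ... | yes ≡.refl = trans (cf m) (atm (coeff m (a ∷ r)) (coeff m P) lu)
        bound zero z≤n | no ne = ⊥-elim (ne ≡.refl)
        bound (suc i) le | no ne = trans (cf (suc i)) (off _ _ (dr i (ℕₚ.≤-pred lt)) (dP (suc i) lt))
          where
            lt : m ℕ.< suc i
            lt = ℕₚ.≤∧≢⇒< le ne

  module Quotient (A : CR) (P : CommutativeRing.Carrier A) where
    open CommutativeRing A
    open Solver A

    infix 4 _~_
    -- The multiplier is kept as data, so that an equality in the quotient can be read back as an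
    -- identity in `A`.
    record _~_ (x y : Carrier) : Set where
      constructor by
      field
        factor : Carrier
        equation : x ≈ y + P * factor

    fromEq : ∀ {x y} → x ≈ y → x ~ y
    fromEq e = by 0# (trans e (sym (trans (+-congˡ (zeroʳ P)) (+-identityʳ _))))

    ~-sym : ∀ {x y} → x ~ y → y ~ x
    ~-sym {x} {y} (by k e) = by (- k) (sym (trans (+-congʳ e) (solve 3 (λ y P k → (y :+ P :* k) :+ P :* (:- k) := y) refl y P k)))

    ~-trans : ∀ {x y z} → x ~ y → y ~ z → x ~ z
    ~-trans {x} {y} {z} (by k e) (by l f) = by (l + k) (trans e (trans (+-congʳ f) (solve 4 (λ z P l k → (z :+ P :* l) :+ P :* k := z :+ P :* (l :+ k)) refl z P l k)))

    quotientRing : CR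
    quotientRing = record
      { Carrier = Carrier ; _≈_ = _~_ ; _+_ = _+_ ; _*_ = _*_ ; -_ = -_ ; 0# = 0# ; 1# = 1#
      ; isCommutativeRing = record
        { isRing = record
          { +-isAbelianGroup = record
            { isGroup = record
              { isMonoid = record
                { isSemigroup = record
                  { isMagma = record
                    { isEquivalence = record { refl = fromEq refl ; sym = ~-sym ; trans = ~-trans }
                    ; ∙-cong = λ { {x} {y} {u} {v} (by k e) (by l f) → by (k + l) (trans (+-cong e f)
                        (solve 5 (λ y v P k l → (y :+ P :* k) :+ (v :+ P :* l) := (y :+ v) :+ P :* (k :+ l)) refl y v P k l)) } }
                  ; assoc = λ x y z → fromEq (+-assoc x y z) }
                ; identity = (λ x → fromEq (+-identityˡ x)) , (λ x → fromEq (+-identityʳ x)) }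
              ; inverse = (λ x → fromEq (-‿inverseˡ x)) , (λ x → fromEq (-‿inverseʳ x))
              ; ⁻¹-cong = λ { {x} {y} (by k e) → by (- k) (trans (-‿cong e) (solve 3 (λ y P k → :- (y :+ P :* k) := (:- y) :+ P :* (:- k)) refl y P k)) } }
            ; comm = λ x y → fromEq (+-comm x y) }
          ; *-cong = λ { {x} {y} {u} {v} (by k e) (by l f) → by (k * v + y * l + k * (P * l)) (trans (*-cong e f)
              (solve 5 (λ y v P k l → (y :+ P :* k) :* (v :+ P :* l) := y :* v :+ P :* (k :* v :+ y :* l :+ k :* (P :* l))) refl y v P k l)) }
          ; *-assoc = λ x y z → fromEq (*-assoc x y z)
          ; *-identity = (λ x → fromEq (*-identityˡ x)) , (λ x → fromEq (*-identityʳ x))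
          ; distrib = (λ x y z → fromEq (distribˡ x y z)) , (λ x y z → fromEq (distribʳ x y z)) }
        ; *-comm = λ x y → fromEq (*-comm x y) } }

    projection : Hom A quotientRing
    projection = record
      { ⟦_⟧ = λ x → x ; ⟦⟧-cong = fromEq ; +-homo = λ _ _ → fromEq refl ; *-homo = λ _ _ → fromEq refl ; 1-homo = fromEq refl }

  -- Differs from `FiniteField` in that equality is a setoid equality and `elems` may list an
  -- element several times, as happens for quotient rings. The enumeration makes the search for
  -- factors finite.
  record FField : Set₁ where
    field
      cring : CR
    open CommutativeRing cring
    field
      _≟_ : ∀ x y → Dec (x ≈ y)
      1≉0 : ¬ (1# ≈ 0#)
      inverse : ∀ x → ¬ x ≈ 0# → ∃ λ y → x * y ≈ 1#
      elems : List Carrier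
      complete : ∀ x → Any (x ≈_) elems

    isDomain : IsDomain cring
    isDomain = record
      { _≟_ = _≟_ ; 1≉0 = 1≉0
      ; noZeroDivisors = λ x y e → nzd x y e (x ≟ 0#) }
      where
        nzd : ∀ x y → x * y ≈ 0# → Dec (x ≈ 0#) → x ≈ 0# ⊎ y ≈ 0#
        nzd x y e (yes z) = inj₁ z
        nzd x y e (no nz) with inverse x nz
        ... | u , xu = inj₂ (trans (sym (*-identityˡ y)) (trans (*-congʳ (sym (trans (*-comm u x) xu)))
                (trans (*-assoc u x y) (trans (*-congˡ e) (zeroʳ u)))))

  module FieldTheory (K : FField) where
    open FField K hiding (_≟_)
    open CommutativeRing cring hiding (zero)
    open PolyTheory cring public
    open DomainTheory cring isDomain public
    open Division cring public
    private module PS = Solver polyRing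

    Irr : Poly → Set
    Irr p = ¬ IsConstP p × (∀ a b → p ≋ a *P b → IsConstP a ⊎ IsConstP b)

    prodPoly : List Poly → Poly
    prodPoly = foldr _*P_ 1P

    MonicIrr : Poly → Set
    MonicIrr p = (∃ λ j → MonicDeg (suc j) p) × Irr p

    const-DegLt : ∀ {p} → IsConstP p → DegLt 1 p
    const-DegLt c = dlt λ { (suc i) _ → c i }

    -- The Euclidean algorithm with `P` kept fixed: `P` is divided by ever smaller remainders until
    -- a nonzero constant is reached.
    monic-Irr-bezout : ∀ {m} P → MonicDeg m P → Irr P → ∀ p → (∃ λ k → p ≋ P *P k) ⊎ (∃ λ u → ∃ λ v → P *P v +P p *P u ≋ 1P)
    monic-Irr-bezout {m} P (lP & dP) (_ , irr) p with divMod P 1# dP (trans (*-identityʳ _) lP) p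
    ... | k , r , e , dr with degView r
    ...   | inj₁ z = inj₁ (k , PR.trans e (PR.trans (PR.+-congˡ (mk z)) (PR.+-identityʳ _)))
    ...   | inj₂ (j , nj , dj) = inj₂ (lift (low (suc j) j r ℕₚ.≤-refl nj dj j<m))
      where
        j<m : j ℕ.< m
        j<m with j ℕ.<? m
        ... | yes lt = lt
        ... | no ge = ⊥-elim (nj (vanish dr j (ℕₚ.≮⇒≥ ge)))
        lift : (∃ λ u → ∃ λ v → P *P v +P r *P u ≋ 1P) → ∃ λ u → ∃ λ v → P *P v +P p *P u ≋ 1P
        lift (u , v , f) = u , v +P -P (k *P u) , PR.trans (PR.+-congˡ (PR.*-congʳ e))
          (PR.trans (PS.solve 5 (λ P v k u r → P PS.:* (v PS.:- k PS.:* u) PS.:+ (P PS.:* k PS.:+ r) PS.:* u PS.:= P PS.:* v PS.:+ r PS.:* u) PR.refl P v k u r) f)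
        -- `N` is fuel bounding the degree j of the current remainder.
        low : ∀ N j p → j ℕ.< N → ¬ coeff j p ≈ 0# → DegLt (suc j) p → j ℕ.< m → ∃ λ u → ∃ λ v → P *P v +P p *P u ≋ 1P
        low (suc N) j p (s≤s j≤N) nj dp j<m with inverse (coeff j p) nj
        low (suc N) zero p _ nj dp j<m | y , xy = constP y , [] , PR.trans (PR.+-cong (PR.zeroʳ P) (PR.*-comm p (constP y)))
            (PR.trans (PR.+-identityˡ _) (mk λ { zero → trans (coeff-const* 0 y p) (trans (*-comm y _) xy)
              ; (suc i) → trans (coeff-const* (suc i) y p) (trans (*-congˡ (vanish dp (suc i) (s≤s z≤n))) (zeroʳ y)) }))
        low (suc N) (suc j) p (s≤s j≤N) nj dp j<m | y , xy with divMod p y dp xy P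
        ... | t , s , e , ds with degView s
        -- A zero remainder would exhibit p as a factor of `P` of degree strictly between 0 and m.
        ...   | inj₁ z = ⊥-elim (absurd (irr p t pe))
          where
            pe : P ≋ p *P t
            pe = PR.trans e (PR.trans (PR.+-congˡ (mk z)) (PR.+-identityʳ _))
            absurd : IsConstP p ⊎ IsConstP t → ⊥
            absurd (inj₁ c) = nj (c j)
            absurd (inj₂ c) = 1≉0 (trans (sym lP) (trans (at pe m) (vanish (degLt-* p t dp (const-DegLt c)) m (≡.subst (ℕ._< m) (≡.sym (ℕₚ.+-identityʳ (suc j))) j<m))))
        ...   | inj₂ (i , ni , di) = let u , v , f = low N i s (ℕₚ.≤-trans i<sj j≤N) ni di (ℕₚ.<-trans i<sj j<m) in
                -P (t *P u) , v +P u , PR.trans (PR.+-congʳ (PR.*-comm P _))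
                  (PR.trans (PR.+-congʳ (PR.*-congˡ e))
                  (PR.trans (PS.solve 5 (λ v u p t s → (v PS.:+ u) PS.:* (p PS.:* t PS.:+ s) PS.:+ p PS.:* (PS.:- (t PS.:* u)) PS.:= (p PS.:* t PS.:+ s) PS.:* v PS.:+ s PS.:* u) PR.refl v u p t s)
                  (PR.trans (PR.+-congʳ (PR.*-congʳ (PR.sym e))) f)))
          where
            i<sj : i ℕ.< suc j
            i<sj with i ℕ.<? suc j
            ... | yes lt = lt
            ... | no ge = ⊥-elim (ni (vanish ds i (ℕₚ.≮⇒≥ ge)))

    lowPolys : ℕ → List Poly
    lowPolys m = map toList (allVecs elems m)

    lowPolys-complete : ∀ m p → DegLt m p → Any (p ≋_) (lowPolys m)
    lowPolys-complete m p d = Anyₚ.map⁺ (go m p d)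
      where
        tl : Poly → Poly
        tl [] = []
        tl (_ ∷ p) = p
        coeff-tl : ∀ i p → coeff i (tl p) ≈ coeff (suc i) p
        coeff-tl i [] = refl
        coeff-tl i (_ ∷ p) = refl
        go : ∀ m p → DegLt m p → Any (λ v → p ≋ toList v) (allVecs elems m)
        go zero p (dlt d) = here (mk λ i → d i z≤n)
        go (suc m) p (dlt d) = Anyₚ.concatMap⁺ _ (Any.map (λ {a} e → Anyₚ.map⁺ (Any.map (λ f →
            mk λ { zero → e ; (suc i) → trans (sym (coeff-tl i p)) (at f i) }) (go m (tl p) (dlt λ i le → trans (coeff-tl i p) (d (suc i) (s≤s le))))))
            (complete (coeff 0 p)))

    deg-sum : ∀ {m i j} P a b → MonicDeg m P → P ≋ a *P b → ¬ coeff i a ≈ 0# → DegLt (suc i) a → ¬ coeff j b ≈ 0# → DegLt (suc j) b →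
      i ℕ.+ j ≡ m × coeff i a * coeff j b ≈ 1#
    deg-sum {m} {i} {j} P a b (l & dlt d) e ni di nj dj with ℕₚ.<-cmp (i ℕ.+ j) m
    ... | tri< lt _ _ = ⊥-elim (1≉0 (trans (sym l) (trans (at e m) (vanish (degLt-* a b di dj) m lt))))
    ... | tri≈ _ ≡.refl _ = ≡.refl , trans (sym (coeff-top-* a b di dj)) (trans (sym (at e m)) l)
    ... | tri> _ _ gt = ⊥-elim (nonzero-* ni nj (trans (sym (coeff-top-* a b di dj)) (trans (sym (at e (i ℕ.+ j))) (d (i ℕ.+ j) gt))))

    Splitting : ℕ → Poly → Set
    Splitting m P = ∃ λ a → ∃ λ b → ∃ λ i → ∃ λ j → MonicDeg (suc i) a × MonicDeg (suc j) b × P ≋ a *P b × suc i ℕ.+ suc j ≡ m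

    -- Decided by a search through all pairs of polynomials of degree at most m + 1 over the finite
    -- field.
    irr-or-splitting : ∀ {m} P → MonicDeg (suc m) P → Irr P ⊎ Splitting (suc m) P
    irr-or-splitting {m} P mP@(l & d) with Any.any? (λ a → Any.any? (λ b → (IsDomain._≟_ poly-isDomain P (a *P b)) ×-dec (¬? (isConst? a) ×-dec ¬? (isConst? b))) cands) cands
      where cands = lowPolys (suc (suc m))
    ... | yes found = inj₂ (normalise (Any.satisfied found))
      where
        cands = lowPolys (suc (suc m))
        pos : ∀ p → ¬ IsConstP p → ∃ λ i → ¬ coeff (suc i) p ≈ 0# × DegLt (suc (suc i)) p
        pos p nc with degView p
        ... | inj₁ z = ⊥-elim (nc (λ i → z (suc i)))
        ... | inj₂ (zero , _ , dlt d) = ⊥-elim (nc (λ i → d (suc i) (s≤s z≤n)))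
        ... | inj₂ (suc i , n , d) = i , n , d
        normalise : (∃ λ a → Any (λ b → P ≋ a *P b × ¬ IsConstP a × ¬ IsConstP b) cands) → Splitting (suc m) P
        normalise (a , an) with Any.satisfied an
        ... | b , e , na , nb with pos a na | pos b nb
        ... | i , ni , di | j , nj , dj with deg-sum P a b mP e ni di nj dj
        -- The leading coefficients satisfy x y = 1, so exchanging them as scalars makes both
        -- factors monic without changing the product.
        ... | s , ll = constP y *P a , constP x *P b , i , j ,
                (trans (coeff-const* (suc i) y a) (trans (*-comm y x) ll) & dlt (λ k le → trans (coeff-const* k y a) (trans (*-congˡ (vanish di k le)) (zeroʳ y)))) ,
                (trans (coeff-const* (suc j) x b) ll & dlt (λ k le → trans (coeff-const* k x b) (trans (*-congˡ (vanish dj k le)) (zeroʳ x)))) ,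
                PR.trans e (PR.sym (PR.trans (PS.solve 4 (λ y a x b → (y PS.:* a) PS.:* (x PS.:* b) PS.:= (x PS.:* y) PS.:* (a PS.:* b)) PR.refl (constP y) a (constP x) b)
                   (PR.trans (PR.*-congʳ (PR.trans (PR.sym (Hom.*-homo constHom x y)) (constP-cong ll))) (PR.*-identityˡ _)))) ,
                s
          where
            x = coeff (suc i) a
            y = coeff (suc j) b
    ... | no none = inj₁ ((λ c → 1≉0 (trans (sym l) (c m))) , irr)
      where
        irr : ∀ a b → P ≋ a *P b → IsConstP a ⊎ IsConstP b
        irr a b e with isConst? a | isConst? b
        ... | yes c | _ = inj₁ c
        ... | no _ | yes c = inj₂ c
        ... | no na | no nb with degView a | degView b
        ... | inj₁ z | _ = ⊥-elim (na λ i → z (suc i))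
        ... | inj₂ _ | inj₁ z = ⊥-elim (nb λ i → z (suc i))
        ... | inj₂ (i , ni , di) | inj₂ (j , nj , dj) with deg-sum P a b mP e ni di nj dj
        ... | s , _ = ⊥-elim (none (Any.map (λ {a'} ea → Any.map (λ {b'} eb →
                PR.trans e (PR.*-cong ea eb) , (λ c → na λ k → trans (at ea (suc k)) (c k)) , (λ c → nb λ k → trans (at eb (suc k)) (c k)))
                  (lowPolys-complete (suc (suc m)) b (degLt-mono (s≤s (≡.subst (j ℕ.≤_) s (ℕₚ.m≤n+m j i))) dj)))
                (lowPolys-complete (suc (suc m)) a (degLt-mono (s≤s (≡.subst (i ℕ.≤_) s (ℕₚ.m≤m+n i j))) di))))

    prodPoly-++ : ∀ ps qs → prodPoly (ps ++ qs) ≋ prodPoly ps *P prodPoly qs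
    prodPoly-++ [] qs = PR.sym (PR.*-identityˡ _)
    prodPoly-++ (p ∷ ps) qs = PR.trans (PR.*-congˡ (prodPoly-++ ps qs)) (PR.sym (PR.*-assoc _ _ _))

    monicDeg-0 : ∀ {p} → MonicDeg 0 p → p ≋ 1P
    monicDeg-0 (l & dlt d) = mk λ { zero → l ; (suc i) → d (suc i) (s≤s z≤n) }

    factorisation : ∀ {m} P → MonicDeg m P → ∃ λ ps → All MonicIrr ps × P ≋ prodPoly ps
    factorisation {m} P mP = go (suc m) m P ℕₚ.≤-refl mP
      where
        go : ∀ N m P → m ℕ.< N → MonicDeg m P → ∃ λ ps → All MonicIrr ps × P ≋ prodPoly ps
        go (suc N) zero P _ mP = [] , [] , monicDeg-0 mP
        go (suc N) (suc m) P (s≤s lt) mP with irr-or-splitting P mP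
        ... | inj₁ irr = P ∷ [] , ((m , mP) , irr) ∷ [] , PR.sym (PR.*-identityʳ P)
        ... | inj₂ (a , b , i , j , ma , mb , e , s) with go N (suc i) a (ℕₚ.≤-trans (s≤s (≡.subst (suc i ℕ.≤_) (ℕₚ.suc-injective (≡.trans (≡.sym (ℕₚ.+-suc (suc i) j)) s)) (ℕₚ.m≤m+n (suc i) j))) lt) ma
                                                      | go N (suc j) b (ℕₚ.≤-trans (s≤s (≡.subst (suc j ℕ.≤_) (ℕₚ.suc-injective s) (ℕₚ.m≤n+m (suc j) i))) lt) mb
        ...   | ps , aps , ep | qs , aqs , eq = ps ++ qs , Allₚ.++⁺ aps aqs , PR.trans e (PR.trans (PR.*-cong ep eq) (PR.sym (prodPoly-++ ps qs)))

  -- If x ≠ y, the image of x - y would be 0 and yet invertible.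
  field-hom-injective : (A B : FField) (h : Hom (FField.cring A) (FField.cring B)) → ∀ {x y} →
    CommutativeRing._≈_ (FField.cring B) (Hom.⟦_⟧ h x) (Hom.⟦_⟧ h y) → CommutativeRing._≈_ (FField.cring A) x y
  field-hom-injective A B h {x} {y} e = decide (FField._≟_ A (x A.- y) A.0#)
    where
      module A = CommutativeRing (FField.cring A)
      module B = CommutativeRing (FField.cring B)
      open Hom h
      decide : Dec ((x A.- y) A.≈ A.0#) → x A.≈ y
      decide (yes z) = DomainTheory.sub-zero (FField.cring A) (FField.isDomain A) z
      decide (no nz) = let u , xu = FField.inverse A _ nz in
        ⊥-elim (FField.1≉0 B (B.trans (B.sym 1-homo) (B.trans (⟦⟧-cong (A.sym xu)) (B.trans (*-homo _ u) (B.trans (B.*-congʳ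
          (B.trans (+-homo x _) (B.trans (B.+-cong e (-‿homo y)) (B.-‿inverseʳ _)))) (B.zeroˡ _))))))

  Extension : FField → Set₁
  Extension K = Σ FField λ K' → Hom (FField.cring K) (FField.cring K')

  module Adjoin (K : FField) where
    open FField K
    open CommutativeRing cring hiding (zero)
    open FieldTheory K
    private module PS = Solver polyRing

    -- Kronecker's construction. The Bezout alternative decides divisibility by `P`, hence equality
    -- in the quotient, and its cofactor is the inverse.
    adjoin-irr : ∀ {m} P → MonicDeg (suc m) P → Irr P → FField
    adjoin-irr {m} P mP irr = record
      { cring = Q.quotientRing
      ; _≟_ = dec
      ; 1≉0 = λ { (Q.by k e) → unit (k , PR.trans e (PR.+-identityˡ _)) }
      ; inverse = inv
      ; elems = lowPolys (suc m)
      ; complete = compl }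
      where
        module Q = Quotient polyRing P
        unit : ¬ (∃ λ k → 1P ≋ P *P k)
        unit (k , e) = 1≉0 (trans (at e 0) (at (PR.trans (PR.*-congˡ (mk (monic-multiple-zero P k mP (degLt-cong e (degLt-mono (s≤s z≤n) (degLt monicDeg-1)))))) (PR.zeroʳ P)) 0))
        dec : ∀ x y → Dec (x Q.~ y)
        dec x y with monic-Irr-bezout P mP irr (x +P -P y)
        ... | inj₁ (k , e) = yes (Q.by k (PR.trans (PS.solve 2 (λ x y → x PS.:= y PS.:+ (x PS.:- y)) PR.refl x y) (PR.+-congˡ e)))
        ... | inj₂ (u , v , e) = no λ { (Q.by k f) → unit (v +P k *P u , PR.trans (PR.sym e) (PR.trans (PR.+-congˡ (PR.*-congʳ (PR.+-congʳ f)))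
                (PS.solve 5 (λ P v y k u → P PS.:* v PS.:+ ((y PS.:+ P PS.:* k) PS.:- y) PS.:* u PS.:= P PS.:* (v PS.:+ k PS.:* u)) PR.refl P v y k u))) }
        inv : ∀ x → ¬ (x Q.~ 0P) → ∃ λ y → (x *P y) Q.~ 1P
        inv x nx with monic-Irr-bezout P mP irr x
        ... | inj₁ (k , e) = ⊥-elim (nx (Q.by k (PR.trans e (PR.sym (PR.+-identityˡ _)))))
        ... | inj₂ (u , v , e) = u , Q.by (-P v) (PR.trans (PS.solve 4 (λ P v x u → x PS.:* u PS.:= (P PS.:* v PS.:+ x PS.:* u) PS.:+ P PS.:* (PS.:- v)) PR.refl P v x u) (PR.+-congʳ e))
        compl : ∀ x → Any (x Q.~_) (lowPolys (suc m))
        compl x with divMod P 1# (degLt mP) (trans (*-identityʳ _) (lead mP)) x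
        ... | k , r , e , dr = Any.map (λ f → Q.by k (PR.trans e (PR.trans (PR.+-comm _ _) (PR.+-congʳ f)))) (lowPolys-complete (suc m) r dr)

    -- Evaluating at the class of X returns the polynomial itself, which is 0 in the quotient by it:
    -- X is the adjoined root.
    eval-X : ∀ p → PolyTheory.evalP polyRing (map constP p) (0# ∷ 1# ∷ []) ≋ p
    eval-X [] = PR.refl
    eval-X (a ∷ p) = PR.trans (PR.+-congˡ (PR.trans (shift* (1# ∷ []) _) (∷-cong refl (PR.trans (PR.*-identityˡ _) (eval-X p))))) (PR.sym (∷-split a p))

    adjoin-root : ∀ {m} P → MonicDeg (suc m) P → Σ (Extension K) λ { (K' , h) → ∃ λ x →
      CommutativeRing._≈_ (FField.cring K') (PolyTheory.evalP (FField.cring K') (MapPoly.mapP h P) x) (CommutativeRing.0# (FField.cring K')) }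
    adjoin-root {m} P mP with factorisation P mP
    ... | [] , _ , e = ⊥-elim (1≉0 (trans (sym (lead mP)) (at e (suc m))))
    ... | p ∷ ps , ((j , mp) , irr) ∷ _ , e = (K' , h) , X , K'.trans (PK'.eval-cong (Hom.⟦⟧-cong (MapPoly.polyHom h) e) K'.refl)
            (K'.trans (PK'.eval-cong (MapPoly.mapP-* h p (prodPoly ps)) K'.refl) (K'.trans (PK'.eval-* (MapPoly.mapP h p) _ X) (K'.trans (K'.*-congʳ root) (K'.zeroˡ _))))
      where
        K' = adjoin-irr p mp irr
        module Q = Quotient polyRing p
        module K' = CommutativeRing (FField.cring K')
        module PK' = PolyTheory (FField.cring K')
        h = Q.projection ∘H constHom
        X = 0# ∷ 1# ∷ []
        root : PK'.evalP (MapPoly.mapP h p) X K'.≈ K'.0#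
        root = Q.by 1P (PR.trans (eval-X p) (PR.sym (PR.trans (PR.+-identityˡ _) (PR.*-identityʳ p))))

  Splits : (K : FField) → PolyOps.Poly (CommutativeRing.rawRing (FField.cring K)) → Set
  Splits K p = ∃ λ bs → PolyTheory._≋_ (FField.cring K) p (PolyTheory.prodLin (FField.cring K) bs)

  splits-map : ∀ {K K'} (h : Hom (FField.cring K) (FField.cring K')) {p} → Splits K p → Splits K' (MapPoly.mapP h p)
  splits-map h (bs , e) = map (Hom.⟦_⟧ h) bs , PolyTheory.≋-trans _ (Hom.⟦⟧-cong (MapPoly.polyHom h) e) (MapPoly.mapP-prodLin h bs)

  mapP-∘ : ∀ {A B C : CR} (g : Hom B C) (f : Hom A B) p → MapPoly.mapP (g ∘H f) p ≡ MapPoly.mapP g (MapPoly.mapP f p)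
  mapP-∘ g f p = Listₚ.map-∘ p

  -- The field is quantified inside the induction on the degree, because it grows with every root
  -- adjoined.
  splits-monic : ∀ m K P → PolyTheory.MonicDeg (FField.cring K) m P → Σ (Extension K) λ { (K' , h) → Splits K' (MapPoly.mapP h P) }
  splits-monic zero K P mP = (K , idH) , [] , ≡.subst (_≋ 1P) (≡.sym (Listₚ.map-id P)) (monicDeg-0 mP)
    where open FieldTheory K
  splits-monic (suc m) K P mP with Adjoin.adjoin-root K P mP
  ... | (K₁ , h₁) , x , r with splits-monic m K₁ (quot (mapP P) x) (monic-cofactor (lin x) _ (monicDeg-lin x) (monicDeg-cong (factor (mapP P) x r) (mapP-monicDeg mP)))
    where
      open FieldTheory K₁
      open MapPoly h₁
  ... | (K₂ , h₂) , bs , e = (K₂ , h₂ ∘H h₁) , Hom.⟦_⟧ h₂ x ∷ bs ,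
        ≡.subst (_≋ prodLin (Hom.⟦_⟧ h₂ x ∷ bs)) (≡.sym (mapP-∘ h₂ h₁ P))
          (PR.trans (Hom.⟦⟧-cong (MapPoly.polyHom h₂) (F₁.factor _ x r))
            (PR.trans (MapPoly.mapP-* h₂ _ _) (PR.*-cong (MapPoly.mapP-lin h₂ x) e)))
    where
      open FieldTheory K₂
      module F₁ = FieldTheory K₁

  splitting-field : ∀ K (ps : List (PolyOps.Poly (CommutativeRing.rawRing (FField.cring K)))) →
    All (λ P → ∃ λ m → PolyTheory.MonicDeg (FField.cring K) m P) ps →
    Σ (Extension K) λ { (K' , h) → All (λ P → Splits K' (MapPoly.mapP h P)) ps }
  splitting-field K [] [] = (K , idH) , []
  splitting-field K (P ∷ ps) ((m , mP) ∷ mps) with splitting-field K ps mps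
  ... | (K₁ , h₁) , ss with splits-monic m K₁ (MapPoly.mapP h₁ P) (MapPoly.mapP-monicDeg h₁ mP)
  ... | (K₂ , h₂) , s = (K₂ , h₂ ∘H h₁) ,
        ≡.subst (Splits K₂) (≡.sym (mapP-∘ h₂ h₁ P)) s ∷
        All.map (λ {q} t → ≡.subst (Splits K₂) (≡.sym (mapP-∘ h₂ h₁ q)) (splits-map {K₁} {K₂} h₂ t)) ss

open FieldExtensions

-- Determinants by columns, resultants as products of values, discriminants.

module Discriminants where
  open import Level using (0ℓ)
  open import Algebra.Bundles using (CommutativeRing)
  open import Algebra.Bundles.Raw using (RawRing)
  open import Data.Bool using (Bool; true; false)
  open import Data.Nat as ℕ using (ℕ; zero; suc; z≤n; s≤s; _∸_)
  import Data.Nat.Properties as ℕₚ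
  import Data.Nat.DivMod
  open import Data.Fin as Fin using (Fin; zero; suc; toℕ; _↑ˡ_; _↑ʳ_; punchIn)
  import Data.Fin.Properties as Finₚ
  open import Data.List using (List; []; _∷_; map; foldr; length; _++_; [_]; tabulate; allFin)
  import Data.List.Properties as Listₚ
  open import Data.List.Relation.Unary.All as All using (All; []; _∷_)
  import Data.List.Relation.Unary.All.Properties as Allₚ
  open import Data.List.Relation.Binary.Pointwise as Pointwise using (Pointwise; []; _∷_)
  open import Data.Product using (_×_; _,_; proj₁; proj₂)
  open import Data.Sum using (inj₁; inj₂; [_,_]′)
  open import Data.Empty using (⊥-elim)
  open import Relation.Nullary using (¬_; yes; no)
  open import Relation.Binary.PropositionalEquality as ≡ using (_≡_)
  import Algebra.Properties.Ring as RingProperties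
  import Relation.Binary.Reasoning.Setoid as SetoidReasoning

  module Determinant (R : CR) where
    open CommutativeRing R hiding (zero)
    open PolyTheory R
    open Solver R
    open RingProperties ring using (-0#≈0#; x+x≈x⇒x≈0; -‿distribˡ-*; -‿distribʳ-*)
    open SetoidReasoning setoid

    Col : ℕ → Set
    Col n = Fin n → Carrier

    infix 4 _≗_
    _≗_ : ∀ {n} → Col n → Col n → Set
    c ≗ c' = ∀ i → c i ≈ c' i

    tailC : ∀ {n} → Col (suc n) → Col n
    tailC c i = c (suc i)

    infixl 6 _⊞_·_
    _⊞_·_ : ∀ {n} → Col n → Carrier → Col n → Col n
    (x ⊞ a · y) i = x i + a * y i

    -- A matrix is a list of columns, so that column operations become list surgery. `expand` runs
    -- along the first row with the columns already passed in `pre`; the subtracted recursive call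
    -- produces the alternating signs. Lists of the wrong length get the value 0, which keeps length
    -- conditions out of the multilinearity lemmas.
    columnDet : ∀ n → List (Col n) → Carrier
    expand : ∀ n → List (Col (suc n)) → List (Col (suc n)) → Carrier
    columnDet zero [] = 1#
    columnDet zero (_ ∷ _) = 0#
    columnDet (suc n) cs = expand n [] cs
    expand n pre [] = 0#
    expand n pre (c ∷ post) = c zero * columnDet n (map tailC (pre ++ post)) - expand n (pre ++ [ c ]) post

    columnDet-cong : ∀ n {cs ds} → Pointwise _≗_ cs ds → columnDet n cs ≈ columnDet n ds
    expand-cong : ∀ n {p p' q q'} → Pointwise _≗_ p p' → Pointwise _≗_ q q' → expand n p q ≈ expand n p' q'
    columnDet-cong zero [] = refl
    columnDet-cong zero (_ ∷ _) = refl
    columnDet-cong (suc n) es = expand-cong n [] es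
    expand-cong n ps [] = refl
    expand-cong n ps (e ∷ es) = +-cong
      (*-cong (e zero) (columnDet-cong n (Pointwise.map⁺ tailC tailC (Pointwise.map (λ f i → f (suc i)) (Pointwise.++⁺ ps es)))))
      (-‿cong (expand-cong n (Pointwise.++⁺ ps (e ∷ [])) es))

    ≗-refl : ∀ {n} {c : Col n} → c ≗ c
    ≗-refl i = refl

    replace-column : ∀ {n} as {x y : Col n} bs → x ≗ y → columnDet n (as ++ x ∷ bs) ≈ columnDet n (as ++ y ∷ bs)
    replace-column as bs e = columnDet-cong _ (Pointwise.++⁺ (Pointwise.refl ≗-refl) (e ∷ Pointwise.refl ≗-refl))

    private
      tails-pre : ∀ {n} as (z : Col (suc n)) bs post → map tailC ((as ++ z ∷ bs) ++ post) ≡ map tailC as ++ tailC z ∷ map tailC (bs ++ post)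
      tails-pre as z bs post = ≡.trans (≡.cong (map tailC) (Listₚ.++-assoc as (z ∷ bs) post)) (Listₚ.map-++ tailC as (z ∷ bs ++ post))

      tails-post : ∀ {n} pre as (z : Col (suc n)) bs → map tailC (pre ++ as ++ z ∷ bs) ≡ map tailC (pre ++ as) ++ tailC z ∷ map tailC bs
      tails-post pre as z bs = ≡.trans (≡.cong (map tailC) (≡.sym (Listₚ.++-assoc pre as (z ∷ bs)))) (Listₚ.map-++ tailC (pre ++ as) (z ∷ bs))

      snoc : ∀ {A : Set} as (z : A) bs c → (as ++ z ∷ bs) ++ [ c ] ≡ as ++ z ∷ (bs ++ [ c ])
      snoc as z bs c = Listₚ.++-assoc as (z ∷ bs) [ c ]

      move : ∀ {A : Set} as (z : A) bs → (as ++ [ z ]) ++ bs ≡ as ++ z ∷ bs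
      move as z bs = Listₚ.++-assoc as [ z ] bs

      zlin : ∀ a → 0# ≈ 0# + a * 0#
      zlin a = sym (trans (+-identityˡ _) (zeroʳ a))

    columnDet-linear : ∀ n as (x : Col n) a y bs →
      columnDet n (as ++ (x ⊞ a · y) ∷ bs) ≈ columnDet n (as ++ x ∷ bs) + a * columnDet n (as ++ y ∷ bs)
    private
      -- Multilinearity splits according to whether the expansion has already passed the altered
      -- column (here) or has yet to reach it (`linear-post`).
      linear-pre : ∀ n as x a y bs post →
        expand n (as ++ (x ⊞ a · y) ∷ bs) post ≈ expand n (as ++ x ∷ bs) post + a * expand n (as ++ y ∷ bs) post
      linear-pre n as x a y bs [] = zlin a
      linear-pre n as x a y bs (c ∷ post)
        rewrite tails-pre as (x ⊞ a · y) bs post | tails-pre as x bs post | tails-pre as y bs post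
              | snoc as (x ⊞ a · y) bs c | snoc as x bs c | snoc as y bs c =
        trans (+-cong (*-congˡ (columnDet-linear n (map tailC as) (tailC x) a (tailC y) (map tailC (bs ++ post))))
                      (-‿cong (linear-pre n as x a y (bs ++ [ c ]) post)))
          (solve 6 (λ c a d e f g → c :* (d :+ a :* e) :- (f :+ a :* g) := (c :* d :- f) :+ a :* (c :* e :- g)) refl (c zero) a _ _ _ _)

      linear-post : ∀ n pre as x a y bs →
        expand n pre (as ++ (x ⊞ a · y) ∷ bs) ≈ expand n pre (as ++ x ∷ bs) + a * expand n pre (as ++ y ∷ bs)
      linear-post n pre [] x a y bs = trans (+-congˡ (-‿cong (linear-pre n pre x a y [] bs)))
        (solve 6 (λ x a y d f g → (x :+ a :* y) :* d :- (f :+ a :* g) := (x :* d :- f) :+ a :* (y :* d :- g)) refl (x zero) a (y zero) _ _ _)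
      linear-post n pre (c ∷ as) x a y bs
        rewrite tails-post pre as (x ⊞ a · y) bs | tails-post pre as x bs | tails-post pre as y bs =
        trans (+-cong (*-congˡ (columnDet-linear n (map tailC (pre ++ as)) (tailC x) a (tailC y) (map tailC bs)))
                      (-‿cong (linear-post n (pre ++ [ c ]) as x a y bs)))
          (solve 6 (λ c a d e f g → c :* (d :+ a :* e) :- (f :+ a :* g) := (c :* d :- f) :+ a :* (c :* e :- g)) refl (c zero) a _ _ _ _)
    columnDet-linear zero [] x a y bs = zlin a
    columnDet-linear zero (_ ∷ as) x a y bs = zlin a
    columnDet-linear (suc n) as x a y bs = linear-post n [] as x a y bs

    columnDet-alternating : ∀ n as (x : Col n) bs → columnDet n (as ++ x ∷ x ∷ bs) ≈ 0#
    private
      alternating-pre : ∀ n as x bs post → expand n (as ++ x ∷ x ∷ bs) post ≈ 0#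
      alternating-pre n as x bs [] = refl
      alternating-pre n as x bs (c ∷ post) rewrite tails-pre as x (x ∷ bs) post | snoc as x (x ∷ bs) c =
        trans (+-cong (trans (*-congˡ (columnDet-alternating n (map tailC as) (tailC x) (map tailC (bs ++ post)))) (zeroʳ _))
                      (trans (-‿cong (alternating-pre n as x (bs ++ [ c ]) post)) -0#≈0#)) (+-identityʳ 0#)

      alternating-post : ∀ n pre as x bs → expand n pre (as ++ x ∷ x ∷ bs) ≈ 0#
      -- The terms of the two equal columns have the same minor and opposite signs.
      alternating-post n pre [] x bs rewrite move pre x bs | snoc pre x [] x =
        trans (+-congˡ (-‿cong (+-congˡ (-‿cong (alternating-pre n pre x [] bs)))))
          (trans (solve 3 (λ u v w → u :* v :- (u :* v :- w) := w) refl (x zero) _ _) refl)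
      alternating-post n pre (c ∷ as) x bs rewrite tails-post pre as x (x ∷ bs) =
        trans (+-cong (trans (*-congˡ (columnDet-alternating n (map tailC (pre ++ as)) (tailC x) (map tailC bs))) (zeroʳ _))
                      (trans (-‿cong (alternating-post n (pre ++ [ c ]) as x bs)) -0#≈0#)) (+-identityʳ 0#)
    columnDet-alternating zero [] x bs = refl
    columnDet-alternating zero (_ ∷ _) x bs = refl
    columnDet-alternating (suc n) as x bs = alternating-post n [] as x bs

    private
      linear₂ : ∀ {n} as u (x : Col n) a y bs →
        columnDet n (as ++ u ∷ (x ⊞ a · y) ∷ bs) ≈ columnDet n (as ++ u ∷ x ∷ bs) + a * columnDet n (as ++ u ∷ y ∷ bs)
      linear₂ {n} as u x a y bs = ≡.subst₂ _≈_ (≡.cong (columnDet n) (move as u _))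
        (≡.cong₂ (λ s t → columnDet n s + a * columnDet n t) (move as u _) (move as u _)) (columnDet-linear n (as ++ [ u ]) x a y bs)

    -- Polarisation: with x + y in both places the determinant vanishes, and so do the terms with x
    -- or y repeated.
    columnDet-swap : ∀ {n} as (x y : Col n) bs → columnDet n (as ++ x ∷ y ∷ bs) ≈ - columnDet n (as ++ y ∷ x ∷ bs)
    columnDet-swap {n} as x y bs = begin
      D x y ≈⟨ solve 2 (λ s t → s := (s :+ t) :- t) refl (D x y) (D y x) ⟩
      (D x y + D y x) - D y x ≈⟨ +-congʳ sum≈0 ⟩
      0# - D y x ≈⟨ +-identityˡ _ ⟩
      - D y x ∎
      where
        D : Col n → Col n → Carrier
        D u v = columnDet n (as ++ u ∷ v ∷ bs)
        z = x ⊞ 1# · y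
        half : ∀ u → D u z ≈ D u x + D u y
        half u = trans (linear₂ as u x 1# y bs) (+-congˡ (*-identityˡ _))
        sum≈0 : D x y + D y x ≈ 0#
        sum≈0 = begin
          D x y + D y x ≈⟨ sym (+-cong (+-identityˡ _) (+-identityʳ _)) ⟩
          (0# + D x y) + (D y x + 0#) ≈⟨ +-cong (+-congʳ (sym (columnDet-alternating n as x bs))) (+-congˡ (sym (columnDet-alternating n as y bs))) ⟩
          (D x x + D x y) + (D y x + D y y) ≈⟨ sym (+-cong (half x) (half y)) ⟩
          D x z + D y z ≈⟨ +-congˡ (sym (*-identityˡ _)) ⟩
          D x z + 1# * D y z ≈⟨ sym (columnDet-linear n as x 1# y (z ∷ bs)) ⟩
          D z z ≈⟨ columnDet-alternating n as z bs ⟩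
          0# ∎

    columnDet-repeated : ∀ {n} as (x : Col n) bs cs → columnDet n (as ++ x ∷ bs ++ x ∷ cs) ≈ 0#
    columnDet-repeated {n} as x [] cs = columnDet-alternating n as x cs
    columnDet-repeated {n} as x (b ∷ bs) cs = trans (columnDet-swap as x b (bs ++ x ∷ cs))
      (trans (-‿cong (trans (reflexive (≡.cong (columnDet n) (≡.sym (move as b (x ∷ bs ++ x ∷ cs))))) (columnDet-repeated (as ++ [ b ]) x bs cs))) -0#≈0#)

    add-right : ∀ {n} as (x : Col n) a y bs cs → columnDet n (as ++ (x ⊞ a · y) ∷ bs ++ y ∷ cs) ≈ columnDet n (as ++ x ∷ bs ++ y ∷ cs)
    add-right {n} as x a y bs cs = trans (columnDet-linear n as x a y (bs ++ y ∷ cs))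
      (trans (+-congˡ (trans (*-congˡ (columnDet-repeated as y bs cs)) (zeroʳ a))) (+-identityʳ _))

    add-left : ∀ {n} as (x : Col n) a y bs → columnDet n (as ++ y ∷ (x ⊞ a · y) ∷ bs) ≈ columnDet n (as ++ y ∷ x ∷ bs)
    add-left {n} as x a y bs = trans (linear₂ as y x a y bs)
      (trans (+-congˡ (trans (*-congˡ (columnDet-alternating n as y bs)) (zeroʳ a))) (+-identityʳ _))

    columnDet-scale : ∀ {n} as (x : Col n) a bs → columnDet n (as ++ (λ i → a * x i) ∷ bs) ≈ a * columnDet n (as ++ x ∷ bs)
    columnDet-scale {n} as x a bs = trans (replace-column as bs (λ i → sym (+-identityˡ _)))
      (trans (columnDet-linear n as (λ _ → 0#) a x bs) (trans (+-congʳ zeroCol) (+-identityˡ _)))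
      where
        -- Linearity applied to 0 = 0 + 1 · 0 gives D = D + D.
        zeroCol : columnDet n (as ++ (λ _ → 0#) ∷ bs) ≈ 0#
        zeroCol = x+x≈x⇒x≈0 _ (sym (trans (replace-column as bs (λ i → sym (trans (+-identityˡ _) (zeroʳ 1#))))
          (trans (columnDet-linear n as (λ _ → 0#) 1# (λ _ → 0#) bs) (+-congˡ (*-identityˡ _)))))

    -- Synthetic division by X - x, carried out on all rows simultaneously.
    inits : ∀ {n} → Carrier → Col n → List (Col n) → List (Col n)
    inits x c [] = []
    inits x c (c' ∷ cs) = c ∷ inits x (c' ⊞ x · c) cs

    value : ∀ {n} → Carrier → Col n → List (Col n) → Col n
    value x c [] = c
    value x c (c' ∷ cs) = value x (c' ⊞ x · c) cs

    -- Each column, once updated, is added x times to its right neighbour. These operations preserve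
    -- the determinant and leave the coefficients of the quotient by X - x followed by the value at
    -- x.
    horner : ∀ {n} x as (c : Col n) cs w → columnDet n (as ++ c ∷ cs ++ w) ≈ columnDet n (as ++ inits x c cs ++ value x c cs ∷ w)
    horner x as c [] w = refl
    horner {n} x as c (c' ∷ cs) w = trans (sym (add-left as c' x c (cs ++ w)))
      (trans (reflexive (≡.cong (columnDet n) (≡.sym (move as c _))))
      (trans (horner x (as ++ [ c ]) (c' ⊞ x · c) cs w) (reflexive (≡.cong (columnDet n) (move as c _)))))

    value-cong : ∀ {n} y {c d : Col n} cs → c ≗ d → value y c cs ≗ value y d cs
    value-cong y [] e = e
    value-cong y (c' ∷ cs) e = value-cong y cs (λ i → +-congˡ (*-congˡ (e i)))

    value-inits : ∀ {n} x y (p h : Col n) cs i →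
      (y - x) * value y p (inits x h cs) i + value x h cs i ≈ value y (λ j → (y - x) * p j + h j) cs i
    value-inits x y p h [] i = refl
    value-inits x y p h (c ∷ cs) i = trans (value-inits x y (h ⊞ y · p) (c ⊞ x · h) cs i)
      (value-cong y cs (λ j → solve 5 (λ x y p h c → (y :- x) :* (h :+ y :* p) :+ (c :+ x :* h) := c :+ y :* ((y :- x) :* p :+ h)) refl x y (p j) (h j) (c j)) i)

    quotCols : ∀ {n} → Carrier → List (Col n) → List (Col n)
    quotCols x [] = []
    quotCols x (c ∷ cs) = inits x c cs

    val : ∀ {n} → Carrier → List (Col n) → Col n
    val x [] = λ _ → 0#
    val x (c ∷ cs) = value x c cs

    -- The identity p(y) = (y - x) Q(y) + p(x) in every row, where Q is the quotient by X - x.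
    val-quotCols : ∀ {n} x y (cs : List (Col n)) i → (y - x) * val y (quotCols x cs) i + val x cs i ≈ val y cs i
    val-quotCols x y [] i = trans (+-identityʳ _) (zeroʳ _)
    val-quotCols x y (c ∷ []) i = trans (+-congʳ (zeroʳ _)) (+-identityˡ _)
    val-quotCols x y (c ∷ c' ∷ cs) i = trans (value-inits x y c (c' ⊞ x · c) cs i)
      (value-cong y cs (λ j → solve 4 (λ x y c d → (y :- x) :* c :+ (d :+ x :* c) := d :+ y :* c) refl x y (c j) (c' j)) i)

    reduce : ∀ {n} → List Carrier → List (Col n) → List (Col n)
    reduce [] cs = cs
    reduce (x ∷ xs) cs = reduce xs (quotCols x cs)

    -- The order is reversed because `horner` leaves the value at x to the right of the quotient
    -- columns, which are processed next.
    vals : ∀ {n} → List Carrier → List (Col n) → List (Col n)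
    vals [] cs = []
    vals (x ∷ xs) cs = vals xs cs ++ [ val x cs ]

    diffsTo : Carrier → List Carrier → Carrier
    diffsTo x [] = 1#
    diffsTo x (y ∷ ys) = (y - x) * diffsTo x ys

    vandermonde : List Carrier → Carrier
    vandermonde [] = 1#
    vandermonde (x ∷ xs) = diffsTo x xs * vandermonde xs

    length-inits : ∀ {n} x (c : Col n) cs → length (inits x c cs) ≡ length cs
    length-inits x c [] = ≡.refl
    length-inits x c (c' ∷ cs) = ≡.cong suc (length-inits x _ cs)

    private
      -- Turns the values of the quotient by X - x back into values of the original rows: the column
      -- for y is scaled by y - x and receives the column for x. The scalars multiply to
      -- `diffsTo x xs`.
      restore : ∀ {n} x (cs : List (Col n)) as xs bs w →
        diffsTo x xs * columnDet n (as ++ vals xs (quotCols x cs) ++ bs ++ val x cs ∷ w) ≈ columnDet n (as ++ vals xs cs ++ bs ++ val x cs ∷ w)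
      restore x cs as [] bs w = *-identityˡ _
      restore {n} x cs as (y ∷ xs) bs w = begin
        ((y - x) * diffsTo x xs) * columnDet n (as ++ (vals xs qs ++ [ v ]) ++ bs ++ t ∷ w)
          ≈⟨ *-cong (*-comm _ _) (reflexive (≡.cong (columnDet n) (assoc₁ qs v))) ⟩
        (diffsTo x xs * (y - x)) * columnDet n ((as ++ vals xs qs) ++ v ∷ bs ++ t ∷ w)
          ≈⟨ trans (*-assoc _ _ _) (*-congˡ (sym (columnDet-scale (as ++ vals xs qs) v (y - x) (bs ++ t ∷ w)))) ⟩
        diffsTo x xs * columnDet n ((as ++ vals xs qs) ++ (λ i → (y - x) * v i) ∷ bs ++ t ∷ w)
          ≈⟨ *-congˡ (sym (add-right (as ++ vals xs qs) _ 1# t bs w)) ⟩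
        diffsTo x xs * columnDet n ((as ++ vals xs qs) ++ ((λ i → (y - x) * v i) ⊞ 1# · t) ∷ bs ++ t ∷ w)
          ≈⟨ *-congˡ (replace-column (as ++ vals xs qs) _ (λ i → trans (+-congˡ (*-identityˡ _)) (val-quotCols x y cs i))) ⟩
        diffsTo x xs * columnDet n ((as ++ vals xs qs) ++ val y cs ∷ bs ++ t ∷ w)
          ≈⟨ *-congˡ (reflexive (≡.cong (columnDet n) (Listₚ.++-assoc as (vals xs qs) _))) ⟩
        diffsTo x xs * columnDet n (as ++ vals xs qs ++ (val y cs ∷ bs) ++ t ∷ w)
          ≈⟨ restore x cs as xs (val y cs ∷ bs) w ⟩
        columnDet n (as ++ vals xs cs ++ (val y cs ∷ bs) ++ t ∷ w)
          ≈⟨ reflexive (≡.cong (columnDet n) (≡.cong (as ++_) (≡.sym (move (vals xs cs) (val y cs) _)))) ⟩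
        columnDet n (as ++ (vals xs cs ++ [ val y cs ]) ++ bs ++ t ∷ w) ∎
        where
          qs = quotCols x cs
          v = val y qs
          t = val x cs
          assoc₁ : ∀ qs v → as ++ (vals xs qs ++ [ v ]) ++ bs ++ t ∷ w ≡ (as ++ vals xs qs) ++ v ∷ bs ++ t ∷ w
          assoc₁ qs v = ≡.trans (≡.cong (as ++_) (move (vals xs qs) v _)) (≡.sym (Listₚ.++-assoc as (vals xs qs) _))

    -- Replaces coefficient columns by the coefficients of the quotients by the product of the X -
    -- x, followed by the values at the points. The divided differences passed through on the way
    -- cost exactly the Vandermonde product.
    vandermonde-reduce : ∀ {n} xs (cs w : List (Col n)) → length xs ℕ.≤ length cs →
      vandermonde xs * columnDet n (cs ++ w) ≈ columnDet n (reduce xs cs ++ vals xs cs ++ w)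
    vandermonde-reduce [] cs w _ = *-identityˡ _
    vandermonde-reduce {n} (x ∷ xs) (c ∷ cs) w (s≤s le) = begin
      (diffsTo x xs * vandermonde xs) * columnDet n (c ∷ cs ++ w)
        ≈⟨ trans (*-assoc _ _ _) (*-congˡ (*-congˡ (horner x [] c cs w))) ⟩
      diffsTo x xs * (vandermonde xs * columnDet n (inits x c cs ++ value x c cs ∷ w))
        ≈⟨ *-congˡ (vandermonde-reduce xs (inits x c cs) (value x c cs ∷ w) (≡.subst (length xs ℕ.≤_) (≡.sym (length-inits x c cs)) le)) ⟩
      diffsTo x xs * columnDet n (reduce xs (inits x c cs) ++ vals xs (inits x c cs) ++ value x c cs ∷ w)
        ≈⟨ restore x (c ∷ cs) (reduce xs (inits x c cs)) xs [] w ⟩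
      columnDet n (reduce xs (inits x c cs) ++ vals xs (c ∷ cs) ++ value x c cs ∷ w)
        ≈⟨ reflexive (≡.cong (columnDet n) (≡.cong (reduce xs (inits x c cs) ++_) (≡.sym (move (vals xs (c ∷ cs)) _ w)))) ⟩
      columnDet n (reduce xs (inits x c cs) ++ (vals xs (c ∷ cs) ++ [ value x c cs ]) ++ w) ∎

    -- The polynomial whose coefficients, leading one first, are the entries of a row.
    rowPoly : ∀ {n} → Poly → List (Col n) → Fin n → Poly
    rowPoly acc [] i = acc
    rowPoly acc (c ∷ cs) i = rowPoly (c i ∷ acc) cs i

    rowPoly-cong : ∀ {n} {p q} (cs : List (Col n)) i → p ≋ q → rowPoly p cs i ≋ rowPoly q cs i
    rowPoly-cong [] i e = e
    rowPoly-cong (c ∷ cs) i e = rowPoly-cong cs i (∷-cong refl e)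

    rowPoly-value : ∀ {n} y acc (c : Col n) cs i → c i ≈ evalP acc y → value y c cs i ≈ evalP (rowPoly acc cs i) y
    rowPoly-value y acc c [] i e = e
    rowPoly-value y acc c (c' ∷ cs) i e = rowPoly-value y (c' i ∷ acc) _ cs i (+-congˡ (*-congˡ e))

    rowPoly-val : ∀ {n} y (cs : List (Col n)) i → val y cs i ≈ evalP (rowPoly [] cs i) y
    rowPoly-val y [] i = refl
    rowPoly-val y (c ∷ cs) i = rowPoly-value y (c i ∷ []) c cs i (sym (eval-const (c i) y))

    rowPoly-inits : ∀ {n} x acc (c : Col n) cs i → c i ≈ evalP acc x →
      rowPoly (quot acc x) (inits x c cs) i ≋ quot (rowPoly acc cs i) x
    rowPoly-inits x acc c [] i e = ≋-refl
    rowPoly-inits x acc c (c' ∷ cs) i e = PR.trans (rowPoly-cong (inits x (c' ⊞ x · c) cs) i (∷-cong e ≋-refl))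
      (rowPoly-inits x (c' i ∷ acc) (c' ⊞ x · c) cs i (+-congˡ (*-congˡ e)))

    rowPoly-quotCols : ∀ {n} x (cs : List (Col n)) i → rowPoly [] (quotCols x cs) i ≋ quot (rowPoly [] cs i) x
    rowPoly-quotCols x [] i = ≋-refl
    rowPoly-quotCols x (c ∷ cs) i = PR.trans (rowPoly-cong (inits x c cs) i (mk λ { zero → refl ; (suc j) → refl }))
      (rowPoly-inits x (c i ∷ []) c cs i (sym (eval-const (c i) x)))

    coeff-rowPoly-high : ∀ {n} acc (cs : List (Col n)) i j → coeff (length cs ℕ.+ j) (rowPoly acc cs i) ≡ coeff j acc
    coeff-rowPoly-high acc [] i j = ≡.refl
    coeff-rowPoly-high acc (c ∷ cs) i j = ≡.trans (≡.cong (λ k → coeff k (rowPoly (c i ∷ acc) cs i)) (≡.sym (ℕₚ.+-suc (length cs) j)))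
      (coeff-rowPoly-high (c i ∷ acc) cs i (suc j))

    coeff-rowPoly-low : ∀ {n} acc acc' (cs : List (Col n)) i j → j ℕ.< length cs → coeff j (rowPoly acc cs i) ≡ coeff j (rowPoly acc' cs i)
    coeff-rowPoly-low acc acc' (c ∷ cs) i j lt with j ℕ.<? length cs
    ... | yes lt' = coeff-rowPoly-low (c i ∷ acc) (c i ∷ acc') cs i j lt'
    ... | no ge = ≡.subst (λ j → coeff j (rowPoly (c i ∷ acc) cs i) ≡ coeff j (rowPoly (c i ∷ acc') cs i))
        (≡.trans (ℕₚ.+-identityʳ _) (ℕₚ.≤-antisym (ℕₚ.≮⇒≥ ge) (ℕₚ.≤-pred lt)))
        (≡.trans (coeff-rowPoly-high (c i ∷ acc) cs i 0) (≡.sym (coeff-rowPoly-high (c i ∷ acc') cs i 0)))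

    coeff-rowPoly-head : ∀ {n} acc (c : Col n) cs i → coeff (length cs) (rowPoly acc (c ∷ cs) i) ≡ c i
    coeff-rowPoly-head acc c cs i = ≡.trans (≡.cong (λ k → coeff k (rowPoly (c i ∷ acc) cs i)) (≡.sym (ℕₚ.+-identityʳ _))) (coeff-rowPoly-high (c i ∷ acc) cs i 0)

    row-vanishes : ∀ {n} acc (cs : List (Col n)) i → (∀ j → j ℕ.< length cs → coeff j (rowPoly acc cs i) ≈ 0#) → All (λ c → c i ≈ 0#) cs
    row-vanishes acc [] i z = []
    row-vanishes acc (c ∷ cs) i z = trans (reflexive (≡.sym (coeff-rowPoly-head acc c cs i))) (z (length cs) ℕₚ.≤-refl) ∷
      row-vanishes (c i ∷ acc) cs i (λ j lt → z j (ℕₚ.m≤n⇒m≤1+n lt))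

    rowPoly-tail : ∀ {n} acc (cs : List (Col (suc n))) i → rowPoly acc (map tailC cs) i ≡ rowPoly acc cs (suc i)
    rowPoly-tail acc [] i = ≡.refl
    rowPoly-tail acc (c ∷ cs) i = rowPoly-tail (c (suc i) ∷ acc) cs i

    expand-zero : ∀ n pre post → All (λ c → c zero ≈ 0#) post → expand n pre post ≈ 0#
    expand-zero n pre [] [] = refl
    expand-zero n pre (c ∷ post) (z ∷ zs) = trans (+-cong (trans (*-congʳ z) (zeroˡ _)) (trans (-‿cong (expand-zero n (pre ++ [ c ]) post zs)) -0#≈0#)) (+-identityʳ 0#)

    lowerRows : ∀ k {m} → Col (k ℕ.+ m) → Col m
    lowerRows k c j = c (k ↑ʳ j)

    -- In the first k rows, `qs` is the identity matrix (row r is the power X^(k-1-r)) and `ws`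
    -- vanishes, so the matrix is block triangular.
    eliminate : ∀ k m (qs ws : List (Col (k ℕ.+ m))) → length qs ≡ k →
      (∀ (r : Fin k) e → e ℕ.+ suc (toℕ r) ≡ k → ∀ j → j ℕ.< k → coeff j (rowPoly [] qs (r ↑ˡ m)) ≈ coeff j (Xpow e)) →
      All (λ c → ∀ (r : Fin k) → c (r ↑ˡ m) ≈ 0#) ws →
      columnDet (k ℕ.+ m) (qs ++ ws) ≈ columnDet m (map (lowerRows k) ws)
    eliminate zero m [] ws _ _ _ = reflexive (≡.cong (columnDet m) (≡.sym (Listₚ.map-id ws)))
    eliminate (suc k) m (q ∷ qs) ws len rows zs = begin
      q zero * columnDet (k ℕ.+ m) (map tailC (qs ++ ws)) - expand (k ℕ.+ m) [ q ] (qs ++ ws)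
        ≈⟨ +-cong (*-congʳ q0) (-‿cong (expand-zero (k ℕ.+ m) [ q ] (qs ++ ws) (Allₚ.++⁺ qs0 (All.map (λ z → z zero) zs)))) ⟩
      1# * columnDet (k ℕ.+ m) (map tailC (qs ++ ws)) - 0#
        ≈⟨ trans (+-cong (*-identityˡ _) -0#≈0#) (+-identityʳ _) ⟩
      columnDet (k ℕ.+ m) (map tailC (qs ++ ws))
        ≈⟨ reflexive (≡.cong (columnDet (k ℕ.+ m)) (Listₚ.map-++ tailC qs ws)) ⟩
      columnDet (k ℕ.+ m) (map tailC qs ++ map tailC ws)
        ≈⟨ eliminate k m (map tailC qs) (map tailC ws) (≡.trans (Listₚ.length-map tailC qs) len')
             (λ r e es j lt → trans (reflexive (≡.trans (≡.cong (coeff j) (rowPoly-tail [] qs (r ↑ˡ m))) (coeff-rowPoly-low [] (q (suc (r ↑ˡ m)) ∷ []) qs (suc (r ↑ˡ m)) j (≡.subst (j ℕ.<_) (≡.sym len') lt))))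
               (rows (suc r) e (≡.trans (ℕₚ.+-suc e _) (≡.cong suc es)) j (ℕₚ.m≤n⇒m≤1+n lt)))
             (Allₚ.map⁺ (All.map (λ z r → z (suc r)) zs)) ⟩
      columnDet m (map (lowerRows k) (map tailC ws))
        ≈⟨ reflexive (≡.cong (columnDet m) (≡.sym (Listₚ.map-∘ ws))) ⟩
      columnDet m (map (lowerRows (suc k)) ws) ∎
      where
        len' : length qs ≡ k
        len' = ℕₚ.suc-injective len
        first : ∀ j → j ℕ.< suc k → coeff j (rowPoly [] (q ∷ qs) zero) ≈ coeff j (Xpow k)
        first = rows zero k (ℕₚ.+-comm k 1)
        q0 : q zero ≈ 1#
        q0 = trans (reflexive (≡.sym (≡.trans (≡.cong (λ j → coeff j (rowPoly [] (q ∷ qs) zero)) (≡.sym len')) (coeff-rowPoly-head [] q qs zero))))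
          (trans (first k ℕₚ.≤-refl) (lead (monicDeg-Xpow k)))
        xlow : ∀ k j → j ℕ.< k → coeff j (Xpow k) ≈ 0#
        xlow (suc k) zero _ = refl
        xlow (suc k) (suc j) (s≤s lt) = xlow k j lt
        qs0 : All (λ c → c zero ≈ 0#) qs
        qs0 = row-vanishes (q zero ∷ []) qs zero (λ j lt → trans (first j (ℕₚ.m≤n⇒m≤1+n (≡.subst (j ℕ.<_) len' lt))) (xlow k j (≡.subst (j ℕ.<_) len' lt)))

    rowsMatrix : ∀ n → (Fin n → Poly) → List (Col n)
    rowsMatrix n u = tabulate {n = n} (λ c r → coeff (n ∸ suc (toℕ c)) (u r))

    private
      coeff-tabulate : ∀ {n} N (f : Fin N → Col n) acc i (c : Fin N) → coeff (N ∸ suc (toℕ c)) (rowPoly acc (tabulate f) i) ≡ f c i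
      coeff-tabulate (suc N) f acc i zero = ≡.trans (≡.cong (λ k → coeff k (rowPoly acc (tabulate f) i)) (≡.sym (Listₚ.length-tabulate (λ c → f (suc c)))))
        (coeff-rowPoly-head acc (f zero) (tabulate (λ c → f (suc c))) i)
      coeff-tabulate (suc N) f acc i (suc c) = coeff-tabulate N (λ c → f (suc c)) (f zero i ∷ acc) i c

    rowPoly-rowsMatrix : ∀ n (u : Fin n → Poly) i → DegLt n (u i) → rowPoly [] (rowsMatrix n u) i ≋ u i
    rowPoly-rowsMatrix n u i (dlt d) = mk go
      where
        cs = rowsMatrix n u
        len : length cs ≡ n
        len = Listₚ.length-tabulate (λ c r → coeff (n ∸ suc (toℕ c)) (u r))
        go : ∀ j → coeff j (rowPoly [] cs i) ≈ coeff j (u i)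
        go j with j ℕ.<? n
        ... | no ge = trans (reflexive (≡.trans (≡.cong (λ k → coeff k (rowPoly [] cs i)) (≡.trans (≡.sym (ℕₚ.m+[n∸m]≡n (ℕₚ.≮⇒≥ ge))) (≡.cong (ℕ._+ (j ∸ n)) (≡.sym len)))) (coeff-rowPoly-high [] cs i (j ∸ n))))
                (sym (d j (ℕₚ.≮⇒≥ ge)))
        ... | yes lt = trans (reflexive (≡.cong (λ k → coeff k (rowPoly [] cs i)) (≡.sym e))) (trans (reflexive (coeff-tabulate n _ [] i c)) (reflexive (≡.cong (λ k → coeff k (u i)) e)))
          where
            pos : suc (n ∸ suc j) ℕ.≤ n
            pos = ≡.subst (ℕ._≤ n) (ℕₚ.+-∸-assoc 1 lt) (ℕₚ.m∸n≤m n j)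
            c : Fin n
            c = Fin.fromℕ< pos
            e : n ∸ suc (toℕ c) ≡ j
            e = ≡.trans (≡.cong (λ t → n ∸ suc t) (Finₚ.toℕ-fromℕ< pos)) (≡.trans (≡.cong (n ∸_) (≡.sym (ℕₚ.+-∸-assoc 1 lt))) (ℕₚ.m∸[m∸n]≡n (ℕₚ.<⇒≤ lt)))

    vals-map : ∀ {n} (f : Carrier → Col n) xs cs → (∀ x → val x cs ≗ f x) → Pointwise _≗_ (vals xs cs) (map f (Data.List.reverse xs))
    vals-map f [] cs e = []
    vals-map f (x ∷ xs) cs e = ≡.subst (Pointwise _≗_ _) (≡.sym (≡.trans (≡.cong (map f) (Listₚ.unfold-reverse x xs)) (Listₚ.map-++ f (Data.List.reverse xs) [ x ])))
      (Pointwise.++⁺ (vals-map f xs cs e) (e x ∷ []))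

    prodValues : Poly → List Carrier → Carrier
    prodValues h [] = 1#
    prodValues h (x ∷ xs) = evalP h x * prodValues h xs

    module Resultant (dom : IsDomain R) where
      open DomainTheory R dom

      prodLin-roots : ∀ xs → Roots (prodLin xs) xs
      prodLin-roots [] = []
      prodLin-roots (y ∷ ys) = lin-root y (prodLin ys) ∷
        All.map (λ {z} r → trans (eval-* (lin y) (prodLin ys) z) (trans (*-congˡ r) (zeroʳ _))) (prodLin-roots ys)

      root-reduce : ∀ {n} xs (cs : List (Col n)) i v → rowPoly [] cs i ≋ prodLin xs *P v →
        rowPoly [] (reduce xs cs) i ≋ v × All (λ c → c i ≈ 0#) (vals xs cs)
      root-reduce xs cs i v e = reduced xs cs e ,
        go xs (All.map (λ {y} r → trans (rowPoly-val y cs i) (trans (eval-cong e refl) (trans (eval-* (prodLin xs) v y) (trans (*-congʳ r) (zeroˡ _))))) (prodLin-roots xs))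
        where
          reduced : ∀ xs cs → rowPoly [] cs i ≋ prodLin xs *P v → rowPoly [] (reduce xs cs) i ≋ v
          reduced [] cs e = PR.trans e (PR.*-identityˡ v)
          reduced (x ∷ xs) cs e = reduced xs (quotCols x cs) (PR.trans (rowPoly-quotCols x cs i)
            (poly-cancelˡ (monicDeg-lin x) (PR.trans (PR.sym (factor _ x root)) (PR.trans e (PR.*-assoc _ _ _)))))
            where
              root : evalP (rowPoly [] cs i) x ≈ 0#
              root = trans (eval-cong (PR.trans e (PR.*-assoc _ _ _)) refl) (lin-root x _)
          go : ∀ ys → All (λ y → val y cs i ≈ 0#) ys → All (λ c → c i ≈ 0#) (vals ys cs)
          go [] [] = []
          go (y ∷ ys) (r ∷ rs) = Allₚ.++⁺ (go ys rs) (r ∷ [])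

      length-reduce : ∀ {n} k xs (cs : List (Col n)) → length cs ≡ k ℕ.+ length xs → length (reduce xs cs) ≡ k
      length-reduce k [] cs e = ≡.trans e (ℕₚ.+-identityʳ k)
      length-reduce k (x ∷ xs) [] e = ⊥-elim (ℕₚ.m≢1+m+n 0 (≡.trans e (ℕₚ.+-suc k (length xs))))
      length-reduce k (x ∷ xs) (c ∷ cs) e = length-reduce k xs (inits x c cs) (≡.trans (length-inits x c cs) (ℕₚ.suc-injective (≡.trans e (ℕₚ.+-suc k (length xs)))))

      -- The upper k rows are the product of the X - x times powers of X: they vanish at all points,
      -- and their quotients form an identity block. Only the values of the lower rows remain.
      rowsMatrix-det : ∀ k m xs → length xs ≡ m → (u : Fin (k ℕ.+ m) → Poly) → (∀ i → DegLt (k ℕ.+ m) (u i)) →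
        (∀ (r : Fin k) e → e ℕ.+ suc (toℕ r) ≡ k → u (r ↑ˡ m) ≋ prodLin xs *P Xpow e) →
        vandermonde xs * columnDet (k ℕ.+ m) (rowsMatrix (k ℕ.+ m) u) ≈ columnDet m (map (λ x j → evalP (u (k ↑ʳ j)) x) (Data.List.reverse xs))
      rowsMatrix-det k m xs ≡.refl u deg rows = begin
        vandermonde xs * columnDet N cs ≈⟨ *-congˡ (reflexive (≡.cong (columnDet N) (≡.sym (Listₚ.++-identityʳ cs)))) ⟩
        vandermonde xs * columnDet N (cs ++ []) ≈⟨ vandermonde-reduce xs cs [] (≡.subst (length xs ℕ.≤_) (≡.sym len) (ℕₚ.m≤n+m _ k)) ⟩
        columnDet N (reduce xs cs ++ vals xs cs ++ []) ≈⟨ reflexive (≡.cong (λ t → columnDet N (reduce xs cs ++ t)) (Listₚ.++-identityʳ _)) ⟩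
        columnDet N (reduce xs cs ++ vals xs cs)
          ≈⟨ eliminate k m (reduce xs cs) (vals xs cs) (length-reduce k xs cs len)
               (λ r e es j _ → at (proj₁ (reduced r e es)) j)
               (allRows (λ r → proj₂ (reduced r (k ∸ suc (toℕ r)) (ℕₚ.m∸n+n≡m (Finₚ.toℕ<n r))))) ⟩
        columnDet m (map (lowerRows k) (vals xs cs))
          ≈⟨ columnDet-cong m (≡.subst (Pointwise _≗_ _) (≡.sym (Listₚ.map-∘ (Data.List.reverse xs)))
               (Pointwise.map⁺ (lowerRows k) (lowerRows k) (Pointwise.map (λ e j → e (k ↑ʳ j))
                 (vals-map (λ x i → evalP (u i) x) xs cs (λ x i → trans (rowPoly-val x cs i) (eval-cong (rowPoly-rowsMatrix N u i (deg i)) refl)))))) ⟩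
        columnDet m (map (λ x j → evalP (u (k ↑ʳ j)) x) (Data.List.reverse xs)) ∎
        where
          N = k ℕ.+ length xs
          cs = rowsMatrix N u
          len : length cs ≡ k ℕ.+ length xs
          len = Listₚ.length-tabulate (λ c r → coeff (N ∸ suc (toℕ c)) (u r))
          reduced : ∀ (r : Fin k) e → e ℕ.+ suc (toℕ r) ≡ k → _
          reduced r e es = root-reduce xs cs (r ↑ˡ m) (Xpow e) (PR.trans (rowPoly-rowsMatrix N u (r ↑ˡ m) (deg _)) (rows r e es))
          allRows : ∀ {ws : List (Col N)} → (∀ (r : Fin k) → All (λ c → c (r ↑ˡ m) ≈ 0#) ws) → All (λ c → ∀ (r : Fin k) → c (r ↑ˡ m) ≈ 0#) ws
          allRows {[]} h = []
          allRows {w ∷ ws} h = (λ r → All.head (h r)) ∷ allRows (λ r → All.tail (h r))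

      private
        powers : ∀ m → Fin m → Poly
        powers m j = Xpow (m ∸ suc (toℕ j))

        powers-deg : ∀ m (j : Fin m) → DegLt m (powers m j)
        powers-deg m j = degLt-mono (≡.subst (ℕ._≤ m) (ℕₚ.+-∸-assoc 1 (Finₚ.toℕ<n j)) (ℕₚ.m∸n≤m m (toℕ j))) (degLt (monicDeg-Xpow (m ∸ suc (toℕ j))))

        -- The case of `rowsMatrix-det` without points; there the size reads m + 0, hence the
        -- transport.
        identity-det : ∀ m → columnDet m (rowsMatrix m (powers m)) ≈ 1#
        identity-det m = ≡.subst (λ n → columnDet n (rowsMatrix n (powers n)) ≈ 1#) (ℕₚ.+-identityʳ m)
          (trans (sym (*-identityˡ _)) (rowsMatrix-det m 0 [] ≡.refl (powers (m ℕ.+ 0)) (powers-deg (m ℕ.+ 0))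
            (λ r e es → PR.trans (PR.reflexive (≡.cong Xpow (exponent r e es))) (PR.sym (PR.*-identityˡ _)))))
          where
            exponent : ∀ (r : Fin m) e → e ℕ.+ suc (toℕ r) ≡ m → m ℕ.+ 0 ∸ suc (toℕ (r ↑ˡ 0)) ≡ e
            exponent r e es = ≡.trans (≡.cong₂ (λ a b → a ∸ suc b) (≡.trans (ℕₚ.+-identityʳ m) (≡.sym es)) (Finₚ.toℕ-↑ˡ r 0)) (ℕₚ.m+n∸n≡m e (suc (toℕ r)))

        scale-values : ∀ {m} (h : Poly) (f : Carrier → Col m) as ys →
          columnDet m (as ++ map (λ x j → evalP h x * f x j) ys) ≈ prodValues h ys * columnDet m (as ++ map f ys)
        scale-values h f as [] = sym (*-identityˡ _)
        scale-values {m} h f as (y ∷ ys) = begin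
          columnDet m (as ++ (λ j → evalP h y * f y j) ∷ map (λ x j → evalP h x * f x j) ys)
            ≈⟨ columnDet-scale as (f y) (evalP h y) _ ⟩
          evalP h y * columnDet m (as ++ f y ∷ map (λ x j → evalP h x * f x j) ys)
            ≈⟨ *-congˡ (trans (reflexive (≡.cong (columnDet m) (≡.sym (move as (f y) _)))) (scale-values h f (as ++ [ f y ]) ys)) ⟩
          evalP h y * (prodValues h ys * columnDet m ((as ++ [ f y ]) ++ map f ys))
            ≈⟨ trans (sym (*-assoc _ _ _)) (*-congˡ (reflexive (≡.cong (columnDet m) (move as (f y) _)))) ⟩
          (evalP h y * prodValues h ys) * columnDet m (as ++ f y ∷ map f ys) ∎

        prodValues-++ : ∀ h xs ys → prodValues h (xs ++ ys) ≈ prodValues h xs * prodValues h ys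
        prodValues-++ h [] ys = sym (*-identityˡ _)
        prodValues-++ h (x ∷ xs) ys = trans (*-congˡ (prodValues-++ h xs ys)) (sym (*-assoc _ _ _))

        prodValues-reverse : ∀ h xs → prodValues h (Data.List.reverse xs) ≈ prodValues h xs
        prodValues-reverse h [] = refl
        prodValues-reverse h (x ∷ xs) = trans (reflexive (≡.cong (prodValues h) (Listₚ.unfold-reverse x xs)))
          (trans (prodValues-++ h (Data.List.reverse xs) [ x ]) (trans (*-cong (prodValues-reverse h xs) (*-identityʳ _)) (*-comm _ _)))

      -- In the matrix of values, each column carries the factor h(x); what is left is the matrix of
      -- powers of the points. `rowsMatrix-det` with k = 0 evaluates that matrix as the Vandermonde
      -- product, which then cancels. This is the formula for the resultant as the product of the
      -- h(x).
      resultant-rows : ∀ k m xs → length xs ≡ m → (h : Poly) (u : Fin (k ℕ.+ m) → Poly) → (∀ i → DegLt (k ℕ.+ m) (u i)) →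
        (∀ (r : Fin k) e → e ℕ.+ suc (toℕ r) ≡ k → u (r ↑ˡ m) ≋ prodLin xs *P Xpow e) →
        (∀ (j : Fin m) → u (k ↑ʳ j) ≋ h *P Xpow (m ∸ suc (toℕ j))) →
        ¬ vandermonde xs ≈ 0# → columnDet (k ℕ.+ m) (rowsMatrix (k ℕ.+ m) u) ≈ prodValues h xs
      resultant-rows k m xs len h u deg top bottom nv = cancelˡ nv (begin
        V * columnDet (k ℕ.+ m) (rowsMatrix (k ℕ.+ m) u) ≈⟨ rowsMatrix-det k m xs len u deg top ⟩
        columnDet m (map (λ x j → evalP (u (k ↑ʳ j)) x) ys)
          ≈⟨ columnDet-cong m (pointwise ys (λ x j → trans (eval-cong (bottom j) refl) (eval-* h _ x))) ⟩
        columnDet m (map (λ x j → evalP h x * evalP (powers m j) x) ys) ≈⟨ scale-values {m} h (λ x j → evalP (powers m j) x) [] ys ⟩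
        prodValues h ys * columnDet m (map (λ x j → evalP (powers m j) x) ys)
          ≈⟨ *-cong (prodValues-reverse h xs) (sym (rowsMatrix-det 0 m xs len (powers m) (powers-deg m) (λ ()))) ⟩
        prodValues h xs * (V * columnDet m (rowsMatrix m (powers m))) ≈⟨ *-congˡ (trans (*-congˡ (identity-det m)) (*-identityʳ V)) ⟩
        prodValues h xs * V ≈⟨ *-comm _ _ ⟩
        V * prodValues h xs ∎)
        where
          V = vandermonde xs
          ys = Data.List.reverse xs
          pointwise : ∀ ys {f g : Carrier → Col m} → (∀ x → f x ≗ g x) → Pointwise _≗_ (map f ys) (map g ys)
          pointwise [] e = []
          pointwise (y ∷ ys) e = e y ∷ pointwise ys e

    private
      negPow-cong : ∀ n {a b} → a ≈ b → negPow n a ≈ negPow n b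
      negPow-cong zero e = e
      negPow-cong (suc n) e = -‿cong (negPow-cong n e)

      sum : List Carrier → Carrier
      sum = foldr _+_ 0#

      sum-cong : ∀ {A : Set} (xs : List A) {f g : A → Carrier} → (∀ x → f x ≈ g x) → sum (map f xs) ≈ sum (map g xs)
      sum-cong [] e = refl
      sum-cong (x ∷ xs) e = +-cong (e x) (sum-cong xs e)

      sum-neg : ∀ {A : Set} (xs : List A) (f : A → Carrier) → sum (map (λ x → - f x) xs) ≈ - sum (map f xs)
      sum-neg [] f = sym -0#≈0#
      sum-neg (x ∷ xs) f = trans (+-congˡ (sum-neg xs f)) (solve 2 (λ a b → (:- a) :+ (:- b) := :- (a :+ b)) refl _ _)

      remaining : ∀ {A : Set} {k} → (Fin k → A) → Fin k → List A
      remaining {k = suc k} C j = tabulate (λ c → C (punchIn j c))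

      -- Identifies the expansion indexed by `punchIn` with `expand`. The prefix `pre` is what makes
      -- the induction on the remaining columns go through.
      laplace : ∀ m pre k (C : Fin k → Col (suc m)) →
        sum (map (λ j → negPow (toℕ j) (C j zero * columnDet m (map tailC (pre ++ remaining C j)))) (allFin k)) ≈ expand m pre (tabulate C)
      laplace m pre zero C = refl
      laplace m pre (suc k) C = +-congˡ (begin
        sum (map (λ j → term j) (tabulate {n = k} suc))
          ≈⟨ reflexive (≡.cong sum (≡.trans (Listₚ.map-tabulate suc (λ j → term j)) (≡.sym (Listₚ.map-tabulate (λ j → j) (λ j → term (suc j)))))) ⟩
        sum (map (λ j → term (suc j)) (allFin k))
          ≈⟨ sum-cong (allFin k) (λ j → -‿cong (negPow-cong (toℕ j) (*-congˡ (reflexive (≡.cong (λ l → columnDet m (map tailC l)) (shift k C j)))))) ⟩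
        sum (map (λ j → - negPow (toℕ j) (C (suc j) zero * columnDet m (map tailC ((pre ++ [ C zero ]) ++ remaining (λ c → C (suc c)) j)))) (allFin k))
          ≈⟨ sum-neg (allFin k) _ ⟩
        - sum (map (λ j → negPow (toℕ j) (C (suc j) zero * columnDet m (map tailC ((pre ++ [ C zero ]) ++ remaining (λ c → C (suc c)) j)))) (allFin k))
          ≈⟨ -‿cong (laplace m (pre ++ [ C zero ]) k (λ c → C (suc c))) ⟩
        - expand m (pre ++ [ C zero ]) (tabulate (λ c → C (suc c))) ∎)
        where
          term : Fin (suc k) → Carrier
          term j = negPow (toℕ j) (C j zero * columnDet m (map tailC (pre ++ remaining C j)))
          shift : ∀ k (C : Fin (suc k) → Col (suc m)) (j : Fin k) → pre ++ remaining C (suc j) ≡ (pre ++ [ C zero ]) ++ remaining (λ c → C (suc c)) j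
          shift (suc k) C j = ≡.sym (move pre (C zero) _)

    det-columnDet : ∀ m (M : Fin m → Fin m → Carrier) → det m M ≈ columnDet m (tabulate (λ c r → M r c))
    det-columnDet zero M = refl
    det-columnDet (suc m) M = trans (sum-cong (allFin (suc m)) (λ j → negPow-cong (toℕ j) (*-congˡ
        (trans (det-columnDet m (λ r c → M (suc r) (punchIn j c)))
          (reflexive (≡.cong (columnDet m) (≡.sym (Listₚ.map-tabulate (λ c r → M r (punchIn j c)) tailC))))))))
      (laplace m [] (suc m) (λ c r → M r c))

    coeff-*Xpow-high : ∀ p e i → coeff (i ℕ.+ e) (p *P Xpow e) ≈ coeff i p
    coeff-*Xpow-high p e i = trans (at (PR.*-comm p (Xpow e)) (i ℕ.+ e)) (go e)
      where
        go : ∀ e → coeff (i ℕ.+ e) (Xpow e *P p) ≈ coeff i p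
        go zero = trans (at (PR.*-identityˡ p) (i ℕ.+ 0)) (reflexive (≡.cong (λ j → coeff j p) (ℕₚ.+-identityʳ i)))
        go (suc e) = trans (reflexive (≡.cong (λ j → coeff j (Xpow (suc e) *P p)) (ℕₚ.+-suc i e))) (trans (at (shift* (Xpow e) p) (suc (i ℕ.+ e))) (go e))

    coeff-*Xpow-low : ∀ p e i → i ℕ.< e → coeff i (p *P Xpow e) ≈ 0#
    coeff-*Xpow-low p e i lt = trans (at (PR.*-comm p (Xpow e)) i) (go e i lt)
      where
        go : ∀ e i → i ℕ.< e → coeff i (Xpow e *P p) ≈ 0#
        go (suc e) zero _ = at (shift* (Xpow e) p) 0
        go (suc e) (suc i) (s≤s lt) = trans (at (shift* (Xpow e) p) (suc i)) (go e i lt)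

    private
      <ᵇ-yes : ∀ {m n} → m ℕ.< n → (m ℕ.<ᵇ n) ≡ true
      <ᵇ-yes {m} {n} lt with m ℕ.<ᵇ n | ℕₚ.<⇒<ᵇ lt
      ... | true | _ = ≡.refl

      <ᵇ-no : ∀ {m n} → ¬ m ℕ.< n → (m ℕ.<ᵇ n) ≡ false
      <ᵇ-no {m} {n} ge with m ℕ.<ᵇ n | ℕₚ.<ᵇ⇒< m n
      ... | true | f = ⊥-elim (ge (f _))
      ... | false | _ = ≡.refl

      ≤ᵇ-yes : ∀ {m n} → m ℕ.≤ n → (m ℕ.≤ᵇ n) ≡ true
      ≤ᵇ-yes {m} {n} le with m ℕ.≤ᵇ n | ℕₚ.≤⇒≤ᵇ le
      ... | true | _ = ≡.refl

      ≤ᵇ-no : ∀ {m n} → ¬ m ℕ.≤ n → (m ℕ.≤ᵇ n) ≡ false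
      ≤ᵇ-no {m} {n} gt with m ℕ.≤ᵇ n | ℕₚ.≤ᵇ⇒≤ m n
      ... | true | f = ⊥-elim (gt (f _))
      ... | false | _ = ≡.refl

      entry : ℕ → ℕ → ℕ → Poly → Carrier
      entry m r c p = Data.Bool.if (Data.Bool.if r ℕ.≤ᵇ c then (c ∸ r) ℕ.≤ᵇ m else false) then coeff (m ∸ (c ∸ r)) p else 0#

      -- Both halves of the Sylvester matrix are bands of shifted coefficients. The cases are: left
      -- of the band, where i exceeds the degree; inside it; right of it, where i is below the shift
      -- e.
      entry-coeff : ∀ m r c e i p → DegLt (suc m) p → i ℕ.+ c ≡ m ℕ.+ e ℕ.+ r → entry m r c p ≈ coeff i (p *P Xpow e)
      entry-coeff m r c e i p (dlt d) s with r ℕ.≤? c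
      ... | no gt rewrite ≤ᵇ-no gt = sym (trans (reflexive (≡.cong (λ j → coeff j (p *P Xpow e)) i≡)) (trans (coeff-*Xpow-high p e (i ∸ e)) (d (i ∸ e) i-e>m)))
        where
          big : suc m ℕ.+ e ℕ.≤ i
          big = ℕₚ.+-cancelʳ-≤ c (suc m ℕ.+ e) i (≡.subst (suc m ℕ.+ e ℕ.+ c ℕ.≤_) (≡.sym s)
            (≡.subst (ℕ._≤ m ℕ.+ e ℕ.+ r) (ℕₚ.+-suc (m ℕ.+ e) c) (ℕₚ.+-monoʳ-≤ (m ℕ.+ e) (ℕₚ.≰⇒> gt))))
          i≡ : i ≡ (i ∸ e) ℕ.+ e
          i≡ = ≡.sym (ℕₚ.m∸n+n≡m (ℕₚ.≤-trans (ℕₚ.m≤n+m e (suc m)) big))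
          i-e>m : suc m ℕ.≤ i ∸ e
          i-e>m = ≡.subst (ℕ._≤ i ∸ e) (ℕₚ.m+n∸n≡m (suc m) e) (ℕₚ.∸-monoˡ-≤ e big)
      ... | yes le rewrite ≤ᵇ-yes le with (c ∸ r) ℕ.≤? m
      ...   | yes le' rewrite ≤ᵇ-yes le' = sym (trans (reflexive (≡.cong (λ j → coeff j (p *P Xpow e)) i≡)) (coeff-*Xpow-high p e (m ∸ (c ∸ r))))
        where
          i≡ : i ≡ (m ∸ (c ∸ r)) ℕ.+ e
          i≡ = ℕₚ.+-cancelʳ-≡ c i _ (≡.trans s (≡.trans (≡.cong (λ t → t ℕ.+ e ℕ.+ r) (≡.sym (ℕₚ.m∸n+n≡m le')))
            (≡.trans (rearr (m ∸ (c ∸ r)) (c ∸ r) e r) (≡.cong ((m ∸ (c ∸ r)) ℕ.+ e ℕ.+_) (ℕₚ.m∸n+n≡m le)))))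
            where
              open import Data.Nat.Solver using (module +-*-Solver)
              rearr : ∀ a b e r → a ℕ.+ b ℕ.+ e ℕ.+ r ≡ a ℕ.+ e ℕ.+ (b ℕ.+ r)
              rearr = S.solve 4 (λ a b e r → a S.:+ b S.:+ e S.:+ r S.:= a S.:+ e S.:+ (b S.:+ r)) ≡.refl
                where module S = +-*-Solver
      ...   | no gt rewrite ≤ᵇ-no gt = sym (coeff-*Xpow-low p e i (ℕₚ.+-cancelʳ-< c i e (≡.subst (ℕ._< e ℕ.+ c) (≡.sym s)
                (≡.subst₂ ℕ._<_ (≡.sym (ℕₚ.+-assoc m e r)) (≡.trans (rearr (c ∸ r) e r) (≡.cong (e ℕ.+_) (ℕₚ.m∸n+n≡m le))) (ℕₚ.+-monoˡ-< (e ℕ.+ r) (ℕₚ.≰⇒> gt))))))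
        where
          rearr : ∀ a e r → a ℕ.+ (e ℕ.+ r) ≡ e ℕ.+ (a ℕ.+ r)
          rearr a e r = ≡.trans (≡.sym (ℕₚ.+-assoc a e r)) (≡.trans (≡.cong (ℕ._+ r) (ℕₚ.+-comm a e)) (ℕₚ.+-assoc e a r))

      sylvester-top : ∀ m k p g (r c : Fin (k ℕ.+ m)) → toℕ r ℕ.< k → sylvester m k p g r c ≡ entry m (toℕ r) (toℕ c) p
      sylvester-top m k p g r c lt rewrite <ᵇ-yes lt with toℕ r ℕ.≤ᵇ toℕ c
      ... | true = ≡.refl
      ... | false = ≡.refl

      sylvester-bottom : ∀ m k p g (r c : Fin (k ℕ.+ m)) → ¬ toℕ r ℕ.< k → sylvester m k p g r c ≡ entry k (toℕ r ∸ k) (toℕ c) g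
      sylvester-bottom m k p g r c ge rewrite <ᵇ-no ge with (toℕ r ∸ k) ℕ.≤ᵇ toℕ c
      ... | true = ≡.refl
      ... | false = ≡.refl

      sylvesterRow : ∀ m k → Poly → Poly → Fin (k ℕ.+ m) → Poly
      sylvesterRow m k p g r = [ (λ r → p *P Xpow (k ∸ suc (toℕ r))) , (λ j → g *P Xpow (m ∸ suc (toℕ j))) ]′ (Fin.splitAt k r)

      complement : ∀ {n} (c : Fin n) → (n ∸ suc (toℕ c)) ℕ.+ suc (toℕ c) ≡ n
      complement c = ℕₚ.m∸n+n≡m (Finₚ.toℕ<n c)

      sylvester-coeff : ∀ m k p g → DegLt (suc m) p → DegLt (suc k) g → ∀ r c →
        sylvester m k p g r c ≈ coeff (k ℕ.+ m ∸ suc (toℕ c)) (sylvesterRow m k p g r)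
      sylvester-coeff m k p g dp dg r c with Fin.splitAt k r in eq
      ... | inj₁ r' rewrite ≡.sym (Finₚ.splitAt⁻¹-↑ˡ {i = r} eq) =
        trans (reflexive (≡.trans (sylvester-top m k p g (r' ↑ˡ m) c (≡.subst (ℕ._< k) (≡.sym (Finₚ.toℕ-↑ˡ r' m)) (Finₚ.toℕ<n r')))
                                  (≡.cong (λ t → entry m t (toℕ c) p) (Finₚ.toℕ-↑ˡ r' m))))
          (entry-coeff m (toℕ r') (toℕ c) (k ∸ suc (toℕ r')) _ p dp
            (ℕₚ.suc-injective (≡.trans (≡.sym (ℕₚ.+-suc _ (toℕ c))) (≡.trans (complement c) (≡.trans (≡.cong (ℕ._+ m) (≡.sym (complement r')))
              (S.solve 3 (λ e r m → e S.:+ (S.con 1 S.:+ r) S.:+ m S.:= S.con 1 S.:+ (m S.:+ e S.:+ r)) ≡.refl (k ∸ suc (toℕ r')) (toℕ r') m))))))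
        where
          open import Data.Nat.Solver using (module +-*-Solver)
          module S = +-*-Solver
      ... | inj₂ j rewrite ≡.sym (Finₚ.splitAt⁻¹-↑ʳ {i = r} eq) =
        trans (reflexive (≡.trans (sylvester-bottom m k p g (k ↑ʳ j) c (λ lt → ℕₚ.<⇒≱ lt (≡.subst (k ℕ.≤_) (≡.sym (Finₚ.toℕ-↑ʳ k j)) (ℕₚ.m≤m+n k (toℕ j)))))
                                  (≡.cong (λ t → entry k t (toℕ c) g) (≡.trans (≡.cong (_∸ k) (Finₚ.toℕ-↑ʳ k j)) (ℕₚ.m+n∸m≡n k (toℕ j))))))
          (entry-coeff k (toℕ j) (toℕ c) (m ∸ suc (toℕ j)) _ g dg
            (ℕₚ.suc-injective (≡.trans (≡.sym (ℕₚ.+-suc _ (toℕ c))) (≡.trans (complement c) (≡.trans (≡.cong (k ℕ.+_) (≡.sym (complement j)))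
              (S.solve 3 (λ e j k → k S.:+ (e S.:+ (S.con 1 S.:+ j)) S.:= S.con 1 S.:+ (k S.:+ e S.:+ j)) ≡.refl (m ∸ suc (toℕ j)) (toℕ j) k))))))
        where
          open import Data.Nat.Solver using (module +-*-Solver)
          module S = +-*-Solver

      tabulate-≗ : ∀ {n} N {f g : Fin N → Col n} → (∀ c → f c ≗ g c) → Pointwise _≗_ (tabulate f) (tabulate g)
      tabulate-≗ zero e = []
      tabulate-≗ (suc N) e = e zero ∷ tabulate-≗ N (λ c → e (suc c))

      sylvesterRow-deg : ∀ m k p g → DegLt (suc m) p → DegLt (suc k) g → ∀ i → DegLt (k ℕ.+ m) (sylvesterRow m k p g i)
      sylvesterRow-deg m k p g dp dg i with Fin.splitAt k i
      ... | inj₁ r = ≡.subst (λ t → DegLt t (p *P Xpow (k ∸ suc (toℕ r)))) eq (degLt-mono (s≤s (ℕₚ.m≤m+n _ (toℕ r))) (degLt-* p _ dp (degLt (monicDeg-Xpow (k ∸ suc (toℕ r))))))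
        where
          eq : suc (m ℕ.+ (k ∸ suc (toℕ r)) ℕ.+ toℕ r) ≡ k ℕ.+ m
          eq = ≡.trans (≡.cong suc (ℕₚ.+-assoc m _ _)) (≡.trans (≡.sym (ℕₚ.+-suc m _)) (≡.trans (≡.cong (m ℕ.+_) (≡.trans (≡.sym (ℕₚ.+-suc _ (toℕ r))) (complement r))) (ℕₚ.+-comm m k)))
      ... | inj₂ j = ≡.subst (λ t → DegLt t (g *P Xpow (m ∸ suc (toℕ j)))) eq (degLt-mono (s≤s (ℕₚ.m≤m+n _ (toℕ j))) (degLt-* g _ dg (degLt (monicDeg-Xpow (m ∸ suc (toℕ j))))))
        where
          eq : suc (k ℕ.+ (m ∸ suc (toℕ j)) ℕ.+ toℕ j) ≡ k ℕ.+ m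
          eq = ≡.trans (≡.cong suc (ℕₚ.+-assoc k _ _)) (≡.trans (≡.sym (ℕₚ.+-suc k _)) (≡.cong (k ℕ.+_) (≡.trans (≡.sym (ℕₚ.+-suc _ (toℕ j))) (complement j))))

    sgn : ℕ → Carrier
    sgn k = negPow k 1#

    negPow-sgn : ∀ k a → negPow k a ≈ sgn k * a
    negPow-sgn zero a = sym (*-identityˡ a)
    negPow-sgn (suc k) a = trans (-‿cong (negPow-sgn k a)) (-‿distribˡ-* (sgn k) a)

    sgn-+ : ∀ j k → sgn (j ℕ.+ k) ≈ sgn j * sgn k
    sgn-+ zero k = sym (*-identityˡ _)
    sgn-+ (suc j) k = trans (-‿cong (sgn-+ j k)) (-‿distribˡ-* (sgn j) (sgn k))

    module Discriminant (dom : IsDomain R) where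
      open DomainTheory R dom
      open Resultant dom

      resultant-prodValues : ∀ k p g xs → p ≋ prodLin xs → DegLt (suc k) g → ¬ vandermonde xs ≈ 0# →
        resultant (length xs) k p g ≈ prodValues g xs
      resultant-prodValues k p g xs e dg nv = trans (det-columnDet (k ℕ.+ m) (sylvester m k p g))
        (trans (columnDet-cong (k ℕ.+ m) (tabulate-≗ (k ℕ.+ m) (λ c r → sylvester-coeff m k p g dp dg r c)))
          (resultant-rows k m xs ≡.refl g (sylvesterRow m k p g) (sylvesterRow-deg m k p g dp dg) top bottom nv))
        where
          m = length xs
          dp : DegLt (suc m) p
          dp = degLt (monicDeg-cong (PR.sym e) (monicDeg-prodLin xs))
          top : ∀ (r : Fin k) t → t ℕ.+ suc (toℕ r) ≡ k → sylvesterRow m k p g (r ↑ˡ m) ≋ prodLin xs *P Xpow t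
          top r t es rewrite Finₚ.splitAt-↑ˡ k r m = PR.*-cong e (PR.reflexive (≡.cong Xpow (≡.trans (≡.cong (_∸ suc (toℕ r)) (≡.sym es)) (ℕₚ.m+n∸n≡m t (suc (toℕ r))))))
          bottom : ∀ (j : Fin m) → sylvesterRow m k p g (k ↑ʳ j) ≋ g *P Xpow (m ∸ suc (toℕ j))
          bottom j rewrite Finₚ.splitAt-↑ʳ k m j = PR.refl

      diffs-diffsTo : ∀ x xs → diffs x xs ≈ sgn (length xs) * diffsTo x xs
      diffs-diffsTo x [] = sym (*-identityˡ _)
      diffs-diffsTo x (y ∷ ys) = trans (*-congˡ (diffs-diffsTo x ys))
        (solve 4 (λ x y s d → (x :- y) :* (s :* d) := (:- s) :* ((y :- x) :* d)) refl x y (sgn (length ys)) (diffsTo x ys))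

      deriv-prodLin-∷ : ∀ x xs → deriv (prodLin (x ∷ xs)) ≋ prodLin xs +P lin x *P deriv (prodLin xs)
      deriv-prodLin-∷ x xs = PR.trans (deriv-* (lin x) (prodLin xs)) (PR.+-congʳ (PR.trans (PR.*-congʳ (deriv-lin x)) (PR.*-identityˡ _)))

      deriv-prodLin-head : ∀ x xs → evalP (deriv (prodLin (x ∷ xs))) x ≈ diffs x xs
      deriv-prodLin-head x xs = trans (eval-cong (deriv-prodLin-∷ x xs) refl) (trans (eval-+ (prodLin xs) _ x)
        (trans (+-cong (eval-prodLin xs x) (lin-root x _)) (+-identityʳ _)))

      deriv-prodLin-tail : ∀ x xs y → evalP (prodLin xs) y ≈ 0# → evalP (deriv (prodLin (x ∷ xs))) y ≈ (y - x) * evalP (deriv (prodLin xs)) y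
      deriv-prodLin-tail x xs y r = trans (eval-cong (deriv-prodLin-∷ x xs) refl) (trans (eval-+ (prodLin xs) _ y)
        (trans (+-cong r (trans (eval-* (lin x) _ y) (*-congʳ (eval-lin x y)))) (+-identityˡ _)))

      derivExp : ℕ → ℕ
      derivExp zero = 0
      derivExp (suc n) = n ℕ.+ derivExp n

      -- At the head x the derivative is the product of the x - y; at every other root y it is y - x
      -- times the derivative of the shorter product. Each pair occurs twice with opposite
      -- orientation, giving the square of the Vandermonde product and the sign exponent 0 + 1 + ...
      -- + (n - 1).
      prodValues-deriv : ∀ xs → prodValues (deriv (prodLin xs)) xs ≈ sgn (derivExp (length xs)) * (vandermonde xs * vandermonde xs)
      prodValues-deriv [] = sym (trans (*-identityˡ _) (*-identityˡ _))
      prodValues-deriv (x ∷ xs) = trans (*-cong (trans (deriv-prodLin-head x xs) (diffs-diffsTo x xs))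
          (trans (rest xs (prodLin-roots xs)) (*-congˡ (prodValues-deriv xs))))
        (trans (solve 4 (λ s d t v → (s :* d) :* (d :* (t :* (v :* v))) := (s :* t) :* ((d :* v) :* (d :* v))) refl _ _ _ _)
          (*-congʳ (sym (sgn-+ (length xs) (derivExp (length xs))))))
        where
          rest : ∀ ys → Roots (prodLin xs) ys → prodValues (deriv (prodLin (x ∷ xs))) ys ≈ diffsTo x ys * prodValues (deriv (prodLin xs)) ys
          rest [] [] = sym (*-identityˡ _)
          rest (y ∷ ys) (r ∷ rs) = trans (*-cong (deriv-prodLin-tail x xs y r) (rest ys rs))
            (solve 4 (λ a b c d → (a :* b) :* (c :* d) := (a :* c) :* (b :* d)) refl _ _ _ _)

      -- The sign in the definition of the discriminant together with the one of `prodValues-deriv`.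
      -- Later arguments use that it depends on n alone.
      discExp : ℕ → ℕ
      discExp n = ((n ℕ.* (n ∸ 1)) Data.Nat.DivMod./ 2) ℕ.+ derivExp n

      discMonic-vandermonde : ∀ p xs → p ≋ prodLin xs → ¬ vandermonde xs ≈ 0# →
        discMonic (length xs) p ≈ sgn (discExp (length xs)) * (vandermonde xs * vandermonde xs)
      discMonic-vandermonde p xs e nv = trans (negPow-sgn ((n ℕ.* (n ∸ 1)) Data.Nat.DivMod./ 2) _)
        (trans (*-congˡ (trans (resultant-prodValues (n ∸ 1) p (deriv p) xs e dg nv)
            (trans (prodValues-cong xs (deriv-cong e)) (prodValues-deriv xs))))
          (trans (sym (*-assoc _ _ _)) (*-congʳ (sym (sgn-+ ((n ℕ.* (n ∸ 1)) Data.Nat.DivMod./ 2) (derivExp n))))))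
        where
          n = length xs
          dg : DegLt (suc (n ∸ 1)) (deriv p)
          dg = degLt-mono (n≤ n) (degLt-deriv (degLt (monicDeg-cong (PR.sym e) (monicDeg-prodLin xs))))
            where
              n≤ : ∀ n → n ℕ.≤ suc (n ∸ 1)
              n≤ zero = z≤n
              n≤ (suc n) = ℕₚ.≤-refl
          prodValues-cong : ∀ ys {g h} → g ≋ h → prodValues g ys ≈ prodValues h ys
          prodValues-cong [] e = refl
          prodValues-cong (y ∷ ys) e = *-cong (eval-cong e refl) (prodValues-cong ys e)

  -- The bivariate discriminant of the statement is computed in a raw ring that carries no laws. A
  -- map compatible with its operations is pushed through each stage of that computation.
  module RawHom (A : RawRing 0ℓ 0ℓ) (B : CR) (h : RawRing.Carrier A → CommutativeRing.Carrier B)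
    (h0 : CommutativeRing._≈_ B (h (RawRing.0# A)) (CommutativeRing.0# B))
    (h1 : CommutativeRing._≈_ B (h (RawRing.1# A)) (CommutativeRing.1# B))
    (h+ : ∀ x y → CommutativeRing._≈_ B (h (RawRing._+_ A x y)) (CommutativeRing._+_ B (h x) (h y)))
    (h* : ∀ x y → CommutativeRing._≈_ B (h (RawRing._*_ A x y)) (CommutativeRing._*_ B (h x) (h y)))
    (h- : ∀ x → CommutativeRing._≈_ B (h (RawRing.-_ A x)) (CommutativeRing.-_ B (h x))) where
    open CommutativeRing B hiding (zero)
    private
      module OA = PolyOps A
      module OB = PolyOps rawRing

    coeff-h : ∀ i p → h (OA.coeff i p) ≈ OB.coeff i (map h p)
    coeff-h i [] = h0
    coeff-h zero (a ∷ p) = refl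
    coeff-h (suc i) (a ∷ p) = coeff-h i p

    natMul-h : ∀ n a → h (OA.natMul n a) ≈ OB.natMul n (h a)
    natMul-h zero a = h0
    natMul-h (suc n) a = trans (h+ a _) (+-congˡ (natMul-h n a))

    negPow-h : ∀ n {a b} → h a ≈ b → h (OA.negPow n a) ≈ OB.negPow n b
    negPow-h zero e = e
    negPow-h (suc n) e = trans (h- _) (-‿cong (negPow-h n e))

    derivAux-h : ∀ k i p → h (OA.coeff i (OA.derivAux k p)) ≈ OB.coeff i (OB.derivAux k (map h p))
    derivAux-h k i [] = h0
    derivAux-h k zero (a ∷ p) = natMul-h k a
    derivAux-h k (suc i) (a ∷ p) = derivAux-h (suc k) i p

    deriv-h : ∀ i p → h (OA.coeff i (OA.deriv p)) ≈ OB.coeff i (OB.deriv (map h p))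
    deriv-h i [] = h0
    deriv-h i (a ∷ p) = derivAux-h 1 i p

    sylvester-h : ∀ m k {p p' g g'} → (∀ i → h (OA.coeff i p) ≈ OB.coeff i p') → (∀ i → h (OA.coeff i g) ≈ OB.coeff i g') →
      ∀ r c → h (OA.sylvester m k p g r c) ≈ OB.sylvester m k p' g' r c
    sylvester-h m k ep eg r c with toℕ r ℕ.<ᵇ k
    ... | true with toℕ r ℕ.≤ᵇ toℕ c
    ...   | false = h0
    ...   | true with (toℕ c ∸ toℕ r) ℕ.≤ᵇ m
    ...     | true = ep _
    ...     | false = h0
    sylvester-h m k ep eg r c | false with (toℕ r ∸ k) ℕ.≤ᵇ toℕ c
    ...   | false = h0
    ...   | true with (toℕ c ∸ (toℕ r ∸ k)) ℕ.≤ᵇ k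
    ...     | true = eg _
    ...     | false = h0

    det-h : ∀ m {M M'} → (∀ r c → h (M r c) ≈ M' r c) → h (OA.det m M) ≈ OB.det m M'
    det-h zero e = h1
    det-h (suc m) {M} {M'} e = go (allFin (suc m))
      where
        go : ∀ js → h (foldr (RawRing._+_ A) (RawRing.0# A) (map (λ j → OA.negPow (toℕ j) (RawRing._*_ A (M zero j) (OA.det m (λ r c → M (suc r) (punchIn j c))))) js))
          ≈ foldr _+_ 0# (map (λ j → OB.negPow (toℕ j) (M' zero j * OB.det m (λ r c → M' (suc r) (punchIn j c)))) js)
        go [] = h0
        go (j ∷ js) = trans (h+ _ _) (+-cong (negPow-h (toℕ j) (trans (h* _ _) (*-cong (e zero j) (det-h m (λ r c → e (suc r) (punchIn j c)))))) (go js))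

    discMonic-h : ∀ n p → h (OA.discMonic n p) ≈ OB.discMonic n (map h p)
    discMonic-h n p = negPow-h ((n ℕ.* (n ∸ 1)) Data.Nat.DivMod./ 2) (det-h (n ∸ 1 ℕ.+ n) (sylvester-h n (n ∸ 1) {p} {map h p} {OA.deriv p} {OB.deriv (map h p)} (λ i → coeff-h i p) (λ i → deriv-h i p)))

open Discriminants

-- Permutation arguments in a finite field and the Frobenius map.

module FrobeniusMaps where
  open import Algebra.Bundles using (CommutativeRing)
  open import Data.Nat as ℕ using (ℕ; zero; suc; z≤n; s≤s)
  import Data.Nat.Properties as ℕₚ
  import Data.Fin.Properties as Finₚ
  open import Data.List using (List; []; _∷_; map; foldr; filter; length; _++_; lookup)
  import Data.List.Properties as Listₚ
  open import Data.List.Relation.Unary.All as All using (All; []; _∷_)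
  open import Data.List.Relation.Unary.Any as Any using (Any; here; there)
  import Data.List.Relation.Unary.Any.Properties as Anyₚ
  import Data.List.Relation.Unary.All.Properties as Allₚ
  open import Data.List.Relation.Unary.AllPairs as AllPairs using (AllPairs; []; _∷_)
  import Data.List.Relation.Unary.AllPairs.Properties as AllPairsₚ
  open import Data.List.Relation.Unary.Unique.Propositional using (Unique)
  import Data.List.Relation.Unary.Unique.Propositional.Properties as Uniqueₚ
  open import Data.List.Membership.Propositional using (_∈_)
  import Data.List.Membership.Propositional.Properties as ∈ₚ
  open import Data.List.Relation.Binary.Permutation.Propositional as Perm using (_↭_; ↭-sym; ↭-trans; prep; swap)
  import Data.List.Relation.Binary.Permutation.Propositional.Properties as Permₚ
  open import Data.Product using (∃; _,_; proj₂)
  open import Data.Sum using (inj₁; inj₂)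
  open import Data.Empty using (⊥-elim)
  open import Relation.Nullary using (¬_; Dec; yes; no; ¬?)
  open import Relation.Binary.PropositionalEquality as ≡ using (_≡_)
  import Relation.Binary.Reasoning.Setoid as SetoidReasoning

  -- The pigeonhole principle for finite sets given as lists without repetition; comparisons of
  -- length and permutations are both drawn from it.
  unique-extend : ∀ {A : Set} (xs ys : List A) → Unique xs → (∀ {x} → x ∈ xs → x ∈ ys) → ∃ λ zs → ys ↭ xs ++ zs
  unique-extend [] ys _ _ = ys , Perm.refl
  unique-extend (x ∷ xs) ys (x∉ ∷ u) sub with ∈ₚ.∈-∃++ (sub (here ≡.refl))
  ... | as , bs , ≡.refl with unique-extend xs (as ++ bs) u rest
    where
      rest : ∀ {y} → y ∈ xs → y ∈ as ++ bs
      rest {y} y∈ with Permₚ.∈-resp-↭ (Permₚ.shift x as bs) (sub (there y∈))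
      ... | here ≡.refl = ⊥-elim (All.lookup x∉ y∈ ≡.refl)
      ... | there y∈' = y∈'
  ... | zs , p = zs , ↭-trans (Permₚ.shift x as bs) (prep x p)

  unique-length : ∀ {A : Set} {xs ys : List A} → Unique xs → (∀ {x} → x ∈ xs → x ∈ ys) → length xs ℕ.≤ length ys
  unique-length {xs = xs} {ys} u sub with unique-extend xs ys u sub
  ... | zs , p = ≡.subst (length xs ℕ.≤_) (≡.sym (≡.trans (Permₚ.↭-length p) (Listₚ.length-++ xs))) (ℕₚ.m≤m+n _ _)

  unique-permutation : ∀ {A : Set} {xs ys : List A} → Unique xs → (∀ {x} → x ∈ xs → x ∈ ys) → length ys ℕ.≤ length xs → ys ↭ xs
  unique-permutation {xs = xs} {ys} u sub le with unique-extend xs ys u sub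
  ... | [] , p = ≡.subst (ys ↭_) (Listₚ.++-identityʳ xs) p
  ... | z ∷ zs , p = ⊥-elim (ℕₚ.<⇒≱ (ℕₚ.m<m+n (length xs) (s≤s z≤n)) (≡.subst (ℕ._≤ length xs) (≡.trans (Permₚ.↭-length p) (Listₚ.length-++ xs)) le))

  module ListProducts (R : CR) where
    open CommutativeRing R
    open Solver R
    open PolyTheory R using (pow; natMul)

    prod : List Carrier → Carrier
    prod = foldr _*_ 1#

    total : List Carrier → Carrier
    total = foldr _+_ 0#

    prod-map-↭ : ∀ {A : Set} (f : A → Carrier) {xs ys} → xs ↭ ys → prod (map f xs) ≈ prod (map f ys)
    prod-map-↭ f Perm.refl = refl
    prod-map-↭ f (prep x p) = *-congˡ (prod-map-↭ f p)
    prod-map-↭ f (swap x y p) = trans (solve 3 (λ a b c → a :* (b :* c) := b :* (a :* c)) refl _ _ _) (*-congˡ (*-congˡ (prod-map-↭ f p)))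
    prod-map-↭ f (Perm.trans p q) = trans (prod-map-↭ f p) (prod-map-↭ f q)

    total-map-↭ : ∀ {A : Set} (f : A → Carrier) {xs ys} → xs ↭ ys → total (map f xs) ≈ total (map f ys)
    total-map-↭ f Perm.refl = refl
    total-map-↭ f (prep x p) = +-congˡ (total-map-↭ f p)
    total-map-↭ f (swap x y p) = trans (solve 3 (λ a b c → a :+ (b :+ c) := b :+ (a :+ c)) refl _ _ _) (+-congˡ (+-congˡ (total-map-↭ f p)))
    total-map-↭ f (Perm.trans p q) = trans (total-map-↭ f p) (total-map-↭ f q)

    prod-scale : ∀ a xs → prod (map (a *_) xs) ≈ pow a (length xs) * prod xs
    prod-scale a [] = sym (*-identityˡ 1#)
    prod-scale a (x ∷ xs) = trans (*-congˡ (prod-scale a xs)) (solve 4 (λ a x p q → (a :* x) :* (p :* q) := (a :* p) :* (x :* q)) refl a x _ _)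

    total-shift : ∀ a xs → total (map (_+ a) xs) ≈ natMul (length xs) a + total xs
    total-shift a [] = sym (+-identityˡ 0#)
    total-shift a (x ∷ xs) = trans (+-congˡ (total-shift a xs)) (solve 4 (λ a x p q → (x :+ a) :+ (p :+ q) := (a :+ p) :+ (x :+ q)) refl a x _ _)

  baseRing : FiniteField → CR
  baseRing K = record { isCommutativeRing = FiniteField.isCommutativeRing K }

  module BaseField (K : FiniteField) where
    open FiniteField K
    private R = baseRing K
    open CommutativeRing R using (+-comm; +-assoc; +-identityˡ; +-identityʳ; -‿inverseʳ; -‿inverseˡ; *-comm; *-assoc; *-identityˡ; *-identityʳ; zeroˡ; zeroʳ)
    open PolyTheory R using (pow; natMul)
    open ListProducts R

    infix 4 _≟F_
    -- An element is identified by the position that `elems-complete` assigns to it.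
    _≟F_ : (x y : F) → Dec (x ≡ y)
    x ≟F y with Any.index (elems-complete x) Finₚ.≟ Any.index (elems-complete y)
    ... | yes e = yes (≡.trans (Anyₚ.lookup-index (elems-complete x)) (≡.trans (≡.cong (lookup elems) e) (≡.sym (Anyₚ.lookup-index (elems-complete y)))))
    ... | no ne = no λ { ≡.refl → ne ≡.refl }

    baseField : FField
    baseField = record
      { cring = R ; _≟_ = _≟F_ ; 1≉0 = λ e → 0≢1 (≡.sym e) ; inverse = inverse ; elems = elems ; complete = elems-complete }

    private module D = DomainTheory R (FField.isDomain baseField)

    injective-permutes : (f : F → F) → (∀ {x y} → f x ≡ f y → x ≡ y) → elems ↭ map f elems
    injective-permutes f inj = unique-permutation (Uniqueₚ.map⁺ inj elems-unique) (λ _ → elems-complete _) (ℕₚ.≤-reflexive (≡.sym (Listₚ.length-map f elems)))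

    private
      nonzero? : ∀ x → Dec (¬ x ≡ 0#)
      nonzero? x = ¬? (x ≟F 0#)

      nz : List F
      nz = filter nonzero? elems

      nz-complete : ∀ {x} → ¬ x ≡ 0# → x ∈ nz
      nz-complete n = ∈ₚ.∈-filter⁺ nonzero? (elems-complete _) n

      nz-nonzero : ∀ {x} → x ∈ nz → ¬ x ≡ 0#
      nz-nonzero x∈ = proj₂ (∈ₚ.∈-filter⁻ nonzero? {xs = elems} x∈)

      nz-unique : Unique (0# ∷ nz)
      nz-unique = All.tabulate (λ x∈ e → nz-nonzero x∈ (≡.sym e)) ∷ Uniqueₚ.filter⁺ nonzero? elems-unique

    card-suc : card ≡ suc (length nz)
    card-suc = ℕₚ.≤-antisym (unique-length elems-unique (λ {x} _ → cover x)) (unique-length nz-unique (λ _ → elems-complete _))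
      where
        cover : ∀ x → x ∈ 0# ∷ nz
        cover x with x ≟F 0#
        ... | yes e = here e
        ... | no n = there (nz-complete n)

    -- Multiplication by a ≠ 0 permutes the nonzero elements, so their product is unchanged by the
    -- factor a^(q-1).
    fermat : ∀ a → pow a card ≡ a
    fermat a rewrite card-suc with a ≟F 0#
    ... | yes ≡.refl = zeroˡ _
    ... | no na = ≡.trans (≡.cong (a *_) (D.cancelˡ prod≢0 (≡.trans (*-comm _ _) (≡.trans (≡.sym (prod-scale a nz)) (≡.trans (≡.sym same) (≡.sym (*-identityʳ _))))))) (*-identityʳ a)
      where
        perm : nz ↭ map (a *_) nz
        perm = unique-permutation (Uniqueₚ.map⁺ (D.cancelˡ na) (AllPairs.tail nz-unique))
          (λ x∈ → let y , y∈ , e = ∈ₚ.∈-map⁻ (a *_) x∈ in nz-complete (λ z → D.nonzero-* na (nz-nonzero y∈) (≡.trans (≡.sym e) z)))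
          (ℕₚ.≤-reflexive (≡.sym (Listₚ.length-map (a *_) nz)))
        same : prod nz ≡ prod (map (a *_) nz)
        same = ≡.trans (≡.cong prod (≡.sym (Listₚ.map-id nz))) (≡.trans (prod-map-↭ (λ x → x) perm) (≡.cong prod (Listₚ.map-id (map (a *_) nz))))
        prod≢0 : ¬ prod nz ≡ 0#
        prod≢0 = go nz (λ x∈ → nz-nonzero x∈)
          where
            go : ∀ xs → (∀ {x} → x ∈ xs → ¬ x ≡ 0#) → ¬ prod xs ≡ 0#
            go [] _ e = 0≢1 (≡.sym e)
            go (x ∷ xs) n = D.nonzero-* (n (here ≡.refl)) (go xs (λ x∈ → n (there x∈)))

    1<card : 1 ℕ.< card
    1<card = unique-length {xs = 0# ∷ 1# ∷ []} ((0≢1 ∷ []) ∷ [] ∷ []) (λ _ → elems-complete _)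

    -- Translation by 1 permutes the field, so the sum of all elements is unchanged by the summand q
    -- · 1.
    card·1 : natMul card 1# ≡ 0#
    card·1 = ≡.trans (≡.sym (+-identityʳ _)) (≡.trans (≡.cong (natMul card 1# +_) (≡.sym (-‿inverseʳ (total elems))))
      (≡.trans (≡.sym (+-assoc _ _ _)) (≡.trans (≡.cong (_+ (- total elems)) shifted) (-‿inverseʳ _))))
      where
        shifted : natMul card 1# + total elems ≡ total elems
        shifted = ≡.trans (≡.sym (total-shift 1# elems))
          (≡.trans (≡.cong total (≡.sym (Listₚ.map-id (map (_+ 1#) elems)))) (≡.trans (total-map-↭ (λ x → x) (↭-sym (injective-permutes (_+ 1#) inj))) (≡.cong total (Listₚ.map-id elems))))
          where
            inj : ∀ {x y} → x + 1# ≡ y + 1# → x ≡ y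
            inj {x} {y} e = ≡.trans (un x) (≡.trans (≡.cong (_+ (- 1#)) e) (≡.sym (un y)))
              where
                un : ∀ x → x ≡ (x + 1#) + (- 1#)
                un x = ≡.sym (≡.trans (+-assoc _ _ _) (≡.trans (≡.cong (x +_) (-‿inverseʳ 1#)) (+-identityʳ x)))

  module Frobenius (K : FiniteField) (E : FField) (ι : Hom (baseRing K) (FField.cring E)) where
    private
      module K = FiniteField K
      module KR = CommutativeRing (baseRing K)
    open BaseField K using (fermat; 1<card; injective-permutes; card·1; baseField; _≟F_)
    open K using (elems; card; elems-unique; elems-complete)
    open FField E using (cring; isDomain; inverse) renaming (_≟_ to _≟E_; 1≉0 to 1≉0E)
    open CommutativeRing cring hiding (zero)
    open FieldTheory E
    open Solver cring
    open Hom ι using () renaming (⟦_⟧ to ι⟦_⟧; ⟦⟧-cong to ι-cong; +-homo to ι-+; *-homo to ι-*; 1-homo to ι-1; 0-homo to ι-0; -‿homo to ι-neg)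
    open SetoidReasoning setoid
    module MP = MapPoly ι

    ι-injective : ∀ {a b} → ι⟦ a ⟧ ≈ ι⟦ b ⟧ → a ≡ b
    ι-injective = field-hom-injective baseField E ι

    q : ℕ
    q = card

    fr : Carrier → Carrier
    fr x = pow x q

    pow-cong : ∀ n {x y} → x ≈ y → pow x n ≈ pow y n
    pow-cong zero e = refl
    pow-cong (suc n) e = *-cong e (pow-cong n e)

    pow-distrib : ∀ n x y → pow (x * y) n ≈ pow x n * pow y n
    pow-distrib zero x y = sym (*-identityˡ 1#)
    pow-distrib (suc n) x y = trans (*-congˡ (pow-distrib n x y)) (solve 4 (λ x y p q → (x :* y) :* (p :* q) := (x :* p) :* (y :* q)) refl x y _ _)

    pow-one : ∀ n → pow 1# n ≈ 1#
    pow-one zero = refl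
    pow-one (suc n) = trans (*-identityˡ _) (pow-one n)

    pow-add : ∀ m n x → pow x (m ℕ.+ n) ≈ pow x m * pow x n
    pow-add zero n x = sym (*-identityˡ _)
    pow-add (suc m) n x = trans (*-congˡ (pow-add m n x)) (sym (*-assoc _ _ _))

    pow-mul : ∀ m n x → pow x (m ℕ.* n) ≈ pow (pow x n) m
    pow-mul zero n x = refl
    pow-mul (suc m) n x = trans (pow-add n (m ℕ.* n) x) (*-congˡ (pow-mul m n x))

    fr-ι : ∀ a → fr ι⟦ a ⟧ ≈ ι⟦ a ⟧
    fr-ι a = trans (sym (MP.pow-homo q a)) (ι-cong (fermat a))

    points : List Carrier
    points = map ι⟦_⟧ elems

    length-points : length points ≡ q
    length-points = Listₚ.length-map ι⟦_⟧ elems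

    points-distinct : Distinct points
    points-distinct = AllPairsₚ.map⁺ (AllPairs.map (λ ne e → ne (ι-injective e)) elems-unique)

    XQ-X : ℕ → Poly
    XQ-X Q = Xpow Q +P -P Xpow 1

    monicDeg-XQ-X : ∀ Q → 1 ℕ.< Q → MonicDeg Q (XQ-X Q)
    monicDeg-XQ-X Q lt with monicDeg-Xpow Q
    ... | l & d = trans (coeff-+ Q (Xpow Q) _) (trans (+-cong l (vanish (degLt-neg (degLt (monicDeg-Xpow 1))) Q lt)) (+-identityʳ 1#)) &
      degLt-+ d (degLt-mono (ℕₚ.m≤n⇒m≤1+n lt) (degLt-neg (degLt (monicDeg-Xpow 1))))

    eval-XQ-X : ∀ Q x → evalP (XQ-X Q) x ≈ pow x Q - x
    eval-XQ-X Q x = trans (eval-+ (Xpow Q) _ x) (+-cong (eval-Xpow Q x) (trans (Hom.-‿homo (evalHom x) (Xpow 1)) (-‿cong (trans (eval-Xpow 1 x) (*-identityʳ x)))))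

    monic-difference : ∀ {m p p'} → MonicDeg m p → MonicDeg m p' → DegLt m (p +P -P p')
    monic-difference {m} {p} {p'} (l & d) (l' & d') = dlt bound
      where
        bound : ∀ i → m ℕ.≤ i → coeff i (p +P -P p') ≈ 0#
        bound i le with m ℕ.≟ i
        ... | yes ≡.refl = trans (coeff-+ m p _) (trans (+-cong l (trans (coeff-neg m p') (-‿cong l'))) (-‿inverseʳ 1#))
        ... | no ne = vanish (degLt-+ d (degLt-neg d')) i (ℕₚ.≤∧≢⇒< le ne)

    -- X^q - X and the product of the X - a are monic of degree q with the same q distinct roots, so
    -- their difference has too many roots for its degree.
    fr-product : ∀ x → fr x - x ≈ diffs x points
    fr-product x = begin
      fr x - x                  ≈⟨ sym (eval-XQ-X q x) ⟩
      evalP (XQ-X q) x          ≈⟨ sub-zero (trans (trans (+-congˡ (sym (Hom.-‿homo (evalHom x) (prodLin points)))) (sym (eval-+ (XQ-X q) _ x))) (eval-cong same refl)) ⟩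
      evalP (prodLin points) x  ≈⟨ eval-prodLin points x ⟩
      diffs x points            ∎
      where
        same : XQ-X q +P -P prodLin points ≋ 0P
        same = too-many-roots _ points
          (≡.subst (λ m → DegLt m (XQ-X q +P -P prodLin points)) (≡.sym length-points)
            (monic-difference (monicDeg-XQ-X q 1<card) (≡.subst (λ m → MonicDeg m (prodLin points)) length-points (monicDeg-prodLin points))))
          points-distinct
          (Allₚ.map⁺ (All.tabulate λ {a} a∈ → trans (eval-+ (XQ-X q) _ ι⟦ a ⟧) (trans (+-cong (trans (eval-XQ-X q ι⟦ a ⟧) (zero-sub (fr-ι a)))
             (trans (Hom.-‿homo (evalHom ι⟦ a ⟧) (prodLin points)) (-‿cong (trans (eval-prodLin points ι⟦ a ⟧) (vanishes a elems a∈))))) (-‿inverseʳ 0#))))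
          where
            vanishes : ∀ a xs → a ∈ xs → diffs ι⟦ a ⟧ (map ι⟦_⟧ xs) ≈ 0#
            vanishes a (_ ∷ xs) (here ≡.refl) = trans (*-congʳ (-‿inverseʳ _)) (zeroˡ _)
            vanishes a (_ ∷ xs) (there a∈) = trans (*-congˡ (vanishes a xs a∈)) (zeroʳ _)

    private
      open ListProducts cring

      diffs-prod : ∀ x (xs : List K.F) → diffs x (map ι⟦_⟧ xs) ≈ prod (map (λ c → x - ι⟦ c ⟧) xs)
      diffs-prod x [] = refl
      diffs-prod x (c ∷ cs) = *-congˡ (diffs-prod x cs)

      -- By `fr-product`, x^q - x is the product of the x - c over F_q, and x ↦ x + 1 permutes these
      -- factors. Additivity thus comes out with q known only as a number of elements, without
      -- binomial coefficients.
      fr-+1 : ∀ x → fr (x + 1#) ≈ fr x + 1#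
      fr-+1 x = begin
        fr (x + 1#)                               ≈⟨ solve 2 (λ a b → a := (a :- b) :+ b) refl _ _ ⟩
        (fr (x + 1#) - (x + 1#)) + (x + 1#)       ≈⟨ +-congʳ shifted ⟩
        (fr x - x) + (x + 1#)                     ≈⟨ solve 3 (λ a x o → (a :- x) :+ (x :+ o) := a :+ o) refl _ _ _ ⟩
        fr x + 1#                                 ∎
        where
          shift : K.F → K.F
          shift c = c K.+ K.1#
          unshift : ∀ c → (c K.+ K.1#) K.+ (K.- K.1#) ≡ c
          unshift c = ≡.trans (KR.+-assoc _ _ _) (≡.trans (≡.cong (c K.+_) (KR.-‿inverseʳ K.1#)) (KR.+-identityʳ c))
          perm : elems ↭ map shift elems
          perm = injective-permutes shift (λ {c} {c'} e → ≡.trans (≡.sym (unshift c)) (≡.trans (≡.cong (K._+ (K.- K.1#)) e) (unshift c')))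
          each : ∀ xs → prod (map (λ c → (x + 1#) - ι⟦ c ⟧) (map shift xs)) ≈ prod (map (λ c → x - ι⟦ c ⟧) xs)
          each [] = refl
          each (c ∷ cs) = *-cong (trans (+-congˡ (-‿cong (trans (ι-+ c K.1#) (+-congˡ ι-1)))) (solve 3 (λ x o c → (x :+ o) :- (c :+ o) := x :- c) refl x 1# ι⟦ c ⟧)) (each cs)
          shifted : fr (x + 1#) - (x + 1#) ≈ fr x - x
          shifted = trans (fr-product (x + 1#)) (trans (diffs-prod (x + 1#) elems) (trans (prod-map-↭ _ perm) (trans (each elems) (sym (trans (fr-product x) (diffs-prod x elems))))))

      fr-0 : fr 0# ≈ 0#
      fr-0 = trans (pow-cong q (sym ι-0)) (trans (fr-ι K.0#) ι-0)

    -- Reduced to the case y = 1 by dividing by y.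
    fr-+ : ∀ x y → fr (x + y) ≈ fr x + fr y
    fr-+ x y with y ≟E 0#
    ... | yes z = trans (pow-cong q (trans (+-congˡ z) (+-identityʳ x))) (sym (trans (+-congˡ (trans (pow-cong q z) fr-0)) (+-identityʳ _)))
    ... | no nz with inverse y nz
    ...   | u , yu = begin
        fr (x + y)               ≈⟨ pow-cong q (sym (trans (distribˡ y _ _) (+-cong (trans (solve 3 (λ x y u → y :* (x :* u) := x :* (y :* u)) refl x y u) (trans (*-congˡ yu) (*-identityʳ x))) (*-identityʳ y)))) ⟩
        fr (y * (x * u + 1#))    ≈⟨ pow-distrib q y _ ⟩
        fr y * fr (x * u + 1#)   ≈⟨ *-congˡ (trans (fr-+1 _) (+-congʳ (pow-distrib q x u))) ⟩
        fr y * (fr x * fr u + 1#) ≈⟨ solve 4 (λ a b c o → a :* (b :* c :+ o) := b :* (a :* c) :+ a :* o) refl _ _ _ _ ⟩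
        fr x * (fr y * fr u) + fr y * 1# ≈⟨ +-cong (trans (*-congˡ (trans (sym (pow-distrib q y u)) (trans (pow-cong q yu) (pow-one q)))) (*-identityʳ _)) (*-identityʳ _) ⟩
        fr x + fr y ∎

    φ : Hom cring cring
    φ = record { ⟦_⟧ = fr ; ⟦⟧-cong = pow-cong q ; +-homo = fr-+ ; *-homo = pow-distrib q ; 1-homo = pow-one q }

    -- If x^q = x, the product of the x - a vanishes, hence one of its factors.
    fr-fixed : ∀ x → fr x ≈ x → ∃ λ a → ι⟦ a ⟧ ≈ x
    fr-fixed x e = go elems (trans (sym (fr-product x)) (zero-sub e))
      where
        go : ∀ xs → diffs x (map ι⟦_⟧ xs) ≈ 0# → ∃ λ a → ι⟦ a ⟧ ≈ x
        go [] z = ⊥-elim (1≉0E z)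
        go (a ∷ xs) z with FField.isDomain E .IsDomain.noZeroDivisors _ _ z
        ... | inj₁ e = a , sym (sub-zero e)
        ... | inj₂ e = go xs e

    char : natMul q 1# ≈ 0#
    char = trans (natMul-cong q (sym ι-1)) (trans (sym (MP.natMul-homo q K.1#)) (trans (ι-cong card·1) ι-0))

open FrobeniusMaps

-- Descent from Frobenius-fixed elements, periods, minimal polynomials.

module GaloisTheory where
  open import Algebra.Bundles using (CommutativeRing)
  open import Data.Nat as ℕ using (ℕ; zero; suc; z≤n; s≤s)
  import Data.Nat.Properties as ℕₚ
  import Data.Nat.DivMod as DivMod
  open import Data.List using (List; []; _∷_; map; length; _++_; [_])
  open import Data.List.Relation.Unary.All as All using (All; []; _∷_)
  open import Data.List.Relation.Unary.AllPairs using ([]; _∷_)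
  open import Data.List.Relation.Binary.Pointwise as Pointwise using (Pointwise; []; _∷_)
  open import Data.Product using (∃; _×_; _,_; proj₁; proj₂)
  open import Data.Sum using (_⊎_; inj₁; inj₂)
  open import Data.Empty using (⊥-elim)
  open import Relation.Nullary using (¬_; yes; no)
  open import Relation.Binary.PropositionalEquality as ≡ using (_≡_)

  -- `ι` identifies `A` with the elements of `B` fixed by `φ`. Stated for rings so that it passes to
  -- polynomials; it is used for F_q in E, for F_q[y] in E[y], and for F_q[y][T] in E[y][T].
  record Descent {A B : CR} (ι : Hom A B) (φ : Hom B B) : Set where
    private
      module A = CommutativeRing A
      module B = CommutativeRing B
      module ι = Hom ι
      module φ = Hom φ
    field
      injective : ∀ {x y} → ι.⟦ x ⟧ B.≈ ι.⟦ y ⟧ → x A.≈ y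
      invariant : ∀ x → φ.⟦ ι.⟦ x ⟧ ⟧ B.≈ ι.⟦ x ⟧
      descend : ∀ y → φ.⟦ y ⟧ B.≈ y → ∃ λ x → ι.⟦ x ⟧ B.≈ y

  polyDescent : ∀ {A B : CR} {ι : Hom A B} {φ : Hom B B} → Descent ι φ → Descent (MapPoly.polyHom ι) (MapPoly.polyHom φ)
  polyDescent {A} {B} {ι} {φ} D = record
    { injective = λ {p} {q} e → PA.mk λ i → injective (B.trans (B.sym (Mι.coeff-map i p)) (B.trans (PB.at e i) (Mι.coeff-map i q)))
    ; invariant = inv
    ; descend = λ p e → down p (λ i → B.trans (B.sym (Mφ.coeff-map i p)) (PB.at e i)) }
    where
      open Descent D
      module B = CommutativeRing B
      module PA = PolyTheory A
      module PB = PolyTheory B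
      module Mι = MapPoly ι
      module Mφ = MapPoly φ
      inv : ∀ p → Mφ.mapP (Mι.mapP p) PB.≋ Mι.mapP p
      inv [] = PB.≋-refl
      inv (a ∷ p) = PB.∷-cong (invariant a) (inv p)
      down : ∀ p → (∀ i → Hom.⟦_⟧ φ (PB.coeff i p) B.≈ PB.coeff i p) → ∃ λ p' → Mι.mapP p' PB.≋ p
      down [] _ = [] , PB.≋-refl
      down (a ∷ p) f with descend a (f 0) | down p (λ i → f (suc i))
      ... | a' , ea | p' , ep = a' ∷ p' , PB.∷-cong ea ep

  module Iterate {R : CR} (ψ : Hom R R) where
    open CommutativeRing R hiding (zero)
    open Hom ψ

    iter : ℕ → Carrier → Carrier
    iter zero x = x
    iter (suc n) x = iter n ⟦ x ⟧

    iter-cong : ∀ n {x y} → x ≈ y → iter n x ≈ iter n y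
    iter-cong zero e = e
    iter-cong (suc n) e = iter-cong n (⟦⟧-cong e)

    iterHom : ℕ → Hom R R
    iterHom zero = idH
    iterHom (suc n) = iterHom n ∘H ψ

    iterHom-iter : ∀ n x → Hom.⟦_⟧ (iterHom n) x ≡ iter n x
    iterHom-iter zero x = ≡.refl
    iterHom-iter (suc n) x = iterHom-iter n ⟦ x ⟧

    iter-+ : ∀ m n x → iter (m ℕ.+ n) x ≡ iter n (iter m x)
    iter-+ zero n x = ≡.refl
    iter-+ (suc m) n x = iter-+ m n ⟦ x ⟧

    iter-suc : ∀ n x → iter (suc n) x ≡ ⟦ iter n x ⟧
    iter-suc n x = ≡.trans (≡.cong (λ m → iter m x) (ℕₚ.+-comm 1 n)) (iter-+ n 1 x)

    iter-comm : ∀ m n x → iter m (iter n x) ≡ iter n (iter m x)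
    iter-comm m n x = ≡.trans (≡.sym (iter-+ n m x)) (≡.trans (≡.cong (λ k → iter k x) (ℕₚ.+-comm n m)) (iter-+ m n x))

    iter-multiple : ∀ e {s x} → iter s x ≈ x → iter (e ℕ.* s) x ≈ x
    iter-multiple zero f = refl
    iter-multiple (suc e) {s} {x} f = trans (reflexive (iter-+ s (e ℕ.* s) x)) (trans (iter-cong (e ℕ.* s) f) (iter-multiple e f))

    iter-fixed : ∀ n {x} → ⟦ x ⟧ ≈ x → iter n x ≈ x
    iter-fixed zero f = refl
    iter-fixed (suc n) f = trans (iter-cong n f) (iter-fixed n f)

    orb : ℕ → Carrier → List Carrier
    orb zero x = []
    orb (suc n) x = x ∷ orb n ⟦ x ⟧

    length-orb : ∀ n x → length (orb n x) ≡ n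
    length-orb zero x = ≡.refl
    length-orb (suc n) x = ≡.cong suc (length-orb n ⟦ x ⟧)

    orb-cong : ∀ n {x y} → x ≈ y → Pointwise _≈_ (orb n x) (orb n y)
    orb-cong zero e = []
    orb-cong (suc n) e = e ∷ orb-cong n (⟦⟧-cong e)

    orb-+ : ∀ m n x → orb (m ℕ.+ n) x ≡ orb m x ++ orb n (iter m x)
    orb-+ zero n x = ≡.refl
    orb-+ (suc m) n x = ≡.cong (x ∷_) (orb-+ m n ⟦ x ⟧)

    map-orb : ∀ n x → map ⟦_⟧ (orb n x) ≡ orb n ⟦ x ⟧
    map-orb zero x = ≡.refl
    map-orb (suc n) x = ≡.cong (⟦ x ⟧ ∷_) (map-orb n ⟦ x ⟧)

    orb-snoc : ∀ n x → orb (suc n) x ≡ orb n x ++ [ iter n x ]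
    orb-snoc n x = ≡.trans (≡.cong (λ m → orb m x) (ℕₚ.+-comm 1 n)) (orb-+ n 1 x)

    all-orb : ∀ {P : Carrier → Set} n x → (∀ j → j ℕ.< n → P (iter j x)) → All P (orb n x)
    all-orb zero x f = []
    all-orb (suc n) x f = f 0 (s≤s z≤n) ∷ all-orb n ⟦ x ⟧ (λ j lt → f (suc j) (s≤s lt))

  module OrbitPoly {R : CR} (ψ : Hom R R) where
    open CommutativeRing R hiding (zero)
    open PolyTheory R
    open Hom ψ
    open Iterate ψ
    private module Mψ = MapPoly ψ

    prodLin-cong : ∀ {xs ys} → Pointwise _≈_ xs ys → prodLin xs ≋ prodLin ys
    prodLin-cong [] = PR.refl
    prodLin-cong (e ∷ es) = PR.*-cong (lin-cong e) (prodLin-cong es)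

    prodLin-rotate : ∀ xs x → prodLin (xs ++ [ x ]) ≋ prodLin (x ∷ xs)
    prodLin-rotate xs x = PR.trans (prodLin-++ xs [ x ]) (PR.trans (PR.*-comm _ _) (PR.*-congʳ (PR.*-identityʳ _)))

    -- The homomorphism rotates the list of roots cyclically.
    orbit-fixed : ∀ s {x} → iter s x ≈ x → Mψ.mapP (prodLin (orb s x)) ≋ prodLin (orb s x)
    orbit-fixed zero r = Mψ.mapP-prodLin []
    orbit-fixed (suc s) {x} r = PR.trans (Mψ.mapP-prodLin (orb (suc s) x))
      (PR.trans (PR.reflexive (≡.cong prodLin (≡.trans (map-orb (suc s) x) (orb-snoc s ⟦ x ⟧))))
      (PR.trans (prodLin-rotate (orb s ⟦ x ⟧) (iter s ⟦ x ⟧)) (PR.*-congʳ (lin-cong r))))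

  module Periods (E : FField) (ψ : Hom (FField.cring E) (FField.cring E)) where
    open FField E using (cring; isDomain; inverse; _≟_; 1≉0)
    open CommutativeRing cring hiding (zero)
    open FieldTheory E
    open Hom ψ
    open Iterate ψ public
    open OrbitPoly ψ public
    private module Mψ = MapPoly ψ

    hom-injective : ∀ {x y} → ⟦ x ⟧ ≈ ⟦ y ⟧ → x ≈ y
    hom-injective = field-hom-injective E E ψ

    hom-nonzero : ∀ {x} → ⟦ x ⟧ ≈ 0# → x ≈ 0#
    hom-nonzero e = hom-injective (trans e (sym 0-homo))

    iter-injective : ∀ n {x y} → iter n x ≈ iter n y → x ≈ y
    iter-injective zero e = e
    iter-injective (suc n) e = hom-injective (iter-injective n e)

    NoReturn : ℕ → Carrier → Set
    NoReturn n x = ∀ j → 0 ℕ.< j → j ℕ.< n → ¬ iter j x ≈ x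

    record Period (s : ℕ) (x : Carrier) : Set where
      field
        positive : 0 ℕ.< s
        returns : iter s x ≈ x
        minimal : NoReturn s x
    open Period public

    period-or-noReturn : ∀ n x → (∃ λ s → Period s x × s ℕ.≤ n) ⊎ NoReturn (suc n) x
    period-or-noReturn zero x = inj₂ λ { (suc j) _ (s≤s ()) }
    period-or-noReturn (suc n) x with period-or-noReturn n x
    ... | inj₁ (s , p , le) = inj₁ (s , p , ℕₚ.m≤n⇒m≤1+n le)
    ... | inj₂ nr with iter (suc n) x ≟ x
    ...   | yes e = inj₁ (suc n , record { positive = s≤s z≤n ; returns = e ; minimal = nr } , ℕₚ.≤-refl)
    ...   | no ne = inj₂ λ j 0<j j<n → case j 0<j (ℕₚ.m≤n⇒m<n∨m≡n (ℕₚ.≤-pred j<n))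
      where
        case : ∀ j → 0 ℕ.< j → j ℕ.< suc n ⊎ j ≡ suc n → ¬ iter j x ≈ x
        case j 0<j (inj₁ lt) = nr j 0<j lt
        case _ 0<j (inj₂ ≡.refl) = ne

    noReturn-distinct : ∀ n x → NoReturn n x → Distinct (orb n x)
    noReturn-distinct zero x nr = []
    noReturn-distinct (suc n) x nr =
      all-orb n ⟦ x ⟧ (λ j lt e → nr (suc j) (s≤s z≤n) (s≤s lt) (sym e)) ∷
      noReturn-distinct n ⟦ x ⟧ (λ j 0<j lt e → nr j 0<j (ℕₚ.m≤n⇒m≤1+n lt) (hom-injective (trans (reflexive (≡.sym (iter-suc j x))) e)))

    return-period : ∀ N x → 0 ℕ.< N → iter N x ≈ x → ∃ λ s → Period s x × s ℕ.≤ N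
    return-period N x 0<N e with period-or-noReturn N x
    ... | inj₁ p = p
    ... | inj₂ nr = ⊥-elim (nr N 0<N ℕₚ.≤-refl e)

    period-distinct : ∀ {s x} → Period s x → Distinct (orb s x)
    period-distinct {s} {x} p = noReturn-distinct s x (minimal p)

    period-divides : ∀ {s x} N → Period s x → iter N x ≈ x → ∃ λ e → N ≡ e ℕ.* s
    period-divides {suc s} {x} N p f with (N DivMod.% suc s) in eq
    ... | zero = N DivMod./ suc s , ≡.trans (DivMod.m≡m%n+[m/n]*n N (suc s)) (≡.cong (ℕ._+ (N DivMod./ suc s) ℕ.* suc s) eq)
    ... | suc r = ⊥-elim (minimal p (suc r) (s≤s z≤n) (≡.subst (ℕ._< suc s) eq (DivMod.m%n<n N (suc s)))
        (trans (sym (iter-cong (suc r) (iter-multiple (N DivMod./ suc s) (returns p)))) (trans (reflexive (≡.trans (≡.sym (iter-+ ((N DivMod./ suc s) ℕ.* suc s) (suc r) x))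
          (≡.cong (λ t → iter t x) (≡.trans (ℕₚ.+-comm _ (suc r)) (≡.sym (≡.trans (DivMod.m≡m%n+[m/n]*n N (suc s)) (≡.cong (ℕ._+ (N DivMod./ suc s) ℕ.* suc s) eq))))))) f)))

    Fixed : Poly → Set
    Fixed p = Mψ.mapP p ≋ p

    fixed-root : ∀ {p} → Fixed p → ∀ n {x} → evalP p x ≈ 0# → evalP p (iter n x) ≈ 0#
    fixed-root fp zero r = r
    fixed-root {p} fp (suc n) {x} r = fixed-root fp n (trans (eval-cong (PR.sym fp) refl) (trans (sym (Mψ.eval-map p x)) (trans (⟦⟧-cong r) 0-homo)))

    fixed-roots : ∀ {p} → Fixed p → ∀ n {x} → evalP p x ≈ 0# → Roots p (orb n x)
    fixed-roots fp n {x} r = all-orb n x (λ j _ → fixed-root fp j r)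

    -- Without a return among the first m steps, the m + 1 iterates of x would be distinct roots of
    -- a nonzero polynomial of degree at most m.
    root-period : ∀ {p m} → Fixed p → ¬ p ≋ 0P → DegLt (suc m) p → ∀ {x} → evalP p x ≈ 0# → ∃ λ s → Period s x × s ℕ.≤ m
    root-period {p} {m} fp nz d {x} r with period-or-noReturn m x
    ... | inj₁ q = q
    ... | inj₂ nr = ⊥-elim (nz (too-many-roots p (orb (suc m) x) (≡.subst (λ k → DegLt k p) (≡.sym (length-orb (suc m) x)) d)
          (noReturn-distinct (suc m) x nr) (fixed-roots fp (suc m) r)))

    fixed-cofactor : ∀ {m p q r} → MonicDeg m p → Fixed p → Fixed r → r ≋ p *P q → Fixed q
    fixed-cofactor {m} {p} {q} {r} mp fp fr e = poly-cancelˡ mp (PR.trans (PR.*-congʳ (PR.sym fp)) (PR.trans (PR.sym (Mψ.mapP-* p q))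
      (PR.trans (Hom.⟦⟧-cong Mψ.polyHom (PR.sym e)) (PR.trans fr e))))

  module Galois (K : FiniteField) (E : FField) (ι : Hom (baseRing K) (FField.cring E)) where
    open Frobenius K E ι public
    open Periods E φ public
    private
      module FK = FieldTheory (BaseField.baseField K)
      module K = FiniteField K
    open BaseField K using (baseField)
    open FField E using (cring; isDomain; inverse; _≟_; 1≉0)
    open CommutativeRing cring hiding (zero)
    open FieldTheory E

    descent : Descent ι φ
    descent = record { injective = ι-injective ; invariant = fr-ι ; descend = fr-fixed }

    descentP : Descent (MapPoly.polyHom ι) (MapPoly.polyHom φ)
    descentP = polyDescent descent

    fixed-mapP : ∀ p → Fixed (MP.mapP p)
    fixed-mapP = Descent.invariant descentP

    monicDeg-reflect : ∀ {m p} → MonicDeg m (MP.mapP p) → FK.MonicDeg m p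
    monicDeg-reflect {m} {p} (l & d) = ι-injective (trans (sym (MP.coeff-map m p)) (trans l (sym (Hom.1-homo ι)))) FK.&
      FK.dlt λ i le → ι-injective (trans (sym (MP.coeff-map i p)) (trans (vanish d i le) (sym (Hom.0-homo ι))))

    conjugates-factor : ∀ {s β} → Period s β → ∀ p → Fixed p → evalP p β ≈ 0# → ∃ λ k → p ≋ prodLin (orb s β) *P k
    conjugates-factor {s} {β} per p fp r = distinct-roots p (orb s β) (period-distinct per) (fixed-roots fp s r)

    -- The product over the Frobenius orbit is fixed by Frobenius, so it descends to F_q.
    minPoly : ∀ {s β} → Period s β → ∃ λ M → MP.mapP M ≋ prodLin (orb s β)
    minPoly {s} {β} per = Descent.descend descentP _ (orbit-fixed s (returns per))

    minPoly-monic : ∀ {s β} (per : Period s β) → FK.MonicDeg s (proj₁ (minPoly per))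
    minPoly-monic {s} {β} per = monicDeg-reflect (monicDeg-cong (PR.sym (proj₂ (minPoly per))) (≡.subst (λ m → MonicDeg m (prodLin (orb s β))) (length-orb s β) (monicDeg-prodLin (orb s β))))

    orb-root : ∀ {s β} → Period s β → evalP (prodLin (orb s β)) β ≈ 0#
    orb-root {suc s} {β} per = lin-root β _

    minPoly-divides : ∀ {s β} (per : Period s β) p → evalP (MP.mapP p) β ≈ 0# → ∃ λ k → p FK.≋ proj₁ (minPoly per) FK.*P k
    minPoly-divides {s} {β} per p r =
      let k , e = conjugates-factor per (MP.mapP p) (fixed-mapP p) r
          k' , e' = Descent.descend descentP k (fixed-cofactor (monicDeg-prodLin (orb s β)) (orbit-fixed s (returns per)) (fixed-mapP p) e)
      in k' , Descent.injective descentP (PR.trans e (PR.trans (PR.*-cong (PR.sym (proj₂ (minPoly per))) (PR.sym e')) (PR.sym (MP.mapP-* (proj₁ (minPoly per)) k'))))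

    -- One of two factors vanishes at β, hence on its whole orbit of s distinct points. Its degree
    -- is then at least s, and the other factor is constant.
    minPoly-irreducible : ∀ {s β} (per : Period s β) → FK.MonicIrr (proj₁ (minPoly per))
    minPoly-irreducible {suc s} {β} per = (s , mM) , (λ c → K.0≢1 (≡.trans (≡.sym (c s)) (FK.lead mM))) , irr
      where
        M = proj₁ (minPoly per)
        mM = minPoly-monic per
        root : evalP (MP.mapP M) β ≈ 0#
        root = trans (eval-cong (proj₂ (minPoly per)) refl) (orb-root per)
        half : ∀ a b → M FK.≋ a FK.*P b → evalP (MP.mapP a) β ≈ 0# → FK.IsConstP b
        half a b e r with FK.degView a | FK.degView b
        ... | inj₁ z | _ = ⊥-elim (FK.monic-nonzero mM (FK.PR.trans e (FK.PR.trans (FK.PR.*-congʳ (FK.mk z)) (FK.PR.zeroˡ b))))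
        ... | inj₂ _ | inj₁ z = λ i → z (suc i)
        ... | inj₂ (i , ni , di) | inj₂ (j , nj , dj) with FK.deg-sum M a b mM e ni di nj dj
        ...   | sum , _ with i ℕ.<? suc s
        ...     | yes lt = ⊥-elim (ni (FK.at (Descent.injective descentP {a} {[]} (too-many-roots (MP.mapP a) (orb (suc s) β)
                      (≡.subst (λ m → DegLt m (MP.mapP a)) (≡.sym (length-orb (suc s) β)) (MP.mapP-degLt (FK.degLt-mono lt di)))
                      (period-distinct per) (fixed-roots (fixed-mapP a) (suc s) r))) i))
        ...     | no ge = λ l → FK.vanish dj (suc l) (s≤s (≡.subst (ℕ._≤ l) (≡.sym j≡0) z≤n))
          where
            j≡0 : j ≡ 0
            j≡0 = ℕₚ.n≤0⇒n≡0 (ℕₚ.+-cancelˡ-≤ i j 0 (≡.subst₂ ℕ._≤_ (≡.sym sum) (≡.sym (ℕₚ.+-identityʳ i)) (ℕₚ.≮⇒≥ ge)))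
        irr : ∀ a b → M FK.≋ a FK.*P b → FK.IsConstP a ⊎ FK.IsConstP b
        irr a b e with FField.isDomain E .IsDomain.noZeroDivisors (evalP (MP.mapP a) β) (evalP (MP.mapP b) β)
            (trans (sym (eval-* (MP.mapP a) (MP.mapP b) β)) (trans (eval-cong (PR.trans (PR.sym (MP.mapP-* a b)) (Hom.⟦⟧-cong MP.polyHom (FK.PR.sym e))) refl) root))
        ... | inj₁ r = inj₂ (half a b e r)
        ... | inj₂ r = inj₁ (half b a (FK.PR.trans e (FK.PR.*-comm a b)) r)

open GaloisTheory

-- The Liouville function of a norm and Stickelberger's parity theorem.

module StickelbergerTheorem where
  open import Algebra.Bundles using (CommutativeRing)
  open import Data.Nat as ℕ using (ℕ; zero; suc; z≤n; s≤s)
  import Data.Nat.Properties as ℕₚ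
  open import Data.Integer as ℤ using (ℤ)
  import Data.Integer.Properties as ℤₚ
  open import Data.Nat.Solver using (module +-*-Solver)
  open import Data.List using (List; []; _∷_; map; length; _++_; [_]; replicate)
  import Data.List.Properties as Listₚ
  open import Data.List.Relation.Unary.All as All using (All; []; _∷_)
  open import Data.List.Relation.Unary.Any as Any using (Any)
  import Data.List.Relation.Unary.All.Properties as Allₚ
  open import Data.List.Relation.Unary.AllPairs using ([]; _∷_)
  open import Data.List.Relation.Binary.Pointwise as Pointwise using (Pointwise; []; _∷_)
  open import Data.Product using (Σ; ∃; _×_; _,_; proj₁; proj₂)
  open import Data.Sum using (_⊎_; inj₁; inj₂; [_,_]′)
  open import Data.Empty using (⊥-elim)
  open import Relation.Nullary using (¬_; Dec; yes; no)
  open import Relation.Binary.PropositionalEquality as ≡ using (_≡_; _≢_)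
  import Relation.Binary.Reasoning.Setoid as SetoidReasoning

  parity : ∀ n → (∃ λ h → n ≡ h ℕ.+ h) ⊎ (∃ λ h → n ≡ suc (h ℕ.+ h))
  parity zero = inj₁ (0 , ≡.refl)
  parity (suc n) with parity n
  ... | inj₁ (h , e) = inj₂ (h , ≡.cong suc e)
  ... | inj₂ (h , e) = inj₁ (suc h , ≡.cong suc (≡.trans e (≡.sym (ℕₚ.+-suc h h))))

  odd≢even : ∀ a b → suc (a ℕ.+ a) ≢ b ℕ.+ b
  odd≢even zero (suc b) e = ℕₚ.1+n≢0 (≡.trans (≡.sym (ℕₚ.+-suc b b)) (≡.sym (ℕₚ.suc-injective e)))
  odd≢even (suc a) (suc b) e = odd≢even a b (ℕₚ.suc-injective (≡.trans (≡.cong suc (≡.sym (ℕₚ.+-suc a a))) (≡.trans (ℕₚ.suc-injective e) (ℕₚ.+-suc b b))))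

  double-injective : ∀ a b → a ℕ.+ a ≡ b ℕ.+ b → a ≡ b
  double-injective zero zero e = ≡.refl
  double-injective (suc a) (suc b) e = ≡.cong suc (double-injective a b (ℕₚ.suc-injective (≡.trans (≡.sym (ℕₚ.+-suc a a)) (≡.trans (ℕₚ.suc-injective e) (ℕₚ.+-suc b b)))))

  signℤ-+ : ∀ m n → signℤ (m ℕ.+ n) ≡ signℤ m ℤ.* signℤ n
  signℤ-+ zero n = ≡.sym (ℤₚ.*-identityˡ _)
  signℤ-+ (suc m) n = ≡.trans (≡.cong ℤ.-_ (signℤ-+ m n)) (ℤₚ.neg-distribˡ-* (signℤ m) (signℤ n))

  signℤ-square : ∀ n → signℤ n ℤ.* signℤ n ≡ ℤ.+ 1
  signℤ-square zero = ≡.refl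
  signℤ-square (suc n) = ≡.trans (≡.sym (ℤₚ.neg-distribˡ-* (signℤ n) _)) (≡.trans (≡.cong ℤ.-_ (≡.sym (ℤₚ.neg-distribʳ-* (signℤ n) (signℤ n)))) (≡.trans (ℤₚ.neg-involutive _) (signℤ-square n)))

  signℤ-unit : ∀ n → ℤ.∣ signℤ n ∣ ≡ 1
  signℤ-unit zero = ≡.refl
  signℤ-unit (suc n) = ≡.trans (ℤₚ.∣-i∣≡∣i∣ (signℤ n)) (signℤ-unit n)

  signℤ-double : ∀ h → signℤ (h ℕ.+ h) ≡ ℤ.+ 1
  signℤ-double h = ≡.trans (signℤ-+ h h) (signℤ-square h)

  Odd : ℕ → Set
  Odd k = ∃ λ h → k ≡ suc (h ℕ.+ h)

  module Liouville (K : FiniteField) (lam : OverField.Poly K → ℤ) (isL : OverField.IsLiouville K lam) where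
    open FieldTheory (BaseField.baseField K)
    private module K = FiniteField K

    opaque
      unfolding PolyTheory._*P_

      irreducible : ∀ {p} → Irr p → Irreducible p
      irreducible (nc , f) = nc , λ a b e → f a b (mk e)

    lam-cong : ∀ {p p'} → p ≋ p' → lam p ≡ lam p'
    lam-cong e = proj₁ isL _ _ (at e)

    lam-factored : ∀ {p} ps → All MonicIrr ps → p ≋ prodPoly ps → lam p ≡ signℤ (length ps)
    lam-factored ps irr e = ≡.trans (lam-cong (PR.trans e (PR.trans (PR.sym (PR.*-identityˡ _)) (PR.reflexive (≡.trans (≡.cong (1P *P_) (≡.sym (raw ps))) (≡.sym (raw-* 1P (prodP ps))))))))
      (proj₂ isL K.1# ps (λ e → K.0≢1 (≡.sym e)) (All.map (λ { ((j , l & d) , i) → (suc j , l , vanish d) , irreducible i }) irr))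
      where
        raw : ∀ ps → prodP ps ≡ prodPoly ps
        raw [] = ≡.refl
        raw (p ∷ ps) = ≡.trans (raw-* p (prodP ps)) (≡.cong (p *P_) (raw ps))

    lam-monic : ∀ {m p} → MonicDeg m p → ∃ λ r → lam p ≡ signℤ r
    lam-monic {p = p} mp = let ps , irr , e = factorisation p mp in length ps , lam-factored ps irr e

    -- `IsLiouville` prescribes values on factored polynomials, so multiplicativity is obtained by
    -- joining two factorisations.
    lam-* : ∀ {m n p p'} → MonicDeg m p → MonicDeg n p' → lam (p *P p') ≡ lam p ℤ.* lam p'
    lam-* {p = p} {p'} mp mp' =
      let ps , irr , e = factorisation p mp
          ps' , irr' , e' = factorisation p' mp'
      in ≡.trans (lam-factored (ps ++ ps') (Allₚ.++⁺ irr irr') (PR.trans (PR.*-cong e e') (PR.sym (prodPoly-++ ps ps'))))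
        (≡.trans (≡.cong signℤ (Listₚ.length-++ ps)) (≡.trans (signℤ-+ (length ps) (length ps')) (≡.sym (≡.cong₂ ℤ._*_ (lam-factored ps irr e) (lam-factored ps' irr' e')))))

  module QuadraticCharacter (K : FiniteField) where
    private module K = FiniteField K

    IsSquare : K.F → Set
    IsSquare a = Any (λ c → c K.* c ≡ a) K.elems

    isSquare? : ∀ a → Dec (IsSquare a)
    isSquare? a = Any.any? (λ c → BaseField._≟F_ K (c K.* c) a) K.elems

    -- The quadratic character, except that 0 counts as a square and gets the value 1; thus every
    -- value is a unit.
    quadraticSign : K.F → ℤ
    quadraticSign a with isSquare? a
    ... | yes _ = ℤ.+ 1
    ... | no _ = ℤ.- (ℤ.+ 1)

    quadraticSign-square : ∀ {a} → IsSquare a → quadraticSign a ≡ ℤ.+ 1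
    quadraticSign-square {a} s with isSquare? a
    ... | yes _ = ≡.refl
    ... | no ns = ⊥-elim (ns s)

    quadraticSign-nonsquare : ∀ {a} → ¬ IsSquare a → quadraticSign a ≡ ℤ.- (ℤ.+ 1)
    quadraticSign-nonsquare {a} ns with isSquare? a
    ... | yes s = ⊥-elim (ns s)
    ... | no _ = ≡.refl

    quadraticSign-unit : ∀ a → ℤ.∣ quadraticSign a ∣ ≡ 1
    quadraticSign-unit a with isSquare? a
    ... | yes _ = ≡.refl
    ... | no _ = ≡.refl

  module OrbitTheory (K : FiniteField) (E : FField) (ι : Hom (baseRing K) (FField.cring E)) (k : ℕ) (k-odd : Odd k) where
    open Galois K E ι public
    open QuadraticCharacter K
    private
      module FK = FieldTheory (BaseField.baseField K)
      module K = FiniteField K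
    open FField E using (cring; isDomain; inverse; _≟_; 1≉0)
    open CommutativeRing cring hiding (zero)
    open FieldTheory E
    open Solver cring
    open Determinant cring
    private module Mφ = MapPoly φ

    -- φ^k. When k is the period of α this generates the automorphisms over F_q(α), and so fixes
    -- f(α, y) and permutes its roots.
    ψ : Hom cring cring
    ψ = iterHom k

    module Ψ = Periods E ψ
    private module Mψ = MapPoly ψ

    ψ-iter : ∀ x → Hom.⟦_⟧ ψ x ≡ iter k x
    ψ-iter = iterHom-iter k

    Ψ-iter : ∀ m x → Ψ.iter m x ≡ iter (m ℕ.* k) x
    Ψ-iter zero x = ≡.refl
    Ψ-iter (suc m) x = ≡.trans (Ψ-iter m _) (≡.trans (≡.cong (iter (m ℕ.* k)) (ψ-iter x)) (≡.sym (iter-+ k (m ℕ.* k) x)))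

    -- A starting point of a ψ-orbit with its length. Multiplicities are allowed: one orbit may
    -- occur in several blocks.
    Block : Set
    Block = Σ Carrier λ β → ∃ λ m → Ψ.Period m β

    roots : List Block → List Carrier
    roots [] = []
    roots ((β , m , _) ∷ os) = Ψ.orb m β ++ roots os

    remove-root : ∀ bs x → evalP (prodLin bs) x ≈ 0# → ∃ λ bs' → prodLin bs ≋ lin x *P prodLin bs' × length bs ≡ suc (length bs')
    remove-root [] x r = ⊥-elim (1≉0 (trans (sym (eval-const 1# x)) r))
    remove-root (b ∷ bs) x r with IsDomain.noZeroDivisors isDomain (x - b) (evalP (prodLin bs) x) (trans (*-congʳ (sym (eval-lin b x))) (trans (sym (eval-* (lin b) (prodLin bs) x)) r))
    ... | inj₁ e = bs , PR.*-congʳ (lin-cong (sym (sub-zero e))) , ≡.refl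
    ... | inj₂ e with remove-root bs x e
    ...   | bs' , f , l = b ∷ bs' , PR.trans (PR.*-congˡ f) (PS.solve 3 (λ a b c → a PS.:* (b PS.:* c) PS.:= b PS.:* (a PS.:* c)) PR.refl (lin b) (lin x) (prodLin bs')) , ≡.cong suc l
      where module PS = Solver polyRing

    remove-roots : ∀ os bs → Distinct os → Roots (prodLin bs) os →
      ∃ λ bs' → prodLin bs ≋ prodLin os *P prodLin bs' × length bs ≡ length os ℕ.+ length bs'
    remove-roots [] bs _ _ = bs , PR.sym (PR.*-identityˡ _) , ≡.refl
    remove-roots (x ∷ os) bs (nx ∷ ds) (r ∷ rs) with remove-root bs x r
    ... | bs₁ , e , l with remove-roots os bs₁ ds (All.tabulate λ {y} y∈ → other (All.lookup nx y∈) (All.lookup rs y∈))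
      where
        other : ∀ {y} → ¬ x ≈ y → evalP (prodLin bs) y ≈ 0# → evalP (prodLin bs₁) y ≈ 0#
        other {y} ne ry with IsDomain.noZeroDivisors isDomain (evalP (lin x) y) (evalP (prodLin bs₁) y) (trans (sym (eval-* (lin x) _ y)) (trans (eval-cong (PR.sym e) refl) ry))
        ... | inj₁ z = ⊥-elim (eval-lin-nonzero ne z)
        ... | inj₂ z = z
    ... | bs' , e' , l' = bs' , PR.trans e (PR.trans (PR.*-congˡ e') (PR.sym (PR.*-assoc _ _ _))) , ≡.trans l (≡.cong suc l')

    -- Each root drags its whole ψ-orbit along; dividing that orbit off leaves a shorter product
    -- which is again fixed by ψ.
    decompose : ∀ bs → Ψ.Fixed (prodLin bs) → ∃ λ os → prodLin bs ≋ prodLin (roots os)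
    decompose bs fixed = go (length bs) bs ℕₚ.≤-refl fixed
      where
        go : ∀ N bs → length bs ℕ.≤ N → Ψ.Fixed (prodLin bs) → ∃ λ os → prodLin bs ≋ prodLin (roots os)
        go N [] _ _ = [] , PR.refl
        go (suc N) (b ∷ bs) (s≤s le) fixed =
          let m , per , _ = Ψ.root-period fixed (monic-nonzero (monicDeg-prodLin (b ∷ bs))) (degLt (monicDeg-prodLin (b ∷ bs))) root
              bs' , e , l = remove-roots (Ψ.orb m b) (b ∷ bs) (Ψ.period-distinct per) (Ψ.fixed-roots fixed m root)
              os , f = go N bs' (ℕₚ.≤-trans (ℕₚ.≤-pred (shorter m (Ψ.positive per) (≡.trans l (≡.cong (ℕ._+ length bs') (Ψ.length-orb m b))))) le)
                (Ψ.fixed-cofactor (monicDeg-prodLin (Ψ.orb m b)) (Ψ.orbit-fixed m (Ψ.returns per)) fixed e)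
          in (b , m , per) ∷ os , PR.trans e (PR.trans (PR.*-congˡ f) (PR.sym (prodLin-++ (Ψ.orb m b) (roots os))))
          where
            root : evalP (prodLin (b ∷ bs)) b ≈ 0#
            root = lin-root b _
            shorter : ∀ m {a b} → 0 ℕ.< m → a ≡ m ℕ.+ b → b ℕ.< a
            shorter (suc m) _ ≡.refl = s≤s (ℕₚ.m≤n+m _ m)

    -- The product of the first j Frobenius conjugates; with j = k it is the norm from F_q(α)[y] to
    -- F_q[y].
    norm : ℕ → Poly → Poly
    norm zero p = 1P
    norm (suc j) p = p *P norm j (Mφ.mapP p)

    norm-cong : ∀ j {p p'} → p ≋ p' → norm j p ≋ norm j p'
    norm-cong zero e = PR.refl
    norm-cong (suc j) e = PR.*-cong e (norm-cong j (Hom.⟦⟧-cong Mφ.polyHom e))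

    norm-* : ∀ j p p' → norm j (p *P p') ≋ norm j p *P norm j p'
    norm-* zero p p' = PR.sym (PR.*-identityˡ _)
    norm-* (suc j) p p' = PR.trans (PR.*-congˡ (PR.trans (norm-cong j (Mφ.mapP-* p p')) (norm-* j _ _)))
      (PS.solve 4 (λ a b c d → (a PS.:* b) PS.:* (c PS.:* d) PS.:= (a PS.:* c) PS.:* (b PS.:* d)) PR.refl p p' (norm j (Mφ.mapP p)) (norm j (Mφ.mapP p')))
      where module PS = Solver polyRing

    norm-1 : ∀ j → norm j 1P ≋ 1P
    norm-1 zero = PR.refl
    norm-1 (suc j) = PR.trans (PR.*-identityˡ _) (PR.trans (norm-cong j (Hom.1-homo Mφ.polyHom)) (norm-1 j))

    norm-lin : ∀ j β → norm j (lin β) ≋ prodLin (orb j β)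
    norm-lin zero β = PR.refl
    norm-lin (suc j) β = PR.*-congˡ (PR.trans (norm-cong j (Mφ.mapP-lin β)) (norm-lin j _))

    -- The conjugates under φ of the ψ-orbit of β, put end to end, run through β, φβ, ...,
    -- φ^(mk-1)β.
    norm-orb : ∀ m β → norm k (prodLin (Ψ.orb m β)) ≋ prodLin (orb (m ℕ.* k) β)
    norm-orb zero β = norm-1 k
    norm-orb (suc m) β = PR.trans (norm-* k (lin β) _) (PR.trans (PR.*-cong (norm-lin k β) (norm-orb m _))
      (PR.trans (PR.reflexive (≡.cong (λ x → prodLin (orb k β) *P prodLin (orb (m ℕ.* k) x)) (ψ-iter β)))
        (PR.trans (PR.sym (prodLin-++ (orb k β) _)) (PR.reflexive (≡.cong prodLin (≡.sym (orb-+ k (m ℕ.* k) β)))))))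

    power-orb : ∀ e {s β} M → MP.mapP M ≋ prodLin (orb s β) → iter s β ≈ β → MP.mapP (FK.prodPoly (replicate e M)) ≋ prodLin (orb (e ℕ.* s) β)
    power-orb zero M f r = Hom.1-homo MP.polyHom
    power-orb (suc e) {s} {β} M f r = PR.trans (MP.mapP-* M _) (PR.trans (PR.*-cong f (PR.trans (power-orb e M f r) (prodLin-cong (orb-cong (e ℕ.* s) (sym r)))))
      (PR.trans (PR.sym (prodLin-++ (orb s β) _)) (PR.reflexive (≡.cong prodLin (≡.sym (orb-+ s (e ℕ.* s) β))))))

    -- If the exponent were even then, k being odd, half of the block would already be a ψ-orbit.
    odd-exponent : ∀ {m s β} e → Ψ.Period m β → iter s β ≈ β → m ℕ.* k ≡ e ℕ.* s → Odd e
    odd-exponent {m} {s} {β} e per r eq with parity e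
    ... | inj₂ o = o
    ... | inj₁ (h , ≡.refl) with parity m
    ...   | inj₁ (zero , ≡.refl) = ⊥-elim (ℕₚ.<-irrefl ≡.refl (Ψ.positive per))
    ...   | inj₁ (suc m' , ≡.refl) = ⊥-elim (Ψ.minimal per (suc m') (s≤s z≤n) (s≤s (ℕₚ.m<m+n m' (s≤s z≤n)))
              (trans (reflexive (≡.trans (Ψ-iter (suc m') β) (≡.cong (λ t → iter t β) half))) (iter-multiple h r)))
      where
        half : suc m' ℕ.* k ≡ h ℕ.* s
        half = double-injective _ _ (≡.trans (≡.sym (ℕₚ.*-distribʳ-+ k (suc m') (suc m'))) (≡.trans eq (ℕₚ.*-distribʳ-+ s h h)))
    ...   | inj₂ (m' , ≡.refl) = ⊥-elim (odd≢even (m' ℕ.* k ℕ.+ k') (h ℕ.* s) (≡.trans (≡.trans (S.solve 3 (λ m k k' → S.con 1 S.:+ ((m S.:* k S.:+ k') S.:+ (m S.:* k S.:+ k')) S.:= (S.con 1 S.:+ (k' S.:+ k')) S.:+ (m S.:+ m) S.:* k) ≡.refl m' k k')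
              (≡.cong (ℕ._+ (m' ℕ.+ m') ℕ.* k) (≡.sym (proj₂ k-odd)))) (≡.trans eq (ℕₚ.*-distribʳ-+ s h h))))
      where
        k' = proj₁ k-odd
        module S = +-*-Solver

    k>0 : 0 ℕ.< k
    k>0 rewrite proj₂ k-odd = s≤s z≤n

    -- The norm of a ψ-orbit of length m is M^e', with M the minimal polynomial of the starting
    -- point over F_q, of degree s, and m k = e' s. Since e' is odd by `odd-exponent`, every block
    -- contributes the sign -1.
    block-factors : ∀ os → ∃ λ ps → All FK.MonicIrr ps × MP.mapP (FK.prodPoly ps) ≋ norm k (prodLin (roots os)) × signℤ (length ps) ≡ signℤ (length os)
    block-factors [] = [] , [] , PR.trans (Hom.1-homo MP.polyHom) (PR.sym (norm-1 k)) , ≡.refl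
    block-factors ((β , m , per) ∷ os) with block-factors os
    ... | ps , irr , e , sg with return-period (m ℕ.* k) β (ℕₚ.*-mono-≤ (Ψ.positive per) k>0) (trans (reflexive (≡.sym (Ψ-iter m β))) (Ψ.returns per))
    ...   | s , perφ , _ with period-divides (m ℕ.* k) perφ (trans (reflexive (≡.sym (Ψ-iter m β))) (Ψ.returns per))
    ...     | e' , eq = replicate e' M ++ ps , Allₚ.++⁺ (Allₚ.replicate⁺ e' (minPoly-irreducible perφ)) irr ,
        PR.trans (Hom.⟦⟧-cong MP.polyHom (FK.prodPoly-++ (replicate e' M) ps)) (PR.trans (MP.mapP-* _ _) (PR.trans (PR.*-cong (PR.trans (power-orb e' M (proj₂ (minPoly perφ)) (returns perφ))
          (PR.trans (PR.reflexive (≡.cong (λ t → prodLin (orb t β)) (≡.sym eq))) (PR.sym (norm-orb m β)))) e)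
          (PR.trans (PR.sym (norm-* k _ _)) (norm-cong k (PR.sym (prodLin-++ (Ψ.orb m β) (roots os))))))) ,
        ≡.trans (≡.cong signℤ (≡.trans (Listₚ.length-++ (replicate e' M)) (≡.cong (ℕ._+ length ps) (Listₚ.length-replicate e'))))
          (≡.trans (signℤ-+ e' (length ps)) (≡.trans (≡.cong₂ ℤ._*_ odd-sign sg) (ℤₚ.-1*i≡-i _)))
      where
        M = proj₁ (minPoly perφ)
        odd-sign : signℤ e' ≡ ℤ.- (ℤ.+ 1)
        odd-sign with odd-exponent e' per (returns perφ) eq
        ... | h , ≡.refl = ≡.cong ℤ.-_ (signℤ-double h)

    diffsTo-++ : ∀ x as bs → diffsTo x (as ++ bs) ≈ diffsTo x as * diffsTo x bs
    diffsTo-++ x [] bs = sym (*-identityˡ _)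
    diffsTo-++ x (a ∷ as) bs = trans (*-congˡ (diffsTo-++ x as bs)) (sym (*-assoc _ _ _))

    diffsTo-cong : ∀ {x y as bs} → x ≈ y → Pointwise _≈_ as bs → diffsTo x as ≈ diffsTo y bs
    diffsTo-cong e [] = refl
    diffsTo-cong e (f ∷ fs) = *-cong (+-cong f (-‿cong e)) (diffsTo-cong e fs)

    vandermonde-cong : ∀ {as bs} → Pointwise _≈_ as bs → vandermonde as ≈ vandermonde bs
    vandermonde-cong [] = refl
    vandermonde-cong (e ∷ es) = *-cong (diffsTo-cong e es) (vandermonde-cong es)

    cross : List Carrier → List Carrier → Carrier
    cross [] bs = 1#
    cross (a ∷ as) bs = diffsTo a bs * cross as bs

    vandermonde-++ : ∀ as bs → vandermonde (as ++ bs) ≈ (vandermonde as * vandermonde bs) * cross as bs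
    vandermonde-++ [] bs = sym (trans (*-identityʳ _) (*-identityˡ _))
    vandermonde-++ (a ∷ as) bs = trans (*-cong (diffsTo-++ a as bs) (vandermonde-++ as bs))
      (solve 5 (λ p q v w c → (p :* q) :* ((v :* w) :* c) := ((p :* v) :* w) :* (q :* c)) refl _ _ _ _ _)

    cross-snoc : ∀ as a bs → cross (as ++ [ a ]) bs ≈ diffsTo a bs * cross as bs
    cross-snoc [] a bs = refl
    cross-snoc (b ∷ as) a bs = trans (*-congˡ (cross-snoc as a bs)) (solve 3 (λ x y z → x :* (y :* z) := y :* (x :* z)) refl _ _ _)

    cross-cong : ∀ {as as' bs bs'} → Pointwise _≈_ as as' → (∀ x → diffsTo x bs ≈ diffsTo x bs') → cross as bs ≈ cross as' bs'
    cross-cong [] f = refl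
    cross-cong {bs = bs} (e ∷ es) f = *-cong (trans (diffsTo-cong {as = bs} {bs = bs} e (Pointwise.refl refl)) (f _)) (cross-cong {bs = bs} es f)

    -- Moving x from the end to the front reverses one difference for each element of xs.
    vandermonde-rotate : ∀ xs x → vandermonde (xs ++ [ x ]) ≈ sgn (length xs) * vandermonde (x ∷ xs)
    vandermonde-rotate [] x = sym (*-identityˡ _)
    vandermonde-rotate (y ∷ xs) x = trans (*-cong (diffsTo-++ y xs [ x ]) (vandermonde-rotate xs x))
      (trans (*-congʳ (*-congˡ (*-identityʳ _))) (solve 6 (λ d x y s e v → (d :* (x :- y)) :* (s :* (e :* v)) := (:- s) :* (((y :- x) :* e) :* (d :* v))) refl (diffsTo y xs) x y _ _ _))

    vandermonde-hom : ∀ xs → Hom.⟦_⟧ ψ (vandermonde xs) ≈ vandermonde (map (Hom.⟦_⟧ ψ) xs)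
    vandermonde-hom [] = Hom.1-homo ψ
    vandermonde-hom (x ∷ xs) = trans (Hom.*-homo ψ _ _) (*-cong (dh xs) (vandermonde-hom xs))
      where
        dh : ∀ xs → Hom.⟦_⟧ ψ (diffsTo x xs) ≈ diffsTo (Hom.⟦_⟧ ψ x) (map (Hom.⟦_⟧ ψ) xs)
        dh [] = Hom.1-homo ψ
        dh (y ∷ ys) = trans (Hom.*-homo ψ _ _) (*-cong (trans (Hom.+-homo ψ y (- x)) (+-congˡ (Hom.-‿homo ψ x))) (dh ys))

    -- A cycle of length m has sign (-1)^(m-1), so the parity of this sum is the sign of ψ as a
    -- permutation of the roots.
    excess : List Block → ℕ
    excess [] = 0
    excess ((β , m , _) ∷ os) = (m ℕ.∸ 1) ℕ.+ excess os

    excess-length : ∀ os → excess os ℕ.+ length os ≡ length (roots os)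
    excess-length [] = ≡.refl
    excess-length ((β , zero , per) ∷ os) = ⊥-elim (ℕₚ.<-irrefl ≡.refl (Ψ.positive per))
    excess-length ((β , suc m , per) ∷ os) = ≡.trans (≡.trans (ℕₚ.+-suc _ _) (≡.cong suc (≡.trans (ℕₚ.+-assoc m _ _) (≡.cong (m ℕ.+_) (excess-length os)))))
      (≡.sym (≡.trans (Listₚ.length-++ (Ψ.orb (suc m) β)) (≡.cong (ℕ._+ length (roots os)) (Ψ.length-orb (suc m) β))))

    private
      ψ⟦_⟧ : Carrier → Carrier
      ψ⟦_⟧ = Hom.⟦_⟧ ψ

      rotated : ∀ m β → Ψ.Period (suc m) β → Pointwise _≈_ (map ψ⟦_⟧ (Ψ.orb (suc m) β)) (Ψ.orb m ψ⟦ β ⟧ ++ [ β ])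
      rotated m β per = ≡.subst (λ l → Pointwise _≈_ l (Ψ.orb m ψ⟦ β ⟧ ++ [ β ])) (≡.sym (≡.trans (Ψ.map-orb (suc m) β) (Ψ.orb-snoc m ψ⟦ β ⟧)))
        (Pointwise.++⁺ (Pointwise.refl refl) (Ψ.returns per ∷ []))

      diffsTo-ψ : ∀ os x → diffsTo x (map ψ⟦_⟧ (roots os)) ≈ diffsTo x (roots os)
      diffsTo-ψ [] x = refl
      diffsTo-ψ ((β , zero , per) ∷ os) x = diffsTo-ψ os x
      diffsTo-ψ ((β , suc m , per) ∷ os) x = trans (reflexive (≡.cong (diffsTo x) (Listₚ.map-++ ψ⟦_⟧ (Ψ.orb (suc m) β) (roots os))))
        (trans (diffsTo-++ x (map ψ⟦_⟧ (Ψ.orb (suc m) β)) _) (trans (*-cong (trans (diffsTo-cong refl (rotated m β per))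
          (trans (diffsTo-++ x (Ψ.orb m ψ⟦ β ⟧) [ β ]) (trans (*-congˡ (*-identityʳ _)) (*-comm _ _)))) (diffsTo-ψ os x)) (sym (diffsTo-++ x (Ψ.orb (suc m) β) _))))

    -- ψ rotates each block, which costs (-1)^(m-1). The differences between two blocks are merely
    -- permuted, without change of sign.
    vandermonde-ψ : ∀ os → vandermonde (map ψ⟦_⟧ (roots os)) ≈ sgn (excess os) * vandermonde (roots os)
    vandermonde-ψ [] = sym (*-identityˡ _)
    vandermonde-ψ ((β , zero , per) ∷ os) = ⊥-elim (ℕₚ.<-irrefl ≡.refl (Ψ.positive per))
    vandermonde-ψ ((β , suc m , per) ∷ os) = begin
      vandermonde (map ψ⟦_⟧ (O ++ C)) ≈⟨ reflexive (≡.cong vandermonde (Listₚ.map-++ ψ⟦_⟧ O C)) ⟩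
      vandermonde (map ψ⟦_⟧ O ++ map ψ⟦_⟧ C) ≈⟨ vandermonde-++ (map ψ⟦_⟧ O) (map ψ⟦_⟧ C) ⟩
      (vandermonde (map ψ⟦_⟧ O) * vandermonde (map ψ⟦_⟧ C)) * cross (map ψ⟦_⟧ O) (map ψ⟦_⟧ C)
        ≈⟨ *-cong (*-cong vO (vandermonde-ψ os)) (trans (cross-cong {bs = map ψ⟦_⟧ C} (rotated m β per) (diffsTo-ψ os)) (cross-snoc (Ψ.orb m ψ⟦ β ⟧) β C)) ⟩
      ((sgn m * vandermonde O) * (sgn (excess os) * vandermonde C)) * cross O C
        ≈⟨ solve 5 (λ s v t w c → ((s :* v) :* (t :* w)) :* c := (s :* t) :* ((v :* w) :* c)) refl _ _ _ _ _ ⟩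
      (sgn m * sgn (excess os)) * ((vandermonde O * vandermonde C) * cross O C)
        ≈⟨ *-cong (sym (sgn-+ m (excess os))) (sym (vandermonde-++ O C)) ⟩
      sgn (m ℕ.+ excess os) * vandermonde (O ++ C) ∎
      where
        open SetoidReasoning setoid
        O = Ψ.orb (suc m) β
        C = roots os
        vO : vandermonde (map ψ⟦_⟧ O) ≈ sgn m * vandermonde O
        vO = trans (vandermonde-cong (rotated m β per)) (trans (vandermonde-rotate (Ψ.orb m ψ⟦ β ⟧) β) (*-congʳ (reflexive (≡.cong sgn (Ψ.length-orb m ψ⟦ β ⟧)))))

    -- Two equal entries produce a common root of the product and its derivative. Hence without
    -- double roots the Vandermonde product is invertible.
    vandermonde-zero : ∀ xs → vandermonde xs ≈ 0# → ∃ λ x → evalP (prodLin xs) x ≈ 0# × evalP (deriv (prodLin xs)) x ≈ 0#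
    vandermonde-zero [] z = ⊥-elim (1≉0 z)
    vandermonde-zero (x ∷ xs) z with IsDomain.noZeroDivisors isDomain _ _ z
    ... | inj₁ e = x , lin-root x _ ,
          trans (Discriminant.deriv-prodLin-head isDomain x xs) (trans (Discriminant.diffs-diffsTo isDomain x xs) (trans (*-congˡ e) (zeroʳ _)))
    ... | inj₂ e with vandermonde-zero xs e
    ...   | y , r , r' = y , trans (eval-* (lin x) _ y) (trans (*-congˡ r) (zeroʳ _)) , trans (Discriminant.deriv-prodLin-tail isDomain x xs y r) (trans (*-congˡ r') (zeroʳ _))

    open Discriminant isDomain using (discExp; discMonic-vandermonde)

    -- q · 1 = 0 with q = 2h + 1: if 2 were 0, so would be 1.
    two : (FiniteField.card K ℕ.% 2 ≡ 1) → ¬ 1# + 1# ≈ 0#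
    two odd e = 1≉0 (trans (sym (+-identityʳ 1#)) (trans (+-congˡ (sym (even h))) (trans (reflexive (≡.cong (λ m → natMul m 1#) (≡.sym qh))) char)))
      where
        h = q ℕ./ 2
        qh : q ≡ suc (h ℕ.+ h)
        qh = ≡.trans (DM.m≡m%n+[m/n]*n q 2) (≡.cong₂ ℕ._+_ odd (≡.trans (ℕₚ.*-comm h 2) (≡.cong (h ℕ.+_) (ℕₚ.+-identityʳ h))))
          where import Data.Nat.DivMod as DM
        even : ∀ h → natMul (h ℕ.+ h) 1# ≈ 0#
        even zero = refl
        even (suc h) = trans (reflexive (≡.cong (λ m → natMul (suc m) 1#) (ℕₚ.+-suc h h))) (trans (sym (+-assoc _ _ _)) (trans (+-cong e (even h)) (+-identityʳ 0#)))

    sgn-cases : ∀ t → (sgn t ≈ 1# × signℤ t ≡ ℤ.+ 1) ⊎ (sgn t ≈ - 1# × signℤ t ≡ ℤ.- (ℤ.+ 1))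
    sgn-cases zero = inj₁ (refl , ≡.refl)
    sgn-cases (suc t) with sgn-cases t
    ... | inj₁ (e , f) = inj₂ (-‿cong e , ≡.cong ℤ.-_ f)
    ... | inj₂ (e , f) = inj₁ (trans (-‿cong e) (solve 1 (λ a → :- (:- a) := a) refl 1#) , ≡.cong ℤ.-_ f)

    private
      ι⟦_⟧ : K.F → Carrier
      ι⟦_⟧ = Hom.⟦_⟧ ι

    -- A square root b of a ∈ F_q satisfies φ b = ± b, and ψ b = φ b because k is odd.
    ψ-sqrt : (FiniteField.card K ℕ.% 2 ≡ 1) → ∀ a b → ¬ b ≈ 0# → b * b ≈ ι⟦ a ⟧ →
      (ψ⟦ b ⟧ ≈ b × quadraticSign a ≡ ℤ.+ 1) ⊎ (ψ⟦ b ⟧ ≈ - b × quadraticSign a ≡ ℤ.- (ℤ.+ 1))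
    ψ-sqrt odd a b nb sq = [ (λ e → inj₁ (fixed (sub-zero e))) , (λ e → inj₂ (negated e)) ]′
      (IsDomain.noZeroDivisors isDomain (fr b - b) (fr b + b) (trans (difference-of-squares (fr b) b)
        (zero-sub (trans (sym (Hom.*-homo φ b b)) (trans (Hom.⟦⟧-cong φ sq) (trans (fr-ι a) (sym sq)))))))
      where
        difference-of-squares : ∀ x y → (x - y) * (x + y) ≈ x * x - y * y
        difference-of-squares = solve 2 (λ x y → (x :- y) :* (x :+ y) := x :* x :- y :* y) refl
        opposite : ∀ {x y} → x + y ≈ 0# → x ≈ - y
        opposite {x} {y} e = trans (solve 2 (λ x y → x := (x :+ y) :- y) refl x y) (trans (+-congʳ e) (+-identityˡ _))
        fixed : fr b ≈ b → ψ⟦ b ⟧ ≈ b × quadraticSign a ≡ ℤ.+ 1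
        fixed e = trans (reflexive (ψ-iter b)) (iter-fixed k e) ,
          (let c , ec = fr-fixed b e in quadraticSign-square (Any.map (λ { ≡.refl → ι-injective (trans (Hom.*-homo ι c c) (trans (*-cong ec ec) sq)) }) (K.elems-complete c)))
        negated : fr b + b ≈ 0# → ψ⟦ b ⟧ ≈ - b × quadraticSign a ≡ ℤ.- (ℤ.+ 1)
        negated e = trans (reflexive (ψ-iter b)) iterated , quadraticSign-nonsquare nonsquare
          where
            fb : fr b ≈ - b
            fb = opposite e
            twice : ∀ h → iter (h ℕ.+ h) b ≈ b
            twice zero = refl
            twice (suc h) = trans (reflexive (≡.cong (λ m → iter (suc m) b) (ℕₚ.+-suc h h)))
              (trans (iter-cong (h ℕ.+ h) (trans (Hom.⟦⟧-cong φ fb) (trans (Hom.-‿homo φ b) (trans (-‿cong fb) (solve 1 (λ a → :- (:- a) := a) refl b))))) (twice h))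
            iterated : iter k b ≈ - b
            iterated = trans (reflexive (≡.trans (≡.cong (λ m → iter m b) (proj₂ k-odd)) (iter-suc (proj₁ k-odd ℕ.+ proj₁ k-odd) b))) (trans (Hom.⟦⟧-cong φ (twice (proj₁ k-odd))) fb)
            not-fixed : ¬ fr b ≈ b
            not-fixed f = nonzero-* (two odd) nb (trans (solve 2 (λ o b → (o :+ o) :* b := o :* b :+ o :* b) refl 1# b) (trans (+-cong (*-identityˡ b) (*-identityˡ b)) (trans (+-congʳ (sym f)) e)))
            -- A square root c of a in F_q would give b = c or b = -c, and b would be fixed by
            -- Frobenius.
            nonsquare : ¬ IsSquare a
            nonsquare s = let c , cc = Any.satisfied s in
              [ (λ f → not-fixed (trans (Hom.⟦⟧-cong φ (sub-zero f)) (trans (fr-ι c) (sym (sub-zero f)))))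
              , (λ f → not-fixed (trans (Hom.⟦⟧-cong φ (opposite f)) (trans (Hom.-‿homo φ _) (trans (-‿cong (fr-ι c)) (sym (opposite f)))))) ]′
              (IsDomain.noZeroDivisors isDomain (b - ι⟦ c ⟧) (b + ι⟦ c ⟧) (trans (difference-of-squares b ι⟦ c ⟧) (zero-sub (trans sq (trans (Hom.⟦⟧-cong ι (≡.sym cc)) (Hom.*-homo ι c c))))))

    -- The square V² of the Vandermonde product is the discriminant up to a sign depending on n.
    -- Absorbing that sign into a makes V² equal to this constant times T².
    signedK : ℕ → K.F → K.F
    signedK n a = Determinant.sgn (baseRing K) (discExp n) K.* a

    private
      ι-sgn : ∀ t → ι⟦ Determinant.sgn (baseRing K) t ⟧ ≈ sgn t
      ι-sgn zero = Hom.1-homo ι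
      ι-sgn (suc t) = trans (Hom.-‿homo ι _) (-‿cong (ι-sgn t))

      sgn-square : ∀ t → sgn t * sgn t ≈ 1#
      sgn-square zero = *-identityˡ 1#
      sgn-square (suc t) = trans (solve 1 (λ a → (:- a) :* (:- a) := a :* a) refl (sgn t)) (sgn-square t)

    -- Two computations of ψV for the Vandermonde product V of the roots. As a permutation, ψ
    -- multiplies V by (-1)^excess. On the other hand V = b T with b² in F_q and ψT = T, so ψ
    -- multiplies V by the quadratic character of b². Since n is `excess` plus the number of blocks,
    -- the parity of the latter follows.
    block-sign : (FiniteField.card K ℕ.% 2 ≡ 1) → ∀ {n} g → MonicDeg n g →
      (∀ x → evalP g x ≈ 0# → ¬ evalP (deriv g) x ≈ 0#) →
      ∀ a T → ψ⟦ T ⟧ ≈ T → discMonic n g ≈ ι⟦ a ⟧ * (T * T) →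
      ∀ os → g ≋ prodLin (roots os) → signℤ (length os) ≡ signℤ n ℤ.* quadraticSign (signedK n a)
    block-sign odd {n} g mg simple a T ψT disc os ge = result
      where
        cs = roots os
        len : length cs ≡ n
        len = monicDeg-unique (monicDeg-prodLin cs) (monicDeg-cong ge mg)
        V = vandermonde cs
        nV : ¬ V ≈ 0#
        nV z = let x , r , r' = vandermonde-zero cs z in simple x (trans (eval-cong ge refl) r) (trans (eval-cong (deriv-cong ge) refl) r')
        w = discExp n
        a' = signedK n a
        VV : V * V ≈ ι⟦ a' ⟧ * (T * T)
        VV = begin
          V * V ≈⟨ sym (*-identityˡ _) ⟩
          1# * (V * V) ≈⟨ *-congʳ (sym (sgn-square w)) ⟩
          (sgn w * sgn w) * (V * V) ≈⟨ *-assoc _ _ _ ⟩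
          sgn w * (sgn w * (V * V)) ≈⟨ *-congˡ (trans (sym (≡.subst (λ m → discMonic m g ≈ sgn (discExp m) * (V * V)) len (discMonic-vandermonde g cs ge nV))) disc) ⟩
          sgn w * (ι⟦ a ⟧ * (T * T)) ≈⟨ sym (*-assoc _ _ _) ⟩
          (sgn w * ι⟦ a ⟧) * (T * T) ≈⟨ *-congʳ (sym (trans (Hom.*-homo ι _ a) (*-congʳ (ι-sgn w)))) ⟩
          ι⟦ a' ⟧ * (T * T) ∎
          where open SetoidReasoning setoid
        nT : ¬ T ≈ 0#
        nT z = nonzero-* nV nV (trans VV (trans (*-congˡ (trans (*-congʳ z) (zeroˡ T))) (zeroʳ _)))
        u = proj₁ (inverse T nT)
        Tu = proj₂ (inverse T nT)
        b = V * u
        bT : b * T ≈ V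
        bT = trans (*-assoc V u T) (trans (*-congˡ (trans (*-comm u T) Tu)) (*-identityʳ V))
        nb : ¬ b ≈ 0#
        nb z = nV (trans (sym bT) (trans (*-congʳ z) (zeroˡ T)))
        bb : b * b ≈ ι⟦ a' ⟧
        bb = trans (solve 2 (λ v u → (v :* u) :* (v :* u) := (v :* v) :* (u :* u)) refl V u) (trans (*-congʳ VV)
          (trans (solve 3 (λ a t u → (a :* (t :* t)) :* (u :* u) := a :* ((t :* u) :* (t :* u))) refl ι⟦ a' ⟧ T u) (trans (*-congˡ (trans (*-cong Tu Tu) (*-identityˡ 1#))) (*-identityʳ _))))
        ψV : ψ⟦ V ⟧ ≈ ψ⟦ b ⟧ * T
        ψV = trans (Hom.⟦⟧-cong ψ (sym bT)) (trans (Hom.*-homo ψ b T) (*-congˡ ψT))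
        ψV' : ψ⟦ V ⟧ ≈ sgn (excess os) * V
        ψV' = trans (vandermonde-hom cs) (vandermonde-ψ os)
        V≉-V : ¬ V ≈ - V
        V≉-V e = nonzero-* (two odd) nV (trans (solve 2 (λ o b → (o :+ o) :* b := o :* b :+ o :* b) refl 1# V) (trans (+-cong (*-identityˡ V) (*-identityˡ V)) (trans (+-congˡ e) (-‿inverseʳ V))))
        -1* : ∀ v → (- 1#) * v ≈ - v
        -1* v = trans (solve 2 (λ o v → (:- o) :* v := :- (o :* v)) refl 1# v) (-‿cong (*-identityˡ v))
        agree : (ψ⟦ b ⟧ ≈ b × quadraticSign a' ≡ ℤ.+ 1) ⊎ (ψ⟦ b ⟧ ≈ - b × quadraticSign a' ≡ ℤ.- (ℤ.+ 1)) →
          (sgn (excess os) ≈ 1# × signℤ (excess os) ≡ ℤ.+ 1) ⊎ (sgn (excess os) ≈ - 1# × signℤ (excess os) ≡ ℤ.- (ℤ.+ 1)) →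
          signℤ (excess os) ≡ quadraticSign a'
        agree (inj₁ (e , f)) (inj₁ (e' , f')) = ≡.trans f' (≡.sym f)
        agree (inj₂ (e , f)) (inj₂ (e' , f')) = ≡.trans f' (≡.sym f)
        -- If the two signs differed, V = -V would follow, which is impossible for V ≠ 0 and q odd.
        agree (inj₁ (e , f)) (inj₂ (e' , f')) = ⊥-elim (V≉-V (trans (sym bT) (trans (*-congʳ (sym e)) (trans (sym ψV) (trans ψV' (trans (*-congʳ e') (-1* V)))))))
        agree (inj₂ (e , f)) (inj₁ (e' , f')) = ⊥-elim (V≉-V (trans (sym (trans ψV' (trans (*-congʳ e') (*-identityˡ V)))) (trans ψV (trans (*-congʳ e) (trans (solve 2 (λ b t → (:- b) :* t := :- (b :* t)) refl b T) (-‿cong bT))))))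
        result : signℤ (length os) ≡ signℤ n ℤ.* quadraticSign a'
        -- The factor 1 = (-1)^excess (-1)^excess is inserted; one copy joins the number of blocks
        -- to make (-1)^n, the other becomes the character.
        result = ≡.trans (≡.sym (ℤₚ.*-identityˡ _)) (≡.trans (≡.cong (ℤ._* signℤ (length os)) (≡.sym (signℤ-square (excess os))))
          (≡.trans (ℤₚ.*-assoc (signℤ (excess os)) _ _) (≡.trans (ℤₚ.*-comm (signℤ (excess os)) _) (≡.cong₂ ℤ._*_
            (≡.trans (≡.sym (signℤ-+ (excess os) (length os))) (≡.cong signℤ (≡.trans (excess-length os) len))) (agree (ψ-sqrt odd a' b nb bb) (sgn-cases (excess os)))))))

    -- The number of ψ-orbits of roots links both halves: `block-factors` reads off λ of the norm
    -- from its parity, and `block-sign` determines that parity from the discriminant.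
    stickelberger : (FiniteField.card K ℕ.% 2 ≡ 1) → ∀ {n} g → MonicDeg n g → Splits E g → Ψ.Fixed g →
      (∀ x → evalP g x ≈ 0# → ¬ evalP (deriv g) x ≈ 0#) →
      ∀ a T → ψ⟦ T ⟧ ≈ T → discMonic n g ≈ ι⟦ a ⟧ * (T * T) →
      ∃ λ ps → All FK.MonicIrr ps × MP.mapP (FK.prodPoly ps) ≋ norm k g × signℤ (length ps) ≡ signℤ n ℤ.* quadraticSign (signedK n a)
    stickelberger odd g mg (bs , eb) fixed simple a T ψT disc =
      let os , eo = decompose bs (PR.trans (Hom.⟦⟧-cong Mψ.polyHom (PR.sym eb)) (PR.trans fixed eb))
          ps , irr , en , sg = block-factors os
          ge = PR.trans eb eo
      in ps , irr , PR.trans en (norm-cong k (PR.sym ge)) , ≡.trans sg (block-sign odd g mg simple a T ψT disc os ge)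

open StickelbergerTheorem

-- Elements of period 3^j, and separability of polynomials given by their roots.

module PeriodsAndSeparability where
  open import Algebra.Bundles using (CommutativeRing)
  open import Data.Nat as ℕ using (ℕ; zero; suc; z≤n; s≤s)
  import Data.Nat.Properties as ℕₚ
  open import Data.Nat.Divisibility as Div using (_∣_; divides)
  open import Data.Nat.Coprimality as Coprime using (Coprime)
  open import Data.Nat.Primality using (prime?; prime⇒irreducible)
  open import Data.Nat.Solver using (module +-*-Solver)
  open import Data.List using ([]; _∷_; map; length; _++_)
  import Data.List.Properties as Listₚ
  open import Data.List.Relation.Unary.All as All using (All; []; _∷_)
  open import Data.List.Relation.Unary.Any as Any using (Any; here; there)
  import Data.List.Relation.Unary.All.Properties as Allₚ
  open import Data.List.Relation.Unary.AllPairs using ([]; _∷_)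
  open import Data.List.Relation.Binary.Pointwise as Pointwise using (Pointwise; []; _∷_)
  open import Data.Product using (∃; _×_; _,_; proj₁; proj₂)
  open import Data.Sum using (_⊎_; inj₁; inj₂)
  open import Data.Empty using (⊥-elim)
  open import Relation.Nullary using (¬_; Dec; yes; no)
  open import Relation.Nullary.Decidable using (from-yes)
  open import Relation.Binary.PropositionalEquality as ≡ using (_≡_)

  odd-3^ : ∀ j → Odd (3 ℕ.^ j)
  odd-3^ zero = 0 , ≡.refl
  odd-3^ (suc j) with odd-3^ j
  ... | h , e = suc (h ℕ.+ h ℕ.+ h) , ≡.trans (≡.cong (3 ℕ.*_) e)
    (S.solve 1 (λ h → S.con 3 S.:* (S.con 1 S.:+ (h S.:+ h)) S.:= S.con 1 S.:+ ((S.con 1 S.:+ (h S.:+ h S.:+ h)) S.:+ (S.con 1 S.:+ (h S.:+ h S.:+ h)))) ≡.refl h)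
    where module S = +-*-Solver

  -- A proper divisor of 3^(j+1) already divides 3^j. To certify the period 3^(j+1), it is therefore
  -- enough that φ^(3^j) moves the element.
  divisor-3^ : ∀ j e s → e ℕ.* s ≡ 3 ℕ.^ suc j → s ≡ 3 ℕ.^ suc j ⊎ (∃ λ e' → e' ℕ.* s ≡ 3 ℕ.^ j)
  divisor-3^ j e s eq with 3 Div.∣? e
  ... | yes (divides e' ≡.refl) = inj₂ (e' , ℕₚ.*-cancelˡ-≡ _ _ 3 (≡.trans (≡.trans (≡.sym (ℕₚ.*-assoc 3 e' s)) (≡.cong (ℕ._* s) (ℕₚ.*-comm 3 e'))) eq))
  ... | no 3∤e = inj₁ (≡.trans (≡.sym (ℕₚ.*-identityˡ s)) (≡.trans (≡.cong (ℕ._* s) (≡.sym (unit (suc j) (divides s (≡.trans (≡.sym eq) (ℕₚ.*-comm e s)))))) eq))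
    where
      coprime : Coprime e 3
      coprime {d} (d∣e , d∣3) with prime⇒irreducible (from-yes (prime? 3)) d∣3
      ... | inj₁ d≡1 = d≡1
      ... | inj₂ ≡.refl = ⊥-elim (3∤e d∣e)
      unit : ∀ i → e ∣ 3 ℕ.^ i → e ≡ 1
      unit zero d = Div.∣1⇒≡1 d
      unit (suc i) d = unit i (Coprime.coprime-divisor coprime d)

  module PrimitiveElements (K : FiniteField) (E : FField) (ι : Hom (baseRing K) (FField.cring E)) where
    open Galois K E ι public
    open FField E using (cring; isDomain; inverse; _≟_; 1≉0)
    open CommutativeRing cring hiding (zero)
    open FieldTheory E
    open Determinant cring using (vandermonde; diffsTo)
    private module OT = OrbitTheory K E ι 1 (0 , ≡.refl)

    iter-pow : ∀ n x → iter n x ≈ pow x (q ℕ.^ n)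
    iter-pow zero x = sym (*-identityʳ x)
    iter-pow (suc n) x = trans (iter-pow n (fr x)) (trans (sym (pow-mul (q ℕ.^ n) q x)) (reflexive (≡.cong (pow x) (ℕₚ.*-comm (q ℕ.^ n) q))))

    1<q : 1 ℕ.< q
    1<q = BaseField.1<card K

    1<q^ : ∀ n → 0 ℕ.< n → 1 ℕ.< q ℕ.^ n
    1<q^ (suc n) _ = ℕₚ.≤-trans 1<q (≡.subst (ℕ._≤ q ℕ.^ suc n) (ℕₚ.*-identityʳ q) (ℕₚ.*-monoʳ-≤ q (ℕₚ.m^n>0 q {{ℕ.>-nonZero (ℕₚ.<⇒≤ 1<q)}} n)))

    root-XQ-X : ∀ n x → iter n x ≈ x → evalP (XQ-X (q ℕ.^ n)) x ≈ 0#
    root-XQ-X n x e = trans (eval-XQ-X (q ℕ.^ n) x) (zero-sub (trans (sym (iter-pow n x)) e))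

    returns-XQ-X : ∀ n x → evalP (XQ-X (q ℕ.^ n)) x ≈ 0# → iter n x ≈ x
    returns-XQ-X n x e = trans (iter-pow n x) (sub-zero (trans (sym (eval-XQ-X (q ℕ.^ n) x)) e))

    private
      natMul-q^ : ∀ n → 0 ℕ.< n → natMul (q ℕ.^ n) 1# ≈ 0#
      natMul-q^ (suc n) _ = trans (natMul-mul q (q ℕ.^ n) 1#) (trans (natMul-1 q _) (trans (*-congˡ char) (zeroʳ _)))

    -- The derivative is the constant -1, because q^n · 1 = 0.
    simple-XQ-X : ∀ n x → 0 ℕ.< n → ¬ evalP (deriv (XQ-X (q ℕ.^ n))) x ≈ 0#
    simple-XQ-X n x 0<n e = 1≉0 (trans (sym (trans (solve 1 (λ a → :- (:- a) := a) refl 1#) refl)) (trans (-‿cong (trans (sym value) e)) (trans (sym (+-identityˡ _)) (-‿inverseʳ 0#))))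
      where
        open Solver cring
        value : evalP (deriv (XQ-X (q ℕ.^ n))) x ≈ - 1#
        value = trans (eval-cong (deriv-+ (Xpow (q ℕ.^ n)) (-P Xpow 1)) refl) (trans (eval-+ _ _ x) (trans (+-cong (eval-cong (deriv-Xpow (q ℕ.^ n) (natMul-q^ n 0<n)) refl)
          (trans (eval-cong deriv-neg refl) (eval-const (- 1#) x))) (+-identityˡ _)))
          where
            coeffs : ∀ i → natMul (suc i) (coeff (suc i) (-P Xpow 1)) ≈ coeff i (constP (- 1#))
            coeffs zero = trans (+-identityʳ _) (coeff-neg 1 (Xpow 1))
            coeffs (suc i) = trans (natMul-cong (suc (suc i)) (vanish (degLt-neg (degLt (monicDeg-Xpow 1))) (suc (suc i)) (s≤s (s≤s z≤n)))) (natMul-0 (suc (suc i)))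
            deriv-neg : deriv (-P Xpow 1) ≋ constP (- 1#)
            deriv-neg = mk λ i → trans (coeff-deriv i (-P Xpow 1)) (coeffs i)

    vandermonde-distinct : ∀ xs → ¬ vandermonde xs ≈ 0# → Distinct xs
    vandermonde-distinct [] _ = []
    vandermonde-distinct (x ∷ xs) nz = go xs (λ z → nz (trans (*-congʳ z) (zeroˡ _))) ∷ vandermonde-distinct xs (λ z → nz (trans (*-congˡ z) (zeroʳ _)))
      where
        go : ∀ ys → ¬ diffsTo x ys ≈ 0# → All (λ y → ¬ x ≈ y) ys
        go [] _ = []
        go (y ∷ ys) n = (λ e → n (trans (*-congʳ (zero-sub (sym e))) (zeroˡ _))) ∷ go ys (λ z → n (trans (*-congˡ z) (zeroʳ _)))

    prodLin-member : ∀ zs {x} → evalP (prodLin zs) x ≈ 0# → Any (x ≈_) zs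
    prodLin-member [] {x} r = ⊥-elim (1≉0 (trans (sym (eval-const 1# x)) r))
    prodLin-member (z ∷ zs) {x} r with IsDomain.noZeroDivisors isDomain (x - z) (evalP (prodLin zs) x) (trans (*-congʳ (sym (eval-lin z x))) (trans (sym (eval-* (lin z) _ x)) r))
    ... | inj₁ e = here (sub-zero e)
    ... | inj₂ e = there (prodLin-member zs e)

    -- The roots of X^(q^n) - X are the elements of F_(q^n). There are exactly q^n of them, since a
    -- repetition would be a double root.
    fieldPoints : ∀ n → 0 ℕ.< n → Splits E (XQ-X (q ℕ.^ n)) → ∃ λ zs → length zs ≡ q ℕ.^ n × (∀ x → iter n x ≈ x → Any (x ≈_) zs) × Roots (XQ-X (q ℕ.^ n)) zs × Distinct zs
    fieldPoints n 0<n (zs , e) = zs , monicDeg-unique (monicDeg-prodLin zs) (monicDeg-cong e (monicDeg-XQ-X (q ℕ.^ n) (1<q^ n 0<n))) ,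
      (λ x r → prodLin-member zs (trans (eval-cong (PR.sym e) refl) (root-XQ-X n x r))) ,
      All.map (λ r → trans (eval-cong e refl) r) (Determinant.Resultant.prodLin-roots cring isDomain zs) ,
      vandermonde-distinct zs (λ z → let x , r , r' = OT.vandermonde-zero zs z in simple-XQ-X n x 0<n (trans (eval-cong (deriv-cong e) refl) r'))

    -- F_{q^(3^(j+1))} has more elements than F_{q^(3^j)}, and its elements outside the latter have period 3^(j+1).
    odd-period-element : ∀ j → Splits E (XQ-X (q ℕ.^ (3 ℕ.^ suc j))) → ∃ λ α → Period (3 ℕ.^ suc j) α
    odd-period-element j sp = choose (All.all? (λ z → iter m z ≟ z) zs)
      where
        n = 3 ℕ.^ suc j
        m = 3 ℕ.^ j
        0<m : 0 ℕ.< m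
        0<m = ℕₚ.m^n>0 3 j
        0<n : 0 ℕ.< n
        0<n = ℕₚ.m^n>0 3 (suc j)
        pts = fieldPoints n 0<n sp
        zs = proj₁ pts
        m<n : m ℕ.< n
        m<n = ℕₚ.m<m+n m (ℕₚ.≤-trans 0<m (ℕₚ.m≤m+n m _))
        absurd : ¬ All (λ z → iter m z ≈ z) zs
        absurd all = monic-nonzero (monicDeg-XQ-X (q ℕ.^ m) (1<q^ m 0<m)) (too-many-roots (XQ-X (q ℕ.^ m)) zs
          (degLt-mono (≡.subst (q ℕ.^ m ℕ.<_) (≡.sym (proj₁ (proj₂ pts))) (ℕₚ.^-monoʳ-< q 1<q m<n)) (degLt (monicDeg-XQ-X (q ℕ.^ m) (1<q^ m 0<m))))
          (proj₂ (proj₂ (proj₂ (proj₂ pts)))) (All.map (λ {z} → root-XQ-X m z) all))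
        finish : ∀ z → ¬ iter m z ≈ z → iter n z ≈ z → (∃ λ s → Period s z × s ℕ.≤ n) → Period n z
        finish z ne r (s , per , _) with period-divides n per r
        ... | e , eq with divisor-3^ j e s (≡.sym eq)
        ...   | inj₁ s≡n = ≡.subst (λ t → Period t z) s≡n per
        ...   | inj₂ (e' , eq') = ⊥-elim (ne (≡.subst (λ t → iter t z ≈ z) eq' (iter-multiple e' (returns per))))
        choose : Dec (All (λ z → iter m z ≈ z) zs) → ∃ λ α → Period n α
        choose (yes all) = ⊥-elim (absurd all)
        choose (no not) = go zs (proj₁ (proj₂ (proj₂ (proj₂ pts)))) not
          where
            go : ∀ zs → Roots (XQ-X (q ℕ.^ n)) zs → ¬ All (λ z → iter m z ≈ z) zs → ∃ λ α → Period n α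
            go [] _ na = ⊥-elim (na [])
            go (z ∷ zs) (r ∷ rs) na with iter m z ≟ z
            ... | yes e = go zs rs (λ a → na (e ∷ a))
            ... | no ne = z , finish z ne (returns-XQ-X n z r) (return-period n z 0<n (returns-XQ-X n z r))

  -- With C(Z) the polynomial whose roots are the values F'(r) at the roots r of F, the polynomial
  -- C(F'(T)) vanishes at all roots of F, and its constant term C(0) is nonzero.
  module Separability {A B : CR} {ι : Hom A B} {φ : Hom B B} (D : Descent ι φ) (dom : IsDomain B) where
    private
      module A = CommutativeRing A
      module PA = PolyTheory A
      module PPA = PolyTheory (A [X])
      module PPB = PolyTheory (B [X])
      module Mι = MapPoly ι
      module Mφ = MapPoly φ
      module MMι = MapPoly Mι.polyHom
      DP = polyDescent D
    open CommutativeRing B hiding (zero)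
    open PolyTheory B
    open DomainTheory B dom
    open Iterate φ
    open OrbitPoly φ
    open Determinant.Resultant B dom using (prodLin-roots)
    open Determinant.Discriminant B dom using (deriv-prodLin-head; deriv-prodLin-tail)

    diffs-nonzero : ∀ x ys → All (λ y → ¬ x ≈ y) ys → ¬ diffs x ys ≈ 0#
    diffs-nonzero x [] [] = IsDomain.1≉0 dom
    diffs-nonzero x (y ∷ ys) (n ∷ ns) = nonzero-* (λ z → n (sub-zero z)) (diffs-nonzero x ys ns)

    simple-roots : ∀ xs → Distinct xs → All (λ x → ¬ evalP (deriv (prodLin xs)) x ≈ 0#) xs
    simple-roots [] [] = []
    simple-roots (x ∷ xs) (n ∷ d) = (λ e → diffs-nonzero x xs n (trans (sym (deriv-prodLin-head x xs)) e)) ∷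
      tabulate₂ n (prodLin-roots xs) (simple-roots xs d)
      where
        tabulate₂ : ∀ {ys} → All (λ y → ¬ x ≈ y) ys → Roots (prodLin xs) ys → All (λ y → ¬ evalP (deriv (prodLin xs)) y ≈ 0#) ys → All (λ y → ¬ evalP (deriv (prodLin (x ∷ xs))) y ≈ 0#) ys
        tabulate₂ [] [] [] = []
        tabulate₂ (n ∷ ns) (r ∷ rs) (s ∷ ss) = (λ e → nonzero-* (λ z → n (sym (sub-zero z))) s (trans (sym (deriv-prodLin-tail x xs _ r)) e)) ∷ tabulate₂ ns rs ss

    separable : ∀ k₁ k₂ r₁ r₂ → iter k₁ r₁ ≈ r₁ → iter k₂ r₂ ≈ r₂ → Distinct (orb k₁ r₁ ++ orb k₂ r₂) →
      ∀ F → Mι.mapP F ≋ prodLin (orb k₁ r₁ ++ orb k₂ r₂) →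
      ∃ λ S → ∃ λ U → ∃ λ c → ¬ c A.≈ A.0# × S PA.*P F PA.+P U PA.*P PA.deriv F PA.≋ PA.constP c
    separable k₁ k₂ r₁ r₂ e₁ e₂ dist F eF = A' , PA.-P B' , c₀ , nonzero , conclusion
      where
        rs = orb k₁ r₁ ++ orb k₂ r₂
        F' = PA.deriv F
        v : Carrier → Carrier
        v r = evalP (Mι.mapP F') r
        v-φ : ∀ r → Hom.⟦_⟧ φ (v r) ≈ v (Hom.⟦_⟧ φ r)
        v-φ r = trans (Mφ.eval-map (Mι.mapP F') r) (eval-cong (Descent.invariant DP F') refl)
        v-cong : ∀ {r s} → r ≈ s → v r ≈ v s
        v-cong e = eval-cong {Mι.mapP F'} {Mι.mapP F'} PR.refl e
        iter-v : ∀ n r → iter n (v r) ≈ v (iter n r)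
        iter-v zero r = refl
        iter-v (suc n) r = trans (iter-cong n (v-φ r)) (iter-v n _)
        orb-v : ∀ n r → Pointwise _≈_ (map v (orb n r)) (orb n (v r))
        orb-v zero r = []
        orb-v (suc n) r = refl ∷ Pointwise.transitive trans (orb-v n _) (orb-cong n (sym (v-φ r)))
        -- Taking values under F' commutes with φ, so the values at the roots again form closed
        -- orbits; hence C is fixed and comes from `A`.
        C = prodLin (orb k₁ (v r₁) ++ orb k₂ (v r₂))
        C-fixed : Mφ.mapP C ≋ C
        C-fixed = PR.trans (Hom.⟦⟧-cong Mφ.polyHom (prodLin-++ (orb k₁ (v r₁)) _)) (PR.trans (Mφ.mapP-* _ _)
          (PR.trans (PR.*-cong (orbit-fixed k₁ (trans (iter-v k₁ r₁) (v-cong e₁))) (orbit-fixed k₂ (trans (iter-v k₂ r₂) (v-cong e₂)))) (PR.sym (prodLin-++ (orb k₁ (v r₁)) _))))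
        C-values : C ≋ prodLin (map v rs)
        C-values = PR.sym (PR.trans (PR.reflexive (≡.cong prodLin (Listₚ.map-++ v (orb k₁ r₁) (orb k₂ r₂)))) (prodLin-cong (Pointwise.++⁺ (orb-v k₁ r₁) (orb-v k₂ r₂))))
        C↓ = Descent.descend DP C C-fixed
        C' = proj₁ C↓
        eC : Mι.mapP C' ≋ C
        eC = proj₂ C↓
        constant : PA.Poly → A.Carrier
        constant [] = A.0#
        constant (a ∷ _) = a
        tail : PA.Poly → PA.Poly
        tail [] = []
        tail (_ ∷ p) = p
        constant-coeff : ∀ p → constant p A.≈ PA.coeff 0 p
        constant-coeff [] = A.refl
        constant-coeff (_ ∷ _) = A.refl
        c₀ = constant C'
        B' = PPA.evalP (map PA.constP (tail C')) F'
        W = PPA.evalP (map PA.constP C') F'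
        -- C'(F') is its constant term plus a multiple of F'; the multiplier gives the coefficient
        -- of F' in the Bezout identity.
        W-split : W PA.≋ PA.constP c₀ PA.+P F' PA.*P B'
        W-split = go C'
          where
            go : ∀ p → PPA.evalP (map PA.constP p) F' PA.≋ PA.constP (constant p) PA.+P F' PA.*P PPA.evalP (map PA.constP (tail p)) F'
            go [] = PA.PR.sym (PA.PR.trans (PA.PR.+-cong (PA.mk λ { zero → A.refl ; (suc i) → A.refl }) (PA.PR.zeroʳ F')) (PA.PR.+-identityʳ _))
            go (a ∷ p) = PA.PR.refl
        W-value : ∀ r → evalP (Mι.mapP W) r ≈ evalP C (v r)
        W-value r = trans (eval-cong (MMι.eval-map (map PA.constP C') F') refl)
          (trans (MapPoly.eval-map (evalHom r) (MMι.mapP (map PA.constP C')) (Mι.mapP F'))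
            (eval-cong (PR.trans (PR.reflexive (≡.trans (≡.cong (map (λ p → evalP p r)) (≡.sym (Listₚ.map-∘ C'))) (≡.sym (Listₚ.map-∘ C')))) (PR.trans (consts C') eC)) refl))
          where
            consts : ∀ p → map (λ a → evalP (Mι.mapP (PA.constP a)) r) p ≋ Mι.mapP p
            consts [] = PR.refl
            consts (a ∷ p) = ∷-cong (eval-const _ r) (consts p)
        W-roots : Roots (Mι.mapP W) rs
        W-roots = All.map (λ {r} z → trans (W-value r) (trans (eval-cong C-values refl) z)) (Allₚ.map⁻ (prodLin-roots (map v rs)))
        A↓E : ∃ λ k → Mι.mapP W ≋ prodLin rs *P k
        A↓E = distinct-roots (Mι.mapP W) rs dist W-roots
        -- F and W both come from `A`, so the quotient W / F is fixed as well and descends.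
        A-fixed : Mφ.mapP (proj₁ A↓E) ≋ proj₁ A↓E
        A-fixed = poly-cancelˡ (monicDeg-prodLin rs) (PR.trans (PR.*-congʳ (PR.trans (PR.sym eF) (PR.trans (PR.sym (Descent.invariant DP F)) (Hom.⟦⟧-cong Mφ.polyHom eF))))
          (PR.trans (PR.sym (Mφ.mapP-* _ _)) (PR.trans (Hom.⟦⟧-cong Mφ.polyHom (PR.sym (proj₂ A↓E))) (PR.trans (Descent.invariant DP W) (proj₂ A↓E)))))
        A↓ = Descent.descend DP (proj₁ A↓E) A-fixed
        A' = proj₁ A↓
        W-F : W PA.≋ F PA.*P A'
        W-F = Descent.injective DP (PR.trans (proj₂ A↓E) (PR.trans (PR.*-cong (PR.sym eF) (PR.sym (proj₂ A↓))) (PR.sym (Mι.mapP-* F A'))))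
        conclusion : A' PA.*P F PA.+P (PA.-P B') PA.*P F' PA.≋ PA.constP c₀
        conclusion = PA.PR.trans (PA.PR.+-congʳ (PA.PR.trans (PA.PR.*-comm A' F) (PA.PR.trans (PA.PR.sym W-F) W-split)))
          (S.solve 3 (λ c f b → (c S.:+ f S.:* b) S.:+ (S.:- b) S.:* f S.:= c) PA.PR.refl (PA.constP c₀) F' B')
          where module S = Solver (A [X])
        -- The constant term is the product of the -F'(r), and no F'(r) vanishes because the roots
        -- are distinct.
        nonzero : ¬ c₀ A.≈ A.0#
        nonzero z = all-nonzero (map v rs) (Allₚ.map⁺ (All.map (λ {r} ns z' → ns (trans (eval-cong (PR.trans (deriv-cong (PR.sym eF)) (PR.sym (Mι.mapP-deriv F))) refl) z')) (simple-roots rs dist)))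
          (trans (sym (trans (eval-prodLin (map v rs) 0#) refl)) (trans (eval-cong (PR.sym C-values) refl) (trans (eval-cong (PR.sym eC) refl) (trans (eval-0 (Mι.mapP C'))
            (trans (Mι.coeff-map 0 C') (trans (Hom.⟦⟧-cong ι (A.trans (A.sym (constant-coeff C')) z)) (Hom.0-homo ι)))))))
          where
            eval-0 : ∀ p → evalP p 0# ≈ coeff 0 p
            eval-0 [] = refl
            eval-0 (a ∷ p) = trans (+-congˡ (zeroˡ _)) (+-identityʳ a)
            all-nonzero : ∀ ys → All (λ y → ¬ y ≈ 0#) ys → ¬ diffs 0# ys ≈ 0#
            all-nonzero ys ns = diffs-nonzero 0# ys (All.map (λ n e → n (sym e)) ns)

open PeriodsAndSeparability

-- Specialisation at x = α and at y = β, and translations of the sample space.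

module Specialisation where
  open import Algebra.Bundles using (CommutativeRing)
  open import Data.Nat as ℕ using (ℕ; zero; suc; z≤n; s≤s)
  import Data.Nat.Properties as ℕₚ
  open import Data.Fin using (Fin; zero; suc; toℕ)
  open import Data.Vec as Vec using (Vec; []; _∷_; toList; updateAt)
  import Data.Vec.Properties as Vecₚ
  open import Data.List using (List; []; _∷_; map; _++_; [_])
  open import Data.List.Relation.Unary.All as All using (All; []; _∷_)
  open import Data.List.Relation.Unary.AllPairs using ([]; _∷_)
  open import Data.Product using (∃; _×_; _,_; proj₁)
  open import Data.Sum using (inj₁; inj₂)
  open import Data.Empty using (⊥-elim)
  open import Relation.Nullary using (¬_; Dec; yes; no)
  open import Relation.Binary.PropositionalEquality as ≡ using (_≡_)
  import Relation.Binary.Reasoning.Setoid as SetoidReasoning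

  module Spread (K : FiniteField) where
    open FiniteField K using (F; card; 0#; 1#)
    open FieldTheory (BaseField.baseField K)
    open BaseField K using (card·1; 1<card)

    -- v(y^q) for v ∈ F_q[y]
    spread : ∀ {m} → Vec F m → Poly
    spread [] = 0P
    spread (c ∷ v) = constP c +P Xpow card *P spread v

    spread-deg : ∀ {m} (v : Vec F m) → DegLt (suc (m ℕ.* card)) (spread v)
    spread-deg [] = dlt λ _ _ → ≡.refl
    spread-deg {suc m} (c ∷ v) = degLt-+ (degLt-mono (s≤s z≤n) (degLt-length (constP c))) (degLt-* (Xpow card) (spread v) (degLt (monicDeg-Xpow card)) (spread-deg v))

    spread-deriv : ∀ {m} (v : Vec F m) → deriv (spread v) ≋ 0P
    spread-deriv [] = PR.refl
    spread-deriv (c ∷ v) = PR.trans (deriv-+ (constP c) _) (PR.trans (PR.+-congˡ (PR.trans (deriv-* (Xpow card) (spread v))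
      (PR.trans (PR.+-cong (PR.trans (PR.*-congʳ (deriv-Xpow card card·1)) (PR.zeroˡ _)) (PR.trans (PR.*-congˡ (spread-deriv v)) (PR.zeroʳ _))) (PR.+-identityʳ _)))) (PR.+-identityʳ _))

    spread-injective : ∀ {m} (v w : Vec F m) → spread v ≋ spread w → v ≡ w
    spread-injective [] [] _ = ≡.refl
    spread-injective (c ∷ v) (c' ∷ w) e = ≡.cong₂ _∷_ c≡c' (spread-injective v w (poly-cancelˡ (monicDeg-Xpow card) (cancel c≡c' e)))
      where
        low : ∀ n p → 0 ℕ.< n → coeff 0 (Xpow n *P p) ≡ 0#
        low (suc n) p _ = at (shift* (Xpow n) p) 0
        first : ∀ c (p : Poly) → coeff 0 (constP c +P Xpow card *P p) ≡ c
        first c p = ≡.trans (coeff-+ 0 (constP c) _) (≡.trans (≡.cong (FiniteField._+_ K c) (low card p (ℕₚ.<⇒≤ 1<card))) (CommutativeRing.+-identityʳ (baseRing K) c))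
        c≡c' : c ≡ c'
        c≡c' = ≡.trans (≡.sym (first c (spread v))) (≡.trans (at e 0) (first c' (spread w)))
        cancel : c ≡ c' → constP c +P Xpow card *P spread v ≋ constP c' +P Xpow card *P spread w → Xpow card *P spread v ≋ Xpow card *P spread w
        cancel ≡.refl e = PR.trans (PS.solve 2 (λ a b → b PS.:= (PS.:- a) PS.:+ (a PS.:+ b)) PR.refl (constP c) _) (PR.trans (PR.+-congˡ e) (PS.solve 2 (λ a b → (PS.:- a) PS.:+ (a PS.:+ b) PS.:= b) PR.refl (constP c) _))
          where module PS = Solver polyRing

    toList-injective : ∀ {m} (v w : Vec F m) → toList v ≋ toList w → v ≡ w
    toList-injective [] [] _ = ≡.refl
    toList-injective (c ∷ v) (c' ∷ w) e = ≡.cong₂ _∷_ (at e 0) (toList-injective v w (mk λ i → at e (suc i)))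

    toList-deg : ∀ {m} (v : Vec F m) → DegLt m (toList v)
    toList-deg {m} v = ≡.subst (λ k → DegLt k (toList v)) (Vecₚ.length-toList v) (degLt-length (toList v))

  module Columns (K : FiniteField) (d : ℕ) where
    open FiniteField K using (F; 0#; 1#; _+_; -_)
    open OverField K using (Outcome)
    private module R = CommutativeRing (baseRing K)

    -- Adds x^j Σ c_i y^i to f. These translations of the sample space preserve the uniform
    -- distribution, and every rare event is bounded on their orbits.
    addCol : ∀ {n} → Fin (suc d) → (ℕ → F) → Outcome d n → Outcome d n
    addCol j c [] = []
    addCol j c (a ∷ as) = updateAt a j (_+ c 0) ∷ addCol j (λ i → c (suc i)) as

    private
      update-cancel : ∀ {m} (a : Vec F m) j x y → y + x ≡ 0# → updateAt (updateAt a j (_+ y)) j (_+ x) ≡ a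
      update-cancel (c ∷ a) zero x y e = ≡.cong (_∷ a) (≡.trans (R.+-assoc c y x) (≡.trans (≡.cong (c +_) e) (R.+-identityʳ c)))
      update-cancel (c ∷ a) (suc j) x y e = ≡.cong (c ∷_) (update-cancel a j x y e)

    addCol-cancel : ∀ {n} j c (as : Outcome d n) → addCol j c (addCol j (λ i → - c i) as) ≡ as
    addCol-cancel j c [] = ≡.refl
    addCol-cancel j c (a ∷ as) = ≡.cong₂ _∷_ (update-cancel a j (c 0) (- c 0) (R.-‿inverseˡ (c 0))) (addCol-cancel j (λ i → c (suc i)) as)

    column₀ : ∀ {n} → Outcome d n → Vec F n
    column₀ = Vec.map Vec.head

    f₀ : ∀ {n} → Outcome d n → OverField.Poly K
    f₀ as = toList (column₀ as) ++ [ 1# ]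

    column₀-addCol : ∀ {n} (v w : Vec F n) (as : Outcome d n) →
      column₀ (addCol zero (λ i → OverField.coeff K i (toList v)) as) ≡ column₀ (addCol zero (λ i → OverField.coeff K i (toList w)) as) → v ≡ w
    column₀-addCol [] [] [] e = ≡.refl
    column₀-addCol (x ∷ v) (y ∷ w) ((c ∷ a) ∷ as) e = ≡.cong₂ _∷_ (add-cancel (Vecₚ.∷-injectiveˡ e)) (column₀-addCol v w as (Vecₚ.∷-injectiveʳ e))
      where
        add-cancel : c + x ≡ c + y → x ≡ y
        add-cancel e = ≡.trans (un x) (≡.trans (≡.cong ((- c) +_) e) (≡.sym (un y)))
          where
            un : ∀ x → x ≡ (- c) + (c + x)
            un x = ≡.sym (≡.trans (≡.sym (R.+-assoc _ _ _)) (≡.trans (≡.cong (_+ x) (R.-‿inverseˡ c)) (R.+-identityˡ x)))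

  module Specialise (K : FiniteField) (E : FField) (ι : Hom (baseRing K) (FField.cring E)) (d : ℕ) where
    open PrimitiveElements K E ι public
    open Spread K public
    open Columns K d public
    private
      module FK = FieldTheory (BaseField.baseField K)
      module K = FiniteField K
      module O = OverField K
    open O using (Outcome; fPoly)
    open FField E using (cring; isDomain; inverse; _≟_; 1≉0)
    open CommutativeRing cring hiding (zero)
    open FieldTheory E
    open Solver cring
    private
      module PS = Solver polyRing
      ι⟦_⟧ : K.F → Carrier
      ι⟦_⟧ = Hom.⟦_⟧ ι

    at-x : Carrier → FK.Poly → Carrier
    at-x α a = evalP (MP.mapP a) α

    spec : Carrier → List FK.Poly → Poly
    spec α = map (at-x α)

    g : ∀ {n} → Carrier → Outcome d n → Poly
    g α as = spec α (fPoly as)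

    private
      at-x-+ : ∀ α a b → at-x α (a FK.+ᴿ b) ≈ at-x α a + at-x α b
      at-x-+ α a b = trans (reflexive (≡.cong (at-x α) (FK.raw-+ a b))) (trans (eval-cong (MP.mapP-+ a b) refl) (eval-+ (MP.mapP a) _ α))
      at-x-* : ∀ α a b → at-x α (a FK.*ᴿ b) ≈ at-x α a * at-x α b
      at-x-* α a b = trans (reflexive (≡.cong (at-x α) (FK.raw-* a b))) (trans (eval-cong (MP.mapP-* a b) refl) (eval-* (MP.mapP a) _ α))
      at-x-neg : ∀ α a → at-x α (FK.-ᴿ a) ≈ - at-x α a
      at-x-neg α a = trans (reflexive (≡.cong (at-x α) (FK.raw-neg a))) (trans (eval-cong (Hom.-‿homo MP.polyHom a) refl) (Hom.-‿homo (evalHom α) (MP.mapP a)))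
      at-x-1 : ∀ α → at-x α FK.1P ≈ 1#
      at-x-1 α = trans (eval-const _ α) (Hom.1-homo ι)

    -- The discriminant is a polynomial expression in the coefficients, so it commutes with x ↦ α.
    disc-spec : ∀ n α f → at-x α (O.P2.discMonic n f) ≈ discMonic n (spec α f)
    disc-spec n α f = RawHom.discMonic-h (PolyRaw (FiniteField.raw K)) cring (at-x α) refl (at-x-1 α) (at-x-+ α) (at-x-* α) (at-x-neg α) n f

    disc-square : ∀ n α f → O.DiscSquareClass n f → ∃ λ a → ∃ λ t → discMonic n (spec α f) ≈ ι⟦ a ⟧ * (at-x α t * at-x α t)
    disc-square n α f (a , t , e) = a , t , trans (sym (disc-spec n α f)) (trans (eval-cong (Hom.⟦⟧-cong MP.polyHom e') refl)
      (trans (at-x-* α (FK.constP a) (t FK.*ᴿ t)) (*-cong (eval-const _ α) (at-x-* α t t))))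
      where
        e' : O.P2.discMonic n f FK.≋ FK.constP a FK.*ᴿ (t FK.*ᴿ t)
        e' = FK.mk e

    g-monic : ∀ {n} α (as : Outcome d n) → MonicDeg n (g α as)
    g-monic α [] = at-x-1 α & dlt λ { (suc i) _ → refl }
    g-monic α (a ∷ as) with g-monic α as
    ... | l & dlt v = l & dlt λ { (suc i) (s≤s le) → v i le }

    at-x-cong : ∀ {α α'} a → α ≈ α' → at-x α a ≈ at-x α' a
    at-x-cong a e = eval-cong {MP.mapP a} {MP.mapP a} PR.refl e

    spec-cong : ∀ {α α'} f → α ≈ α' → spec α f ≋ spec α' f
    spec-cong [] e = PR.refl
    spec-cong (a ∷ f) e = ∷-cong (at-x-cong a e) (spec-cong f e)

    module _ (σ : Hom cring cring) (σι : ∀ a → Hom.⟦_⟧ σ ι⟦ a ⟧ ≈ ι⟦ a ⟧) where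
      private module Mσ = MapPoly σ

      mapP-invariant : ∀ p → Mσ.mapP (MP.mapP p) ≋ MP.mapP p
      mapP-invariant [] = PR.refl
      mapP-invariant (a ∷ p) = ∷-cong (σι a) (mapP-invariant p)

      at-x-σ : ∀ α a → Hom.⟦_⟧ σ (at-x α a) ≈ at-x (Hom.⟦_⟧ σ α) a
      at-x-σ α a = trans (Mσ.eval-map (MP.mapP a) α) (eval-cong (mapP-invariant a) refl)

      spec-σ : ∀ α f → Mσ.mapP (spec α f) ≋ spec (Hom.⟦_⟧ σ α) f
      spec-σ α [] = PR.refl
      spec-σ α (a ∷ f) = ∷-cong (at-x-σ α a) (spec-σ α f)

    iterHom-ι : ∀ s a → Hom.⟦_⟧ (iterHom s) ι⟦ a ⟧ ≈ ι⟦ a ⟧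
    iterHom-ι s a = trans (reflexive (iterHom-iter s _)) (iter-fixed s (fr-ι a))

    -- f(x, β) as a polynomial in x; its coefficients are the f_j(β).
    at-y : Carrier → List FK.Poly → Poly
    at-y β [] = 0P
    at-y β (a ∷ f) = MP.mapP a +P constP β *P at-y β f

    at-y-coeff : ∀ β j f → coeff j (at-y β f) ≈ evalP (MP.mapP (map (FK.coeff j) f)) β
    at-y-coeff β j [] = refl
    at-y-coeff β j (a ∷ f) = trans (coeff-+ j (MP.mapP a) _) (+-cong (MP.coeff-map j a) (trans (coeff-const* j β _) (*-congˡ (at-y-coeff β j f))))

    at-y-eval : ∀ α β f → evalP (at-y β f) α ≈ evalP (spec α f) β
    at-y-eval α β [] = refl
    at-y-eval α β (a ∷ f) = trans (eval-+ (MP.mapP a) _ α) (+-congˡ (trans (eval-* (constP β) _ α) (*-cong (eval-const β α) (at-y-eval α β f))))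

    at-y-deg : ∀ β {J} f → All (FK.DegLt (suc J)) f → DegLt (suc J) (at-y β f)
    at-y-deg β [] [] = dlt λ _ _ → refl
    at-y-deg β (a ∷ f) (da ∷ df) = degLt-+ (MP.mapP-degLt da) (degLt-* (constP β) _ (degLt-length (constP β)) (at-y-deg β f df))

    at-y-σ : ∀ s {β} → iter s β ≈ β → ∀ f → MapPoly.mapP (iterHom s) (at-y β f) ≋ at-y β f
    at-y-σ s r [] = PR.refl
    at-y-σ s {β} r (a ∷ f) = PR.trans (Mσ.mapP-+ (MP.mapP a) _) (PR.+-cong (mapP-invariant (iterHom s) (iterHom-ι s) a)
      (PR.trans (Mσ.mapP-* (constP β) _) (PR.*-cong (∷-cong (trans (reflexive (iterHom-iter s β)) r) PR.refl) (at-y-σ s r f))))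
      where module Mσ = MapPoly (iterHom s)

    fPoly-deg : ∀ {n} (as : Outcome d n) → All (FK.DegLt (suc d)) (fPoly as)
    fPoly-deg [] = FK.degLt-mono (s≤s z≤n) (FK.degLt-length FK.1P) ∷ []
    fPoly-deg (a ∷ as) = toList-deg a ∷ fPoly-deg as

    -- The powers of α up to α^d are independent over F_q(β) unless s d ≥ k.
    content-period : ∀ {n} (as : Outcome d n) → O.ContentOne (fPoly as) → ∀ {s β k α} → Period s β → Period k α →
      evalP (g α as) β ≈ 0# → k ℕ.≤ s ℕ.* d
    content-period as content {s} {β} {k} {α} perβ perα root = decide (isZero? (at-y β f))
      where
        f = fPoly as
        module Σs = Periods E (iterHom s)
        Σs-iter : ∀ t x → Σs.iter t x ≡ iter (t ℕ.* s) x
        Σs-iter zero x = ≡.refl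
        Σs-iter (suc t) x = ≡.trans (Σs-iter t _) (≡.trans (≡.cong (iter (t ℕ.* s)) (iterHom-iter s x)) (≡.sym (iter-+ s (t ℕ.* s) x)))
        M = proj₁ (minPoly perβ)
        decide : Dec (IsZeroP (at-y β f)) → k ℕ.≤ s ℕ.* d
        -- If f(x, β) = 0 identically, all f_j vanish at β, and the minimal polynomial of β divides
        -- the content.
        decide (yes z) = ⊥-elim (not-const (content M (λ j → divides j)))
          where
            divides : ∀ j → O.Divides M (map (FK.coeff j) f)
            divides j = let c , e = minPoly-divides perβ (map (FK.coeff j) f) (trans (sym (at-y-coeff β j f)) (z j))
              in c , λ i → ≡.trans (≡.cong (FK.coeff i) (FK.raw-* M c)) (≡.sym (FK.at e i))
            not-const : ¬ FK.IsConstP M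
            not-const c = K.0≢1 (≡.trans (≡.sym (≡.trans (≡.cong (λ t → FK.coeff t M) (≡.sym suc-pred)) (c (ℕ.pred s)))) (FK.lead (minPoly-monic perβ)))
              where
                suc-pred : suc (ℕ.pred s) ≡ s
                suc-pred = ℕₚ.suc-pred s {{ℕ.>-nonZero (positive perβ)}}
        -- Otherwise α is a root of a nonzero polynomial of degree at most d fixed by φ^s, so it
        -- returns after t ≤ d steps of φ^s, that is, after t s steps of φ.
        decide (no nz) = bound (Σs.root-period (at-y-σ s (returns perβ) f) (λ e → nz (at e)) (at-y-deg β f (fPoly-deg as)) (trans (at-y-eval α β f) root))
          where
            bound : (∃ λ t → Σs.Period t α × t ℕ.≤ d) → k ℕ.≤ s ℕ.* d
            bound (t , per , t≤d) with k ℕ.≤? s ℕ.* d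
            ... | yes le = le
            ... | no gt = ⊥-elim (minimal perα (t ℕ.* s) (ℕₚ.*-mono-≤ (Σs.positive per) (positive perβ))
                    (ℕₚ.≤-<-trans (≡.subst (t ℕ.* s ℕ.≤_) (ℕₚ.*-comm d s) (ℕₚ.*-monoˡ-≤ s t≤d)) (ℕₚ.≰⇒> gt))
                    (trans (reflexive (≡.sym (Σs-iter t α))) (Σs.returns per)))

    update-spec : ∀ {m} α (a : Vec K.F m) j x → at-x α (toList (updateAt a j (K._+ x))) ≈ at-x α (toList a) + pow α (toℕ j) * ι⟦ x ⟧
    update-spec α (c ∷ a) zero x = trans (+-congʳ (Hom.+-homo ι c x)) (trans (solve 3 (λ c x r → (c :+ x) :+ r := (c :+ r) :+ x) refl _ _ _) (+-congˡ (sym (*-identityˡ _))))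
    update-spec α (c ∷ a) (suc j) x = trans (+-congˡ (*-congˡ (update-spec α a j x)))
      (solve 5 (λ c α r p x → c :+ α :* (r :+ p :* x) := (c :+ α :* r) :+ (α :* p) :* x) refl ι⟦ c ⟧ α _ _ ι⟦ x ⟧)

    coeffs : FK.Poly → ℕ → K.F
    coeffs p i = FK.coeff i p

    g-addCol : ∀ {n} α j p (as : Outcome d n) → FK.DegLt n p → g α (addCol j (coeffs p) as) ≋ g α as +P constP (pow α (toℕ j)) *P MP.mapP p
    g-addCol α j p as (FK.dlt v) = mk λ i → trans (go (coeffs p) as v i) (sym (trans (coeff-+ i (g α as) _) (+-congˡ (trans (coeff-const* i (pow α (toℕ j)) _) (*-congˡ (MP.coeff-map i p))))))
      where
        go : ∀ {n} c (as : Outcome d n) → (∀ i → n ℕ.≤ i → c i ≡ K.0#) → ∀ i → coeff i (g α (addCol j c as)) ≈ coeff i (g α as) + pow α (toℕ j) * ι⟦ c i ⟧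
        go c [] z i = sym (trans (+-congˡ (trans (*-congˡ (trans (Hom.⟦⟧-cong ι (z i z≤n)) (Hom.0-homo ι))) (zeroʳ _))) (+-identityʳ _))
        go c (a ∷ as) z zero = update-spec α a j (c 0)
        go c (a ∷ as) z (suc i) = go (λ i → c (suc i)) as (λ i le → z (suc i) (s≤s le)) i

    g-addCol₀ : ∀ {n} α p (as : Outcome d n) → FK.DegLt n p → g α (addCol zero (coeffs p) as) ≋ g α as +P MP.mapP p
    g-addCol₀ α p as dp = PR.trans (g-addCol α zero p as dp) (PR.+-congˡ (PR.*-identityˡ _))

    mapP-difference : ∀ p p' → MP.mapP (p FK.+P FK.-P p') ≋ MP.mapP p +P -P MP.mapP p'
    mapP-difference p p' = PR.trans (MP.mapP-+ p _) (PR.+-congˡ (Hom.-‿homo MP.polyHom p'))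

    private
      eval-difference : ∀ a b c x → evalP (c +P a) x ≈ 0# → evalP (c +P b) x ≈ 0# → evalP (a +P -P b) x ≈ 0#
      eval-difference a b c x ea eb = trans (eval-cong (PS.solve 3 (λ a b c → a PS.:- b PS.:= (c PS.:+ a) PS.:- (c PS.:+ b)) PR.refl a b c) refl)
        (trans (eval-+ (c +P a) _ x) (trans (+-cong ea (trans (Hom.-‿homo (evalHom x) (c +P b)) (-‿cong eb))) (-‿inverseʳ 0#)))

      deriv-neg : ∀ p → deriv (-P p) ≋ -P deriv p
      deriv-neg p = mk λ i → trans (coeff-deriv i (-P p)) (trans (natMul-cong (suc i) (coeff-neg (suc i) p)) (trans (neg (suc i)) (sym (trans (coeff-neg i (deriv p)) (-‿cong (coeff-deriv i p))))))
        where
          neg : ∀ n {a} → natMul n (- a) ≈ - natMul n a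
          neg zero = sym (trans (sym (+-identityˡ _)) (-‿inverseʳ 0#))
          neg (suc n) {a} = trans (+-congˡ (neg n)) (solve 2 (λ a b → (:- a) :+ (:- b) := :- (a :+ b)) refl a _)

    equal-of-difference : ∀ p p' → MP.mapP (p FK.+P FK.-P p') ≋ 0P → p FK.≋ p'
    equal-of-difference p p' e = Descent.injective descentP (PR.trans (PS.solve 2 (λ a b → a PS.:= (a PS.:- b) PS.:+ b) PR.refl (MP.mapP p) (MP.mapP p'))
      (PR.trans (PR.+-congʳ (PR.trans (PR.sym (mapP-difference p p')) e)) (PR.+-identityˡ _)))

    -- M is separable, so a double root at β makes M² divide p, where M is the minimal polynomial of
    -- β; but M² has degree 2s.
    double-root-zero : ∀ {s β} → Period s β → ∀ p → Fixed p → DegLt (s ℕ.+ s) p → evalP p β ≈ 0# → evalP (deriv p) β ≈ 0# → p ≋ 0P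
    double-root-zero {s} {β} per p fp dp r r' =
      let k₁ , e₁ = conjugates-factor per p fp r
          f₁ = fixed-cofactor mM (orbit-fixed s (returns per)) fp e₁
          k₂ , e₂ = conjugates-factor per k₁ f₁ (root₁ k₁ e₁)
          e = PR.trans e₁ (PR.trans (PR.*-congˡ e₂) (PR.sym (PR.*-assoc M M k₂)))
      in PR.trans e (PR.trans (PR.*-congˡ (mk (monic-multiple-zero (M *P M) k₂ (monicDeg-* mM' mM') (degLt-cong e dp)))) (PR.zeroʳ _))
      where
        M = prodLin (orb s β)
        mM = monicDeg-prodLin (orb s β)
        mM' : MonicDeg s M
        mM' = ≡.subst (λ t → MonicDeg t M) (length-orb s β) mM
        simple : ¬ evalP (deriv M) β ≈ 0#
        simple = head s (positive per) (Separability.simple-roots descent isDomain (orb s β) (period-distinct per))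
          where
            head : ∀ s {P : Carrier → Set} → 0 ℕ.< s → All P (orb s β) → P β
            head (suc s) _ (p ∷ _) = p
        root₁ : ∀ k₁ → p ≋ M *P k₁ → evalP k₁ β ≈ 0#
        root₁ k₁ e₁ with IsDomain.noZeroDivisors isDomain (evalP (deriv M) β) (evalP k₁ β) (trans (sym (trans (+-cong (eval-* (deriv M) k₁ β) (trans (eval-* M (deriv k₁) β) (trans (*-congʳ (orb-root per)) (zeroˡ _)))) (+-identityʳ _)))
            (trans (sym (eval-+ (deriv M *P k₁) _ β)) (trans (eval-cong (PR.sym (PR.trans (deriv-cong e₁) (deriv-* M k₁))) refl) r')))
        ... | inj₁ z = ⊥-elim (simple z)
        ... | inj₂ z = z

    DoubleRoot : ∀ {n} → Carrier → Carrier → Outcome d n → Set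
    DoubleRoot α β as = evalP (g α as) β ≈ 0# × evalP (deriv (g α as)) β ≈ 0#

    -- The difference of two solutions is a polynomial over F_q of degree below 2s with a double
    -- root at β. So at most one of the q^(2s) translates of f_0 works.
    small-fibre : ∀ {n s β} α (as : Outcome d n) → s ℕ.+ s ℕ.≤ n → Period s β → ∀ (v w : Vec K.F (s ℕ.+ s)) →
      DoubleRoot α β (addCol zero (coeffs (toList v)) as) → DoubleRoot α β (addCol zero (coeffs (toList w)) as) → v ≡ w
    small-fibre {n} {s} {β} α as le per v w (rv , rv') (rw , rw') = toList-injective v w (equal-of-difference _ _
      (double-root-zero per (MP.mapP D) (fixed-mapP D) (MP.mapP-degLt (FK.degLt-+ (toList-deg v) (FK.degLt-neg (toList-deg w))))
        (trans (eval-cong (mapP-difference _ _) refl) (eval-difference _ _ (g α as) β (trans (eval-cong (PR.sym ev) refl) rv) (trans (eval-cong (PR.sym ew) refl) rw)))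
        (trans (eval-cong (PR.trans (deriv-cong (mapP-difference _ _)) (PR.trans (deriv-+ _ _) (PR.+-congˡ (deriv-neg _)))) refl)
          (eval-difference _ _ (deriv (g α as)) β (trans (eval-cong (PR.sym (PR.trans (deriv-cong ev) (deriv-+ _ _))) refl) rv') (trans (eval-cong (PR.sym (PR.trans (deriv-cong ew) (deriv-+ _ _))) refl) rw')))))
      where
        D = toList v FK.+P FK.-P toList w
        ev = g-addCol₀ α (toList v) as (FK.degLt-mono le (toList-deg v))
        ew = g-addCol₀ α (toList w) as (FK.degLt-mono le (toList-deg w))

    eval-spread : ∀ {m} (v : Vec K.F m) β → evalP (MP.mapP (spread v)) β ≈ fr (evalP (MP.mapP (toList v)) β)
    eval-spread [] β = sym (Hom.0-homo φ)
    eval-spread (c ∷ v) β = trans (eval-cong (PR.trans (MP.mapP-+ (FK.constP c) _) (PR.+-congˡ (PR.trans (MP.mapP-* (FK.Xpow q) _) (PR.*-congʳ (mapXpow q))))) refl)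
      (trans (eval-+ _ _ β) (trans (+-cong (trans (eval-const _ β) (sym (fr-ι c))) (trans (eval-* (Xpow q) _ β) (*-cong (eval-Xpow q β) (eval-spread v β))))
        (sym (trans (Hom.+-homo φ _ _) (+-congˡ (Hom.*-homo φ _ _))))))
      where
        mapXpow : ∀ n → MP.mapP (FK.Xpow n) ≋ Xpow n
        mapXpow zero = Hom.1-homo MP.polyHom
        mapXpow (suc n) = ∷-cong (Hom.0-homo ι) (mapXpow n)

    -- The value of v(y^q) at β is φ(v(β)). A common root of two translates thus forces v(β) = w(β),
    -- and v - w has degree below s, too small for the period of β.
    large-fibre : ∀ {n s β m} α (as : Outcome d n) → suc (m ℕ.* q) ℕ.≤ n → n ℕ.< s ℕ.+ s → Period s β → ∀ (v w : Vec K.F m) →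
      evalP (g α (addCol zero (coeffs (spread v)) as)) β ≈ 0# → evalP (g α (addCol zero (coeffs (spread w)) as)) β ≈ 0# → v ≡ w
    large-fibre {n} {s} {β} {m} α as le lt per v w rv rw = toList-injective v w (equal-of-difference _ _
      (too-many-roots (MP.mapP D) (orb s β) (≡.subst (λ t → DegLt t (MP.mapP D)) (≡.sym (length-orb s β)) (MP.mapP-degLt (FK.degLt-mono m≤s (FK.degLt-+ (toList-deg v) (FK.degLt-neg (toList-deg w))))))
        (period-distinct per) (fixed-roots (fixed-mapP D) s (trans (eval-cong (mapP-difference _ _) refl) (hom-nonzero (begin
          fr (evalP (A +P -P B) β) ≈⟨ pow-cong q (trans (eval-+ A _ β) (+-congˡ (Hom.-‿homo (evalHom β) B))) ⟩
          fr (evalP A β - evalP B β) ≈⟨ trans (Hom.+-homo φ _ _) (+-congˡ (Hom.-‿homo φ _)) ⟩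
          fr (evalP A β) - fr (evalP B β) ≈⟨ +-cong (sym (eval-spread v β)) (-‿cong (sym (eval-spread w β))) ⟩
          evalP (MP.mapP (spread v)) β - evalP (MP.mapP (spread w)) β ≈⟨ trans (+-congˡ (sym (Hom.-‿homo (evalHom β) _))) (sym (eval-+ _ _ β)) ⟩
          evalP (MP.mapP (spread v) +P -P MP.mapP (spread w)) β ≈⟨ eval-difference _ _ (g α as) β (trans (eval-cong (PR.sym (ev v)) refl) rv) (trans (eval-cong (PR.sym (ev w)) refl) rw) ⟩
          0# ∎))))))
      where
        open SetoidReasoning setoid
        A = MP.mapP (toList v)
        B = MP.mapP (toList w)
        D = toList v FK.+P FK.-P toList w
        ev : ∀ v → g α (addCol zero (coeffs (spread v)) as) ≋ g α as +P MP.mapP (spread v)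
        ev v = g-addCol₀ α (spread v) as (FK.degLt-mono le (spread-deg v))
        -- From m > s would follow n < 2s < 2m ≤ m q < n.
        m≤s : m ℕ.≤ s
        m≤s with m ℕ.≤? s
        ... | yes p = p
        ... | no np = ⊥-elim (ℕₚ.<-irrefl ≡.refl (ℕₚ.<-trans lt (ℕₚ.<-≤-trans (ℕₚ.+-mono-< (ℕₚ.≰⇒> np) (ℕₚ.≰⇒> np)) (ℕₚ.≤-trans (≡.subst (ℕ._≤ m ℕ.* q) (≡.trans (ℕₚ.*-comm m 2) (≡.cong (m ℕ.+_) (ℕₚ.+-identityʳ m))) (ℕₚ.*-monoʳ-≤ m 1<q)) (ℕₚ.<⇒≤ le)))))

    deriv-addCol-spread : ∀ {n m} α (as : Outcome d n) (v : Vec K.F m) → suc (m ℕ.* q) ℕ.≤ n → deriv (g α (addCol zero (coeffs (spread v)) as)) ≋ deriv (g α as)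
    deriv-addCol-spread α as v le = PR.trans (deriv-cong (g-addCol₀ α (spread v) as (FK.degLt-mono le (spread-deg v)))) (PR.trans (deriv-+ _ _)
      (PR.trans (PR.+-congˡ (PR.trans (PR.sym (MP.mapP-deriv (spread v))) (Hom.⟦⟧-cong MP.polyHom (spread-deriv v)))) (PR.+-identityʳ _)))

    -- The translate is by y v(y^q), whose derivative is v(y^q): it changes the derivative of f(α,
    -- y) injectively.
    zero-fibre : ∀ {n m} α (as : Outcome d n) → suc (suc (m ℕ.* q)) ℕ.≤ n → ∀ (v w : Vec K.F m) →
      deriv (g α (addCol zero (coeffs (K.0# ∷ spread v)) as)) ≋ 0P → deriv (g α (addCol zero (coeffs (K.0# ∷ spread w)) as)) ≋ 0P → v ≡ w
    zero-fibre {n} {m} α as le v w ev ew = spread-injective v w (Descent.injective descentP (PR.trans (opposite v ev) (PR.sym (opposite w ew))))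
      where
        deg : ∀ (v : Vec K.F m) → FK.DegLt n (K.0# ∷ spread v)
        deg v = FK.degLt-mono le (FK.dlt λ { (suc i) (s≤s l) → FK.vanish (spread-deg v) i l })
        derivative : ∀ (v : Vec K.F m) → FK.deriv (K.0# ∷ spread v) FK.≋ spread v
        derivative v = FK.PR.trans (FK.deriv-∷ K.0# (spread v)) (FK.PR.trans (FK.PR.+-congˡ (FK.PR.trans (FK.∷-cong ≡.refl (spread-deriv v)) (FK.mk λ { zero → ≡.refl ; (suc i) → ≡.refl }))) (FK.PR.+-identityʳ _))
        opposite : ∀ v → deriv (g α (addCol zero (coeffs (K.0# ∷ spread v)) as)) ≋ 0P → MP.mapP (spread v) ≋ -P deriv (g α as)
        opposite v e = PR.trans (PS.solve 2 (λ a b → b PS.:= (a PS.:+ b) PS.:- a) PR.refl (deriv (g α as)) _) (PR.trans (PR.+-congʳ (PR.trans (PR.sym total) e)) (PR.+-identityˡ _))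
          where
            total : deriv (g α (addCol zero (coeffs (K.0# ∷ spread v)) as)) ≋ deriv (g α as) +P MP.mapP (spread v)
            total = PR.trans (deriv-cong (g-addCol₀ α (K.0# ∷ spread v) as (deg v))) (PR.trans (deriv-+ _ _) (PR.+-congˡ (PR.trans (PR.sym (MP.mapP-deriv (K.0# ∷ spread v))) (Hom.⟦⟧-cong MP.polyHom (derivative v)))))

    -- Adding v to f_1 changes f(γ, y) - f(γ', y) by (γ - γ') v, so the difference vanishes for at
    -- most one v.
    separable-fibre : ∀ {n} γ γ' → ¬ γ ≈ γ' → (one : Fin (suc d)) → toℕ one ≡ 1 → (as : Outcome d n) → ∀ (v w : Vec K.F n) →
      g γ (addCol one (coeffs (toList v)) as) ≋ g γ' (addCol one (coeffs (toList v)) as) →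
      g γ (addCol one (coeffs (toList w)) as) ≋ g γ' (addCol one (coeffs (toList w)) as) → v ≡ w
    separable-fibre {n} γ γ' ne one one≡1 as v w ev ew = toList-injective v w (Descent.injective descentP (cancel (PR.trans (same v ev) (PR.sym (same w ew)))))
      where
        pow1 : ∀ γ → pow γ (toℕ one) ≈ γ
        pow1 γ rewrite one≡1 = *-identityʳ γ
        shifted : ∀ γ v → g γ (addCol one (coeffs (toList v)) as) ≋ g γ as +P constP γ *P MP.mapP (toList v)
        shifted γ v = PR.trans (g-addCol γ one (toList v) as (toList-deg v)) (PR.+-congˡ (PR.*-congʳ (constP-cong (pow1 γ))))
        same : ∀ v → g γ (addCol one (coeffs (toList v)) as) ≋ g γ' (addCol one (coeffs (toList v)) as) →
          (constP γ +P -P constP γ') *P MP.mapP (toList v) ≋ g γ' as +P -P g γ as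
        same v e = PR.trans (PS.solve 5 (λ c c' m a a' → (c PS.:- c') PS.:* m PS.:= ((a PS.:+ c PS.:* m) PS.:- (a' PS.:+ c' PS.:* m)) PS.:+ (a' PS.:- a)) PR.refl (constP γ) (constP γ') (MP.mapP (toList v)) (g γ as) (g γ' as))
          (PR.trans (PR.+-congʳ (PR.trans (PR.+-congʳ (PR.trans (PR.sym (shifted γ v)) (PR.trans e (shifted γ' v)))) (PR.-‿inverseʳ _))) (PR.+-identityˡ _))
        cancel : ∀ {a b} → (constP γ +P -P constP γ') *P a ≋ (constP γ +P -P constP γ') *P b → a ≋ b
        cancel = DomainBasics.cancelˡ polyRing poly-isDomain (λ z → ne (sub-zero (trans (sym (trans (coeff-+ 0 (constP γ) _) (+-congˡ (coeff-neg 0 (constP γ'))))) (at z 0))))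

open Specialisation

-- Union bounds, averaging over translates, second moments, rational estimates.

module Counting where
  open import Data.Nat as ℕ using (ℕ; zero; suc; z≤n; _+_; _*_; _^_; _≤_; _<_)
  import Data.Nat.Properties as ℕₚ
  open import Data.Nat.Solver using (module +-*-Solver)
  open import Data.Integer as ℤ using (ℤ; ∣_∣)
  import Data.Integer.Properties as ℤₚ
  import Data.Integer.Solver as ℤSolver
  open import Data.Rational as ℚ using (ℚ; mkℚ)
  import Data.Rational.Properties as ℚₚ
  open import Data.Rational.Unnormalised as ℚᵘ using (mkℚᵘ)
  import Data.Rational.Unnormalised.Properties as ℚᵘₚ
  open import Data.Vec as Vec using (Vec; []; _∷_)
  import Data.Vec.Properties as Vecₚ
  open import Data.List using (List; []; _∷_; map; foldr; length; _++_; concatMap; cartesianProduct)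
  import Data.List.Properties as Listₚ
  open import Data.List.Relation.Unary.All as All using (All; []; _∷_)
  open import Data.List.Relation.Unary.Any as Any using (Any; here; there)
  import Data.List.Relation.Unary.Any.Properties as Anyₚ
  import Data.List.Relation.Unary.All.Properties as Allₚ
  open import Data.List.Relation.Unary.AllPairs as AllPairs using (AllPairs; []; _∷_)
  open import Data.List.Relation.Unary.Unique.Propositional using (Unique)
  import Data.List.Relation.Unary.Unique.Propositional.Properties as Uniqueₚ
  open import Data.List.Membership.Propositional using (_∈_)
  import Data.List.Membership.Propositional.Properties as ∈ₚ
  open import Data.List.Relation.Binary.Permutation.Propositional as Perm using (_↭_; prep; swap)
  open import Data.Product using (∃; _×_; _,_; proj₁; proj₂)
  open import Data.Sum using (_⊎_; inj₁; inj₂)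
  open import Data.Empty using (⊥; ⊥-elim)
  open import Relation.Binary.PropositionalEquality as ≡ using (_≡_)

  -- `inherit` holds for every predicate `R`, because both absence of repetitions and facts about
  -- all elements have to pass to the halves.
  record Partition {A : Set} (P Q : A → Set) (L : List A) : Set₁ where
    field
      left right : List A
      left-unique : Unique left
      right-unique : Unique right
      left-all : All P left
      right-all : All Q right
      lengths : length L ≡ length left + length right
      inherit : ∀ {R : A → Set} → All R L → All R left × All R right

  partition : ∀ {A : Set} {P Q : A → Set} (L : List A) → Unique L → All (λ a → P a ⊎ Q a) L → Partition P Q L
  partition [] _ _ = record { left = [] ; right = [] ; left-unique = [] ; right-unique = [] ; left-all = [] ; right-all = [] ; lengths = ≡.refl ; inherit = λ _ → [] , [] }
  partition (a ∷ L) (n ∷ u) (c ∷ cs) with partition L u cs | c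
  ... | p | inj₁ x = record { left = a ∷ p.left ; right = p.right ; left-unique = proj₁ (p.inherit n) ∷ p.left-unique ; right-unique = p.right-unique
      ; left-all = x ∷ p.left-all ; right-all = p.right-all ; lengths = ≡.cong suc p.lengths
      ; inherit = λ { (r ∷ rs) → r ∷ proj₁ (p.inherit rs) , proj₂ (p.inherit rs) } }
    where module p = Partition p
  ... | p | inj₂ x = record { left = p.left ; right = a ∷ p.right ; left-unique = p.left-unique ; right-unique = proj₂ (p.inherit n) ∷ p.right-unique
      ; left-all = p.left-all ; right-all = x ∷ p.right-all ; lengths = ≡.trans (≡.cong suc p.lengths) (≡.sym (ℕₚ.+-suc _ _))
      ; inherit = λ { (r ∷ rs) → proj₁ (p.inherit rs) , r ∷ proj₂ (p.inherit rs) } }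
    where module p = Partition p

  -- The union bound. A probability bound C / M is kept in the form M · count ≤ C.
  cover-count : ∀ {A B : Set} (Z : List B) (Q : B → A → Set) {M C} (L : List A) → Unique L → All (λ a → Any (λ z → Q z a) Z) L →
    (∀ z → z ∈ Z → ∀ L' → Unique L' → All (Q z) L' → M * length L' ≤ C) → M * length L ≤ C * length Z
  cover-count [] Q {M} [] _ _ _ = ℕₚ.≤-trans (ℕₚ.≤-reflexive (ℕₚ.*-zeroʳ M)) z≤n
  cover-count [] Q (_ ∷ _) _ (() ∷ _) _
  cover-count (z ∷ Z) Q {M} {C} L u cov bound = begin
    M * length L                            ≡⟨ ≡.trans (≡.cong (M *_) p.lengths) (ℕₚ.*-distribˡ-+ M _ _) ⟩
    M * length p.left + M * length p.right  ≤⟨ ℕₚ.+-mono-≤ (bound z (here ≡.refl) p.left p.left-unique p.left-all) (cover-count Z Q {M} {C} p.right p.right-unique p.right-all (λ z z∈ → bound z (there z∈))) ⟩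
    C + C * length Z                        ≡⟨ ≡.sym (ℕₚ.*-suc C (length Z)) ⟩
    C * suc (length Z)                      ∎
    where
      open ℕₚ.≤-Reasoning
      split : ∀ {a} → Any (λ z → Q z a) (z ∷ Z) → Q z a ⊎ Any (λ z → Q z a) Z
      split (here q) = inj₁ q
      split (there q) = inj₂ q
      module p = Partition (partition L u (All.map split cov))

  unique-map-on : ∀ {A B : Set} {R : A → Set} (f : A → B) {L} → (∀ {a b} → R a → R b → f a ≡ f b → a ≡ b) → All R L → Unique L → Unique (map f L)
  unique-map-on f inj [] [] = []
  unique-map-on f inj (r ∷ rs) (n ∷ u) = Allₚ.map⁺ (All.map (λ { (ne , r') e → ne (inj r r' e) }) (All.zip (n , rs))) ∷ unique-map-on f inj rs u

  length-product : ∀ {A B : Set} (xs : List A) (ys : List B) → length (cartesianProduct xs ys) ≡ length xs * length ys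
  length-product [] ys = ≡.refl
  length-product (x ∷ xs) ys = ≡.trans (Listₚ.length-++ (map (x ,_) ys)) (≡.cong₂ _+_ (Listₚ.length-map (x ,_) ys) (length-product xs ys))

  -- Double counting of the pairs (x , i) with act i x ∈ S.
  translate-count : ∀ {X I : Set} (xs : List X) → (∀ x → x ∈ xs) → (is : List I) → Unique is → (act act⁻¹ : I → X → X) → (∀ i x → act i (act⁻¹ i x) ≡ x) →
    ∀ (P : X → Set) {M C} S → Unique S → All P S →
    (∀ x J → Unique J → All (λ i → P (act i x)) J → M * length J ≤ C) → M * (length S * length is) ≤ C * length xs
  translate-count {X} {I} xs complete is u act act⁻¹ inv P {M} {C} S uS aS fibre =
    ≡.subst (λ l → M * l ≤ C * length xs) (length-product S is)
      (cover-count xs (λ x → λ { (s , i) → P s × act i x ≡ s }) {M} {C} (cartesianProduct S is) (Uniqueₚ.cartesianProduct⁺ uS u)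
        (Allₚ.cartesianProduct⁺ (≡.setoid X) (≡.setoid I) S is (λ {s} {i} s∈ _ → Any.map (λ { ≡.refl → All.lookup aS s∈ , inv i s }) (complete (act⁻¹ i s))))
        (λ x _ L' uL aL → ≡.subst (λ l → M * l ≤ C) (Listₚ.length-map proj₂ L')
          (fibre x (map proj₂ L')
            (unique-map-on {R = λ { (s , i) → P s × act i x ≡ s }} proj₂ (λ { (_ , e) (_ , e') ≡.refl → ≡.cong (_, _) (≡.trans (≡.sym e) e') }) aL uL)
            (Allₚ.map⁺ (All.map (λ { (p , ≡.refl) → p }) aL)))))

  -- A union bound over densities proportional to q^(-s). Since q ≥ 2, the tail beyond `lo` weighs
  -- no more than the bound for `lo` itself, so the total is at most twice that bound.
  geometric-count : ∀ {A : Set} (Q : ℕ → A → Set) {q C} → 1 < q → ∀ j lo (L : List A) → Unique L → All (λ a → ∃ λ s → lo ≤ s × s < lo + j × Q s a) L →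
    (∀ s → lo ≤ s → ∀ L' → Unique L' → All (Q s) L' → q ^ s * length L' ≤ C) → q ^ lo * length L ≤ 2 * C
  geometric-count Q {q} 1<q zero lo [] _ _ _ = ℕₚ.≤-trans (ℕₚ.≤-reflexive (ℕₚ.*-zeroʳ (q ^ lo))) z≤n
  geometric-count Q 1<q zero lo (_ ∷ _) _ ((s , le , lt , _) ∷ _) _ = ⊥-elim (ℕₚ.<⇒≱ (≡.subst (s <_) (ℕₚ.+-identityʳ lo) lt) le)
  geometric-count {A} Q {q} {C} 1<q (suc j) lo L u cov bound = begin
    q ^ lo * length L                                 ≡⟨ ≡.trans (≡.cong (q ^ lo *_) p.lengths) (ℕₚ.*-distribˡ-+ (q ^ lo) _ _) ⟩
    q ^ lo * length p.left + q ^ lo * length p.right  ≤⟨ ℕₚ.+-mono-≤ (bound lo ℕₚ.≤-refl p.left p.left-unique p.left-all) half ⟩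
    C + C                                             ≡⟨ ≡.cong (C +_) (≡.sym (ℕₚ.+-identityʳ C)) ⟩
    2 * C                                             ∎
    where
      open ℕₚ.≤-Reasoning
      split : ∀ {a} → (∃ λ s → lo ≤ s × s < lo + suc j × Q s a) → Q lo a ⊎ (∃ λ s → suc lo ≤ s × s < suc lo + j × Q s a)
      split (s , le , lt , x) with ℕₚ.m≤n⇒m<n∨m≡n le
      ... | inj₁ lt' = inj₂ (s , lt' , ≡.subst (s <_) (ℕₚ.+-suc lo j) lt , x)
      ... | inj₂ ≡.refl = inj₁ x
      module p = Partition (partition L u (All.map split cov))
      half : q ^ lo * length p.right ≤ C
      half = ℕₚ.*-cancelˡ-≤ 2 (begin
        2 * (q ^ lo * length p.right) ≤⟨ ℕₚ.*-monoˡ-≤ (q ^ lo * length p.right) 1<q ⟩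
        q * (q ^ lo * length p.right) ≡⟨ ≡.sym (ℕₚ.*-assoc q (q ^ lo) _) ⟩
        q ^ suc lo * length p.right   ≤⟨ geometric-count Q 1<q j (suc lo) p.right p.right-unique p.right-all (λ s le → bound s (ℕₚ.≤-trans (ℕₚ.n≤1+n lo) le)) ⟩
        2 * C                         ∎)

  length-allVecs : ∀ {A : Set} (xs : List A) n → length (allVecs xs n) ≡ length xs ^ n
  length-allVecs xs zero = ≡.refl
  length-allVecs xs (suc n) = go xs
    where
      go : ∀ ys → length (concatMap (λ x → map (x Vec.∷_) (allVecs xs n)) ys) ≡ length ys * length xs ^ n
      go [] = ≡.refl
      go (y ∷ ys) = ≡.trans (Listₚ.length-++ (map (y Vec.∷_) (allVecs xs n))) (≡.cong₂ _+_ (≡.trans (Listₚ.length-map (y Vec.∷_) (allVecs xs n)) (length-allVecs xs n)) (go ys))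

  allVecs-complete : ∀ {A : Set} {xs : List A} → (∀ a → a ∈ xs) → ∀ {n} (v : Vec A n) → v ∈ allVecs xs n
  allVecs-complete c [] = here ≡.refl
  allVecs-complete c (a ∷ v) = Anyₚ.concatMap⁺ _ (Any.map (λ { ≡.refl → ∈ₚ.∈-map⁺ (a Vec.∷_) (allVecs-complete c v) }) (c a))

  allVecs-unique : ∀ {A : Set} {xs : List A} → Unique xs → ∀ n → Unique (allVecs xs n)
  allVecs-unique u zero = [] ∷ []
  allVecs-unique {A} {xs} u (suc n) = go xs u
    where
      go : ∀ ys → Unique ys → Unique (concatMap (λ x → map (x Vec.∷_) (allVecs xs n)) ys)
      go [] _ = []
      go (y ∷ ys) (ny ∷ uy) = Uniqueₚ.++⁺ (Uniqueₚ.map⁺ Vecₚ.∷-injectiveʳ (allVecs-unique u n)) (go ys uy) disjoint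
        where
          disjoint : ∀ {v} → v ∈ map (y Vec.∷_) (allVecs xs n) × v ∈ concatMap (λ x → map (x Vec.∷_) (allVecs xs n)) ys → ⊥
          disjoint (v∈ , v∈') with ∈ₚ.∈-map⁻ (y Vec.∷_) v∈ | All.lookupAny ny (Anyₚ.concatMap⁻ (λ x → map (x Vec.∷_) (allVecs xs n)) v∈')
          ... | w , _ , ≡.refl | ne , w∈ with ∈ₚ.∈-map⁻ _ w∈
          ...   | _ , _ , e = ne (Vecₚ.∷-injectiveˡ e)

  module Moments {I : Set} (hs : List I) where
    private N = length hs

    Sum : (I → ℤ) → ℤ
    Sum f = sumℤ (map f hs)

    sumℕ : (I → ℕ) → List I → ℕ
    sumℕ f = foldr (λ h acc → f h + acc) 0

    tot : List (I → ℤ) → I → ℤ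
    tot [] h = ℤ.+ 0
    tot (u ∷ us) h = u h ℤ.+ tot us h

    private
      module S = ℤSolver.+-*-Solver

      Sum-cong : ∀ {f g : I → ℤ} → (∀ h → h ∈ hs → f h ≡ g h) → Sum f ≡ Sum g
      Sum-cong = go hs
        where
          go : ∀ hs {f g : I → ℤ} → (∀ h → h ∈ hs → f h ≡ g h) → sumℤ (map f hs) ≡ sumℤ (map g hs)
          go [] e = ≡.refl
          go (h ∷ hs) e = ≡.cong₂ ℤ._+_ (e h (here ≡.refl)) (go hs (λ h h∈ → e h (there h∈)))

      Sum-+ : ∀ (f g : I → ℤ) → Sum (λ h → f h ℤ.+ g h) ≡ Sum f ℤ.+ Sum g
      Sum-+ f g = go hs
        where
          go : ∀ hs → sumℤ (map (λ h → f h ℤ.+ g h) hs) ≡ sumℤ (map f hs) ℤ.+ sumℤ (map g hs)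
          go [] = ≡.refl
          go (h ∷ hs) = ≡.trans (≡.cong (λ z → (f h ℤ.+ g h) ℤ.+ z) (go hs)) (S.solve 4 (λ a b c d → (a S.:+ b) S.:+ (c S.:+ d) S.:= (a S.:+ c) S.:+ (b S.:+ d)) ≡.refl (f h) (g h) (sumℤ (map f hs)) (sumℤ (map g hs)))

      Sum-1 : ∀ {f : I → ℤ} → (∀ h → h ∈ hs → f h ≡ ℤ.+ 1) → Sum f ≡ ℤ.+ N
      Sum-1 = go hs
        where
          go : ∀ hs {f : I → ℤ} → (∀ h → h ∈ hs → f h ≡ ℤ.+ 1) → sumℤ (map f hs) ≡ ℤ.+ length hs
          go [] e = ≡.refl
          go (h ∷ hs) e = ≡.cong₂ ℤ._+_ (e h (here ≡.refl)) (go hs (λ h h∈ → e h (there h∈)))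

      cross-bound : ∀ {M} (u : I → ℤ) (us : List (I → ℤ)) → All (λ u' → M * ∣ Sum (λ h → u h ℤ.* u' h) ∣ ≤ N) us → M * ∣ Sum (λ h → u h ℤ.* tot us h) ∣ ≤ length us * N
      cross-bound {M} u [] [] = ℕₚ.≤-reflexive (≡.trans (≡.cong (λ z → M * ∣ z ∣) (≡.trans (Sum-cong {g = λ _ → ℤ.+ 0} (λ h _ → ℤₚ.*-zeroʳ (u h))) (zeros hs))) (ℕₚ.*-zeroʳ M))
        where
          zeros : ∀ hs → sumℤ (map (λ (h : I) → ℤ.+ 0) hs) ≡ ℤ.+ 0
          zeros [] = ≡.refl
          zeros (h ∷ hs) = ≡.trans (ℤₚ.+-identityˡ _) (zeros hs)
      cross-bound {M} u (u' ∷ us) (b ∷ bs) = begin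
        M * ∣ Sum (λ h → u h ℤ.* (u' h ℤ.+ tot us h)) ∣ ≡⟨ ≡.cong (λ z → M * ∣ z ∣) (≡.trans (Sum-cong {g = λ h → u h ℤ.* u' h ℤ.+ u h ℤ.* tot us h} (λ h _ → ℤₚ.*-distribˡ-+ (u h) (u' h) (tot us h))) (Sum-+ (λ h → u h ℤ.* u' h) (λ h → u h ℤ.* tot us h))) ⟩
        M * ∣ Sum (λ h → u h ℤ.* u' h) ℤ.+ Sum (λ h → u h ℤ.* tot us h) ∣ ≤⟨ ℕₚ.*-monoʳ-≤ M (ℤₚ.∣i+j∣≤∣i∣+∣j∣ (Sum (λ h → u h ℤ.* u' h)) (Sum (λ h → u h ℤ.* tot us h))) ⟩
        M * (∣ Sum (λ h → u h ℤ.* u' h) ∣ + ∣ Sum (λ h → u h ℤ.* tot us h) ∣) ≡⟨ ℕₚ.*-distribˡ-+ M _ _ ⟩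
        M * ∣ Sum (λ h → u h ℤ.* u' h) ∣ + M * ∣ Sum (λ h → u h ℤ.* tot us h) ∣ ≤⟨ ℕₚ.+-mono-≤ b (cross-bound {M} u us bs) ⟩
        N + length us * N ∎
        where open ℕₚ.≤-Reasoning

    -- The r diagonal terms contribute N each and the off-diagonal ones at most N / M each. Counting
    -- r² of the latter closes the induction.
    second-moment : ∀ {M} (us : List (I → ℤ)) → All (λ u → ∀ h → h ∈ hs → u h ℤ.* u h ≡ ℤ.+ 1) us →
      AllPairs (λ u u' → M * ∣ Sum (λ h → u h ℤ.* u' h) ∣ ≤ N) us →
      M * ∣ Sum (λ h → tot us h ℤ.* tot us h) ∣ ≤ (M * length us + length us * length us) * N
    second-moment {M} [] _ _ = ℕₚ.≤-trans (ℕₚ.≤-reflexive (≡.trans (≡.cong (λ z → M * ∣ z ∣) (zeros hs)) (ℕₚ.*-zeroʳ M))) z≤n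
      where
        zeros : ∀ hs → sumℤ (map (λ (h : I) → ℤ.+ 0 ℤ.* ℤ.+ 0) hs) ≡ ℤ.+ 0
        zeros [] = ≡.refl
        zeros (h ∷ hs) = ≡.trans (ℤₚ.+-identityˡ _) (zeros hs)
    second-moment {M} (u ∷ us) (sq ∷ sqs) (b ∷ bs) = begin
      M * ∣ Sum (λ h → (u h ℤ.+ tot us h) ℤ.* (u h ℤ.+ tot us h)) ∣ ≡⟨ ≡.cong (λ z → M * ∣ z ∣) expanded ⟩
      M * ∣ ℤ.+ N ℤ.+ (X ℤ.+ X ℤ.+ Q) ∣ ≤⟨ ℕₚ.*-monoʳ-≤ M (ℕₚ.≤-trans (ℤₚ.∣i+j∣≤∣i∣+∣j∣ (ℤ.+ N) (X ℤ.+ X ℤ.+ Q)) (ℕₚ.+-monoʳ-≤ N (ℕₚ.≤-trans (ℤₚ.∣i+j∣≤∣i∣+∣j∣ (X ℤ.+ X) Q) (ℕₚ.+-monoˡ-≤ ∣ Q ∣ (ℤₚ.∣i+j∣≤∣i∣+∣j∣ X X))))) ⟩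
      M * (N + (∣ X ∣ + ∣ X ∣ + ∣ Q ∣)) ≡⟨ T.solve 4 (λ m n x q → m T.:* (n T.:+ (x T.:+ x T.:+ q)) T.:= m T.:* n T.:+ (m T.:* x T.:+ m T.:* x T.:+ m T.:* q)) ≡.refl M N ∣ X ∣ ∣ Q ∣ ⟩
      M * N + (M * ∣ X ∣ + M * ∣ X ∣ + M * ∣ Q ∣) ≤⟨ ℕₚ.+-monoʳ-≤ (M * N) (ℕₚ.+-mono-≤ (ℕₚ.+-mono-≤ (cross-bound {M} u us b) (cross-bound {M} u us b)) (second-moment {M} us sqs bs)) ⟩
      -- The extra N completes r² + 2r to (r + 1)².
      M * N + (r * N + r * N + (M * r + r * r) * N) ≤⟨ ℕₚ.m≤m+n _ N ⟩
      M * N + (r * N + r * N + (M * r + r * r) * N) + N ≡⟨ T.solve 3 (λ m n r → m T.:* n T.:+ (r T.:* n T.:+ r T.:* n T.:+ (m T.:* r T.:+ r T.:* r) T.:* n) T.:+ n T.:= (m T.:* (T.con 1 T.:+ r) T.:+ (T.con 1 T.:+ r) T.:* (T.con 1 T.:+ r)) T.:* n) ≡.refl M N r ⟩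
      (M * suc r + suc r * suc r) * N ∎
      where
        open ℕₚ.≤-Reasoning
        module T = +-*-Solver
        r = length us
        X = Sum (λ h → u h ℤ.* tot us h)
        Q = Sum (λ h → tot us h ℤ.* tot us h)
        expanded : Sum (λ h → (u h ℤ.+ tot us h) ℤ.* (u h ℤ.+ tot us h)) ≡ ℤ.+ N ℤ.+ (X ℤ.+ X ℤ.+ Q)
        sq' cr' to' : I → ℤ
        sq' h = u h ℤ.* u h
        cr' h = u h ℤ.* tot us h
        to' h = tot us h ℤ.* tot us h
        expanded = ≡.trans (Sum-cong {g = λ h → sq' h ℤ.+ ((cr' h ℤ.+ cr' h) ℤ.+ to' h)} (λ h _ → S.solve 2 (λ a b → (a S.:+ b) S.:* (a S.:+ b) S.:= a S.:* a S.:+ ((a S.:* b S.:+ a S.:* b) S.:+ b S.:* b)) ≡.refl (u h) (tot us h)))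
          (≡.trans (Sum-+ sq' (λ h → (cr' h ℤ.+ cr' h) ℤ.+ to' h)) (≡.cong₂ ℤ._+_ (Sum-1 {sq'} sq) (≡.trans (Sum-+ (λ h → cr' h ℤ.+ cr' h) to') (≡.cong (λ z → z ℤ.+ Q) (Sum-+ cr' cr')))))

    private
      sumℕ-↭ : ∀ f {xs ys} → xs ↭ ys → sumℕ f xs ≡ sumℕ f ys
      sumℕ-↭ f Perm.refl = ≡.refl
      sumℕ-↭ f (prep x p) = ≡.cong (f x +_) (sumℕ-↭ f p)
      sumℕ-↭ f (swap {ys = ys} x y p) = ≡.trans (≡.cong (λ t → f x + (f y + t)) (sumℕ-↭ f p)) (exchange (f x) (f y) (sumℕ f ys))
        where
          exchange : ∀ a b c → a + (b + c) ≡ b + (a + c)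
          exchange a b c = ≡.trans (≡.sym (ℕₚ.+-assoc a b c)) (≡.trans (≡.cong (_+ c) (ℕₚ.+-comm a b)) (ℕₚ.+-assoc b a c))
      sumℕ-↭ f (Perm.trans p p') = ≡.trans (sumℕ-↭ f p) (sumℕ-↭ f p')

      sumℕ-lower : ∀ f c xs ys → All (λ h → c ≤ f h) xs → c * length xs ≤ sumℕ f (xs ++ ys)
      sumℕ-lower f c [] ys [] = ℕₚ.≤-trans (ℕₚ.≤-reflexive (ℕₚ.*-zeroʳ c)) z≤n
      sumℕ-lower f c (x ∷ xs) ys (l ∷ ls) = ℕₚ.≤-trans (ℕₚ.≤-reflexive (ℕₚ.*-suc c (length xs))) (ℕₚ.+-mono-≤ l (sumℕ-lower f c xs ys ls))

      square-abs : ∀ z → z ℤ.* z ≡ ℤ.+ (∣ z ∣ * ∣ z ∣)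
      square-abs (ℤ.+ n) = ≡.sym (ℤₚ.pos-* n n)
      square-abs ℤ.-[1+ n ] = ≡.refl

      Sum-squares : ∀ (f : I → ℤ) → ∣ Sum (λ h → f h ℤ.* f h) ∣ ≡ sumℕ (λ h → ∣ f h ∣ * ∣ f h ∣) hs
      Sum-squares f = ≡.cong ∣_∣ (go hs)
        where
          go : ∀ hs → sumℤ (map (λ h → f h ℤ.* f h) hs) ≡ ℤ.+ sumℕ (λ h → ∣ f h ∣ * ∣ f h ∣) hs
          go [] = ≡.refl
          go (h ∷ hs) = ≡.trans (≡.cong₂ ℤ._+_ (square-abs (f h)) (go hs)) (≡.sym (ℤₚ.pos-+ (∣ f h ∣ * ∣ f h ∣) _))

    tot-constant : ∀ us h ε → All (λ u → u h ≡ ε) us → tot us h ≡ ℤ.+ length us ℤ.* ε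
    tot-constant [] h ε [] = ≡.sym (ℤₚ.*-zeroˡ ε)
    tot-constant (u ∷ us) h ε (e ∷ es) = ≡.trans (≡.cong₂ ℤ._+_ e (tot-constant us h ε es))
      (≡.trans (≡.cong (λ z → z ℤ.+ ℤ.+ length us ℤ.* ε) (≡.sym (ℤₚ.*-identityˡ ε))) (≡.sym (ℤₚ.*-distribʳ-+ ε (ℤ.+ 1) (ℤ.+ length us))))

    constant-count : ∀ (us : List (I → ℤ)) → All (λ u → ∀ h → h ∈ hs → u h ℤ.* u h ≡ ℤ.+ 1) us →
      AllPairs (λ u u' → length us * ∣ Sum (λ h → u h ℤ.* u' h) ∣ ≤ N) us → 0 < length us →
      ∀ J → Unique J → (∀ {h} → h ∈ J → h ∈ hs) → All (λ h → ∃ λ ε → ∣ ε ∣ ≡ 1 × All (λ u → u h ≡ ε) us) J →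
      length us * length J ≤ 2 * N
    -- Chebyshev's argument: where all M signs agree, the total has absolute value M. Hence M² · |J|
    -- is at most the second moment, which is at most 2 M N.
    constant-count us sq pairs pos J uJ sub con = ℕₚ.*-cancelˡ-≤ (M * M) {{ℕ.>-nonZero (ℕₚ.*-mono-< pos pos)}} (begin
      (M * M) * (M * length J)  ≡⟨ T.solve 2 (λ m j → (m T.:* m) T.:* (m T.:* j) T.:= m T.:* ((m T.:* m) T.:* j)) ≡.refl M (length J) ⟩
      M * ((M * M) * length J)  ≤⟨ ℕₚ.*-monoʳ-≤ M lower ⟩
      M * ∣ Sum (λ h → tot us h ℤ.* tot us h) ∣ ≤⟨ second-moment {M} us sq pairs ⟩
      (M * M + M * M) * N       ≡⟨ T.solve 2 (λ m n → (m T.:* m T.:+ m T.:* m) T.:* n T.:= (m T.:* m) T.:* (T.con 2 T.:* n)) ≡.refl M N ⟩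
      (M * M) * (2 * N)         ∎)
      where
        open ℕₚ.≤-Reasoning
        module T = +-*-Solver
        M = length us
        abs : ∀ {h} → (∃ λ ε → ∣ ε ∣ ≡ 1 × All (λ u → u h ≡ ε) us) → ∣ tot us h ∣ ≡ M
        abs {h} (ε , e , all) = ≡.trans (≡.cong ∣_∣ (tot-constant us h ε all)) (≡.trans (ℤₚ.abs-* (ℤ.+ M) ε) (≡.trans (≡.cong (M *_) e) (ℕₚ.*-identityʳ M)))
        ext = unique-extend J hs uJ sub
        lower : (M * M) * length J ≤ ∣ Sum (λ h → tot us h ℤ.* tot us h) ∣
        lower = ≡.subst ((M * M) * length J ≤_) (≡.trans (≡.sym (sumℕ-↭ (λ h → ∣ tot us h ∣ * ∣ tot us h ∣) (proj₂ ext))) (≡.sym (Sum-squares (tot us))))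
          (sumℕ-lower (λ h → ∣ tot us h ∣ * ∣ tot us h ∣) (M * M) J (proj₁ ext) (All.map (λ c → ℕₚ.≤-reflexive (≡.sym (≡.cong₂ _*_ (abs c) (abs c)))) con))

  private
    ℕtoℚᵘ : ∀ n → ℚ.toℚᵘ (ℕtoℚ n) ℚᵘ.≃ mkℚᵘ (ℤ.+ n) 0
    ℕtoℚᵘ n = ℚₚ.toℚᵘ-fromℚᵘ (mkℚᵘ (ℤ.+ n) 0)

  ℕtoℚ-mono : ∀ {m n} → m ≤ n → ℕtoℚ m ℚ.≤ ℕtoℚ n
  ℕtoℚ-mono {m} {n} le = ℚₚ.toℚᵘ-cancel-≤ (ℚᵘₚ.≤-respˡ-≃ (ℚᵘₚ.≃-sym (ℕtoℚᵘ m)) (ℚᵘₚ.≤-respʳ-≃ (ℚᵘₚ.≃-sym (ℕtoℚᵘ n))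
    (ℚᵘ.*≤* (≡.subst₂ ℤ._≤_ (≡.sym (ℤₚ.*-identityʳ (ℤ.+ m))) (≡.sym (ℤₚ.*-identityʳ (ℤ.+ n))) (ℤ.+≤+ le)))))

  ℕtoℚ-* : ∀ m n → ℕtoℚ (m * n) ≡ ℕtoℚ m ℚ.* ℕtoℚ n
  ℕtoℚ-* m n = ℚₚ.toℚᵘ-injective (ℚᵘₚ.≃-trans (ℕtoℚᵘ (m * n)) (ℚᵘₚ.≃-sym (ℚᵘₚ.≃-trans (ℚₚ.toℚᵘ-homo-* (ℕtoℚ m) (ℕtoℚ n))
    (ℚᵘₚ.≃-trans (ℚᵘₚ.*-cong (ℕtoℚᵘ m) (ℕtoℚᵘ n)) (ℚᵘ.*≡* (≡.cong (ℤ._* ℤ.+ 1) (≡.sym (ℤₚ.pos-* m n))))))))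

  reciprocal : ℕ → ℚ
  reciprocal m = (ℤ.+ 1) ℚ./ suc m

  reciprocal-positive : ∀ m → ℚ.0ℚ ℚ.< reciprocal m
  reciprocal-positive m = ℚₚ.positive⁻¹ (reciprocal m) {{ℚₚ.normalize-pos 1 (suc m)}}

  reciprocal-bound : ∀ m s N → ℕtoℚ s ℚ.≤ reciprocal m ℚ.* ℕtoℚ N → suc m * s ≤ N
  reciprocal-bound m s N le = ℤₚ.drop‿+≤+ (≡.subst₂ ℤ._≤_ lhs rhs (ℚᵘₚ.drop-*≤* step))
    where
      step : mkℚᵘ (ℤ.+ s) 0 ℚᵘ.≤ mkℚᵘ (ℤ.+ 1) m ℚᵘ.* mkℚᵘ (ℤ.+ N) 0
      step = ℚᵘₚ.≤-respˡ-≃ (ℕtoℚᵘ s) (ℚᵘₚ.≤-respʳ-≃ (ℚᵘₚ.≃-trans (ℚₚ.toℚᵘ-homo-* (reciprocal m) (ℕtoℚ N)) (ℚᵘₚ.*-cong (ℚₚ.toℚᵘ-fromℚᵘ (mkℚᵘ (ℤ.+ 1) m)) (ℕtoℚᵘ N))) (ℚₚ.toℚᵘ-mono-≤ le))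
      lhs : ℤ.+ s ℤ.* ℤ.+ (suc m * 1) ≡ ℤ.+ (suc m * s)
      lhs = ≡.trans (≡.sym (ℤₚ.pos-* s (suc m * 1))) (≡.cong ℤ.+_ (≡.trans (≡.cong (s *_) (ℕₚ.*-identityʳ (suc m))) (ℕₚ.*-comm s (suc m))))
      rhs : ℤ.+ 1 ℤ.* ℤ.+ N ℤ.* ℤ.+ 1 ≡ ℤ.+ N
      rhs = ≡.trans (ℤₚ.*-identityʳ _) (ℤₚ.*-identityˡ _)

  -- A positive rational is at least the reciprocal of its denominator b + 1, so afterwards only
  -- natural numbers are compared.
  denominator-bound : ∀ (ε : ℚ) → ℚ.0ℚ ℚ.< ε → ∃ λ b → ∀ s N → suc b * s ≤ N → ℕtoℚ s ℚ.≤ ε ℚ.* ℕtoℚ N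
  denominator-bound ε@(mkℚ (ℤ.+ zero) b _) 0<ε = ⊥-elim (ℤₚ.<-irrefl ≡.refl (ℚₚ.drop-*<* 0<ε))
  denominator-bound ε@(mkℚ ℤ.-[1+ _ ] b _) 0<ε with ℚₚ.drop-*<* 0<ε
  ... | ()
  denominator-bound ε@(mkℚ (ℤ.+ suc a) b _) 0<ε = b , λ s N le → ℚₚ.toℚᵘ-cancel-≤ (ℚᵘₚ.≤-respˡ-≃ (ℚᵘₚ.≃-sym (ℕtoℚᵘ s))
    (ℚᵘₚ.≤-respʳ-≃ (ℚᵘₚ.≃-sym (ℚᵘₚ.≃-trans (ℚₚ.toℚᵘ-homo-* ε (ℕtoℚ N)) (ℚᵘₚ.*-cong (ℚᵘₚ.≃-refl {mkℚᵘ (ℤ.+ suc a) b}) (ℕtoℚᵘ N))))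
      (ℚᵘ.*≤* (≡.subst₂ ℤ._≤_ (lhs s) (rhs N) (ℤ.+≤+ (ℕₚ.≤-trans le (ℕₚ.m≤n*m N (suc a))))))))
    where
      lhs : ∀ s → ℤ.+ (suc b * s) ≡ ℤ.+ s ℤ.* ℤ.+ (suc b * 1)
      lhs s = ≡.trans (≡.cong ℤ.+_ (≡.trans (ℕₚ.*-comm (suc b) s) (≡.cong (s *_) (≡.sym (ℕₚ.*-identityʳ (suc b)))))) (ℤₚ.pos-* s (suc b * 1))
      rhs : ∀ N → ℤ.+ (suc a * N) ≡ ℤ.+ suc a ℤ.* ℤ.+ N ℤ.* ℤ.+ 1
      rhs N = ≡.trans (ℤₚ.pos-* (suc a) N) (≡.sym (ℤₚ.*-identityʳ _))

open Counting

-- Norms as polynomials in T = f_0, and the second moment on a fibre.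

module ChowlaSums where
  open import Algebra.Bundles using (CommutativeRing)
  open import Data.Nat as ℕ using (ℕ; zero; suc; z≤n; s≤s)
  import Data.Nat.Properties as ℕₚ
  open import Data.Integer as ℤ using (ℤ; ∣_∣)
  open import Data.Rational as ℚ using (ℚ)
  open import Data.Fin using (zero; suc)
  open import Data.Vec as Vec using (Vec; []; _∷_; toList)
  open import Data.List using (List; []; _∷_; map; length; _++_; [_]; concatMap)
  import Data.List.Properties as Listₚ
  open import Data.List.Relation.Unary.All as All using (All; []; _∷_)
  open import Data.List.Relation.Unary.Any as Any using (Any; here; there)
  import Data.List.Relation.Unary.Any.Properties as Anyₚ
  import Data.List.Relation.Unary.All.Properties as Allₚ
  open import Data.List.Relation.Unary.AllPairs as AllPairs using (AllPairs; []; _∷_)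
  import Data.List.Relation.Unary.AllPairs.Properties as AllPairsₚ
  open import Data.List.Relation.Unary.Unique.Propositional using (Unique)
  import Data.List.Relation.Unary.Unique.Propositional.Properties as Uniqueₚ
  open import Data.List.Relation.Binary.Pointwise as Pointwise using (Pointwise; []; _∷_)
  open import Data.List.Membership.Propositional using (_∈_)
  open import Data.Product using (∃; _×_; _,_; proj₁; proj₂)
  open import Data.Sum using (inj₁; inj₂)
  open import Data.Empty using (⊥-elim)
  open import Relation.Nullary using (¬_; yes; no)
  open import Relation.Binary using (tri<; tri≈; tri>)
  open import Relation.Binary.PropositionalEquality as ≡ using (_≡_; _≢_)

  -- The statement iterates the raw construction, while the proof works over `polyRing` with opaque
  -- operations. The two are propositionally equal.
  module BivariateOps (K : FiniteField) where
    private
      module FK = FieldTheory (BaseField.baseField K)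
      module TK = PolyTheory (baseRing K [X])
      module P2 = OverField.P2 K

    P2-coeff : ∀ i p → P2.coeff i p ≡ TK.coeff i p
    P2-coeff i [] = ≡.refl
    P2-coeff zero (a ∷ p) = ≡.refl
    P2-coeff (suc i) (a ∷ p) = P2-coeff i p

    private
      +≡ : ∀ p p' → p P2.+P p' ≡ p TK.+ᴿ p'
      +≡ [] p' = ≡.refl
      +≡ (a ∷ p) [] = ≡.refl
      +≡ (a ∷ p) (b ∷ p') = ≡.cong₂ _∷_ (FK.raw-+ a b) (+≡ p p')

      *≡ : ∀ p p' → p P2.*P p' ≡ p TK.*ᴿ p'
      *≡ [] p' = ≡.refl
      *≡ (a ∷ p) p' = ≡.trans (+≡ (map (a FK.*ᴿ_) p') (FK.0P ∷ (p P2.*P p')))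
        (≡.cong₂ (λ s t → s TK.+ᴿ (FK.0P ∷ t)) (Listₚ.map-cong (FK.raw-* a) p') (*≡ p p'))

      natMul≡ : ∀ n a → P2.natMul n a ≡ TK.natMul n a
      natMul≡ zero a = ≡.refl
      natMul≡ (suc n) a = ≡.trans (FK.raw-+ a _) (≡.cong (a FK.+P_) (natMul≡ n a))

      derivAux≡ : ∀ k p → P2.derivAux k p ≡ TK.derivAux k p
      derivAux≡ k [] = ≡.refl
      derivAux≡ k (a ∷ p) = ≡.cong₂ _∷_ (natMul≡ k a) (derivAux≡ (suc k) p)

    P2-+ : ∀ p p' → p P2.+P p' ≡ p TK.+P p'
    P2-+ p p' = ≡.trans (+≡ p p') (TK.raw-+ p p')

    P2-* : ∀ p p' → p P2.*P p' ≡ p TK.*P p'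
    P2-* p p' = ≡.trans (*≡ p p') (TK.raw-* p p')

    P2-deriv : ∀ p → P2.deriv p ≡ TK.deriv p
    P2-deriv [] = ≡.refl
    P2-deriv (a ∷ p) = derivAux≡ 1 p

    P2-eval : ∀ p x → P2.evalP p x ≡ TK.evalP p x
    P2-eval [] x = ≡.refl
    P2-eval (a ∷ p) x = ≡.trans (FK.raw-+ a _) (≡.cong (a FK.+P_) (≡.trans (FK.raw-* x _) (≡.cong (x FK.*P_) (P2-eval p x))))

  module ChowlaPolynomials (K : FiniteField) (E : FField) (ι : Hom (baseRing K) (FField.cring E)) (d : ℕ) where
    open Specialise K E ι d public
    open BivariateOps K
    private
      module FK = FieldTheory (BaseField.baseField K)
      module TK = PolyTheory (baseRing K [X])
      module K = FiniteField K
      module O = OverField K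
    open O using (Outcome)
    open FField E using (cring; isDomain; inverse; _≟_; 1≉0)
    open CommutativeRing cring hiding (zero)
    open FieldTheory E
    private
      module PS = Solver polyRing
      module TE = PolyTheory (cring [X])
      module Mφ = MapPoly φ
      module Mι₂ = MapPoly MP.polyHom
      Φ = Mφ.polyHom
      module ΦI = Iterate Φ
      module ΦO = OrbitPoly Φ
      descentT = polyDescent descentP

    record Node : Set where
      field
        α : Carrier
        k : ℕ
        k-odd : Odd k
        period : Period k α
    open Node public

    conjugates : Node → List Carrier
    conjugates nd = orb (k nd) (α nd)

    node-norm : Node → Poly → Poly
    node-norm nd = OrbitTheory.norm K E ι (k nd) (k-odd nd) (k nd)

    f₀-g : ∀ {n} (as : Outcome d n) → MP.mapP (f₀ as) ≋ g 0# as
    f₀-g [] = ∷-cong (sym (eval-const _ 0#)) PR.refl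
    f₀-g ((c ∷ a) ∷ as) = ∷-cong (sym (trans (+-congˡ (zeroˡ _)) (+-identityʳ _))) (f₀-g as)

    module _ {n : ℕ} (x : Outcome d n) where
      -- Equals -Σ_{j≥1} f_j(y) γ^j, so T - `rt` γ becomes f(γ, y) at T = f_0. It does not involve
      -- f_0.
      rt : Carrier → Poly
      rt γ = g 0# x +P -P g γ x

      rt-cong : ∀ {γ γ'} → γ ≈ γ' → rt γ ≋ rt γ'
      rt-cong e = PR.+-congˡ (PR.-‿cong (spec-cong (O.fPoly x) e))

      rt-φ : ∀ γ → Mφ.mapP (rt γ) ≋ rt (fr γ)
      rt-φ γ = PR.trans (Mφ.mapP-+ (g 0# x) _) (PR.+-cong (PR.trans (spec-σ φ fr-ι 0# (O.fPoly x)) (spec-cong (O.fPoly x) (Hom.0-homo φ)))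
        (PR.trans (Hom.-‿homo Φ (g γ x)) (PR.-‿cong (spec-σ φ fr-ι γ (O.fPoly x)))))

      iter-rt : ∀ j γ → ΦI.iter j (rt γ) ≋ rt (iter j γ)
      iter-rt zero γ = PR.refl
      iter-rt (suc j) γ = PR.trans (ΦI.iter-cong j (rt-φ γ)) (iter-rt j (fr γ))

      orb-rt : ∀ j γ → Pointwise _≋_ (map rt (orb j γ)) (ΦI.orb j (rt γ))
      orb-rt zero γ = []
      orb-rt (suc j) γ = PR.refl ∷ Pointwise.transitive PR.trans (orb-rt j (fr γ)) (ΦI.orb-cong j (PR.sym (rt-φ γ)))

      rt-returns : ∀ nd → ΦI.iter (k nd) (rt (α nd)) ≋ rt (α nd)
      rt-returns nd = PR.trans (iter-rt (k nd) (α nd)) (rt-cong (returns (period nd)))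

      descended : ∀ nd → ∃ λ R → Mι₂.mapP R TE.≋ TE.prodLin (ΦI.orb (k nd) (rt (α nd)))
      descended nd = Descent.descend descentT _ (ΦO.orbit-fixed (k nd) (rt-returns nd))

      -- The norm of T + Σ_{j≥1} f_j(y) α^j, a polynomial in T over F_q[y].
      normPoly : Node → TK.Poly
      normPoly nd = proj₁ (descended nd)

      private
        diffs-norm : ∀ nd j p r → Mφ.mapP p ≋ p → TE.diffs p (ΦI.orb j r) ≋ OrbitTheory.norm K E ι (k nd) (k-odd nd) j (p +P -P r)
        diffs-norm nd zero p r fp = PR.refl
        diffs-norm nd (suc j) p r fp = PR.*-congˡ (PR.trans (diffs-norm nd j p _ fp) (OrbitTheory.norm-cong K E ι (k nd) (k-odd nd) j
          (PR.sym (PR.trans (Mφ.mapP-+ p _) (PR.+-cong fp (Hom.-‿homo Φ r))))))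

      normPoly-value : ∀ nd p → MP.mapP (TK.evalP (normPoly nd) p) ≋ node-norm nd (MP.mapP p +P -P rt (α nd))
      normPoly-value nd p = PR.trans (Mι₂-eval (normPoly nd) p) (PR.trans (TE.eval-cong (proj₂ (descended nd)) PR.refl) (PR.trans (TE.eval-prodLin (ΦI.orb (k nd) (rt (α nd))) (MP.mapP p))
        (diffs-norm nd (k nd) (MP.mapP p) (rt (α nd)) (fixed-mapP p))))
        where Mι₂-eval = MapPoly.eval-map MP.polyHom

      -- `normPoly` depends on x only through the f_j with j ≥ 1. Changing column 0 therefore keeps
      -- the polynomial and moves the point T at which it is evaluated.
      normPoly-outcome : ∀ nd p → FK.DegLt n p → let f = addCol zero (coeffs p) x in MP.mapP (TK.evalP (normPoly nd) (f₀ f)) ≋ node-norm nd (g (α nd) f)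
      normPoly-outcome nd p dp = PR.trans (normPoly-value nd (f₀ f)) (OrbitTheory.norm-cong K E ι (k nd) (k-odd nd) (k nd)
        (PR.trans (PR.+-congʳ (PR.trans (f₀-g f) (g-addCol₀ 0# p x dp))) (PR.trans (PS.solve 3 (λ a b m → (a PS.:+ m) PS.:- (a PS.:- b) PS.:= b PS.:+ m) PR.refl (g 0# x) (g (α nd) x) (MP.mapP p))
          (PR.sym (g-addCol₀ (α nd) p x dp)))))
        where f = addCol zero (coeffs p) x

      rt-deg : ∀ γ → DegLt n (rt γ)
      rt-deg γ = monic-difference (g-monic 0# x) (g-monic γ x)

      private
        norm-monic : ∀ nd j {p m} → MonicDeg m p → ∃ λ m' → MonicDeg m' (OrbitTheory.norm K E ι (k nd) (k-odd nd) j p)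
        norm-monic nd zero mp = 0 , monicDeg-1
        norm-monic nd (suc j) mp = let m' , q = norm-monic nd j (Mφ.mapP-monicDeg mp) in _ , monicDeg-* mp q

        sub-monic : ∀ {p r} → MonicDeg n p → DegLt n r → MonicDeg n (p +P -P r)
        sub-monic {p} {r} (l & dp) dr = trans (coeff-+ n p _) (trans (+-cong l (vanish (degLt-neg dr) n ℕₚ.≤-refl)) (+-identityʳ 1#)) & degLt-+ dp (degLt-mono (ℕₚ.n≤1+n n) (degLt-neg dr))

      normPoly-monic : ∀ nd {p} → FK.MonicDeg n p → ∃ λ m → FK.MonicDeg m (TK.evalP (normPoly nd) p)
      normPoly-monic nd {p} mp = let m , q = norm-monic nd (k nd) (sub-monic (MP.mapP-monicDeg mp) (rt-deg (α nd))) in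
        m , monicDeg-reflect (monicDeg-cong (PR.sym (normPoly-value nd p)) q)

      YDeg : ℕ → TE.Poly → Set
      YDeg b p = ∀ i → DegLt (suc b) (TE.coeff i p)

      private
        yDeg-* : ∀ {a b} p p' → YDeg a p → YDeg b p' → YDeg (a ℕ.+ b) (p TE.*P p')
        yDeg-* [] p' _ _ i = degLt-cong (PR.sym (TE.at (TE.[]* p') i)) (dlt λ _ _ → refl)
        yDeg-* {a} {b} (c ∷ p) p' dp dp' i = degLt-cong (PR.sym (TE.coeff-∷* i c p p')) (degLt-+ (degLt-* c _ (dp 0) (dp' i)) (shifted i))
          where
            shifted : ∀ i → DegLt (suc (a ℕ.+ b)) (TE.coeff i (0P ∷ (p TE.*P p')))
            shifted zero = dlt λ _ _ → refl
            shifted (suc i) = yDeg-* p p' (λ i → dp (suc i)) dp' i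

        opaque
          unfolding PolyTheory.lin
          yDeg-lin : ∀ {r} → DegLt (suc n) r → YDeg n (TE.lin r)
          yDeg-lin dr zero = degLt-neg dr
          yDeg-lin dr (suc zero) = degLt-mono (s≤s z≤n) (degLt-length 1P)
          yDeg-lin dr (suc (suc i)) = dlt λ _ _ → refl

        yDeg-prodLin : ∀ rs → All (DegLt (suc n)) rs → YDeg (length rs ℕ.* n) (TE.prodLin rs)
        yDeg-prodLin [] _ zero = degLt-length 1P
        yDeg-prodLin [] _ (suc i) = dlt λ _ _ → refl
        yDeg-prodLin (r ∷ rs) (dr ∷ drs) = yDeg-* (TE.lin r) (TE.prodLin rs) (yDeg-lin dr) (yDeg-prodLin rs drs)

      module Pair (nd nd' : Node) (k≢k' : k nd ≢ k nd')
        (sep : ∀ γ γ' → γ ∈ conjugates nd ++ conjugates nd' → γ' ∈ conjugates nd ++ conjugates nd' → ¬ γ ≈ γ' → ¬ g γ x ≋ g γ' x) where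

        product : TK.Poly
        product = normPoly nd TK.*P normPoly nd'

        private
          rs = ΦI.orb (k nd) (rt (α nd)) ++ ΦI.orb (k nd') (rt (α nd'))

          length-rs : length rs ≡ k nd ℕ.+ k nd'
          length-rs = ≡.trans (Listₚ.length-++ (ΦI.orb (k nd) (rt (α nd)))) (≡.cong₂ ℕ._+_ (ΦI.length-orb (k nd) _) (ΦI.length-orb (k nd') _))

          rs-deg : All (DegLt (suc n)) rs
          rs-deg = Allₚ.++⁺ (ΦI.all-orb (k nd) _ (λ j _ → each j (α nd))) (ΦI.all-orb (k nd') _ (λ j _ → each j (α nd')))
            where
              each : ∀ j γ → DegLt (suc n) (ΦI.iter j (rt γ))
              each j γ = degLt-cong (PR.sym (iter-rt j γ)) (degLt-mono (ℕₚ.n≤1+n n) (rt-deg (iter j γ)))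

          Γ = conjugates nd ++ conjugates nd'

          -- Iterates of α keep its return time k, and iterates of α' keep k'. An equality would
          -- make the element with the larger period return too early.
          unrelated : ∀ i j → ¬ iter i (α nd) ≈ iter j (α nd')
          unrelated i j e with ℕₚ.<-cmp (k nd) (k nd')
          ... | tri< lt _ _ = minimal (period nd') (k nd) (positive (period nd)) lt (iter-injective j (trans (reflexive (iter-comm j (k nd) _)) (trans (iter-cong (k nd) (sym e)) (trans (reflexive (iter-comm (k nd) i _)) (trans (iter-cong i (returns (period nd))) e)))))
          ... | tri≈ _ e' _ = k≢k' e'
          ... | tri> _ _ gt = minimal (period nd) (k nd') (positive (period nd')) gt (iter-injective i (trans (reflexive (iter-comm i (k nd') _)) (trans (iter-cong (k nd') e) (trans (reflexive (iter-comm (k nd') j _)) (trans (iter-cong j (returns (period nd'))) (sym e))))))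

          Γ-distinct : Distinct Γ
          Γ-distinct = AllPairsₚ.++⁺ (period-distinct (period nd)) (period-distinct (period nd'))
            (all-orb (k nd) (α nd) (λ i _ → all-orb (k nd') (α nd') (λ j _ → unrelated i j)))

          separated : ∀ Δ → (∀ {γ} → γ ∈ Δ → γ ∈ Γ) → Distinct Δ → AllPairs (λ p p' → ¬ p ≋ p') (map rt Δ)
          separated [] _ _ = []
          separated (γ ∷ Δ) sub (n ∷ u) = Allₚ.map⁺ (All.tabulate (λ {γ'} γ'∈ e → sep γ γ' (sub (here ≡.refl)) (sub (there γ'∈)) (All.lookup n γ'∈) (same e))) ∷ separated Δ (λ γ∈ → sub (there γ∈)) u
            where
              same : ∀ {γ'} → rt γ ≋ rt γ' → g γ x ≋ g γ' x
              same {γ'} e = PR.trans (PS.solve 2 (λ a b → b PS.:= a PS.:- (a PS.:- b)) PR.refl (g 0# x) (g γ x)) (PR.trans (PR.+-congˡ (PR.-‿cong e)) (PS.solve 2 (λ a b → a PS.:- (a PS.:- b) PS.:= b) PR.refl (g 0# x) (g γ' x)))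

          distinct-resp : ∀ {ps ps'} → Pointwise _≋_ ps ps' → AllPairs (λ p p' → ¬ p ≋ p') ps → AllPairs (λ p p' → ¬ p ≋ p') ps'
          distinct-resp [] [] = []
          distinct-resp (e ∷ es) (n ∷ u) = heads es n ∷ distinct-resp es u
            where
              heads : ∀ {qs qs'} → Pointwise _≋_ qs qs' → All (λ p' → ¬ _ ≋ p') qs → All (λ p' → ¬ _ ≋ p') qs'
              heads [] [] = []
              heads (f ∷ fs) (m ∷ ms) = (λ h → m (PR.trans e (PR.trans h (PR.sym f)))) ∷ heads fs ms

          rs-distinct : AllPairs (λ p p' → ¬ p ≋ p') rs
          rs-distinct = distinct-resp (≡.subst (λ l → Pointwise _≋_ l rs) (≡.sym (Listₚ.map-++ rt (conjugates nd) (conjugates nd'))) (Pointwise.++⁺ (orb-rt (k nd) (α nd)) (orb-rt (k nd') (α nd'))))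
            (separated Γ (λ γ∈ → γ∈) Γ-distinct)

          product-roots : Mι₂.mapP product TE.≋ TE.prodLin rs
          product-roots = TE.PR.trans (Mι₂.mapP-* (normPoly nd) _) (TE.PR.trans (TE.PR.*-cong (proj₂ (descended nd)) (proj₂ (descended nd'))) (TE.PR.sym (TE.prodLin-++ (ΦI.orb (k nd) (rt (α nd))) _)))

          mapped-monic : TE.MonicDeg (k nd ℕ.+ k nd') (Mι₂.mapP product)
          mapped-monic = TE.monicDeg-cong (TE.PR.sym product-roots) (≡.subst (λ m → TE.MonicDeg m (TE.prodLin rs)) length-rs (TE.monicDeg-prodLin rs))

        -- `separable` at the level of F_q[y] inside E[y]: the roots in T are the `rt` γ, permuted
        -- by Frobenius acting on coefficients, and `sep` makes them distinct.
        separableT : O.SeparableT product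
        separableT = let S , U , c , nz , e = Separability.separable descentP poly-isDomain (k nd) (k nd') (rt (α nd)) (rt (α nd')) (rt-returns nd) (rt-returns nd') rs-distinct product product-roots
          in S , U , c , (λ z → nz (FK.mk z)) , λ i j → ≡.trans (≡.cong (FK.coeff j) (convert S U i)) (≡.trans (FK.at (TK.at e i) j) (≡.cong (FK.coeff j) (≡.sym (P2-coeff i (TK.constP c)))))
          where
            convert : ∀ S U i → O.P2.coeff i ((S O.P2.*P product) O.P2.+P (U O.P2.*P O.P2.deriv product)) ≡ TK.coeff i (S TK.*P product TK.+P U TK.*P TK.deriv product)
            convert S U i = ≡.trans (P2-coeff i ((S O.P2.*P product) O.P2.+P (U O.P2.*P O.P2.deriv product))) (≡.cong (TK.coeff i) (≡.trans (P2-+ (S O.P2.*P product) (U O.P2.*P O.P2.deriv product)) (≡.cong₂ TK._+P_ (P2-* S product) (≡.trans (P2-* U (O.P2.deriv product)) (≡.cong (U TK.*P_) (P2-deriv product))))))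

        posDegT : O.PosDegT product
        -- `PosDegT` asks for a coefficient of index i + 1, here the leading index k + k'.
        posDegT = ℕ.pred K₀ , λ z → monic-nonzero monicDeg-1 (PR.trans (PR.sym (TE.lead mapped-monic)) (PR.trans (Mι₂.coeff-map K₀ product)
            (Hom.⟦⟧-cong MP.polyHom (FK.mk {q = FK.0P} λ i → ≡.trans (≡.cong (FK.coeff i) (≡.trans (≡.sym (P2-coeff K₀ product)) (≡.cong (λ t → O.P2.coeff t product) (≡.sym suc-K₀)))) (z i)))))
          where
            K₀ = k nd ℕ.+ k nd'
            suc-K₀ : suc (ℕ.pred K₀) ≡ K₀
            suc-K₀ = ℕₚ.suc-pred K₀ {{ℕ.>-nonZero (ℕₚ.≤-trans (positive (period nd)) (ℕₚ.m≤m+n (k nd) (k nd')))}}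

        degT≤ : ∀ c → k nd ℕ.+ k nd' ℕ.≤ c → O.DegT≤ product (ℕtoℚ c)
        degT≤ c le i nz with i ℕ.≤? k nd ℕ.+ k nd'
        ... | yes le' = ℕtoℚ-mono (ℕₚ.≤-trans le' le)
        ... | no gt = ⊥-elim (nz (λ j → ≡.trans (≡.cong (FK.coeff j) (P2-coeff i product))
                (FK.at (Descent.injective descentP {TK.coeff i product} {FK.0P} (PR.trans (PR.sym (Mι₂.coeff-map i product)) (TE.vanish (TE.degLt mapped-monic) i (ℕₚ.≰⇒> gt)))) j)))

        -- The product has k + k' linear factors in T, and each of their coefficients has degree at
        -- most n in y.
        degY≤ : ∀ c → k nd ℕ.+ k nd' ℕ.≤ c → O.DegY≤ product (ℕtoℚ c ℚ.* ℕtoℚ n)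
        degY≤ c le i j nz with j ℕ.≤? c ℕ.* n
        ... | yes le' = ≡.subst (ℕtoℚ j ℚ.≤_) (ℕtoℚ-* c n) (ℕtoℚ-mono le')
        ... | no gt = ⊥-elim (nz (≡.trans (≡.cong (FK.coeff j) (P2-coeff i product)) (ι-injective (trans (sym (MP.coeff-map j (TK.coeff i product)))
                (trans (at (PR.trans (PR.sym (Mι₂.coeff-map i product)) (TE.at product-roots i)) j)
                  (trans (vanish (yDeg-prodLin rs rs-deg i) j (ℕₚ.≤-trans (s≤s (ℕₚ.*-monoˡ-≤ n (≡.subst (ℕ._≤ c) (≡.sym length-rs) le))) (ℕₚ.≰⇒> gt))) (sym (Hom.0-homo ι))))))))

  module GoodFibres (K : FiniteField) (E : FField) (ι : Hom (baseRing K) (FField.cring E)) (d : ℕ)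
    (lam : OverField.Poly K → ℤ) (isL : OverField.IsLiouville K lam) where
    open ChowlaPolynomials K E ι d public
    open Liouville K lam isL
    open BivariateOps K
    private
      module FK = FieldTheory (BaseField.baseField K)
      module TK = PolyTheory (baseRing K [X])
      module K = FiniteField K
      module O = OverField K
    open O using (Outcome)
    open FField E using (cring; isDomain; _≟_)
    open CommutativeRing cring hiding (zero)
    open FieldTheory E

    allConjugates : List Node → List Carrier
    allConjugates = concatMap conjugates

    Separated : ∀ {n} → List Node → Outcome d n → Set
    Separated nodes as = ∀ γ γ' → γ ∈ allConjugates nodes → γ' ∈ allConjugates nodes → ¬ γ ≈ γ' → ¬ g γ as ≋ g γ' as

    -- One sign for all nodes. The norm over F_q is described through its image in E[y], hence the
    -- quantification over its preimages N.
    ConstantSign : ∀ {n} → List Node → Outcome d n → Set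
    ConstantSign nodes as = ∃ λ ε → ∣ ε ∣ ≡ 1 × All (λ nd → ∀ N → MP.mapP N ≋ node-norm nd (g (α nd) as) → lam N ≡ ε) nodes

    module _ {n : ℕ} where
      private
        hs = allVecs K.elems n

        monicPoly : Vec K.F n → FK.Poly
        monicPoly v = toList v ++ [ K.1# ]

        monicPoly-monic : ∀ {m} (v : Vec K.F m) → FK.MonicDeg m (toList v ++ [ K.1# ])
        monicPoly-monic [] = FK.monicDeg-1
        monicPoly-monic (c ∷ v) with monicPoly-monic v
        ... | l FK.& FK.dlt w = l FK.& FK.dlt λ { (suc i) (s≤s le) → w i le }

        u : Outcome d n → Node → Vec K.F n → ℤ
        u x nd v = lam (TK.evalP (normPoly x nd) (monicPoly v))

      open Moments hs

      -- With the f_j for j ≥ 1 fixed, f_0 ranges over all monic polynomials of degree n. The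
      -- correlation of the signs at two nodes is then the Chowla sum of the product of their norm
      -- polynomials, and `constant-count` applies.
      good-fibre : ∀ nodes → 0 ℕ.< length nodes → AllPairs (λ nd nd' → k nd ≢ k nd') nodes →
        (c : ℕ) → All (λ nd → k nd ℕ.+ k nd ℕ.≤ c) nodes →
        (∀ Fp → O.SeparableT Fp → O.PosDegT Fp → O.DegY≤ Fp (ℕtoℚ c ℚ.* ℕtoℚ n) → O.DegT≤ Fp (ℕtoℚ c) →
          length nodes ℕ.* ∣ O.chowlaSum lam Fp n ∣ ℕ.≤ K.card ℕ.^ n) →
        ∀ (x : Outcome d n) J → Unique J →
        All (λ (v : Vec K.F n) → let f = addCol zero (coeffs (toList v)) x in Separated nodes f × ConstantSign nodes f) J →
        length nodes ℕ.* length J ℕ.≤ 2 ℕ.* K.card ℕ.^ n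
      good-fibre nodes pos ks c bounds chowla x [] _ _ = ℕₚ.≤-trans (ℕₚ.≤-reflexive (ℕₚ.*-zeroʳ (length nodes))) z≤n
      good-fibre nodes pos ks c bounds chowla x J@(v₀ ∷ _) uJ all@((sep₀ , _) ∷ _) =
        ≡.subst₂ (λ a b → a ℕ.≤ 2 ℕ.* b) (≡.cong₂ ℕ._*_ (Listₚ.length-map (u x) nodes) (Listₚ.length-map col J)) (length-allVecs K.elems n)
          (constant-count (map (u x) nodes) (Allₚ.map⁺ (All.universal squares nodes))
            (≡.subst (λ M → AllPairs (λ a b → M ℕ.* ∣ Sum (λ h → a h ℤ.* b h) ∣ ℕ.≤ length hs) (map (u x) nodes)) (≡.sym (Listₚ.length-map (u x) nodes))
              (AllPairsₚ.map⁺ (pairs nodes (λ nd∈ → nd∈) ks)))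
            (≡.subst (0 ℕ.<_) (≡.sym (Listₚ.length-map (u x) nodes)) pos)
            (map col J) (Uniqueₚ.map⁺ (λ {v} {w} → column₀-addCol v w x) uJ) (λ _ → allVecs-complete K.elems-complete _)
            (Allₚ.map⁺ (All.map (λ {v} good → constants v (proj₂ good)) all)))
        where
          col : Vec K.F n → Vec K.F n
          col v = column₀ (addCol zero (coeffs (toList v)) x)
          -- The translation adds the same polynomial to f(γ, y) and f(γ', y). Separation is thus a
          -- property of the whole fibre, and one member of `J` suffices to supply it.
          sep : Separated nodes x
          sep γ γ' γ∈ γ'∈ ne e = sep₀ γ γ' γ∈ γ'∈ ne (PR.trans (g-addCol₀ γ (toList v₀) x (toList-deg v₀)) (PR.trans (PR.+-congʳ e) (PR.sym (g-addCol₀ γ' (toList v₀) x (toList-deg v₀)))))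
          squares : ∀ nd h → h ∈ hs → u x nd h ℤ.* u x nd h ≡ ℤ.+ 1
          squares nd h _ = let r , e = lam-monic (proj₂ (normPoly-monic x nd (monicPoly-monic h))) in ≡.trans (≡.cong₂ ℤ._*_ e e) (signℤ-square r)
          constants : ∀ v → ConstantSign nodes (addCol zero (coeffs (toList v)) x) → ∃ λ ε → ∣ ε ∣ ≡ 1 × All (λ a → a (col v) ≡ ε) (map (u x) nodes)
          constants v (ε , unit , signs) = ε , unit , Allₚ.map⁺ (All.map (λ {nd} s → s (TK.evalP (normPoly x nd) (monicPoly (col v))) (normPoly-outcome x nd (toList v) (toList-deg v))) signs)
          pair : ∀ nd nd' → nd ∈ nodes → nd' ∈ nodes → k nd ≢ k nd' → length nodes ℕ.* ∣ Sum (λ h → u x nd h ℤ.* u x nd' h) ∣ ℕ.≤ length hs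
          pair nd nd' nd∈ nd'∈ ne = ≡.subst₂ (λ a b → length nodes ℕ.* ∣ a ∣ ℕ.≤ b) sums (≡.sym (length-allVecs K.elems n))
            (chowla P.product P.separableT P.posDegT (P.degY≤ c small) (P.degT≤ c small))
            where
              member : ∀ {γ} → γ ∈ conjugates nd ++ conjugates nd' → γ ∈ allConjugates nodes
              member γ∈ with Anyₚ.++⁻ (conjugates nd) γ∈
              ... | inj₁ i = Anyₚ.concatMap⁺ conjugates (Any.map (λ { ≡.refl → i }) nd∈)
              ... | inj₂ i = Anyₚ.concatMap⁺ conjugates (Any.map (λ { ≡.refl → i }) nd'∈)
              module P = Pair x nd nd' ne (λ γ γ' γ∈ γ'∈ → sep γ γ' (member γ∈) (member γ'∈))
              small : k nd ℕ.+ k nd' ℕ.≤ c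
              small with ℕₚ.≤-total (k nd) (k nd')
              ... | inj₁ le = ℕₚ.≤-trans (ℕₚ.+-monoˡ-≤ (k nd') le) (All.lookup bounds nd'∈)
              ... | inj₂ le = ℕₚ.≤-trans (ℕₚ.+-monoʳ-≤ (k nd) le) (All.lookup bounds nd∈)
              each : ∀ v → lam (O.P2.evalP P.product (monicPoly v)) ≡ u x nd v ℤ.* u x nd' v
              each v = ≡.trans (lam-cong (FK.PR.trans (FK.PR.reflexive (P2-eval P.product (monicPoly v))) (TK.eval-* (normPoly x nd) (normPoly x nd') (monicPoly v))))
                (lam-* (proj₂ (normPoly-monic x nd (monicPoly-monic v))) (proj₂ (normPoly-monic x nd' (monicPoly-monic v))))
              sums : O.chowlaSum lam P.product n ≡ Sum (λ h → u x nd h ℤ.* u x nd' h)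
              sums = ≡.cong sumℤ (≡.trans (≡.sym (Listₚ.map-∘ hs)) (Listₚ.map-cong each hs))
          pairs : ∀ nds → (∀ {nd} → nd ∈ nds → nd ∈ nodes) → AllPairs (λ nd nd' → k nd ≢ k nd') nds →
            AllPairs (λ nd nd' → length nodes ℕ.* ∣ Sum (λ h → u x nd h ℤ.* u x nd' h) ∣ ℕ.≤ length hs) nds
          pairs [] _ [] = []
          pairs (nd ∷ nds) sub (n ∷ ns) = All.tabulate (λ {nd'} nd'∈ → pair nd nd' (sub (here ≡.refl)) (sub (there nd'∈)) (All.lookup n nd'∈)) ∷ pairs nds (λ nd∈ → sub (there nd∈)) ns

open ChowlaSums

-- Finite fields containing all roots needed for a given n.

module SplittingSettings where
  open import Algebra.Bundles using (CommutativeRing)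
  open import Data.Nat as ℕ using (ℕ; zero; suc; z≤n; s≤s)
  import Data.Nat.Properties as ℕₚ
  open import Data.Fin using (zero; suc)
  open import Data.Vec using ([]; _∷_)
  open import Data.List using (List; []; _∷_; map; _++_; concatMap; applyUpTo)
  import Data.List.Properties as Listₚ
  open import Data.List.Relation.Unary.All as All using (All; []; _∷_)
  open import Data.List.Relation.Unary.Any as Any using (Any)
  import Data.List.Relation.Unary.Any.Properties as Anyₚ
  import Data.List.Relation.Unary.All.Properties as Allₚ
  open import Data.List.Relation.Unary.AllPairs using ([]; _∷_)
  open import Data.List.Membership.Propositional using (_∈_)
  import Data.List.Membership.Propositional.Properties as ∈ₚ
  open import Data.Product using (Σ; ∃; _,_; proj₁; proj₂)
  open import Relation.Binary.PropositionalEquality as ≡ using (_≡_)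

  module Extensions (K : FiniteField) (d : ℕ) where
    private
      module K = FiniteField K
      module O = OverField K
      K₀ = BaseField.baseField K
      module FK = FieldTheory K₀
      module Id = Frobenius K K₀ idH
    open O using (Outcome)

    mapP-XQ-X : ∀ {A B : FField} (ιA : Hom (baseRing K) (FField.cring A)) (ιB : Hom (baseRing K) (FField.cring B)) (h : Hom (FField.cring A) (FField.cring B)) Q →
      PolyTheory._≋_ (FField.cring B) (MapPoly.mapP h (Frobenius.XQ-X K A ιA Q)) (Frobenius.XQ-X K B ιB Q)
    mapP-XQ-X {A} {B} ιA ιB h Q = PR.trans (Mh.mapP-+ (FA.Xpow Q) _) (PR.+-cong (powers Q) (PR.trans (Hom.-‿homo Mh.polyHom (FA.Xpow 1)) (PR.-‿cong (powers 1))))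
      where
        open FieldTheory B
        module FA = FieldTheory A
        module Mh = MapPoly h
        powers : ∀ n → Mh.mapP (FA.Xpow n) ≋ Xpow n
        powers zero = Hom.1-homo Mh.polyHom
        powers (suc n) = ∷-cong (Hom.0-homo h) (powers n)

    module Transport (A B : FField) (ιA : Hom (baseRing K) (FField.cring A)) (h : Hom (FField.cring A) (FField.cring B)) where
      private
        module SA = ChowlaPolynomials K A ιA d
        module SB = ChowlaPolynomials K B (h ∘H ιA) d
        module Mh = MapPoly h
        module FA = FieldTheory A
      open FField B using (cring)
      open CommutativeRing cring hiding (zero)
      open FieldTheory B
      open Hom h

      iter-transport : ∀ n x → ⟦ SA.iter n x ⟧ ≈ SB.iter n ⟦ x ⟧
      iter-transport zero x = refl
      iter-transport (suc n) x = trans (iter-transport n (SA.fr x)) (SB.iter-cong n (Mh.pow-homo SA.q x))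

      node-transport : SA.Node → SB.Node
      node-transport nd = record
        { α = ⟦ SA.α nd ⟧ ; k = SA.k nd ; k-odd = SA.k-odd nd
        ; period = record
          { positive = SA.positive (SA.period nd)
          ; returns = trans (sym (iter-transport (SA.k nd) (SA.α nd))) (⟦⟧-cong (SA.returns (SA.period nd)))
          ; minimal = λ j 0<j j<k e → SA.minimal (SA.period nd) j 0<j j<k (field-hom-injective A B h (trans (iter-transport j (SA.α nd)) e)) } }

      g-transport : ∀ {n} α (as : Outcome d n) → Mh.mapP (SA.g α as) ≋ SB.g ⟦ α ⟧ as
      g-transport α as = go (O.fPoly as)
        where
          go : ∀ f → Mh.mapP (SA.spec α f) ≋ SB.spec ⟦ α ⟧ f
          go [] = PR.refl
          go (a ∷ f) = ∷-cong (trans (Mh.eval-map (MapPoly.mapP ιA a) α) (eval-cong (PR.reflexive (≡.sym (mapP-∘ h ιA a))) refl)) (go f)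

    -- Stands in for an algebraic closure: the points α, all roots of f(α, y) for the finitely many
    -- outcomes of length n, and the fields F_(q^s) for s ≤ n, all inside one finite field.
    record Setting (ks : List ℕ) (n : ℕ) : Set₁ where
      field
        E : FField
        ι : Hom (baseRing K) (FField.cring E)
      open ChowlaPolynomials K E ι d
      field
        nodes : List Node
        nodes-k : map k nodes ≡ ks
        splits-g : ∀ nd → nd ∈ nodes → ∀ (as : Outcome d n) → Splits E (g (α nd) as)
        splits-X : ∀ s → 0 ℕ.< s → s ℕ.≤ n → Splits E (XQ-X (q ℕ.^ s))

    allOutcomes : ∀ n → List (Outcome d n)
    allOutcomes n = allVecs (allVecs K.elems (suc d)) n

    outcome-complete : ∀ {n} (as : Outcome d n) → as ∈ allOutcomes n
    outcome-complete = allVecs-complete (allVecs-complete K.elems-complete)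

    private
      0<3^ : ∀ j → 0 ℕ.< 3 ℕ.^ j
      0<3^ j = ℕₚ.m^n>0 3 j

      base-poly : ℕ → FK.Poly
      base-poly j = Id.XQ-X (K.card ℕ.^ (3 ℕ.^ suc j))

      1<card^ : ∀ n → 0 ℕ.< n → 1 ℕ.< K.card ℕ.^ n
      1<card^ = PrimitiveElements.1<q^ K K₀ idH

    module _ (ks : List ℕ) (n : ℕ) (E₁ : FField) (h₁ : Hom (baseRing K) (FField.cring E₁)) where
      private
        module S₁ = ChowlaPolynomials K E₁ h₁ d

        g-polys : List S₁.Node → List (PolyTheory.Poly (FField.cring E₁))
        g-polys = concatMap (λ nd → map (S₁.g (S₁.α nd)) (allOutcomes n))

        X-poly : ℕ → PolyTheory.Poly (FField.cring E₁)
        X-poly s = S₁.XQ-X (K.card ℕ.^ suc s)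

        g-monics : ∀ nds → All (λ P → ∃ λ m → PolyTheory.MonicDeg (FField.cring E₁) m P) (g-polys nds)
        g-monics [] = []
        g-monics (nd ∷ nds) = Allₚ.++⁺ (Allₚ.map⁺ (All.universal (λ as → n , S₁.g-monic (S₁.α nd) as) (allOutcomes n))) (g-monics nds)

        X-monics : All (λ P → ∃ λ m → PolyTheory.MonicDeg (FField.cring E₁) m P) (applyUpTo X-poly n)
        X-monics = Allₚ.applyUpTo⁺₂ X-poly n (λ s → K.card ℕ.^ suc s , S₁.monicDeg-XQ-X (K.card ℕ.^ suc s) (1<card^ (suc s) (s≤s z≤n)))

        finish : ∀ nodes₁ → map S₁.k nodes₁ ≡ ks →
          Σ (Extension E₁) (λ { (E₂ , h₂) → All (λ P → Splits E₂ (MapPoly.mapP h₂ P)) (g-polys nodes₁ ++ applyUpTo X-poly n) }) → Setting ks n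
        finish nodes₁ nodes₁-k ((E₂ , h₂) , splits) = record
          { E = E₂ ; ι = h₂ ∘H h₁
          ; nodes = map T.node-transport nodes₁
          ; nodes-k = ≡.trans (≡.sym (Listₚ.map-∘ nodes₁)) nodes₁-k
          ; splits-g = split-g
          ; splits-X = split-X }
          where
            module T = Transport E₁ E₂ h₁ h₂
            module S₂ = ChowlaPolynomials K E₂ (h₂ ∘H h₁) d
            splits-resp : ∀ {p p'} → PolyTheory._≋_ (FField.cring E₂) p p' → Splits E₂ p → Splits E₂ p'
            splits-resp e (bs , f) = bs , PolyTheory.≋-trans _ (PolyTheory.≋-sym _ e) f
            split-g : ∀ nd → nd ∈ map T.node-transport nodes₁ → ∀ (as : Outcome d n) → Splits E₂ (S₂.g (S₂.α nd) as)
            split-g nd nd∈ as with ∈ₚ.∈-map⁻ T.node-transport nd∈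
            ... | nd₁ , nd₁∈ , ≡.refl = splits-resp (T.g-transport (S₁.α nd₁) as) (All.lookup splits
                    (∈ₚ.∈-++⁺ˡ (Anyₚ.concatMap⁺ (λ nd → map (S₁.g (S₁.α nd)) (allOutcomes n)) (Any.map (λ { ≡.refl → ∈ₚ.∈-map⁺ (S₁.g (S₁.α nd₁)) (outcome-complete as) }) nd₁∈))))
            split-X : ∀ s → 0 ℕ.< s → s ℕ.≤ n → Splits E₂ (S₂.XQ-X (K.card ℕ.^ s))
            split-X (suc s) _ lt = splits-resp (mapP-XQ-X {E₁} {E₂} h₁ (h₂ ∘H h₁) h₂ (K.card ℕ.^ suc s)) (All.lookup splits (∈ₚ.∈-++⁺ʳ (g-polys nodes₁) (∈ₚ.∈-applyUpTo⁺ X-poly lt)))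

      extend-setting : ∀ nodes₁ → map S₁.k nodes₁ ≡ ks → Setting ks n
      extend-setting nodes₁ e = finish nodes₁ e (splitting-field E₁ (g-polys nodes₁ ++ applyUpTo X-poly n) (Allₚ.++⁺ (g-monics nodes₁) X-monics))

    private
      start : ∀ js n → Σ (Extension K₀) (λ { (E₁ , h₁) → All (λ P → Splits E₁ (MapPoly.mapP h₁ P)) (map base-poly js) }) → Setting (map (λ j → 3 ℕ.^ suc j) js) n
      start js n ((E₁ , h₁) , splits) = extend-setting (map (λ j → 3 ℕ.^ suc j) js) n E₁ h₁ (proj₁ (make js splits)) (proj₂ (make js splits))
        where
          module S₁ = ChowlaPolynomials K E₁ h₁ d
          make-node : ∀ j → Splits E₁ (MapPoly.mapP h₁ (base-poly j)) → S₁.Node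
          make-node j (bs , e) = let α , per = S₁.odd-period-element j (bs , PolyTheory.≋-trans _ (PolyTheory.≋-sym _ (mapP-XQ-X {K₀} {E₁} idH h₁ h₁ (K.card ℕ.^ (3 ℕ.^ suc j)))) e)
            in record { α = α ; k = 3 ℕ.^ suc j ; k-odd = odd-3^ (suc j) ; period = per }
          make : ∀ js → All (λ P → Splits E₁ (MapPoly.mapP h₁ P)) (map base-poly js) → Σ (List S₁.Node) λ nds → map S₁.k nds ≡ map (λ j → 3 ℕ.^ suc j) js
          make [] [] = [] , ≡.refl
          make (j ∷ js) (s ∷ ss) = make-node j s ∷ proj₁ (make js ss) , ≡.cong (3 ℕ.^ suc j ∷_) (proj₂ (make js ss))

    -- Two extensions in succession: the points α must exist before the polynomials f(α, y) that are
    -- to split can be written down.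
    setting : ∀ js n → Setting (map (λ j → 3 ℕ.^ suc j) js) n
    setting js n = start js n (splitting-field K₀ (map base-poly js)
      (Allₚ.map⁺ (All.universal (λ j → K.card ℕ.^ (3 ℕ.^ suc j) , Id.monicDeg-XQ-X (K.card ℕ.^ (3 ℕ.^ suc j)) (1<card^ (3 ℕ.^ suc j) (0<3^ (suc j)))) js)))

open SplittingSettings

-- Bounds for the exceptional outcomes and for the event.

module EventCount where
  open import Algebra.Bundles using (CommutativeRing)
  open import Data.Nat as ℕ using (ℕ; zero; suc; z≤n; s≤s)
  import Data.Nat.Properties as ℕₚ
  import Data.Nat.DivMod as DivMod
  open import Data.Nat.Solver using (module +-*-Solver)
  open import Data.Nat.ListAction using (sum)
  open import Data.Integer as ℤ using (ℤ; ∣_∣)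
  import Data.Integer.Properties as ℤₚ
  open import Data.Rational as ℚ using (ℚ)
  open import Data.Fin using (Fin; zero; suc)
  open import Data.Vec as Vec using (Vec; []; _∷_; toList)
  open import Data.List using (List; []; _∷_; map; length; cartesianProduct)
  import Data.List.Properties as Listₚ
  open import Data.List.Relation.Unary.All as All using (All; []; _∷_)
  open import Data.List.Relation.Unary.Any as Any using (Any; here; there)
  import Data.List.Relation.Unary.All.Properties as Allₚ
  open import Data.List.Relation.Unary.AllPairs as AllPairs using (AllPairs; []; _∷_)
  import Data.List.Relation.Unary.AllPairs.Properties as AllPairsₚ
  open import Data.List.Relation.Unary.Unique.Propositional using (Unique)
  open import Data.List.Membership.Propositional using (_∈_)
  import Data.List.Membership.Propositional.Properties as ∈ₚ
  open import Data.Product using (∃; _×_; _,_; proj₁; proj₂)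
  open import Data.Sum using (_⊎_; inj₁; inj₂)
  open import Data.Empty using (⊥-elim)
  open import Relation.Nullary using (¬_; Dec; yes; no; ¬?)
  open import Relation.Nullary.Decidable using (_×-dec_)
  open import Relation.Binary.PropositionalEquality as ≡ using (_≡_; _≢_)

  module FinalCount (K : FiniteField) (odd : FiniteField.card K ℕ.% 2 ≡ 1) (d′ : ℕ)
    (lam : OverField.Poly K → ℤ) (isL : OverField.IsLiouville K lam) (ks : List ℕ) (n : ℕ)
    (S : Extensions.Setting K (suc d′) ks n) where
    private
      d = suc d′
      module K = FiniteField K
      module O = OverField K
      module FK = FieldTheory (BaseField.baseField K)
    open O using (Outcome)
    open Extensions K d using (allOutcomes; outcome-complete)
    open Extensions.Setting S
    open GoodFibres K E ι d lam isL
    open FField E using (cring; isDomain; _≟_)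
    open CommutativeRing cring hiding (zero)
    open FieldTheory E

    X₀ : ℕ
    X₀ = K.card ℕ.^ (suc d ℕ.* n)

    length-outcomes : length (allOutcomes n) ≡ X₀
    length-outcomes = ≡.trans (length-allVecs (allVecs K.elems (suc d)) n) (≡.trans (≡.cong (ℕ._^ n) (length-allVecs K.elems (suc d))) (ℕₚ.^-*-assoc K.card (suc d) n))

    -- If at most C / M of the q^m translates of any outcome lie in P, then P has density at most C
    -- / (M q^m).
    count-by : ∀ {m} (j : Fin (suc d)) (τ : Vec K.F m → FK.Poly) (P : Outcome d n → Set) M C L → Unique L → All P L →
      (∀ x J → Unique J → All (λ v → P (addCol j (coeffs (τ v)) x)) J → M ℕ.* length J ℕ.≤ C) → M ℕ.* (length L ℕ.* q ℕ.^ m) ℕ.≤ C ℕ.* X₀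
    count-by {m} j τ P M C L uL aL fibre = ≡.subst₂ (λ a b → M ℕ.* (length L ℕ.* a) ℕ.≤ C ℕ.* b) (length-allVecs K.elems m) length-outcomes
      (translate-count (allOutcomes n) outcome-complete (allVecs K.elems m) (allVecs-unique K.elems-unique m)
        (λ v → addCol j (coeffs (τ v))) (λ v → addCol j (λ i → K.- coeffs (τ v) i)) (λ v x → addCol-cancel j (coeffs (τ v)) x) P {M} {C} L uL aL fibre)

    subsingleton : ∀ {A : Set} {P : A → Set} J → Unique J → All P J → (∀ v w → P v → P w → v ≡ w) → 1 ℕ.* length J ℕ.≤ 1
    subsingleton [] _ _ _ = z≤n
    subsingleton (_ ∷ []) _ _ _ = ℕₚ.≤-refl
    subsingleton (v ∷ w ∷ _) ((ne ∷ _) ∷ _) (p ∷ p' ∷ _) eq = ⊥-elim (ne (eq v w p p'))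

    q>0 : 0 ℕ.< q
    q>0 = ℕₚ.<⇒≤ 1<q

    q^>0 : ∀ m → 0 ℕ.< q ℕ.^ m
    q^>0 m = ℕₚ.m^n>0 q {{ℕ.>-nonZero q>0}} m

    n<q^n : ∀ m → m ℕ.< q ℕ.^ m
    n<q^n zero = s≤s z≤n
    n<q^n (suc m) = ℕₚ.≤-trans (s≤s (n<q^n m)) (ℕₚ.≤-trans (ℕₚ.+-monoˡ-≤ (q ℕ.^ m) (q^>0 m))
      (≡.subst (ℕ._≤ q ℕ.^ suc m) (≡.cong (q ℕ.^ m ℕ.+_) (ℕₚ.+-identityʳ _)) (ℕₚ.*-monoˡ-≤ (q ℕ.^ m) 1<q)))

    SmallRoot : Node → ℕ → Outcome d n → Set
    SmallRoot nd s f = s ℕ.+ s ℕ.≤ n × ∃ λ β → Period s β × DoubleRoot (α nd) β f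

    LargeRoot : Node → Outcome d n → Set
    LargeRoot nd f = (¬ deriv (g (α nd) f) ≋ 0P) × ∃ λ s → ∃ λ β → n ℕ.< s ℕ.+ s × Period s β × DoubleRoot (α nd) β f

    private
      period-resp : ∀ {s β β'} → β ≈ β' → Period s β → Period s β'
      period-resp {s} e per = record
        { positive = positive per ; returns = trans (iter-cong s (sym e)) (trans (returns per) e)
        ; minimal = λ j 0<j j<s r → minimal per j 0<j j<s (trans (iter-cong j e) (trans r (sym e))) }

      double-resp : ∀ γ {β β'} (f : Outcome d n) → β ≈ β' → DoubleRoot γ β f → DoubleRoot γ β' f
      double-resp γ f e (r , r') = trans (eval-cong {g γ f} {g γ f} PR.refl (sym e)) r , trans (eval-cong {deriv (g γ f)} {deriv (g γ f)} PR.refl (sym e)) r'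

    -- There are q^s candidates for β, and for each one the density is at most q^(-2s). The list is
    -- split first because 2s ≤ n is read off from one of its members.
    small-count : ∀ nd s → 0 ℕ.< s → ∀ L → Unique L → All (SmallRoot nd s) L → q ℕ.^ s ℕ.* length L ℕ.≤ X₀
    small-count nd s 0<s [] _ _ = ℕₚ.≤-trans (ℕₚ.≤-reflexive (ℕₚ.*-zeroʳ (q ℕ.^ s))) z≤n
    small-count nd s 0<s L@(_ ∷ _) uL aL@((le , _) ∷ _) = ℕₚ.*-cancelˡ-≤ (q ℕ.^ s) {{ℕ.>-nonZero (q^>0 s)}} (begin
      q ℕ.^ s ℕ.* (q ℕ.^ s ℕ.* length L) ≡⟨ ≡.trans (≡.sym (ℕₚ.*-assoc (q ℕ.^ s) (q ℕ.^ s) _)) (≡.cong (ℕ._* length L) (≡.sym (ℕₚ.^-distribˡ-+-* q s s))) ⟩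
      q ℕ.^ (s ℕ.+ s) ℕ.* length L ≤⟨ cover-count zs (λ z f → Period s z × DoubleRoot (α nd) z f) {q ℕ.^ (s ℕ.+ s)} {X₀} L uL
         (All.map (λ {f} → locate f) aL) (λ z _ → each z) ⟩
      X₀ ℕ.* length zs ≡⟨ ≡.trans (≡.cong (X₀ ℕ.*_) (proj₁ (proj₂ pts))) (ℕₚ.*-comm X₀ _) ⟩
      q ℕ.^ s ℕ.* X₀ ∎)
      where
        open ℕₚ.≤-Reasoning
        pts = fieldPoints s 0<s (splits-X s 0<s (ℕₚ.≤-trans (ℕₚ.m≤m+n s s) le))
        zs = proj₁ pts
        locate : ∀ f → SmallRoot nd s f → Any (λ z → Period s z × DoubleRoot (α nd) z f) zs
        locate f (_ , β , per , dbl) = Any.map (λ e → period-resp e per , double-resp (α nd) f e dbl) (proj₁ (proj₂ (proj₂ pts)) β (returns per))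
        each : ∀ z L' → Unique L' → All (λ f → Period s z × DoubleRoot (α nd) z f) L' → q ℕ.^ (s ℕ.+ s) ℕ.* length L' ℕ.≤ X₀
        each z L' u a = ≡.subst₂ ℕ._≤_ (≡.trans (ℕₚ.*-identityˡ _) (ℕₚ.*-comm (length L') _)) (ℕₚ.*-identityˡ X₀)
          (count-by zero toList (λ f → Period s z × DoubleRoot (α nd) z f) 1 1 L' u a
            (λ x J uJ aJ → subsingleton J uJ aJ (λ v w pv pw → small-fibre (α nd) x le (proj₁ pv) v w (proj₂ pv) (proj₂ pw))))

    -- All translates by v(y^q) share one nonzero derivative, of degree below n. The double roots of
    -- different translates are different roots of it, so at most n translates have one.
    large-count : ∀ nd m → suc (m ℕ.* q) ℕ.≤ n → ∀ L → Unique L → All (LargeRoot nd) L → length L ℕ.* q ℕ.^ m ℕ.≤ n ℕ.* X₀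
    large-count nd m le L uL aL = ≡.subst (ℕ._≤ n ℕ.* X₀) (ℕₚ.*-identityˡ _) (count-by {m} zero spread (LargeRoot nd) 1 n L uL aL fibre)
      where
        LR : Outcome d n → Vec K.F m → Set
        LR x v = LargeRoot nd (addCol zero (coeffs (spread v)) x)
        fibre : ∀ x J → Unique J → All (LR x) J → 1 ℕ.* length J ℕ.≤ n
        fibre x [] _ _ = z≤n
        fibre x J@(v₀ ∷ _) uJ aJ@((nz , _) ∷ _) = ≡.subst (ℕ._≤ n) (≡.sym (ℕₚ.*-identityˡ _)) (decide (length J ℕ.≤? n))
          where
            H = deriv (g (α nd) x)
            same : ∀ v → deriv (g (α nd) (addCol zero (coeffs (spread v)) x)) ≋ H
            same v = deriv-addCol-spread (α nd) x v le
            root : ∀ v → LR x v → Carrier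
            root v (_ , _ , β , _) = β
            collect : ∀ J → All (LR x) J → List Carrier
            collect [] [] = []
            collect (v ∷ J) (p ∷ ps) = root v p ∷ collect J ps
            collect-length : ∀ J ps → length (collect J ps) ≡ length J
            collect-length [] [] = ≡.refl
            collect-length (v ∷ J) (p ∷ ps) = ≡.cong suc (collect-length J ps)
            collect-roots : ∀ J ps → Roots H (collect J ps)
            collect-roots [] [] = []
            collect-roots (v ∷ J) ((_ , _ , β , _ , _ , _ , r') ∷ ps) = trans (eval-cong (PR.sym (same v)) refl) r' ∷ collect-roots J ps
            distinct-from : ∀ v (p : LR x v) J ps → All (λ w → v ≢ w) J → All (λ β → ¬ root v p ≈ β) (collect J ps)
            distinct-from v p [] [] [] = []
            distinct-from v p@(_ , s , β , lt , per , r , _) (w ∷ J) (p'@(_ , _ , β' , _ , _ , r₁ , _) ∷ ps) (ne ∷ nes) =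
              (λ e → ne (large-fibre (α nd) x le lt per v w r (trans (eval-cong {g (α nd) (addCol zero (coeffs (spread w)) x)} {g (α nd) (addCol zero (coeffs (spread w)) x)} PR.refl e) r₁))) ∷ distinct-from v p J ps nes
            collect-distinct : ∀ J ps → Unique J → Distinct (collect J ps)
            collect-distinct [] [] [] = []
            collect-distinct (v ∷ J) (p ∷ ps) (n ∷ u) = distinct-from v p J ps n ∷ collect-distinct J ps u
            degree : DegLt n H
            degree = degLt-deriv (degLt (g-monic (α nd) x))
            decide : Dec (length J ℕ.≤ n) → length J ℕ.≤ n
            decide (yes p) = p
            decide (no np) = ⊥-elim (nz (PR.trans (same v₀) (too-many-roots H (collect J aJ)
              (degLt-mono (≡.subst (n ℕ.≤_) (≡.sym (collect-length J aJ)) (ℕₚ.<⇒≤ (ℕₚ.≰⇒> np))) degree) (collect-distinct J aJ uJ) (collect-roots J aJ))))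

    -- The derivative can vanish identically in characteristic p, so this case cannot be left to the
    -- count of roots of the derivative.
    zero-count : ∀ nd m → suc (suc (m ℕ.* q)) ℕ.≤ n → ∀ L → Unique L → All (λ f → deriv (g (α nd) f) ≋ 0P) L → length L ℕ.* q ℕ.^ m ℕ.≤ X₀
    zero-count nd m le L uL aL = ≡.subst₂ ℕ._≤_ (ℕₚ.*-identityˡ _) (ℕₚ.*-identityˡ X₀)
      (count-by {m} zero (λ v → K.0# ∷ spread v) (λ f → deriv (g (α nd) f) ≋ 0P) 1 1 L uL aL (λ x J uJ aJ → subsingleton J uJ aJ (zero-fibre (α nd) x le)))

    Γ : List Carrier
    Γ = allConjugates nodes

    Collision : Carrier × Carrier → Outcome d n → Set
    Collision (γ , γ') f = (¬ γ ≈ γ') × g γ f ≋ g γ' f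

    Collides : Outcome d n → Set
    Collides f = Any (λ p → Collision p f) (cartesianProduct Γ Γ)

    -- For each ordered pair of conjugates at most one of the q^n choices of f_1 collides.
    collision-count : ∀ L → Unique L → All Collides L → length L ℕ.* q ℕ.^ n ℕ.≤ (length Γ ℕ.* length Γ) ℕ.* X₀
    collision-count L uL aL = ≡.subst (ℕ._≤ (length Γ ℕ.* length Γ) ℕ.* X₀) (ℕₚ.*-identityˡ _) (count-by (suc zero) toList Collides 1 (length Γ ℕ.* length Γ) L uL aL
      (λ x J uJ aJ → ≡.subst (1 ℕ.* length J ℕ.≤_) (≡.trans (ℕₚ.*-identityˡ _) (length-product Γ Γ))
        (cover-count (cartesianProduct Γ Γ) (λ p v → Collision p (addCol (suc zero) (coeffs (toList v)) x)) {1} {1} J uJ aJ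
          (λ { (γ , γ') _ J' uJ' aJ' → subsingleton J' uJ' aJ' (λ v w pv pw → separable-fibre γ γ' (proj₁ pv) (suc zero) ≡.refl x v w (proj₂ pv) (proj₂ pw)) }))))

    collides? : ∀ f → Collides f ⊎ Separated nodes f
    collides? f with Any.any? (λ { (γ , γ') → ¬? (γ ≟ γ') ×-dec (IsDomain._≟_ poly-isDomain (g γ f) (g γ' f)) }) (cartesianProduct Γ Γ)
    ... | yes c = inj₁ c
    ... | no nc = inj₂ λ γ γ' γ∈ γ'∈ ne e → nc (Any.map (λ { ≡.refl → ne , e }) (∈ₚ.∈-cartesianProduct⁺ γ∈ γ'∈))

    good-count : (c : ℕ) → 0 ℕ.< length nodes → AllPairs (λ nd nd' → k nd ≢ k nd') nodes → All (λ nd → k nd ℕ.+ k nd ℕ.≤ c) nodes →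
      (∀ Fp → O.SeparableT Fp → O.PosDegT Fp → O.DegY≤ Fp (ℕtoℚ c ℚ.* ℕtoℚ n) → O.DegT≤ Fp (ℕtoℚ c) → length nodes ℕ.* ∣ O.chowlaSum lam Fp n ∣ ℕ.≤ K.card ℕ.^ n) →
      ∀ L → Unique L → All (λ f → Separated nodes f × ConstantSign nodes f) L → length nodes ℕ.* length L ℕ.≤ 2 ℕ.* X₀
    good-count c pos distinct bounds chowla L uL aL = ℕₚ.*-cancelʳ-≤ _ _ (q ℕ.^ n) {{ℕ.>-nonZero (q^>0 n)}}
      (≡.subst₂ ℕ._≤_ (≡.sym (ℕₚ.*-assoc (length nodes) (length L) _)) (S′.solve 2 (λ a b → (S′.con 2 S′.:* a) S′.:* b S′.:= (S′.con 2 S′.:* b) S′.:* a) ≡.refl (q ℕ.^ n) X₀)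
        (count-by zero toList (λ f → Separated nodes f × ConstantSign nodes f) (length nodes) (2 ℕ.* q ℕ.^ n) L uL aL
          (good-fibre nodes pos distinct c bounds chowla)))
      where module S′ = +-*-Solver

    Simple : Node → Outcome d n → Set
    Simple nd f = ∀ x → evalP (g (α nd) f) x ≈ 0# → ¬ evalP (deriv (g (α nd) f)) x ≈ 0#

    -- The three ways to have a double root, each with its own translations. The limit `lo + n`
    -- gives `geometric-count` a finite range.
    Bad : ℕ → Node → Outcome d n → Set
    Bad lo nd f = (∃ λ s → lo ℕ.≤ s × s ℕ.< lo ℕ.+ n × SmallRoot nd s f) ⊎ (LargeRoot nd f ⊎ deriv (g (α nd) f) ≋ 0P)

    private
      node-fixed : ∀ nd (f : Outcome d n) → OrbitTheory.Ψ.Fixed K E ι (k nd) (k-odd nd) (g (α nd) f)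
      node-fixed nd f = PR.trans (spec-σ (iterHom (k nd)) (iterHom-ι (k nd)) (α nd) (O.fPoly f)) (spec-cong (O.fPoly f) (trans (reflexive (iterHom-iter (k nd) (α nd))) (returns (period nd))))

      root-has-period : ∀ nd (f : Outcome d n) β → evalP (g (α nd) f) β ≈ 0# → ∃ λ s → Period s β
      root-has-period nd f β r =
        let m , per , _ = OT.Ψ.root-period (node-fixed nd f) (monic-nonzero (g-monic (α nd) f)) (degLt (g-monic (α nd) f)) r
            s , per' , _ = return-period (m ℕ.* k nd) β (ℕₚ.*-mono-≤ (OT.Ψ.positive per) (positive (period nd))) (trans (reflexive (≡.sym (OT.Ψ-iter m β))) (OT.Ψ.returns per))
        in s , per'
        where module OT = OrbitTheory K E ι (k nd) (k-odd nd)

    classify : ∀ lo nd → nd ∈ nodes → d ℕ.* lo ℕ.≤ k nd → ∀ f → O.ContentOne (O.fPoly f) → Simple nd f ⊎ Bad lo nd f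
    classify lo nd nd∈ big f content = decide (Any.any? (λ b → evalP (deriv (g (α nd) f)) b ≟ 0#) bs)
      where
        bs = proj₁ (splits-g nd nd∈ f)
        e : g (α nd) f ≋ prodLin bs
        e = proj₂ (splits-g nd nd∈ f)
        roots : Roots (g (α nd) f) bs
        roots = All.map (λ r → trans (eval-cong e refl) r) (Determinant.Resultant.prodLin-roots cring isDomain bs)
        sort : ∀ s β → Period s β → DoubleRoot (α nd) β f → Dec (s ℕ.+ s ℕ.≤ n) → Dec (deriv (g (α nd) f) ≋ 0P) → Bad lo nd f
        sort s β per dbl (yes le) _ = inj₁ (s , lo≤s , ℕₚ.≤-trans (ℕₚ.+-monoˡ-≤ s (positive per)) s+s≤ , le , β , per , dbl)
          where
            -- Content one gives k ≤ s d, while the node has k ≥ d · lo.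
            lo≤s : lo ℕ.≤ s
            lo≤s = ℕₚ.*-cancelˡ-≤ d (≡.subst (d ℕ.* lo ℕ.≤_) (ℕₚ.*-comm s d) (ℕₚ.≤-trans big (content-period f content per (period nd) (proj₁ dbl))))
            s+s≤ : s ℕ.+ s ℕ.≤ lo ℕ.+ n
            s+s≤ = ℕₚ.≤-trans le (ℕₚ.m≤n+m n lo)
        sort s β per dbl (no gt) (yes z) = inj₂ (inj₂ z)
        sort s β per dbl (no gt) (no nz) = inj₂ (inj₁ (nz , s , β , ℕₚ.≰⇒> gt , per , dbl))
        decide : Dec (Any (λ b → evalP (deriv (g (α nd) f)) b ≈ 0#) bs) → Simple nd f ⊎ Bad lo nd f
        decide (yes an) = let r , r' = All.lookupAny roots an
                              s , per = root-has-period nd f (Any.lookup an) r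
          in inj₂ (sort s (Any.lookup an) per (r , r') (s ℕ.+ s ℕ.≤? n) (IsDomain._≟_ poly-isDomain (deriv (g (α nd) f)) 0P))
        decide (no none) = inj₁ λ x r r' → none (Any.map (λ {b} x≈b → trans (eval-cong {deriv (g (α nd) f)} {deriv (g (α nd) f)} PR.refl (sym x≈b)) r') (prodLin-member bs (trans (eval-cong (PR.sym e) refl) r)))

    -- Stickelberger's value depends on n and a only, and the same a comes from the discriminant
    -- over F_q[x] for every node.
    constant-sign : ∀ f → O.DiscSquareClass n (O.fPoly f) → All (λ nd → Simple nd f) nodes → ConstantSign nodes f
    constant-sign f disc@(a , t , _) simples = ε₀ , unit , go nodes (λ nd∈ → nd∈) simples
      where
        -- `signedK` is the same for every k; the instance k = 1 merely names it.
        a' = OrbitTheory.signedK K E ι 1 (0 , ≡.refl) n a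
        ε₀ = signℤ n ℤ.* QuadraticCharacter.quadraticSign K a'
        unit : ∣ ε₀ ∣ ≡ 1
        unit = ≡.trans (ℤₚ.abs-* (signℤ n) _) (≡.cong₂ ℕ._*_ (signℤ-unit n) (QuadraticCharacter.quadraticSign-unit K a'))
        go : ∀ nds → (∀ {nd} → nd ∈ nds → nd ∈ nodes) → All (λ nd → Simple nd f) nds → All (λ nd → ∀ N → MP.mapP N ≋ node-norm nd (g (α nd) f) → lam N ≡ ε₀) nds
        go [] _ [] = []
        go (nd ∷ nds) sub (simple ∷ ss) = sign ∷ go nds (λ nd∈ → sub (there nd∈)) ss
          where
            module OT = OrbitTheory K E ι (k nd) (k-odd nd)
            T-fixed : Hom.⟦_⟧ OT.ψ (at-x (α nd) t) ≈ at-x (α nd) t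
            T-fixed = trans (at-x-σ (iterHom (k nd)) (iterHom-ι (k nd)) (α nd) t) (at-x-cong t (trans (reflexive (iterHom-iter (k nd) (α nd))) (returns (period nd))))
            st = OT.stickelberger odd (g (α nd) f) (g-monic (α nd) f) (splits-g nd (sub (here ≡.refl)) f) (node-fixed nd f) simple a (at-x (α nd) t) T-fixed (proj₂ (proj₂ (disc-square n (α nd) (O.fPoly f) disc)))
            sign : ∀ N → MP.mapP N ≋ node-norm nd (g (α nd) f) → lam N ≡ ε₀
            sign N e = ≡.trans (Liouville.lam-factored K lam isL (proj₁ st) (proj₁ (proj₂ st)) (Descent.injective descentP (PR.trans e (PR.sym (proj₁ (proj₂ (proj₂ st))))))) (proj₂ (proj₂ (proj₂ st)))

    length-Γ : length Γ ≡ sum ks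
    length-Γ = ≡.trans (go nodes) (≡.cong sum nodes-k)
      where
        go : ∀ nds → length (allConjugates nds) ≡ sum (map k nds)
        go [] = ≡.refl
        go (nd ∷ nds) = ≡.trans (Listₚ.length-++ (conjugates nd)) (≡.cong₂ ℕ._+_ (length-orb (k nd) (α nd)) (go nds))

    module Bounds (D m : ℕ) (m-small : suc (suc (m ℕ.* q)) ℕ.≤ n) (D-large : D ℕ.* n ℕ.≤ q ℕ.^ m)
      (D-collide : D ℕ.* suc (sum ks ℕ.* sum ks) ℕ.≤ q ℕ.^ n) (ks-large : All (λ k → d ℕ.* (2 ℕ.* suc D) ℕ.≤ k) ks) where
      private
        -- q^lo > lo ≥ 2 D, which absorbs the factor 2 of `geometric-count` and leaves density at
        -- most 1 / D.
        lo = 2 ℕ.* suc D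

        0<n : 0 ℕ.< n
        0<n = ℕₚ.≤-trans (s≤s z≤n) m-small

        -- A density at most c / w with D c ≤ w is at most 1 / D.
        scale : ∀ c w l → 0 ℕ.< c → D ℕ.* c ℕ.≤ w → l ℕ.* w ℕ.≤ c ℕ.* X₀ → D ℕ.* l ℕ.≤ X₀
        scale c w l 0<c Dc le = ℕₚ.*-cancelˡ-≤ c {{ℕ.>-nonZero 0<c}} (ℕₚ.≤-trans (ℕₚ.≤-reflexive (S′.solve 3 (λ c d l → c S′.:* (d S′.:* l) S′.:= l S′.:* (d S′.:* c)) ≡.refl c D l)) (ℕₚ.≤-trans (ℕₚ.*-monoʳ-≤ l Dc) le))
          where module S′ = +-*-Solver

      bad-count : ∀ nd L → Unique L → All (Bad lo nd) L → D ℕ.* length L ℕ.≤ 3 ℕ.* X₀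
      bad-count nd L uL aL = begin
        D ℕ.* length L ≡⟨ ≡.cong (D ℕ.*_) (≡.trans P.lengths (≡.cong (length P.left ℕ.+_) P'.lengths)) ⟩
        D ℕ.* (length P.left ℕ.+ (length P'.left ℕ.+ length P'.right)) ≡⟨ S′.solve 4 (λ d a b c → d S′.:* (a S′.:+ (b S′.:+ c)) S′.:= d S′.:* a S′.:+ (d S′.:* b S′.:+ (d S′.:* c S′.:+ S′.con 0))) ≡.refl D (length P.left) (length P'.left) (length P'.right) ⟩
        D ℕ.* length P.left ℕ.+ (D ℕ.* length P'.left ℕ.+ (D ℕ.* length P'.right ℕ.+ 0))
          ≤⟨ ℕₚ.+-mono-≤ small (ℕₚ.+-mono-≤ (scale n (q ℕ.^ m) (length P'.left) 0<n D-large (large-count nd m (ℕₚ.<⇒≤ m-small) P'.left P'.left-unique P'.left-all))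
               (ℕₚ.+-monoˡ-≤ 0 (scale 1 (q ℕ.^ m) (length P'.right) (s≤s z≤n) D≤ (ℕₚ.≤-trans (zero-count nd m m-small P'.right P'.right-unique P'.right-all) (ℕₚ.≤-reflexive (≡.sym (ℕₚ.*-identityˡ X₀))))))) ⟩
        3 ℕ.* X₀ ∎
        where
          open ℕₚ.≤-Reasoning
          module S′ = +-*-Solver
          module P = Partition (partition L uL aL)
          module P' = Partition (partition P.right P.right-unique P.right-all)
          D≤ : D ℕ.* 1 ℕ.≤ q ℕ.^ m
          D≤ = ℕₚ.≤-trans (ℕₚ.*-monoʳ-≤ D 0<n) D-large
          small : D ℕ.* length P.left ℕ.≤ X₀
          small = ℕₚ.*-cancelˡ-≤ 2 (ℕₚ.≤-trans (ℕₚ.≤-trans (ℕₚ.≤-reflexive (≡.sym (ℕₚ.*-assoc 2 D _))) (ℕₚ.*-monoˡ-≤ (length P.left) (ℕₚ.≤-trans (ℕₚ.*-monoʳ-≤ 2 (ℕₚ.n≤1+n D)) (ℕₚ.<⇒≤ (n<q^n lo)))))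
            (geometric-count (SmallRoot nd) 1<q n lo P.left P.left-unique P.left-all (λ s le → small-count nd s (ℕₚ.≤-trans (s≤s z≤n) le))))

      -- l counts outcomes with a double root at some node (three kinds per node) and colliding
      -- ones; l' counts the rest of the event, where all signs agree.
      total-count : ∀ c → 0 ℕ.< length nodes → AllPairs (λ nd nd' → k nd ≢ k nd') nodes → All (λ nd → k nd ℕ.+ k nd ℕ.≤ c) nodes →
        (∀ Fp → O.SeparableT Fp → O.PosDegT Fp → O.DegY≤ Fp (ℕtoℚ c ℚ.* ℕtoℚ n) → O.DegT≤ Fp (ℕtoℚ c) → length nodes ℕ.* ∣ O.chowlaSum lam Fp n ∣ ℕ.≤ K.card ℕ.^ n) →
        ∀ L → Unique L → All (O.Event d n) L →
        ∃ λ l → ∃ λ l' → length L ≡ l ℕ.+ l' × D ℕ.* l ℕ.≤ (3 ℕ.* length nodes ℕ.+ 1) ℕ.* X₀ × length nodes ℕ.* l' ℕ.≤ 2 ℕ.* X₀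
      total-count c pos distinct bounds chowla L uL aL =
        length P.left ℕ.+ length P'.left , length P'.right , ≡.trans P.lengths (≡.trans (≡.cong (length P.left ℕ.+_) P'.lengths) (≡.sym (ℕₚ.+-assoc (length P.left) _ _))) ,
        (begin
          D ℕ.* (length P.left ℕ.+ length P'.left) ≡⟨ ℕₚ.*-distribˡ-+ D (length P.left) (length P'.left) ⟩
          D ℕ.* length P.left ℕ.+ D ℕ.* length P'.left ≤⟨ ℕₚ.+-mono-≤ (cover-count nodes (Bad lo) {D} {3 ℕ.* X₀} P.left P.left-unique P.left-all (λ nd _ → bad-count nd))
              (scale (suc (sum ks ℕ.* sum ks)) (q ℕ.^ n) (length P'.left) (s≤s z≤n) D-collide
                (ℕₚ.≤-trans (collision-count P'.left P'.left-unique P'.left-all) (ℕₚ.*-monoˡ-≤ X₀ (≡.subst (λ t → t ℕ.* t ℕ.≤ suc (sum ks ℕ.* sum ks)) (≡.sym length-Γ) (ℕₚ.n≤1+n _))))) ⟩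
          3 ℕ.* X₀ ℕ.* length nodes ℕ.+ X₀ ≡⟨ S′.solve 2 (λ x m → S′.con 3 S′.:* x S′.:* m S′.:+ x S′.:= (S′.con 3 S′.:* m S′.:+ S′.con 1) S′.:* x) ≡.refl X₀ (length nodes) ⟩
          (3 ℕ.* length nodes ℕ.+ 1) ℕ.* X₀ ∎) ,
        good-count c pos distinct bounds chowla P'.right P'.right-unique P'.right-all
        where
          open ℕₚ.≤-Reasoning
          module S′ = +-*-Solver
          any-or-all : ∀ nds → (∀ {nd} → nd ∈ nds → nd ∈ nodes) → ∀ f → O.ContentOne (O.fPoly f) → Any (λ nd → Bad lo nd f) nds ⊎ All (λ nd → Simple nd f) nds
          any-or-all [] _ f _ = inj₂ []
          any-or-all (nd ∷ nds) sub f content with classify lo nd (sub (here ≡.refl)) (All.lookup (Allₚ.map⁻ (≡.subst (All _) (≡.sym nodes-k) ks-large)) (sub (here ≡.refl))) f content | any-or-all nds (λ nd∈ → sub (there nd∈)) f content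
          ... | inj₂ bad | _ = inj₁ (here bad)
          ... | inj₁ _ | inj₁ an = inj₁ (there an)
          ... | inj₁ s | inj₂ ss = inj₂ (s ∷ ss)
          rest : ∀ f → O.DiscSquareClass n (O.fPoly f) → All (λ nd → Simple nd f) nodes → Collides f ⊎ (Separated nodes f × ConstantSign nodes f)
          rest f disc ss with collides? f
          ... | inj₁ col = inj₁ col
          ... | inj₂ sep = inj₂ (sep , constant-sign f disc ss)
          sort : ∀ f → O.Event d n f → Any (λ nd → Bad lo nd f) nodes ⊎ (Collides f ⊎ (Separated nodes f × ConstantSign nodes f))
          sort f (content , disc) with any-or-all nodes (λ nd∈ → nd∈) f content
          ... | inj₁ an = inj₁ an
          ... | inj₂ ss = inj₂ (rest f disc ss)
          module P = Partition (partition L uL (All.map (λ {f} → sort f) aL))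
          module P' = Partition (partition P.right P.right-unique P.right-all)

  m<2^m : ∀ m → m ℕ.< 2 ℕ.^ m
  m<2^m zero = s≤s z≤n
  m<2^m (suc m) = ℕₚ.≤-trans (s≤s (m<2^m m)) (ℕₚ.≤-trans (ℕₚ.+-monoˡ-≤ (2 ℕ.^ m) (ℕₚ.m^n>0 2 m)) (ℕₚ.≤-reflexive (≡.cong (2 ℕ.^ m ℕ.+_) (≡.sym (ℕₚ.+-identityʳ _)))))

  m≤3^m : ∀ m → m ℕ.≤ 3 ℕ.^ m
  m≤3^m m = ℕₚ.≤-trans (ℕₚ.<⇒≤ (m<2^m m)) (ℕₚ.^-monoˡ-≤ m (s≤s (s≤s z≤n)))

  -- Split j = a + (i + 1) with a ≤ i: then a ≤ 2^a and j + 1 ≤ 2 (i + 1) ≤ 2^(i+1).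
  linear≤2^ : ∀ a j → suc (a ℕ.+ a) ℕ.≤ j → a ℕ.* suc j ℕ.≤ 2 ℕ.^ j
  linear≤2^ a j le = begin
    a ℕ.* suc j                   ≤⟨ ℕₚ.*-mono-≤ (ℕₚ.<⇒≤ (m<2^m a)) j≤ ⟩
    2 ℕ.^ a ℕ.* 2 ℕ.^ suc i       ≡⟨ ≡.sym (ℕₚ.^-distribˡ-+-* 2 a (suc i)) ⟩
    2 ℕ.^ (a ℕ.+ suc i)           ≡⟨ ≡.cong (2 ℕ.^_) a+i≡j ⟩
    2 ℕ.^ j                       ∎
    where
      open ℕₚ.≤-Reasoning
      i = j ℕ.∸ suc a
      a+i≡j : a ℕ.+ suc i ≡ j
      a+i≡j = ≡.trans (ℕₚ.+-suc a i) (ℕₚ.m+[n∸m]≡n (ℕₚ.≤-trans (s≤s (ℕₚ.m≤m+n a a)) le))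
      a≤i : a ℕ.≤ i
      a≤i = ℕₚ.+-cancelˡ-≤ (suc a) a i (≡.subst (suc (a ℕ.+ a) ℕ.≤_) (≡.trans (≡.sym a+i≡j) (ℕₚ.+-suc a i)) le)
      j≤ : suc j ℕ.≤ 2 ℕ.^ suc i
      j≤ = begin
        suc j             ≡⟨ ≡.cong suc (≡.sym a+i≡j) ⟩
        suc (a ℕ.+ suc i) ≤⟨ s≤s (ℕₚ.+-monoˡ-≤ (suc i) a≤i) ⟩
        suc i ℕ.+ suc i   ≤⟨ ℕₚ.+-mono-≤ (m<2^m i) (m<2^m i) ⟩
        2 ℕ.^ i ℕ.+ 2 ℕ.^ i ≡⟨ ≡.cong (2 ℕ.^ i ℕ.+_) (≡.sym (ℕₚ.+-identityʳ _)) ⟩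
        2 ℕ.^ suc i       ∎

  -- m = (n - 2) / q is the largest exponent whose translations by y v(y^q) stay within the degree
  -- bound; it grows linearly in n, so q^m outgrows D n.
  threshold : ∀ D q → 1 ℕ.< q → ∃ λ N → ∀ n → N ℕ.≤ n → ∃ λ m → suc (suc (m ℕ.* q)) ℕ.≤ n × D ℕ.* n ℕ.≤ q ℕ.^ m
  threshold D q@(suc q') 1<q = 2 ℕ.+ suc (a ℕ.+ a) ℕ.* q , λ n le → (n ℕ.∸ 2) DivMod./ q , lower n le , upper n le
    where
      -- Chosen because n ≤ (2 + q) (m + 1), so that D n ≤ a (m + 1).
      a = D ℕ.* (2 ℕ.+ q)
      2+ : ∀ n → 2 ℕ.+ suc (a ℕ.+ a) ℕ.* q ℕ.≤ n → 2 ℕ.+ (n ℕ.∸ 2) ≡ n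
      2+ n le = ℕₚ.m+[n∸m]≡n (ℕₚ.≤-trans (ℕₚ.m≤m+n 2 _) le)
      lower : ∀ n → 2 ℕ.+ suc (a ℕ.+ a) ℕ.* q ℕ.≤ n → suc (suc ((n ℕ.∸ 2) DivMod./ q ℕ.* q)) ℕ.≤ n
      lower n le = ≡.subst (suc (suc ((n ℕ.∸ 2) DivMod./ q ℕ.* q)) ℕ.≤_) (2+ n le) (s≤s (s≤s (DivMod.m/n*n≤m (n ℕ.∸ 2) q)))
      upper : ∀ n → 2 ℕ.+ suc (a ℕ.+ a) ℕ.* q ℕ.≤ n → D ℕ.* n ℕ.≤ q ℕ.^ ((n ℕ.∸ 2) DivMod./ q)
      upper n le = begin
        D ℕ.* n                       ≤⟨ ℕₚ.*-monoʳ-≤ D n≤ ⟩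
        D ℕ.* ((2 ℕ.+ q) ℕ.* suc j)   ≡⟨ ≡.sym (ℕₚ.*-assoc D (2 ℕ.+ q) (suc j)) ⟩
        a ℕ.* suc j                   ≤⟨ linear≤2^ a j j-large ⟩
        2 ℕ.^ j                       ≤⟨ ℕₚ.^-monoˡ-≤ j 1<q ⟩
        q ℕ.^ j                       ∎
        where
          open ℕₚ.≤-Reasoning
          j = (n ℕ.∸ 2) DivMod./ q
          j-large : suc (a ℕ.+ a) ℕ.≤ j
          j-large = ≡.subst (ℕ._≤ j) (DivMod.m*n/n≡m (suc (a ℕ.+ a)) q) (DivMod./-monoˡ-≤ q (ℕₚ.+-cancelˡ-≤ 2 _ _ (≡.subst (2 ℕ.+ suc (a ℕ.+ a) ℕ.* q ℕ.≤_) (≡.sym (2+ n le)) le)))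
          n≤ : n ℕ.≤ (2 ℕ.+ q) ℕ.* suc j
          n≤ = begin
            n                                         ≡⟨ ≡.sym (2+ n le) ⟩
            2 ℕ.+ (n ℕ.∸ 2)                           ≡⟨ ≡.cong (2 ℕ.+_) (DivMod.m≡m%n+[m/n]*n (n ℕ.∸ 2) q) ⟩
            2 ℕ.+ ((n ℕ.∸ 2) DivMod.% q ℕ.+ j ℕ.* q)  ≤⟨ ℕₚ.+-monoʳ-≤ 2 (ℕₚ.+-monoˡ-≤ (j ℕ.* q) (ℕₚ.<⇒≤ (DivMod.m%n<n (n ℕ.∸ 2) q))) ⟩
            2 ℕ.+ (q ℕ.+ j ℕ.* q)                     ≤⟨ ℕₚ.m≤m+n _ (j ℕ.* 2) ⟩
            2 ℕ.+ (q ℕ.+ j ℕ.* q) ℕ.+ j ℕ.* 2         ≡⟨ T.solve 2 (λ q j → T.con 2 T.:+ (q T.:+ j T.:* q) T.:+ j T.:* T.con 2 T.:= (T.con 2 T.:+ q) T.:* (T.con 1 T.:+ j)) ≡.refl q j ⟩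
            (2 ℕ.+ q) ℕ.* suc j                       ∎
            where module T = +-*-Solver

  -- Both contributions, (3 M + 1) / D and 2 / M, equal 1 / (2 (B + 1)).
  combine : ∀ B M X l l' → M ≡ 4 ℕ.* suc B → (2 ℕ.* suc B ℕ.* (3 ℕ.* M ℕ.+ 1)) ℕ.* l ℕ.≤ (3 ℕ.* M ℕ.+ 1) ℕ.* X → M ℕ.* l' ℕ.≤ 2 ℕ.* X → suc B ℕ.* (l ℕ.+ l') ℕ.≤ X
  combine B M X l l' ≡.refl bad good = ℕₚ.*-cancelˡ-≤ 2 (begin
    2 ℕ.* (suc B ℕ.* (l ℕ.+ l'))                 ≡⟨ T.solve 3 (λ b l l' → T.con 2 T.:* (b T.:* (l T.:+ l')) T.:= T.con 2 T.:* b T.:* l T.:+ T.con 2 T.:* b T.:* l') ≡.refl (suc B) l l' ⟩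
    2 ℕ.* suc B ℕ.* l ℕ.+ 2 ℕ.* suc B ℕ.* l'     ≤⟨ ℕₚ.+-mono-≤ bad' good' ⟩
    X ℕ.+ X                                      ≡⟨ ≡.cong (X ℕ.+_) (≡.sym (ℕₚ.+-identityʳ X)) ⟩
    2 ℕ.* X                                      ∎)
    where
      open ℕₚ.≤-Reasoning
      module T = +-*-Solver
      t = 3 ℕ.* M ℕ.+ 1
      bad' : 2 ℕ.* suc B ℕ.* l ℕ.≤ X
      bad' = ℕₚ.*-cancelˡ-≤ t {{ℕ.>-nonZero (ℕₚ.m≤n+m 1 (3 ℕ.* M))}} (ℕₚ.≤-trans (ℕₚ.≤-reflexive (T.solve 3 (λ t b l → t T.:* (T.con 2 T.:* b T.:* l) T.:= (T.con 2 T.:* b T.:* t) T.:* l) ≡.refl t (suc B) l)) bad)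
      good' : 2 ℕ.* suc B ℕ.* l' ℕ.≤ X
      good' = ℕₚ.*-cancelˡ-≤ 2 (ℕₚ.≤-trans (ℕₚ.≤-reflexive (T.solve 2 (λ b l → T.con 2 T.:* (T.con 2 T.:* b T.:* l) T.:= T.con 4 T.:* b T.:* l) ≡.refl (suc B) l')) good)

  event-bound : ∀ (K : FiniteField) (odd : FiniteField.card K ℕ.% 2 ≡ 1) d′ (lam : OverField.Poly K → ℤ) (isL : OverField.IsLiouville K lam) B M D c m n (ks : List ℕ) →
    let q = FiniteField.card K; d = suc d′ in
    M ≡ 4 ℕ.* suc B → D ≡ 2 ℕ.* suc B ℕ.* (3 ℕ.* M ℕ.+ 1) → length ks ≡ M →
    All (λ k → d ℕ.* (2 ℕ.* suc D) ℕ.≤ k) ks → All (λ k → k ℕ.+ k ℕ.≤ c) ks → AllPairs _≢_ ks →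
    suc (suc (m ℕ.* q)) ℕ.≤ n → D ℕ.* n ℕ.≤ q ℕ.^ m → D ℕ.* suc (sum ks ℕ.* sum ks) ℕ.≤ q ℕ.^ n →
    (∀ Fp → OverField.SeparableT K Fp → OverField.PosDegT K Fp → OverField.DegY≤ K Fp (ℕtoℚ c ℚ.* ℕtoℚ n) → OverField.DegT≤ K Fp (ℕtoℚ c) →
      M ℕ.* ∣ OverField.chowlaSum K lam Fp n ∣ ℕ.≤ q ℕ.^ n) →
    Extensions.Setting K d ks n → ∀ L → Unique L → All (OverField.Event K d n) L → suc B ℕ.* length L ℕ.≤ q ℕ.^ (suc d ℕ.* n)
  event-bound K odd d′ lam isL B M D c m n ks M≡ ≡.refl length-ks large small distinct m-small D-large D-collide chowla St L uL aL =
    let l , l' , len , bad , good = FC.Bounds.total-count D m m-small D-large D-collide large c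
          (≡.subst (0 ℕ.<_) (≡.sym (≡.trans length-nodes M≡)) (s≤s z≤n))
          (AllPairsₚ.map⁻ (≡.subst (AllPairs _≢_) (≡.sym St.nodes-k) distinct))
          (Allₚ.map⁻ (≡.subst (All (λ k → k ℕ.+ k ℕ.≤ c)) (≡.sym St.nodes-k) small))
          (λ Fp sep pos degY degT → ≡.subst (λ M → M ℕ.* ∣ OverField.chowlaSum K lam Fp n ∣ ℕ.≤ q ℕ.^ n) (≡.sym length-nodes) (chowla Fp sep pos degY degT))
          L uL aL
    in ≡.subst (λ t → suc B ℕ.* t ℕ.≤ X) (≡.sym len) (combine B M X l l' M≡
         (≡.subst (λ M′ → D ℕ.* l ℕ.≤ (3 ℕ.* M′ ℕ.+ 1) ℕ.* X) length-nodes bad) (≡.subst (λ M′ → M′ ℕ.* l' ℕ.≤ 2 ℕ.* X) length-nodes good))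
    where
      q = FiniteField.card K
      X = q ℕ.^ (suc (suc d′) ℕ.* n)
      module St = Extensions.Setting St
      module FC = FinalCount K odd d′ lam isL ks n St
      length-nodes : length St.nodes ≡ M
      length-nodes = ≡.trans (≡.sym (Listₚ.length-map _ St.nodes)) (≡.trans (≡.cong length St.nodes-k) length-ks)

open EventCount

-- Choice of the constants and conclusion.

open import Data.Nat using (ℕ; suc; s≤s; z≤n; _≤_; _^_; _%_)
import Data.Nat as ℕ
import Data.Nat.Properties as ℕₚ
import Data.Nat.ListAction as ℕList
open import Data.Integer using (ℤ)
open import Data.Rational using (ℚ; 0ℚ; _<_; _*_)
import Data.Rational as ℚ
import Data.Rational.Properties as ℚₚ
open import Data.List using (List; length; map; applyUpTo)
import Data.List.Properties as Listₚ
open import Data.List.Relation.Unary.All using (All)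
import Data.List.Relation.Unary.All.Properties as Allₚ
open import Data.List.Relation.Unary.AllPairs using (AllPairs)
import Data.List.Relation.Unary.AllPairs.Properties as AllPairsₚ
open import Data.List.Relation.Unary.Unique.Propositional using (Unique)
open import Data.Product using (∃; _,_; proj₁; proj₂)
open import Relation.Binary.PropositionalEquality using (_≡_; _≢_)
import Relation.Binary.PropositionalEquality as ≡

theorem6p5 : (K : FiniteField) → FiniteField.card K % 2 ≡ 1 →
    (d : ℕ) → 1 ≤ d →
    (lam : OverField.Poly K → ℤ) → OverField.IsLiouville K lam →
    OverField.UniformChowla K lam →
    (ε : ℚ) → 0ℚ < ε → ∃ λ N → (n : ℕ) → N ≤ n →
    (L : List (OverField.Outcome K d n)) → Unique L →
    All (OverField.Event K d n) L →
    ℕtoℚ (length L) ℚ.≤ ε * ℕtoℚ (FiniteField.card K ^ (suc d ℕ.* n))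
theorem6p5 K odd d@(suc d′) _ lam isL chowla ε 0<ε = N , result
  where
    module K = FiniteField K
    q = K.card
    1<q = BaseField.1<card K
    denominator = denominator-bound ε 0<ε
    B = proj₁ denominator
    -- ε is at least 1 / (B + 1). `M` and `D` are chosen so that agreeing signs and discarded
    -- outcomes each use up half of that.
    M = 4 ℕ.* suc B
    D = 2 ℕ.* suc B ℕ.* (3 ℕ.* M ℕ.+ 1)
    -- The lower bound that `classify` needs for the periods. The exponents start at `e` because
    -- 3^(j+1) > j ≥ e, and M consecutive ones give distinct periods.
    e = d ℕ.* (2 ℕ.* suc D)
    js = applyUpTo (e ℕ.+_) M
    ks = map (λ j → 3 ^ suc j) js
    -- Bounds all periods, so c = 2 k̂ bounds the T-degree of a product of two norms and its
    -- y-degree divided by n.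
    k̂ = 3 ^ suc (e ℕ.+ M)
    c = k̂ ℕ.+ k̂
    0<c : 0ℚ < ℕtoℚ c
    0<c = ℚₚ.positive⁻¹ (ℕtoℚ c) {{ℚₚ.normalize-pos c 1 {{_}} {{ℕ.>-nonZero (ℕₚ.≤-trans (ℕₚ.m^n>0 3 (suc (e ℕ.+ M))) (ℕₚ.m≤m+n k̂ k̂))}}}}
    cancellation = chowla (ℕtoℚ c) 0<c (reciprocal (ℕ.pred M)) (reciprocal-positive (ℕ.pred M))
    growth = threshold D q 1<q
    -- Three thresholds: for the Chowla sums with saving 1 / M, for D n ≤ q^m, and for the
    -- collisions, where n < 2^n ≤ q^n is enough.
    N = proj₁ cancellation ℕ.+ (proj₁ growth ℕ.+ D ℕ.* suc (ℕList.sum ks ℕ.* ℕList.sum ks))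

    ks-large : All (λ k → d ℕ.* (2 ℕ.* suc D) ≤ k) ks
    ks-large = Allₚ.map⁺ (Allₚ.applyUpTo⁺₂ (e ℕ.+_) M (λ i → ℕₚ.≤-trans (ℕₚ.m≤n⇒m≤1+n (ℕₚ.m≤m+n e i)) (m≤3^m (suc (e ℕ.+ i)))))

    ks-small : All (λ k → k ℕ.+ k ≤ c) ks
    ks-small = Allₚ.map⁺ (Allₚ.applyUpTo⁺₁ (e ℕ.+_) M (λ {i} i<M → let le = ℕₚ.^-monoʳ-≤ 3 (s≤s (ℕₚ.+-monoʳ-≤ e (ℕₚ.<⇒≤ i<M))) in ℕₚ.+-mono-≤ le le))

    ks-distinct : AllPairs _≢_ ks
    ks-distinct = AllPairsₚ.map⁺ (AllPairsₚ.applyUpTo⁺₁ (e ℕ.+_) M (λ i<j _ eq → ℕₚ.<⇒≢ (ℕₚ.^-monoʳ-< 3 (s≤s (s≤s z≤n)) (s≤s (ℕₚ.+-monoʳ-< e i<j))) eq))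

    result : (n : ℕ) → N ≤ n → (L : List (OverField.Outcome K d n)) → Unique L → All (OverField.Event K d n) L →
      ℕtoℚ (length L) ℚ.≤ ε * ℕtoℚ (q ^ (suc d ℕ.* n))
    result n N≤n L uL aL = proj₂ denominator (length L) (q ^ (suc d ℕ.* n))
      (event-bound K odd d′ lam isL B M D c (proj₁ chosen) n ks ≡.refl ≡.refl length-ks ks-large ks-small ks-distinct
        (proj₁ (proj₂ chosen)) (proj₂ (proj₂ chosen)) D-collide
        (λ Fp sep pos degY degT → reciprocal-bound (ℕ.pred M) _ (q ^ n) (proj₂ cancellation n N₁≤n Fp sep pos degY degT))
        (Extensions.setting K d js n) L uL aL)
      where
        length-ks : length ks ≡ M
        length-ks = ≡.trans (Listₚ.length-map (λ j → 3 ^ suc j) js) (Listₚ.length-applyUpTo (e ℕ.+_) M)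
        N₁≤n = ℕₚ.≤-trans (ℕₚ.m≤m+n (proj₁ cancellation) _) N≤n
        N₂₃≤n = ℕₚ.≤-trans (ℕₚ.m≤n+m _ (proj₁ cancellation)) N≤n
        chosen = proj₂ growth n (ℕₚ.≤-trans (ℕₚ.m≤m+n (proj₁ growth) _) N₂₃≤n)
        D-collide : D ℕ.* suc (ℕList.sum ks ℕ.* ℕList.sum ks) ≤ q ^ n
        D-collide = ℕₚ.≤-trans (ℕₚ.≤-trans (ℕₚ.m≤n+m _ (proj₁ growth)) N₂₃≤n) (ℕₚ.≤-trans (ℕₚ.<⇒≤ (m<2^m n)) (ℕₚ.^-monoˡ-≤ n 1<q))
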